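{- Let $p=4m+3$ be a prime with $m\ge\max\{5T(1/4),23\}$ and let $n\ge1$. If $A\subset\mathbb F_p^n$ is a nontrivial $(3,1)$-sum-free set with $|A|\ge mp^{n-1}$, then $A$ is either normal or of type 5.
   Context: Here $(k,\ell)=(3,1)$, $p=(k+\ell)m+2+\lambda$ with $\lambda=1$. For a set $X$ in an abelian group and $h\ge1$, $hX=\{x_1+\dots+x_h:x_i\in X\}$. A nonempty $A\subseteq\mathbb F_p^n$ is $(3,1)$-sum-free if $3A\cap A=\emptyset$. Subsets of $\mathbb F_p^n$ are isomorphic if an automorphism of the additive group $\mathbb F_p^n$ maps one onto the other. For $a,b\in\mathbb F_p$, $[a,b]=\{a,a+1,\dots,b\}\subseteq\mathbb F_p$ (cyclic interval). The extremal cuboid is $[a_0,a_0+m]\times\mathbb F_p^{n-1}$ with $a_0=-(3m+1)2^{ -1}\in\mathbb F_p$; a $(3,1)$-sum-free set is trivial if it is isomorphic to a subset of it, nontrivial otherwise. Types (for $A$ with $|A|=mp^{n-1}$): type 1: $A$ is isomorphic to $[a,a+m-1]\times\mathbb F_p^{n-1}$ for some $a\in\mathbb F_p$ with $a-3(a+m-1)\in[1,1]=\{1\}$ (the other option $[\lambda+\ell+2,k]=[4,3]$ is void). Type 2: $n\ge2$ and $A$ is isomorphic to $(\{a\}\times(\mathbb F_p^{n-1}\setminus V))\sqcup([a+1,a+m-1]\times\mathbb F_p^{n-1})\sqcup(\{a+m\}\times V)$ with $a=3m(1-3)^{ -1}\in\mathbb F_p$ and $V$ a proper subspace of $\mathbb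 F_p^{n-1}$. Normal means type 1 or 2. Type 5: there exist an integer $s\in[0,n-1]$ and a nonempty $P\subseteq\mathbb F_p^s$ with $0\notin 3P$ such that $A$ is isomorphic to $A_0\times\mathbb F_p^{n-1-s}$, where, with $a=(m+2)/2\in\mathbb F_p$, $A_0\subseteq\mathbb F_p\times\mathbb F_p^s$ is $\{(a-1,0)\}\sqcup(\{a\}\times(\mathbb F_p^s\setminus P))\sqcup([a+1,a+m-2]\times\mathbb F_p^s)\sqcup(\{a+m-1\}\times(\mathbb F_p^s\setminus\{0\}))\sqcup(\{a+m\}\times P)$. The function $T$: a finite $X\subseteq\mathbb F_p$ has the covering property if it is contained in an arithmetic progression of length $|X+X|-|X|+1$. For $c\in(0,1)$, $\tau\in(0,1]$ is feasible for $c$ if (for every prime $p$) every $X\subseteq\mathbb F_p$ with $|X|\le cp$ and $|X+X|\le(2+\tau)|X|-3$ has the covering property; $\tau(c)$ is the supremum of feasible $\tau$ and $T(c)=1/\tau(c)$. -}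

module Defs where

open import Data.Nat using (ℕ; zero; suc; _+_; _*_; _∸_; _^_; _≤_; _<_; NonZero)
open import Data.Nat.DivMod using (_mod_)
open import Data.Nat.Primality using (Prime)
open import Data.Fin using (Fin; toℕ)
open import Data.Bool using (Bool; true; false; _∧_; if_then_else_)
open import Data.List using (List; []; _∷_; map; concatMap; allFin)
open import Data.Bool.ListAction using (any)
open import Data.Vec using (Vec; []; _∷_; zipWith; replicate; head; tail; cast; take)
open import Data.Product using (Σ; ∃; ∃-syntax; _×_; _,_)
open import Data.Sum using (_⊎_)
open import Relation.Binary.PropositionalEquality using (_≡_)
open import Relation.Nullary using (¬_; Dec; yes; no)
open import Data.Fin using (_≟_)

module _ {p : ℕ} {{_ : NonZero p}} where

  [_]ₚ : ℕ → Fin p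
  [ k ]ₚ = k mod p

  infixl 6 _+F_ _-F_
  infixl 7 _*F_

  _+F_ : Fin p → Fin p → Fin p
  x +F y = (toℕ x + toℕ y) mod p

  -F_ : Fin p → Fin p
  -F x = (p ∸ toℕ x) mod p

  _-F_ : Fin p → Fin p → Fin p
  x -F y = x +F (-F y)

  _*F_ : Fin p → Fin p → Fin p
  x *F y = (toℕ x * toℕ y) mod p

  -- multiplicative inverse in F_p for p prime and x ≠ 0 (Fermat: x^(p-2))
  invF : Fin p → Fin p
  invF x = (toℕ x ^ (p ∸ 2)) mod p

  -- cyclic interval [a,b] = {a, a+1, ..., b}
  InInterval : Fin p → Fin p → Fin p → Set
  InInterval a b x = toℕ (x -F a) ≤ toℕ (b -F a)

  _+V_ : ∀ {n} → Vec (Fin p) n → Vec (Fin p) n → Vec (Fin p) n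
  _+V_ = zipWith _+F_

  0V : ∀ {n} → Vec (Fin p) n
  0V = replicate _ [ 0 ]ₚ

  _·V_ : ∀ {n} → Fin p → Vec (Fin p) n → Vec (Fin p) n
  c ·V v = Data.Vec.map (c *F_) v

  allVecs : (n : ℕ) → List (Vec (Fin p) n)
  allVecs zero = [] ∷ []
  allVecs (suc n) = concatMap (λ x → map (x ∷_) (allVecs n)) (allFin p)

  countTrue : List Bool → ℕ
  countTrue [] = 0
  countTrue (true ∷ bs) = suc (countTrue bs)
  countTrue (false ∷ bs) = countTrue bs

  card : ∀ {n} → (Vec (Fin p) n → Bool) → ℕ
  card {n} A = countTrue (map A (allVecs n))

  card1 : (Fin p → Bool) → ℕ
  card1 X = countTrue (map X (allFin p))

  sumset : (Fin p → Bool) → (Fin p → Bool)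
  sumset X y = any (λ x → X x ∧ X (y -F x)) (allFin p)

  record Aut (n : ℕ) : Set where
    field
      φ     : Vec (Fin p) n → Vec (Fin p) n
      ψ     : Vec (Fin p) n → Vec (Fin p) n
      ψφ    : ∀ x → ψ (φ x) ≡ x
      φψ    : ∀ x → φ (ψ x) ≡ x
      φ-add : ∀ x y → φ (x +V y) ≡ φ x +V φ y

  open Aut public

  Isomorphic : ∀ {n} → (Vec (Fin p) n → Bool) → (Vec (Fin p) n → Set) → Set
  Isomorphic {n} A B = Σ (Aut n) λ f →
    ∀ x → (A x ≡ true → B (φ f x)) × (B (φ f x) → A x ≡ true)

  IsoToSubset : ∀ {n} → (Vec (Fin p) n → Bool) → (Vec (Fin p) n → Set) → Set
  IsoToSubset {n} A B = Σ (Aut n) λ f → ∀ x → A x ≡ true → B (φ f x)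

  SumFree31 : ∀ {n} → (Vec (Fin p) n → Bool) → Set
  SumFree31 {n} A =
    (∃[ x ] A x ≡ true) ×
    (∀ x y z → A x ≡ true → A y ≡ true → A z ≡ true → ¬ (A ((x +V y) +V z) ≡ true))

  IsSubspace : ∀ {n} → (Vec (Fin p) n → Bool) → Set
  IsSubspace V =
    (V 0V ≡ true) ×
    (∀ x y → V x ≡ true → V y ≡ true → V (x +V y) ≡ true) ×
    (∀ c x → V x ≡ true → V (c ·V x) ≡ true)

  IsProperSubspace : ∀ {n} → (Vec (Fin p) n → Bool) → Set
  IsProperSubspace V = IsSubspace V × (∃[ x ] V x ≡ false)

  Covering : (Fin p → Bool) → Set
  Covering X = Σ (Fin p) λ a → Σ (Fin p) λ d → ¬ (d ≡ [ 0 ]ₚ) ×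
    (∀ x → X x ≡ true →
      ∃[ i ] (i < (card1 (sumset X) ∸ card1 X) + 1) × (x ≡ a +F [ i ]ₚ *F d))

-- τ = u/v (u, v positive naturals) is feasible for c = 1/4:
-- for every prime r and X ⊆ F_r with |X| ≤ r/4 and
-- |X+X| ≤ (2 + u/v)|X| - 3, X has the covering property.

Feasible¼ : ℕ → ℕ → Set
Feasible¼ u v = ∀ (r : ℕ) {{_ : NonZero r}} → Prime r → (X : Fin r → Bool) →
  4 * card1 X ≤ r →
  v * card1 (sumset X) + 3 * v ≤ (2 * v + u) * card1 X →
  Covering X

-- m ≥ 5 T(1/4), i.e. τ(1/4) ≥ 5/m, i.e. (since the set of feasible τ is
-- downward closed in (0,1]) every rational τ = u/v with 0 < τ < 5/m is feasible.
BigEnoughT : ℕ → Set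
BigEnoughT m = ∀ u v → 1 ≤ u → 1 ≤ v → u * m < 5 * v → Feasible¼ u v

-- The specific sets, for p = 4m + 3 (k = 3, ℓ = 1, λ = 1), n = suc n'.

module _ (m : ℕ) where

  private
    p : ℕ
    p = 3 + 4 * m

  a₀ : Fin p
  a₀ = (-F [ 3 * m + 1 ]ₚ) *F invF [ 2 ]ₚ

  Cuboid : ∀ {n'} → Vec (Fin p) (suc n') → Set
  Cuboid x = InInterval a₀ (a₀ +F [ m ]ₚ) (head x)

  Nontrivial : ∀ {n'} → (Vec (Fin p) (suc n') → Bool) → Set
  Nontrivial A = ¬ IsoToSubset A Cuboid

  Type1 : ∀ {n'} → (Vec (Fin p) (suc n') → Bool) → Set
  Type1 A = Σ (Fin p) λ a →
    InInterval [ 1 ]ₚ [ 1 ]ₚ (a -F [ 3 ]ₚ *F (a +F [ m ∸ 1 ]ₚ)) ×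
    Isomorphic A (λ x → InInterval a (a +F [ m ∸ 1 ]ₚ) (head x))

  aT2 : Fin p
  aT2 = [ 3 * m ]ₚ *F invF ([ 1 ]ₚ -F [ 3 ]ₚ)

  Type2 : ∀ {n'} → (Vec (Fin p) (suc n') → Bool) → Set
  Type2 {n'} A = (1 ≤ n') × Σ (Vec (Fin p) n' → Bool) λ V →
    IsProperSubspace V ×
    Isomorphic A (λ x →
      ((head x ≡ aT2) × (V (tail x) ≡ false)) ⊎
      (InInterval (aT2 +F [ 1 ]ₚ) (aT2 +F [ m ∸ 1 ]ₚ) (head x)) ⊎
      ((head x ≡ aT2 +F [ m ]ₚ) × (V (tail x) ≡ true)))

  Normal : ∀ {n'} → (Vec (Fin p) (suc n') → Bool) → Set
  Normal A = Type1 A ⊎ Type2 A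

  aT5 : Fin p
  aT5 = [ m + 2 ]ₚ *F invF [ 2 ]ₚ

  A₀ : ∀ {s} → (Vec (Fin p) s → Bool) → Fin p → Vec (Fin p) s → Set
  A₀ P h y =
    ((h ≡ aT5 -F [ 1 ]ₚ) × (y ≡ 0V)) ⊎
    ((h ≡ aT5) × (P y ≡ false)) ⊎
    (InInterval (aT5 +F [ 1 ]ₚ) (aT5 +F [ m ∸ 2 ]ₚ) h) ⊎
    ((h ≡ aT5 +F [ m ∸ 1 ]ₚ) × ¬ (y ≡ 0V)) ⊎
    ((h ≡ aT5 +F [ m ]ₚ) × (P y ≡ true))

  -- s ∈ [0, n-1] is encoded by s + t ≡ n - 1 (t = n-1-s)
  Type5 : ∀ {n'} → (Vec (Fin p) (suc n') → Bool) → Set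
  Type5 {n'} A = Σ ℕ λ s → Σ ℕ λ t → Σ (s + t ≡ n') λ e →
    Σ (Vec (Fin p) s → Bool) λ P →
      (∃[ y ] P y ≡ true) ×
      (∀ x y z → P x ≡ true → P y ≡ true → P z ≡ true → ¬ ((x +V y) +V z ≡ 0V)) ×
      Isomorphic A (λ x → A₀ P (head x) (take s (cast (Relation.Binary.PropositionalEquality.sym e) (tail x))))

{-# OPTIONS --safe #-}
-- Write q = p^(n-1).  Comparing, over all nonzero linear functionals, the number of solutions of x + y + z = w
-- in A (there are none) with its expected value yields a functional with a fibre of at least mq / (3m + 3) elements of A.
-- Kneser's theorem for the level sets of the fibre sizes then shows that the support S of this functional on A has
-- m, m + 1 or m + 2 elements and contains a set X of values with large fibres such that X + X misses S - S.
-- If |X + X| ≤ 2|X| + 1, the assumption on T(1/4) puts X, and then S, into a short progression.  Otherwise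
-- (X + X, S) is almost critical for the Cauchy-Davenport inequality; Dyson transforms reduce it to one for which
-- S visibly consists of at most three runs with respect to some difference δ, and since S - S is small
-- one of δ, δ/2, δ/3 is the difference of a short progression containing S.  Freiman's bound for S - S
-- cuts the length of the progression down to m + 4.
-- So after an automorphism A lives on m + r ≤ m + 4 consecutive levels, starting at some x.  Two nonempty levels
-- shift every level away from another one at a fixed distance, and two such levels have at most q elements together.
-- Counting excludes all but a few values of 2x - m.  In these either the levels lie in the extremal
-- interval, or equality holds in every estimate, which makes each level full, a subspace, a complement of a subspace,
-- or one of two complementary sets: types 1, 2 and 5.
module Submission where

-- The counting argument only yields a level that is about one third full, while sumset arguments
-- need more than half. The gap is closed by pairing the set of levels with more than t elements
-- against the one for t′, where t + t′ is about q/2: a maximum below that range leaves too little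
-- total mass, and any other maximum is forced up to mq/(m + 1). Everything later rests on two
-- numbers: |S - S| ≤ 2m + 4, and the total mq, which leaves almost no slack in any estimate. The
-- assumption on T(1/4) serves one range of doubling: X has m or m - 1 elements, and 4/(m - 1) < 5/m
-- makes the covering property available up to |X + X| = 2|X| + 1. For larger doubling the inverse
-- problem for X + X is out of reach; instead X + X + S must miss S, and since |X + X| is now large,
-- p leaves at most three units of slack for it. The values 2x that survive at the end are measured
-- against m + 2, which is twice the first element of the extremal interval in F_p; the reflection x
-- ↦ -x halves the cases.

import Data.Nat
open import Data.Nat.Properties
import Data.Fin
import Data.Fin.Properties as FinP
import Data.Fin.Permutation as Perm
import Data.Vec as Vec
import Data.Vec.Properties as VecP
import Algebra.Properties.CommutativeMonoid.Sum as ProductOf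
open import Defs
open import Data.Bool using (Bool; true; false; T; _∧_; _∨_; not)
open import Data.Empty using (⊥; ⊥-elim)
open import Data.List using (List; []; _∷_; map; _++_; length; concatMap; allFin; tabulate)
open import Data.List.Properties using (≡-dec; length-tabulate)
open import Data.Nat using (ℕ; zero; suc; _+_; _*_; _∸_; _≤_; _<_; _≤ᵇ_; _≤?_; z≤n; s≤s; NonZero; _^_; _<?_)
open import Data.Maybe using (Maybe; just; nothing)
open import Data.Product using (_×_; _,_; Σ; ∃-syntax; proj₁; proj₂)
open import Relation.Binary.PropositionalEquality using (_≡_; refl; sym; trans; cong; cong₂; subst; subst₂; module ≡-Reasoning; _≢_; isEquivalence)
open import Relation.Nullary using (¬_; yes; no; does; Dec)
open import Data.Nat.Tactic.RingSolver using (solve-∀)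
open import Data.Sum using (_⊎_; inj₁; inj₂)
open import Data.Bool.ListAction using (any)
open import Relation.Binary using (DecidableEquality)
open import Data.Nat.Primality using (Prime; prime⇒nonZero; prime⇒nonTrivial)
open import Data.Nat.Coprimality using (coprime-Bézout; prime⇒coprime)
open import Data.Nat.GCD using (module Bézout)
open import Data.Fin using (Fin; toℕ)
open import Function using (_∘_)
open import Data.Nat.DivMod using (_%_; m%n<n; %-distribˡ-+; %-distribˡ-*; m<n⇒m%n≡m; [m+n]%n≡m%n; [m+kn]%n≡m%n; _/_; m/n*n≤m; /-monoˡ-≤; m*n/n≡m)
open import Data.Vec using (Vec; head; tail; take; cast)
open import Algebra.Bundles using (CommutativeMonoid)

-- Linear arithmetic over ℕ with monomials as unknowns.
-- Goals are proved by explicit Farkas certificates: in hyp k a b h, the hypothesis h : a ≤ b has multiplier k.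

infixl 6 _⊕_
infixl 7 _⊗_
infix 8 ν_ #_

data Ex : Set where
  ν_ #_   : ℕ → Ex
  _⊕_ _⊗_ : Ex → Ex → Ex

nth : List ℕ → ℕ → ℕ
nth []       _       = 0
nth (x ∷ _)  zero    = x
nth (_ ∷ xs) (suc i) = nth xs i

⟦_⟧ : Ex → List ℕ → ℕ
⟦ ν i ⟧   ρ = nth ρ i
⟦ # k ⟧   ρ = k
⟦ a ⊕ b ⟧ ρ = ⟦ a ⟧ ρ + ⟦ b ⟧ ρ
⟦ a ⊗ b ⟧ ρ = ⟦ a ⟧ ρ * ⟦ b ⟧ ρ

private
  Mono = List ℕ
  Poly = List (ℕ × Mono)

  evalM : Mono → List ℕ → ℕ
  evalM []       ρ = 1
  evalM (i ∷ is) ρ = nth ρ i * evalM is ρ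

  evalP : Poly → List ℕ → ℕ
  evalP []            ρ = 0
  evalP ((c , mo) ∷ p) ρ = c * evalM mo ρ + evalP p ρ

  insM : ℕ → Mono → Mono
  insM i []       = i ∷ []
  insM i (j ∷ js) with i ≤ᵇ j
  ... | true  = i ∷ j ∷ js
  ... | false = j ∷ insM i js

  insM-ok : ∀ i mo ρ → evalM (insM i mo) ρ ≡ nth ρ i * evalM mo ρ
  insM-ok i []       ρ = refl
  insM-ok i (j ∷ js) ρ with i ≤ᵇ j
  ... | true  = refl
  ... | false rewrite insM-ok i js ρ = swap (nth ρ j) (nth ρ i) (evalM js ρ)
    where swap : ∀ a b c → a * (b * c) ≡ b * (a * c)
          swap = solve-∀

  mulM : Mono → Mono → Mono
  mulM []       q = q
  mulM (i ∷ is) q = insM i (mulM is q)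

  mulM-ok : ∀ a b ρ → evalM (mulM a b) ρ ≡ evalM a ρ * evalM b ρ
  mulM-ok []       b ρ = sym (+-identityʳ _)
  mulM-ok (i ∷ is) b ρ rewrite insM-ok i (mulM is b) ρ | mulM-ok is b ρ =
    sym (*-assoc (nth ρ i) (evalM is ρ) (evalM b ρ))

  addT : ℕ → Mono → Poly → Poly
  addT c mo [] = (c , mo) ∷ []
  addT c mo ((d , mo′) ∷ p) with ≡-dec _≟_ mo mo′
  ... | yes _ = (c + d , mo′) ∷ p
  ... | no  _ = (d , mo′) ∷ addT c mo p

  addT-ok : ∀ c mo p ρ → evalP (addT c mo p) ρ ≡ c * evalM mo ρ + evalP p ρ
  addT-ok c mo [] ρ = refl
  addT-ok c mo ((d , mo′) ∷ p) ρ with ≡-dec _≟_ mo mo′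
  ... | yes refl = dist c d (evalM mo ρ) (evalP p ρ)
    where dist : ∀ a b x y → (a + b) * x + y ≡ a * x + (b * x + y)
          dist = solve-∀
  ... | no _ rewrite addT-ok c mo p ρ = swap (d * evalM mo′ ρ) (c * evalM mo ρ) (evalP p ρ)
    where swap : ∀ a b x → a + (b + x) ≡ b + (a + x)
          swap = solve-∀

  addP : Poly → Poly → Poly
  addP []             q = q
  addP ((c , mo) ∷ p) q = addT c mo (addP p q)

  addP-ok : ∀ p q ρ → evalP (addP p q) ρ ≡ evalP p ρ + evalP q ρ
  addP-ok []             q ρ = refl
  addP-ok ((c , mo) ∷ p) q ρ rewrite addT-ok c mo (addP p q) ρ | addP-ok p q ρ =
    sym (+-assoc (c * evalM mo ρ) (evalP p ρ) (evalP q ρ))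

  mulT : ℕ → Mono → Poly → Poly
  mulT c mo []              = []
  mulT c mo ((d , mo′) ∷ q) = addT (c * d) (mulM mo mo′) (mulT c mo q)

  mulT-ok : ∀ c mo q ρ → evalP (mulT c mo q) ρ ≡ (c * evalM mo ρ) * evalP q ρ
  mulT-ok c mo []              ρ = sym (*-zeroʳ (c * evalM mo ρ))
  mulT-ok c mo ((d , mo′) ∷ q) ρ
    rewrite addT-ok (c * d) (mulM mo mo′) (mulT c mo q) ρ | mulM-ok mo mo′ ρ | mulT-ok c mo q ρ =
    rearr c d (evalM mo ρ) (evalM mo′ ρ) (evalP q ρ)
    where rearr : ∀ a b x y z → a * b * (x * y) + a * x * z ≡ a * x * (b * y + z)
          rearr = solve-∀

  mulP : Poly → Poly → Poly
  mulP []             q = []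
  mulP ((c , mo) ∷ p) q = addP (mulT c mo q) (mulP p q)

  mulP-ok : ∀ p q ρ → evalP (mulP p q) ρ ≡ evalP p ρ * evalP q ρ
  mulP-ok []             q ρ = refl
  mulP-ok ((c , mo) ∷ p) q ρ
    rewrite addP-ok (mulT c mo q) (mulP p q) ρ | mulT-ok c mo q ρ | mulP-ok p q ρ =
    sym (*-distribʳ-+ (evalP q ρ) (c * evalM mo ρ) (evalP p ρ))

  nf : Ex → Poly
  nf (ν i)   = (1 , i ∷ []) ∷ []
  nf (# k)   = (k , []) ∷ []
  nf (a ⊕ b) = addP (nf a) (nf b)
  nf (a ⊗ b) = mulP (nf a) (nf b)

  nf-ok : ∀ e ρ → evalP (nf e) ρ ≡ ⟦ e ⟧ ρ
  nf-ok (ν i)   ρ = solve1 (nth ρ i)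
    where solve1 : ∀ x → 1 * (x * 1) + 0 ≡ x
          solve1 = solve-∀
  nf-ok (# k)   ρ = solve2 k
    where solve2 : ∀ x → x * 1 + 0 ≡ x
          solve2 = solve-∀
  nf-ok (a ⊕ b) ρ rewrite addP-ok (nf a) (nf b) ρ | nf-ok a ρ | nf-ok b ρ = refl
  nf-ok (a ⊗ b) ρ rewrite mulP-ok (nf a) (nf b) ρ | nf-ok a ρ | nf-ok b ρ = refl

  takeT : ℕ → Mono → Poly → Maybe Poly
  takeT zero      mo q = just q
  takeT c@(suc _) mo [] = nothing
  takeT c@(suc _) mo ((d , mo′) ∷ q) with ≡-dec _≟_ mo mo′ | c ≤? d
  ... | yes _ | yes _ = just ((d ∸ c , mo′) ∷ q)
  ... | yes _ | no  _ = nothing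
  ... | no  _ | _ with takeT c mo q
  ...   | just q′ = just ((d , mo′) ∷ q′)
  ...   | nothing = nothing

  takeT-ok : ∀ c mo q q′ ρ → takeT c mo q ≡ just q′ → evalP q ρ ≡ c * evalM mo ρ + evalP q′ ρ
  takeT-ok zero mo q .q ρ refl = refl
  takeT-ok (suc c) mo ((d , mo′) ∷ q) q′ ρ eq with ≡-dec _≟_ mo mo′ | suc c ≤? d
  takeT-ok (suc c) mo ((d , mo′) ∷ q) q′ ρ refl | yes refl | yes c≤d =
    trans (cong (λ x → x * evalM mo ρ + evalP q ρ) (sym (m+[n∸m]≡n c≤d)))
          (dist (suc c) (d ∸ suc c) (evalM mo ρ) (evalP q ρ))
    where dist : ∀ a b x y → (a + b) * x + y ≡ a * x + (b * x + y)
          dist = solve-∀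
  ... | no _ | _ with takeT (suc c) mo q in eq′
  takeT-ok (suc c) mo ((d , mo′) ∷ q) _ ρ refl | no _ | _ | just q″
    rewrite takeT-ok (suc c) mo q q″ ρ eq′ = swap (d * evalM mo′ ρ) (suc c * evalM mo ρ) (evalP q″ ρ)
    where swap : ∀ a b x → a + (b + x) ≡ b + (a + x)
          swap = solve-∀

  -- A sufficient test only: each term of the left polynomial is taken out of the right one,
  -- coefficient by coefficient. It is sound because monomials have natural values, so that whatever
  -- remains on the right is nonnegative.
  leq : Poly → Poly → Bool
  leq [] q = true
  leq ((c , mo) ∷ p) q with takeT c mo q
  ... | just q′ = leq p q′
  ... | nothing = false

  leq-ok : ∀ p q ρ → T (leq p q) → evalP p ρ ≤ evalP q ρ
  leq-ok [] q ρ _ = z≤n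
  leq-ok ((c , mo) ∷ p) q ρ ok with takeT c mo q in eq
  ... | just q′ rewrite takeT-ok c mo q q′ ρ eq = +-monoʳ-≤ (c * evalM mo ρ) (leq-ok p q′ ρ ok)

  leqE-ok : ∀ a b ρ → T (leq (nf a) (nf b)) → ⟦ a ⟧ ρ ≤ ⟦ b ⟧ ρ
  leqE-ok a b ρ ok = subst₂ _≤_ (nf-ok a ρ) (nf-ok b ρ) (leq-ok (nf a) (nf b) ρ ok)

data Hyp (ρ : List ℕ) : Set where
  hyp : ℕ → (a b : Ex) → ⟦ a ⟧ ρ ≤ ⟦ b ⟧ ρ → Hyp ρ

private
  ∑l ∑r : ∀ {ρ} → List (Hyp ρ) → Ex
  ∑l [] = # 0
  ∑l (hyp k a b _ ∷ hs) = # k ⊗ a ⊕ ∑l hs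
  ∑r [] = # 0
  ∑r (hyp k a b _ ∷ hs) = # k ⊗ b ⊕ ∑r hs

  ∑≤ : ∀ {ρ} (hs : List (Hyp ρ)) → ⟦ ∑l hs ⟧ ρ ≤ ⟦ ∑r hs ⟧ ρ
  ∑≤ [] = z≤n
  ∑≤ (hyp k a b h ∷ hs) = +-mono-≤ (*-monoʳ-≤ k h) (∑≤ hs)

eql eqr : ∀ {ρ} → ℕ → (a b : Ex) → ⟦ a ⟧ ρ ≡ ⟦ b ⟧ ρ → Hyp ρ
eql k a b h = hyp k a b (≤-reflexive h)
eqr k a b h = hyp k b a (≤-reflexive (sym h))

-- The check is a closed Boolean, so the certificate is verified by evaluation. Nonlinear arguments
-- fit in because a hypothesis may be passed after multiplication by a factor; the resulting
-- products are monomials like any other.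
refute : ∀ ρ (hs : List (Hyp ρ)) {_ : T (leq (nf (# 1 ⊕ ∑r hs)) (nf (∑l hs)))} → ⊥
refute ρ hs {ok} = 1+n≰n (≤-trans (leqE-ok (# 1 ⊕ ∑r hs) (∑l hs) ρ ok) (∑≤ hs))

-- The multiplier k is that of the negated goal.
lin : ∀ ρ (hs : List (Hyp ρ)) k a b
      {_ : T (leq (nf (# 1 ⊕ (# k ⊗ a ⊕ ∑r hs))) (nf (# k ⊗ (# 1 ⊕ b) ⊕ ∑l hs)))} →
      ⟦ a ⟧ ρ ≤ ⟦ b ⟧ ρ
lin ρ hs k a b {ok} = ≮⇒≥ λ b<a → refute ρ (hyp k (# 1 ⊕ b) a b<a ∷ hs) {ok}

data Eqn (ρ : List ℕ) : Set where
  eqn : ℕ → (a b : Ex) → ⟦ a ⟧ ρ ≡ ⟦ b ⟧ ρ → Eqn ρ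

private
  ∑ˡ ∑ʳ : ∀ {ρ} → List (Eqn ρ) → Ex
  ∑ˡ [] = # 0
  ∑ˡ (eqn k a b _ ∷ hs) = # k ⊗ a ⊕ ∑ˡ hs
  ∑ʳ [] = # 0
  ∑ʳ (eqn k a b _ ∷ hs) = # k ⊗ b ⊕ ∑ʳ hs

  ∑≡ : ∀ {ρ} (hs : List (Eqn ρ)) → ⟦ ∑ˡ hs ⟧ ρ ≡ ⟦ ∑ʳ hs ⟧ ρ
  ∑≡ [] = refl
  ∑≡ (eqn k a b h ∷ hs) = cong₂ _+_ (cong (k *_) h) (∑≡ hs)

lin≡ : ∀ ρ (hs : List (Eqn ρ)) a b
       {_ : T (leq (nf (a ⊕ ∑ʳ hs)) (nf (b ⊕ ∑ˡ hs)))} {_ : T (leq (nf (b ⊕ ∑ˡ hs)) (nf (a ⊕ ∑ʳ hs)))} →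
       ⟦ a ⟧ ρ ≡ ⟦ b ⟧ ρ
lin≡ ρ hs a b {ok} {ok′} = +-cancelʳ-≡ (⟦ ∑ʳ hs ⟧ ρ) (⟦ a ⟧ ρ) (⟦ b ⟧ ρ)
  (trans (≤-antisym (leqE-ok (a ⊕ ∑ʳ hs) (b ⊕ ∑ˡ hs) ρ ok) (leqE-ok (b ⊕ ∑ˡ hs) (a ⊕ ∑ʳ hs) ρ ok′)) (cong (⟦ b ⟧ ρ +_) (∑≡ hs)))

v0 v1 v2 v3 v4 v5 v6 v7 v8 v9 v10 v11 v12 v13 v14 v15 : Ex
v0  = ν 0
v1  = ν 1
v2  = ν 2
v3  = ν 3
v4  = ν 4
v5  = ν 5
v6  = ν 6
v7  = ν 7
v8  = ν 8
v9  = ν 9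
v10 = ν 10
v11 = ν 11
v12 = ν 12
v13 = ν 13
v14 = ν 14
v15 = ν 15

-- Finite sums and finite types

∑ : {A : Set} → List A → (A → ℕ) → ℕ
∑ []       f = 0
∑ (x ∷ xs) f = f x + ∑ xs f

⟨_⟩ : Bool → ℕ
⟨ true ⟩  = 1
⟨ false ⟩ = 0

module _ {A : Set} where

  ∑-cong : (l : List A) {f g : A → ℕ} → (∀ x → f x ≡ g x) → ∑ l f ≡ ∑ l g
  ∑-cong []       h = refl
  ∑-cong (x ∷ xs) h = cong₂ _+_ (h x) (∑-cong xs h)

  ∑-mono : (l : List A) {f g : A → ℕ} → (∀ x → f x ≤ g x) → ∑ l f ≤ ∑ l g
  ∑-mono []       h = z≤n
  ∑-mono (x ∷ xs) h = +-mono-≤ (h x) (∑-mono xs h)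

  ∑-+ : (l : List A) (f g : A → ℕ) → ∑ l (λ x → f x + g x) ≡ ∑ l f + ∑ l g
  ∑-+ []       f g = refl
  ∑-+ (x ∷ xs) f g rewrite ∑-+ xs f g = rearr (f x) (g x) (∑ xs f) (∑ xs g)
    where rearr : ∀ a b c d → a + b + (c + d) ≡ a + c + (b + d)
          rearr = solve-∀

  ∑-*ˡ : (l : List A) (c : ℕ) (f : A → ℕ) → ∑ l (λ x → c * f x) ≡ c * ∑ l f
  ∑-*ˡ []       c f = sym (*-zeroʳ c)
  ∑-*ˡ (x ∷ xs) c f rewrite ∑-*ˡ xs c f = sym (*-distribˡ-+ c (f x) (∑ xs f))

  ∑-*ʳ : (l : List A) (f : A → ℕ) (c : ℕ) → ∑ l (λ x → f x * c) ≡ ∑ l f * c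
  ∑-*ʳ l f c = trans (∑-cong l (λ x → *-comm (f x) c)) (trans (∑-*ˡ l c f) (*-comm c (∑ l f)))

  ∑-const : (l : List A) (c : ℕ) → ∑ l (λ _ → c) ≡ length l * c
  ∑-const []       c = refl
  ∑-const (x ∷ xs) c = cong (c +_) (∑-const xs c)

  ∑-++ : (l k : List A) (f : A → ℕ) → ∑ (l ++ k) f ≡ ∑ l f + ∑ k f
  ∑-++ []       k f = refl
  ∑-++ (x ∷ xs) k f rewrite ∑-++ xs k f = sym (+-assoc (f x) (∑ xs f) (∑ k f))

module _ {A B : Set} where

  ∑-swap : (l : List A) (k : List B) (f : A → B → ℕ) →
           ∑ l (λ x → ∑ k (f x)) ≡ ∑ k (λ y → ∑ l (λ x → f x y))
  ∑-swap []       k f = sym (trans (∑-const k 0) (*-zeroʳ (length k)))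
  ∑-swap (x ∷ xs) k f rewrite ∑-swap xs k f = sym (∑-+ k (f x) (λ y → ∑ xs (λ x → f x y)))

  ∑-map : (g : A → B) (l : List A) (f : B → ℕ) → ∑ (map g l) f ≡ ∑ l (λ x → f (g x))
  ∑-map g []       f = refl
  ∑-map g (x ∷ xs) f = cong (f (g x) +_) (∑-map g xs f)

  ∑-concatMap : (g : A → List B) (l : List A) (f : B → ℕ) →
                ∑ (concatMap g l) f ≡ ∑ l (λ x → ∑ (g x) f)
  ∑-concatMap g []       f = refl
  ∑-concatMap g (x ∷ xs) f =
    trans (∑-++ (g x) (concatMap g xs) f) (cong (∑ (g x) f +_) (∑-concatMap g xs f))

any⇒∃ : {A : Set} (X : A → Bool) (l : List A) → any X l ≡ true → ∃[ x ] X x ≡ true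
any⇒∃ X (x ∷ xs) h with X x in eq
... | true  = x , eq
... | false = any⇒∃ X xs h

¬any⇒∑≡0 : {A : Set} (X : A → Bool) (l : List A) → any X l ≡ false → ∑ l (λ x → ⟨ X x ⟩) ≡ 0
¬any⇒∑≡0 X []       h = refl
¬any⇒∑≡0 X (x ∷ xs) h with X x
... | false = ¬any⇒∑≡0 X xs h

∧-elim : ∀ {a b} → a ∧ b ≡ true → a ≡ true × b ≡ true
∧-elim {true} {true} _ = refl , refl

∧-intro : ∀ {a b} → a ≡ true → b ≡ true → a ∧ b ≡ true
∧-intro refl refl = refl

∨-elim : ∀ {a b} → a ∨ b ≡ true → a ≡ true ⊎ b ≡ true
∨-elim {true}  _ = inj₁ refl
∨-elim {false} h = inj₂ h

∨-introˡ : ∀ {a b} → a ≡ true → a ∨ b ≡ true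
∨-introˡ refl = refl

∨-introʳ : ∀ {a b} → b ≡ true → a ∨ b ≡ true
∨-introʳ {true}  _ = refl
∨-introʳ {false} h = h

not-elim : ∀ {a} → not a ≡ true → a ≡ false
not-elim {false} _ = refl

not-intro : ∀ {a} → a ≡ false → not a ≡ true
not-intro refl = refl

true≢false : ∀ {a} → a ≡ true → a ≡ false → ⊥
true≢false refl ()

¬true⇒false : ∀ {a} → ¬ (a ≡ true) → a ≡ false
¬true⇒false {true}  h = ⊥-elim (h refl)
¬true⇒false {false} h = refl

⟨⟩-mono : ∀ {a b} → (a ≡ true → b ≡ true) → ⟨ a ⟩ ≤ ⟨ b ⟩
⟨⟩-mono {false}        h = z≤n
⟨⟩-mono {true} {true}  h = s≤s z≤n
⟨⟩-mono {true} {false} h with h refl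
... | ()

⟨⟩-cong : ∀ {a b} → (a ≡ true → b ≡ true) → (b ≡ true → a ≡ true) → ⟨ a ⟩ ≡ ⟨ b ⟩
⟨⟩-cong f g = ≤-antisym (⟨⟩-mono f) (⟨⟩-mono g)

⟨⟩≤1 : ∀ a → ⟨ a ⟩ ≤ 1
⟨⟩≤1 true  = s≤s z≤n
⟨⟩≤1 false = z≤n

does-intro : ∀ {P : Set} (d : Dec P) → P → does d ≡ true
does-intro (yes _) _ = refl
does-intro (no ¬p) p = ⊥-elim (¬p p)

does-elim : ∀ {P : Set} (d : Dec P) → does d ≡ true → P
does-elim (yes p) _ = p

does-not : ∀ {P : Set} (d : Dec P) → ¬ P → does d ≡ false
does-not (yes p) ¬p = ⊥-elim (¬p p)
does-not (no _)  _  = refl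

-- `once` says at the same time that the list `els` is complete and that nothing is repeated in it.
-- In this form it plugs into exchanges of sums, and no reasoning about permutations of lists
-- arises.
record FinType : Set₁ where
  field
    C    : Set
    els  : List C
    _≡?_  : DecidableEquality C
    once : ∀ a → ∑ els (λ y → ⟨ does (y ≡? a) ⟩) ≡ 1

-- Write f (g x) as a sum over y against a Kronecker delta and exchange the sums; the inner sum
-- counts the x with g x = y, that is x = h y.
bijection-∑ : (F G : FinType) (g : FinType.C F → FinType.C G) (h : FinType.C G → FinType.C F) →
              (∀ x → h (g x) ≡ x) → (∀ y → g (h y) ≡ y) →
              (f : FinType.C G → ℕ) → ∑ (FinType.els F) (λ x → f (g x)) ≡ ∑ (FinType.els G) f
bijection-∑ F G g h hg gh f = begin
  ∑ F.els (λ x → f (g x))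
    ≡⟨ ∑-cong F.els (λ x → sym (delta x)) ⟩
  ∑ F.els (λ x → ∑ G.els (λ y → ⟨ does (y G.≡? g x) ⟩ * f y))
    ≡⟨ ∑-swap F.els G.els _ ⟩
  ∑ G.els (λ y → ∑ F.els (λ x → ⟨ does (y G.≡? g x) ⟩ * f y))
    ≡⟨ ∑-cong G.els (λ y → trans (∑-*ʳ F.els _ (f y)) (trans (cong (_* f y) (inner y)) (+-identityʳ (f y)))) ⟩
  ∑ G.els f ∎
  where
  open ≡-Reasoning
  module F = FinType F
  module G = FinType G
  delta : ∀ x → ∑ G.els (λ y → ⟨ does (y G.≡? g x) ⟩ * f y) ≡ f (g x)
  delta x = trans (∑-cong G.els pt)
                  (trans (∑-*ʳ G.els _ (f (g x))) (trans (cong (_* f (g x)) (G.once (g x))) (+-identityʳ _)))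
    where
    pt : ∀ y → ⟨ does (y G.≡? g x) ⟩ * f y ≡ ⟨ does (y G.≡? g x) ⟩ * f (g x)
    pt y with y G.≡? g x
    ... | yes refl = refl
    ... | no _     = refl
  inner : ∀ y → ∑ F.els (λ x → ⟨ does (y G.≡? g x) ⟩) ≡ 1
  inner y = trans (∑-cong F.els λ x → ⟨⟩-cong
      (λ e → does-intro (x F.≡? h y) (trans (sym (hg x)) (cong h (sym (does-elim (y G.≡? g x) e)))))
      (λ e → does-intro (y G.≡? g x) (trans (sym (gh y)) (cong g (sym (does-elim (x F.≡? h y) e))))))
    (F.once (h y))

module Sets (F : FinType) where
  open FinType F public

  infixr 6 _∪_
  infixr 7 _∩_ _∖_

  Subset : Set
  Subset = C → Bool

  size : Subset → ℕ
  size X = ∑ els (λ x → ⟨ X x ⟩)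

  order : ℕ
  order = length els

  _∩_ _∪_ _∖_ : Subset → Subset → Subset
  (X ∩ Y) x = X x ∧ Y x
  (X ∪ Y) x = X x ∨ Y x
  (X ∖ Y) x = X x ∧ not (Y x)

  ∁ : Subset → Subset
  ∁ X x = not (X x)

  _⊆_ : Subset → Subset → Set
  X ⊆ Y = ∀ x → X x ≡ true → Y x ≡ true

  ｛_｝ : C → Subset
  ｛ a ｝ x = does (x ≡? a)

  size-mono : ∀ {X Y} → X ⊆ Y → size X ≤ size Y
  size-mono h = ∑-mono els (λ x → ⟨⟩-mono (h x))

  size-cong : ∀ {X Y} → X ⊆ Y → Y ⊆ X → size X ≡ size Y
  size-cong f g = ≤-antisym (size-mono f) (size-mono g)

  size-∪∩ : ∀ X Y → size (X ∪ Y) + size (X ∩ Y) ≡ size X + size Y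
  size-∪∩ X Y = trans (sym (∑-+ els _ _)) (trans (∑-cong els (λ x → pt (X x) (Y x))) (∑-+ els _ _))
    where pt : ∀ a b → ⟨ a ∨ b ⟩ + ⟨ a ∧ b ⟩ ≡ ⟨ a ⟩ + ⟨ b ⟩
          pt true  true  = refl
          pt true  false = refl
          pt false true  = refl
          pt false false = refl

  size-∩∖ : ∀ X Y → size (X ∩ Y) + size (X ∖ Y) ≡ size X
  size-∩∖ X Y = trans (sym (∑-+ els _ _)) (∑-cong els (λ x → pt (X x) (Y x)))
    where pt : ∀ a b → ⟨ a ∧ b ⟩ + ⟨ a ∧ not b ⟩ ≡ ⟨ a ⟩
          pt true  true  = refl
          pt true  false = refl
          pt false true  = refl
          pt false false = refl

  size-∁ : ∀ X → size X + size (∁ X) ≡ order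
  size-∁ X = trans (sym (∑-+ els _ _)) (trans (∑-cong els (λ x → pt (X x))) (trans (∑-const els 1) (*-identityʳ order)))
    where pt : ∀ a → ⟨ a ⟩ + ⟨ not a ⟩ ≡ 1
          pt true  = refl
          pt false = refl

  size≤order : ∀ X → size X ≤ order
  size≤order X = ≤-trans (m≤m+n (size X) (size (∁ X))) (≤-reflexive (size-∁ X))

  size-disjoint : ∀ {X Y Z} → X ⊆ Z → Y ⊆ Z → (∀ x → X x ≡ true → Y x ≡ true → ⊥) →
                  size X + size Y ≤ size Z
  size-disjoint {X} {Y} {Z} f g d =
    ≤-trans (≤-reflexive (sym (∑-+ els _ _))) (∑-mono els (λ x → pt (f x) (g x) (d x)))
    where pt : ∀ {a b c} → (a ≡ true → c ≡ true) → (b ≡ true → c ≡ true) → (a ≡ true → b ≡ true → ⊥) →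
               ⟨ a ⟩ + ⟨ b ⟩ ≤ ⟨ c ⟩
          pt {true}  {true}  f g d = ⊥-elim (d refl refl)
          pt {true}  {false} f g d = ⟨⟩-mono f
          pt {false} {b}     f g d = ⟨⟩-mono g

  size-single : ∀ a → size ｛ a ｝ ≡ 1
  size-single = once

  size-pos : ∀ {X a} → X a ≡ true → 1 ≤ size X
  size-pos {X} {a} h = ≤-trans (≤-reflexive (sym (once a)))
    (size-mono {｛ a ｝} {X} (λ x e → subst (λ y → X y ≡ true) (sym (does-elim (x ≡? a) e)) h))

  any-intro : ∀ {X a} → X a ≡ true → any X els ≡ true
  any-intro {X} {a} h with any X els in eq
  ... | true  = refl
  ... | false = ⊥-elim (1+n≰n (≤-trans (size-pos {X} h) (≤-reflexive (¬any⇒∑≡0 X els eq))))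

  search : (X : Subset) → (∃[ x ] X x ≡ true) ⊎ (∀ x → X x ≡ false)
  search X with any X els in eq
  ... | true  = inj₁ (any⇒∃ X els eq)
  ... | false = inj₂ λ x → ¬true⇒false λ h → true≢false (any-intro {X} h) eq

  size-elem : ∀ {X} → 1 ≤ size X → ∃[ x ] X x ≡ true
  size-elem {X} h with search X
  ... | inj₁ r = r
  ... | inj₂ e = ⊥-elim (1+n≰n (≤-trans h (≤-reflexive
        (trans (∑-cong els (λ x → cong ⟨_⟩ (e x))) (trans (∑-const els 0) (*-zeroʳ order))))))

  size-strict : ∀ {X Y a} → X ⊆ Y → Y a ≡ true → X a ≡ false → size X < size Y
  size-strict {X} {Y} {a} h ya xa = ≤-trans
    (≤-reflexive (trans (cong (_+ size X) (sym (once a))) refl))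
    (size-disjoint {｛ a ｝} {X} {Y} (λ x e → subst (λ y → Y y ≡ true) (sym (does-elim (x ≡? a) e)) ya) h
      (λ x e xx → true≢false (subst (λ y → X y ≡ true) (does-elim (x ≡? a) e) xx) xa))

  size-full⊆ : ∀ {X Y} → X ⊆ Y → size Y ≤ size X → Y ⊆ X
  size-full⊆ {X} {Y} h le y yy with X y in eq
  ... | true  = refl
  ... | false = ⊥-elim (<⇒≱ (size-strict {X} {Y} h yy eq) le)

  size-all : ∀ {X} → order ≤ size X → ∀ x → X x ≡ true
  size-all {X} h x = size-full⊆ {X} {λ _ → true} (λ _ _ → refl)
    (≤-trans (≤-reflexive (trans (∑-const els 1) (*-identityʳ order))) h) x refl

  size-∖single : ∀ {X a} → X a ≡ true → suc (size (X ∖ ｛ a ｝)) ≡ size X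
  size-∖single {X} {a} h = trans (cong (_+ size (X ∖ ｛ a ｝)) (trans (sym (once a)) (size-cong
      (λ x e → ∧-intro (subst (λ y → X y ≡ true) (sym (does-elim (x ≡? a) e)) h) e)
      (λ x e → proj₂ (∧-elim e))))) (size-∩∖ X ｛ a ｝)

  size≤1 : ∀ {X a} → (∀ x → X x ≡ true → x ≡ a) → size X ≤ 1
  size≤1 {X} {a} h = ≤-trans (size-mono {X} {｛ a ｝} (λ x e → does-intro (x ≡? a) (h x e))) (≤-reflexive (once a))

  size-two : ∀ {X a} → X a ≡ true → 2 ≤ size X → ∃[ b ] X b ≡ true × b ≢ a
  size-two {X} {a} h le with size-elem {X ∖ ｛ a ｝} (≤-pred (≤-trans le (≤-reflexive (sym (size-∖single {X} h)))))
  ... | b , e = b , proj₁ (∧-elim e) , λ { refl → true≢false (does-intro (b ≡? b) refl) (not-elim (proj₂ (∧-elim e))) }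

  size-∪≤ : ∀ X Y → size (X ∪ Y) ≤ size X + size Y
  size-∪≤ X Y = ≤-trans (m≤m+n _ _) (≤-reflexive (size-∪∩ X Y))

∑-tabulate : ∀ {n} {A : Set} (g : Fin n → A) (f : A → ℕ) → ∑ (tabulate g) f ≡ ∑ (allFin n) (λ i → f (g i))
∑-tabulate {zero}  g f = refl
∑-tabulate {suc n} g f = cong (f (g Data.Fin.zero) +_)
  (trans (∑-tabulate (g ∘ Data.Fin.suc) f) (sym (∑-tabulate Data.Fin.suc (f ∘ g))))

fin-once : ∀ {n} (a : Fin n) → ∑ (allFin n) (λ y → ⟨ does (y FinP.≟ a) ⟩) ≡ 1
fin-once {suc n} Data.Fin.zero = cong suc (trans (∑-tabulate {n} Data.Fin.suc (λ y → ⟨ does (y FinP.≟ Data.Fin.zero) ⟩)) (trans (∑-const (allFin n) 0) (*-zeroʳ (length (allFin n)))))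
fin-once {suc n} (Data.Fin.suc a) = trans (∑-tabulate {n} Data.Fin.suc (λ y → ⟨ does (y FinP.≟ Data.Fin.suc a) ⟩)) (fin-once a)

finType : ℕ → FinType
finType n = record { C = Fin n ; els = allFin n ; _≡?_ = FinP._≟_ ; once = fin-once }

length-allFin : ∀ n → length (allFin n) ≡ n
length-allFin n = length-tabulate (λ i → i)

-- Finite abelian groups of exponent p

infixl 6 _:+_
infix 8 gv_ :-_

data GEx : Set where
  gv_  : ℕ → GEx
  g0   : GEx
  _:+_ : GEx → GEx → GEx
  :-_  : GEx → GEx

private
  _+ˡ_ : List ℕ → List ℕ → List ℕ
  []       +ˡ ys       = ys
  (x ∷ xs) +ˡ []       = x ∷ xs
  (x ∷ xs) +ˡ (y ∷ ys) = x + y ∷ (xs +ˡ ys)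

  unit : ℕ → List ℕ
  unit zero    = 1 ∷ []
  unit (suc i) = 0 ∷ unit i

  posPart negPart : GEx → List ℕ
  posPart (gv i)   = unit i
  posPart g0       = []
  posPart (a :+ b) = posPart a +ˡ posPart b
  posPart (:- a)   = negPart a
  negPart (gv i)   = []
  negPart g0       = []
  negPart (a :+ b) = negPart a +ˡ negPart b
  negPart (:- a)   = posPart a

fold-multiple : {A : Set} → (A → A → A) → A → ℕ → A → A
fold-multiple _∙_ e zero    x = e
fold-multiple _∙_ e (suc n) x = x ∙ fold-multiple _∙_ e n x

record Grp (p : ℕ) : Set₁ where
  infixl 6 _⊞_ _⊟_
  infix 8 ⊟_
  field
    fin  : FinType
  open FinType fin using (C)
  field
    _⊞_    : C → C → C
    𝟘      : C
    ⊟_     : C → C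
    ⊞-assoc : ∀ x y z → (x ⊞ y) ⊞ z ≡ x ⊞ (y ⊞ z)
    ⊞-comm  : ∀ x y → x ⊞ y ≡ y ⊞ x
    ⊞-idˡ   : ∀ x → 𝟘 ⊞ x ≡ x
    ⊞-invʳ  : ∀ x → x ⊞ ⊟ x ≡ 𝟘
    torsion : ∀ x → fold-multiple _⊞_ 𝟘 p x ≡ 𝟘

  _⊟_ : C → C → C
  x ⊟ y = x ⊞ ⊟ y

  infixr 8 _·_
  _·_ : ℕ → C → C
  _·_ = fold-multiple _⊞_ 𝟘

module Group {p : ℕ} (p-prime : Prime p) (𝔾 : Grp p) where
  open Grp 𝔾 public
  open Sets fin public

  ⊞-idʳ : ∀ x → x ⊞ 𝟘 ≡ x
  ⊞-idʳ x = trans (⊞-comm x 𝟘) (⊞-idˡ x)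

  interchange : ∀ a b c d → (a ⊞ b) ⊞ (c ⊞ d) ≡ (a ⊞ c) ⊞ (b ⊞ d)
  interchange a b c d = begin
    (a ⊞ b) ⊞ (c ⊞ d) ≡⟨ ⊞-assoc a b (c ⊞ d) ⟩
    a ⊞ (b ⊞ (c ⊞ d)) ≡⟨ cong (a ⊞_) (sym (⊞-assoc b c d)) ⟩
    a ⊞ ((b ⊞ c) ⊞ d) ≡⟨ cong (λ t → a ⊞ (t ⊞ d)) (⊞-comm b c) ⟩
    a ⊞ ((c ⊞ b) ⊞ d) ≡⟨ cong (a ⊞_) (⊞-assoc c b d) ⟩
    a ⊞ (c ⊞ (b ⊞ d)) ≡⟨ sym (⊞-assoc a c (b ⊞ d)) ⟩
    (a ⊞ c) ⊞ (b ⊞ d) ∎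
    where open ≡-Reasoning

  ⊞-cancelʳ : ∀ {x y} z → x ⊞ z ≡ y ⊞ z → x ≡ y
  ⊞-cancelʳ {x} {y} z h = trans (sym (strip x)) (trans (cong (_⊞ ⊟ z) h) (strip y))
    where strip : ∀ x → (x ⊞ z) ⊞ ⊟ z ≡ x
          strip x = trans (⊞-assoc x z (⊟ z)) (trans (cong (x ⊞_) (⊞-invʳ z)) (⊞-idʳ x))

  ·-+ : ∀ a b x → (a + b) · x ≡ a · x ⊞ b · x
  ·-+ zero    b x = sym (⊞-idˡ _)
  ·-+ (suc a) b x = trans (cong (x ⊞_) (·-+ a b x)) (sym (⊞-assoc x _ _))

  private
    comb : List ℕ → List C → C
    comb (k ∷ ks) (x ∷ xs) = k · x ⊞ comb ks xs
    comb _        _        = 𝟘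

    comb-+ : ∀ k l xs → comb (k +ˡ l) xs ≡ comb k xs ⊞ comb l xs
    comb-+ []       l        xs       = sym (⊞-idˡ _)
    comb-+ (k ∷ ks) []       xs       = sym (⊞-idʳ _)
    comb-+ (k ∷ ks) (l ∷ ls) []       = sym (⊞-idˡ _)
    comb-+ (k ∷ ks) (l ∷ ls) (x ∷ xs) =
      trans (cong₂ _⊞_ (·-+ k l x) (comb-+ ks ls xs)) (interchange _ _ _ _)

    nthG : List C → ℕ → C
    nthG []       _       = 𝟘
    nthG (x ∷ _)  zero    = x
    nthG (_ ∷ xs) (suc i) = nthG xs i

    comb-unit : ∀ i xs → comb (unit i) xs ≡ nthG xs i
    comb-unit zero    []       = refl
    comb-unit (suc i) []       = refl
    comb-unit zero    (x ∷ xs) = trans (⊞-idʳ _) (⊞-idʳ x)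
    comb-unit (suc i) (x ∷ xs) = trans (⊞-idˡ _) (comb-unit i xs)

  ⟦_⟧ᵍ : GEx → List C → C
  ⟦ gv i ⟧ᵍ   xs = nthG xs i
  ⟦ g0 ⟧ᵍ     xs = 𝟘
  ⟦ a :+ b ⟧ᵍ xs = ⟦ a ⟧ᵍ xs ⊞ ⟦ b ⟧ᵍ xs
  ⟦ :- a ⟧ᵍ   xs = ⊟ ⟦ a ⟧ᵍ xs

  private
    split : ∀ e xs → ⟦ e ⟧ᵍ xs ⊞ comb (negPart e) xs ≡ comb (posPart e) xs
    split (gv i) xs = trans (⊞-idʳ _) (sym (comb-unit i xs))
    split g0     xs = ⊞-idˡ 𝟘
    split (a :+ b) xs = trans (cong (⟦ a :+ b ⟧ᵍ xs ⊞_) (comb-+ (negPart a) (negPart b) xs)) (trans (interchange _ _ _ _)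
      (trans (cong₂ _⊞_ (split a xs) (split b xs)) (sym (comb-+ (posPart a) (posPart b) xs))))
    split (:- a) xs = begin
      ⊟ A ⊞ comb (posPart a) xs     ≡⟨ cong (⊟ A ⊞_) (sym (split a xs)) ⟩
      ⊟ A ⊞ (A ⊞ comb (negPart a) xs) ≡⟨ sym (⊞-assoc _ _ _) ⟩
      (⊟ A ⊞ A) ⊞ comb (negPart a) xs ≡⟨ cong (_⊞ comb (negPart a) xs) (trans (⊞-comm _ _) (⊞-invʳ A)) ⟩
      𝟘 ⊞ comb (negPart a) xs       ≡⟨ ⊞-idˡ _ ⟩
      comb (negPart a) xs           ∎
      where open ≡-Reasoning
            A = ⟦ a ⟧ᵍ xs

  -- Decision procedure for identities in abelian groups. The integer coefficients are kept as two
  -- lists of naturals, a positive and a negative one; equality is tested by adding crosswise, and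
  -- `refl` proves the premise.
  grp : ∀ xs a b → posPart a +ˡ negPart b ≡ posPart b +ˡ negPart a → ⟦ a ⟧ᵍ xs ≡ ⟦ b ⟧ᵍ xs
  grp xs a b h = ⊞-cancelʳ (N a ⊞ N b) (begin
    A ⊞ (N a ⊞ N b)  ≡⟨ sym (⊞-assoc _ _ _) ⟩
    (A ⊞ N a) ⊞ N b  ≡⟨ cong (_⊞ N b) (split a xs) ⟩
    comb (posPart a) xs ⊞ N b ≡⟨ sym (comb-+ (posPart a) (negPart b) xs) ⟩
    comb (posPart a +ˡ negPart b) xs ≡⟨ cong (λ l → comb l xs) h ⟩
    comb (posPart b +ˡ negPart a) xs ≡⟨ comb-+ (posPart b) (negPart a) xs ⟩
    comb (posPart b) xs ⊞ N a ≡⟨ cong (_⊞ N a) (sym (split b xs)) ⟩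
    (B ⊞ N b) ⊞ N a  ≡⟨ ⊞-assoc _ _ _ ⟩
    B ⊞ (N b ⊞ N a)  ≡⟨ cong (B ⊞_) (⊞-comm _ _) ⟩
    B ⊞ (N a ⊞ N b)  ∎)
    where open ≡-Reasoning
          A = ⟦ a ⟧ᵍ xs
          B = ⟦ b ⟧ᵍ xs
          N = λ e → comb (negPart e) xs

  ·-* : ∀ a b x → (a * b) · x ≡ a · (b · x)
  ·-* zero    b x = refl
  ·-* (suc a) b x = trans (·-+ b (a * b) x) (cong (b · x ⊞_) (·-* a b x))

  ·-𝟘 : ∀ a → a · 𝟘 ≡ 𝟘
  ·-𝟘 zero    = refl
  ·-𝟘 (suc a) = trans (⊞-idˡ _) (·-𝟘 a)

  ⊟≡· : ∀ x → ⊟ x ≡ (p ∸ 1) · x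
  ⊟≡· x = ⊞-cancelʳ x (trans (grp (x ∷ []) (:- (gv 0) :+ gv 0) g0 refl) (trans (sym (torsion x))
    (trans (cong (_· x) (sym (m+[n∸m]≡n (n≢0⇒n>0 (Data.Nat.≢-nonZero⁻¹ p {{prime⇒nonZero p-prime}})))))
           (⊞-comm x ((p ∸ 1) · x)))))

  -- Bézout for j and p: as p annihilates x, a relation 1 + ap = bj gives x = b (j x). With the
  -- other sign the relation produces -x, which is repaired by -1 = p - 1. It serves as division by
  -- j in every group of exponent p.
  unmultiple : ∀ j x → 0 < j → j < p → (∃[ u ] x ≡ u · (j · x))
  unmultiple j x 0<j j<p with coprime-Bézout (prime⇒coprime p-prime {{Data.Nat.>-nonZero 0<j}} j<p)
  ... | Bézout.-+ a b eq = b , (begin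
    x                 ≡⟨ sym (⊞-idʳ x) ⟩
    x ⊞ 𝟘             ≡⟨ cong (x ⊞_) (sym (trans (·-* a p x) (trans (cong (a ·_) (torsion x)) (·-𝟘 a)))) ⟩
    (1 + a * p) · x   ≡⟨ cong (_· x) eq ⟩
    (b * j) · x       ≡⟨ ·-* b j x ⟩
    b · (j · x)       ∎)
    where open ≡-Reasoning
  ... | Bézout.+- a b eq = (p ∸ 1) * b , (begin
    x                     ≡⟨ (grp (x ∷ y ∷ []) (gv 0) (:- (gv 1 :+ :- (gv 0 :+ gv 1))) refl) ⟩
    ⊟ (y ⊟ (x ⊞ y))       ≡⟨ cong (λ t → ⊟ (y ⊟ t)) x+y ⟩
    ⊟ (y ⊟ 𝟘)             ≡⟨ (grp (y ∷ []) (:- (gv 0 :+ :- g0)) (:- (gv 0)) refl) ⟩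
    ⊟ y                   ≡⟨ ⊟≡· y ⟩
    (p ∸ 1) · y           ≡⟨ sym (·-* (p ∸ 1) b (j · x)) ⟩
    ((p ∸ 1) * b) · (j · x) ∎)
    where open ≡-Reasoning
          y = b · (j · x)
          x+y : x ⊞ y ≡ 𝟘
          x+y = trans (cong (x ⊞_) (sym (·-* b j x))) (trans (cong (_· x) eq)
                (trans (·-* a p x) (trans (cong (a ·_) (torsion x)) (·-𝟘 a))))

  translate : Subset → C → Subset
  translate X e x = X (x ⊟ e)

  size-translate : ∀ X e → size (translate X e) ≡ size X
  size-translate X e = bijection-∑ fin fin (_⊟ e) (_⊞ e)
    (λ x → (grp (x ∷ e ∷ []) (gv 0 :+ :- (gv 1) :+ gv 1) (gv 0) refl)) (λ x → (grp (x ∷ e ∷ []) (gv 0 :+ gv 1 :+ :- (gv 1)) (gv 0) refl)) (λ x → ⟨ X x ⟩)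

  size-reflect : ∀ X e → size (λ x → X (e ⊟ x)) ≡ size X
  size-reflect X e = bijection-∑ fin fin (λ x → e ⊟ x) (λ x → e ⊟ x)
    (λ x → (grp (e ∷ x ∷ []) (gv 0 :+ :- (gv 0 :+ :- (gv 1))) (gv 1) refl)) (λ x → (grp (e ∷ x ∷ []) (gv 0 :+ :- (gv 0 :+ :- (gv 1))) (gv 1) refl)) (λ x → ⟨ X x ⟩)

  _⊹_ : Subset → Subset → Subset
  (X ⊹ Y) z = any (λ x → X x ∧ Y (z ⊟ x)) els

  ⊹-intro : ∀ {X Y x y} → X x ≡ true → Y y ≡ true → (X ⊹ Y) (x ⊞ y) ≡ true
  ⊹-intro {X} {Y} {x} {y} hx hy = any-intro {λ w → X w ∧ Y ((x ⊞ y) ⊟ w)} {x}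
    (∧-intro hx (subst (λ t → Y t ≡ true) (grp (y ∷ x ∷ []) (gv 0) (gv 1 :+ gv 0 :+ :- (gv 1)) refl) hy))

  ⊹-elim : ∀ {X Y z} → (X ⊹ Y) z ≡ true → ∃[ x ] ∃[ y ] X x ≡ true × Y y ≡ true × z ≡ x ⊞ y
  ⊹-elim {X} {Y} {z} h with any⇒∃ (λ x → X x ∧ Y (z ⊟ x)) els h
  ... | x , e = x , z ⊟ x , proj₁ (∧-elim e) , proj₂ (∧-elim e) , (grp (z ∷ x ∷ []) (gv 0) (gv 1 :+ (gv 0 :+ :- (gv 1))) refl)

  Closed : Subset → Set
  Closed H = ∀ x y → H x ≡ true → H y ≡ true → H (x ⊞ y) ≡ true

  closed-· : ∀ {H} → H 𝟘 ≡ true → Closed H → ∀ n x → H x ≡ true → H (n · x) ≡ true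
  closed-· z c zero    x h = z
  closed-· z c (suc n) x h = c x _ h (closed-· z c n x h)

  closed-⊟ : ∀ {H} → H 𝟘 ≡ true → Closed H → ∀ x → H x ≡ true → H (⊟ x) ≡ true
  closed-⊟ {H} z c x h = subst (λ t → H t ≡ true) (sym (⊟≡· x)) (closed-· z c (p ∸ 1) x h)

  -- The translates of H by 0, x, ..., (p - 1) x are disjoint: a common point of two of them would
  -- put a multiple j x with 0 < j < p into H, and x is a multiple of that. So p copies of H fit
  -- into the group.
  proper-index : ∀ {H x} → H 𝟘 ≡ true → Closed H → H x ≡ false → p * size H ≤ order
  proper-index {H} {x} z c x∉H = begin
    p * size H
      ≡⟨ cong (_* size H) (sym (length-allFin p)) ⟩
    length (allFin p) * size H
      ≡⟨ sym (∑-const (allFin p) (size H)) ⟩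
    ∑ (allFin p) (λ j → size H)
      ≡⟨ ∑-cong (allFin p) (λ j → sym (size-translate H (toℕ j · x))) ⟩
    ∑ (allFin p) (λ j → size (translate H (toℕ j · x)))
      ≡⟨ ∑-swap (allFin p) els _ ⟩
    ∑ els (λ y → Sets.size (finType p) (λ j → H (y ⊟ toℕ j · x)))
      ≤⟨ ∑-mono els one ⟩
    ∑ els (λ _ → 1)
      ≡⟨ trans (∑-const els 1) (*-identityʳ order) ⟩
    order ∎
    where
    open ≤-Reasoning
    lower : ∀ i j y → i < j → j < p → H (y ⊟ i · x) ≡ true → H (y ⊟ j · x) ≡ true → ⊥
    lower i j y i<j j<p hi hj with m<n⇒∃[o]m+o≡n i<j
      where
      m<n⇒∃[o]m+o≡n : ∀ {m n} → m < n → ∃[ o ] m + suc o ≡ n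
      m<n⇒∃[o]m+o≡n {m} h with m≤n⇒∃[o]m+o≡n h
      ... | o , e = o , trans (+-suc m o) e
    ... | o , refl with unmultiple (suc o) x (s≤s z≤n) (≤-<-trans (m≤n+m (suc o) i) j<p)
    ... | u , e = true≢false (subst (λ t → H t ≡ true) (sym e) (closed-· {H} z c u _ diff)) x∉H
      where
      diff : H (suc o · x) ≡ true
      diff = subst (λ t → H t ≡ true)
        (trans (cong (λ t → (y ⊟ i · x) ⊟ (y ⊟ t)) (·-+ i (suc o) x))
          (grp (y ∷ (i · x) ∷ (suc o · x) ∷ []) (gv 0 :+ :- (gv 1) :+ :- (gv 0 :+ :- (gv 1 :+ gv 2))) (gv 2) refl))
        (c _ _ hi (closed-⊟ {H} z c _ hj))
    one : ∀ y → Sets.size (finType p) (λ j → H (y ⊟ toℕ j · x)) ≤ 1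
    one y with Sets.search (finType p) (λ j → H (y ⊟ toℕ j · x))
    ... | inj₁ (j , hj) = Sets.size≤1 (finType p) {a = j} same
      where
      same : ∀ i → H (y ⊟ toℕ i · x) ≡ true → i ≡ j
      same i hi with <-cmp (toℕ i) (toℕ j)
        where open import Data.Nat.Properties using (<-cmp)
      ... | Relation.Binary.tri< lt _ _ = ⊥-elim (lower _ _ y lt (FinP.toℕ<n j) hi hj)
      ... | Relation.Binary.tri≈ _ eq _ = FinP.toℕ-injective eq
      ... | Relation.Binary.tri> _ _ gt = ⊥-elim (lower _ _ y gt (FinP.toℕ<n i) hj hi)
    ... | inj₂ none = ≤-trans (≤-reflexive (trans (∑-cong (allFin p) (λ j → cong ⟨_⟩ (none j)))
                       (trans (∑-const (allFin p) 0) (*-zeroʳ (length (allFin p)))))) z≤n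

  -- Dyson's transform: replacing (A, B) by (A ∪ (e + B), B ∩ (A - e)) keeps |A| + |B| and A + B ⊆ Z.
  dyson-A dyson-B : Subset → Subset → C → Subset
  dyson-A A B e x = A x ∨ B (x ⊟ e)
  dyson-B A B e y = B y ∧ A (e ⊞ y)

  dyson-size : ∀ A B e → size (dyson-A A B e) + size (dyson-B A B e) ≡ size A + size B
  dyson-size A B e = begin
    size (dyson-A A B e) + size (dyson-B A B e)
      ≡⟨ cong (size (dyson-A A B e) +_) shift ⟩
    size (A ∪ translate B e) + size (A ∩ translate B e)
      ≡⟨ size-∪∩ A (translate B e) ⟩
    size A + size (translate B e)
      ≡⟨ cong (size A +_) (size-translate B e) ⟩
    size A + size B ∎
    where
    open ≡-Reasoning
    shift : size (dyson-B A B e) ≡ size (A ∩ translate B e)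
    shift = trans (size-cong
      (λ y h → ∧-intro (subst (λ t → A t ≡ true) (grp (e ∷ y ∷ []) (gv 0 :+ gv 1) (gv 1 :+ :- (:- (gv 0))) refl) (proj₂ (∧-elim h)))
                       (subst (λ t → B t ≡ true) (grp (y ∷ e ∷ []) (gv 0) (gv 0 :+ :- (:- (gv 1)) :+ :- (gv 1)) refl) (proj₁ (∧-elim h))))
      (λ y h → ∧-intro (subst (λ t → B t ≡ true) (grp (y ∷ e ∷ []) (gv 0 :+ :- (:- (gv 1)) :+ :- (gv 1)) (gv 0) refl) (proj₂ (∧-elim h)))
                       (subst (λ t → A t ≡ true) (grp (y ∷ e ∷ []) (gv 0 :+ :- (:- (gv 1))) (gv 1 :+ gv 0) refl) (proj₁ (∧-elim h)))))
      (size-translate (A ∩ translate B e) (⊟ e))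

  _⊹_⊆_ : Subset → Subset → Subset → Set
  A ⊹ B ⊆ Z = ∀ x y → A x ≡ true → B y ≡ true → Z (x ⊞ y) ≡ true

  dyson-sum : ∀ {A B Z} → A ⊹ B ⊆ Z → ∀ e → dyson-A A B e ⊹ dyson-B A B e ⊆ Z
  dyson-sum {A} {B} {Z} h e x y hx hy with ∨-elim hx
  ... | inj₁ ax = h x y ax (proj₁ (∧-elim hy))
  ... | inj₂ bx = subst (λ t → Z t ≡ true) (grp (e ∷ y ∷ x ∷ []) (gv 0 :+ gv 1 :+ (gv 2 :+ :- (gv 0))) (gv 2 :+ gv 1) refl)
                    (h (e ⊞ y) (x ⊟ e) (proj₂ (∧-elim hy)) bx)

  size-summand : ∀ {A B Z b} → A ⊹ B ⊆ Z → B b ≡ true → size A ≤ size Z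
  size-summand {A} {B} {Z} {b} h hb = ≤-trans
    (size-mono {A} {λ x → Z (x ⊞ b)} (λ x ax → h x b ax hb))
    (≤-reflexive (trans (∑-cong els (λ x → cong (⟨_⟩ ∘ Z) (grp (x ∷ b ∷ []) (gv 0 :+ gv 1) (gv 0 :+ :- (:- (gv 1))) refl))) (size-translate Z (⊟ b))))

  -- Kneser's bound with the size of the stabiliser replaced by |G|/p, the most a proper subgroup
  -- can have. The induction is on |B|: Dyson transforms shrink B while |A| + |B| and Z stay, until
  -- every one of them is trivial.
  kneser : ∀ {A B Z a b z} → A ⊹ B ⊆ Z → A a ≡ true → B b ≡ true → Z z ≡ false →
           p * (size A + size B) ≤ p * size Z + order
  kneser {A} {B} = go (size B) A B ≤-refl
    where
    go : ∀ n A B → size B ≤ n → ∀ {Z a b z} → A ⊹ B ⊆ Z → A a ≡ true → B b ≡ true → Z z ≡ false →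
         p * (size A + size B) ≤ p * size Z + order
    -- A transform helps if it keeps some but not all of B.
    go n A B le {Z} {a} {b} {z} sum ha hb hz with search (λ e → any (dyson-B A B e) els ∧ any (λ y → B y ∧ not (A (e ⊞ y))) els)
    go zero A B le {Z} {a} {b} {z} sum ha hb hz | inj₁ _ = ⊥-elim (<⇒≱ (size-pos {B} hb) le)
    go (suc n) A B le {Z} {a} {b} {z} sum ha hb hz | inj₁ (e , h)
      with any⇒∃ (dyson-B A B e) els (proj₁ (∧-elim h)) | any⇒∃ (λ y → B y ∧ not (A (e ⊞ y))) els (proj₂ (∧-elim h))
    ... | y , hy | y′ , hy′ = subst (λ t → p * t ≤ p * size Z + order) (dyson-size A B e)
      (go n (dyson-A A B e) (dyson-B A B e)
        (≤-pred (≤-trans (size-strict {dyson-B A B e} {B} (λ w hw → proj₁ (∧-elim hw)) (proj₁ (∧-elim hy′))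
           (¬true⇒false λ t → true≢false (proj₂ (∧-elim {B y′} {A (e ⊞ y′)} t)) (not-elim (proj₂ (∧-elim {B y′} hy′))))) le))
        {Z} {a} {y} {z} (dyson-sum {A} {B} {Z} sum e) (∨-introˡ ha) hy hz)
    go n A B le {Z} {a} {b} {z} sum ha hb hz | inj₂ none = bound
      where
      -- No transform helps. For e = x - b the point b survives, so all of B survives, which says x
      -- - b + B ⊆ A: A is invariant under B - b.
      shift : ∀ x y → A x ≡ true → B y ≡ true → A (x ⊞ (y ⊟ b)) ≡ true
      shift x y hx hy with A ((x ⊟ b) ⊞ y) in eq
      ... | true  = subst (λ t → A t ≡ true) (grp (x ∷ b ∷ y ∷ []) (gv 0 :+ :- (gv 1) :+ gv 2) (gv 0 :+ (gv 2 :+ :- (gv 1))) refl) eq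
      ... | false = ⊥-elim (true≢false (∧-intro
              (any-intro {dyson-B A B (x ⊟ b)} {b} (∧-intro hb (subst (λ t → A t ≡ true) (grp (x ∷ b ∷ []) (gv 0) (gv 0 :+ :- (gv 1) :+ gv 1) refl) hx)))
              (any-intro {λ y → B y ∧ not (A ((x ⊟ b) ⊞ y))} {y} (∧-intro hy (not-intro eq)))) (none (x ⊟ b)))
      -- The translations that map A into itself. They contain B - b, are closed under addition, and
      -- are not everything because A + b omits z. Hence |B| ≤ |H| ≤ |G|/p, while |A| ≤ |Z|.
      H : Subset
      H h = not (any (λ x → A x ∧ not (A (x ⊞ h))) els)
      H-intro : ∀ h → (∀ x → A x ≡ true → A (x ⊞ h) ≡ true) → H h ≡ true
      H-intro h f = not-intro (¬true⇒false λ t → let (x , e) = any⇒∃ _ els t in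
        true≢false (f x (proj₁ (∧-elim e))) (not-elim (proj₂ (∧-elim e))))
      H-elim : ∀ h → H h ≡ true → ∀ x → A x ≡ true → A (x ⊞ h) ≡ true
      H-elim h t x ax with A (x ⊞ h) in eq
      ... | true  = refl
      ... | false = ⊥-elim (true≢false (any-intro {λ x → A x ∧ not (A (x ⊞ h))} {x} (∧-intro ax (not-intro eq))) (not-elim t))
      H-𝟘 : H 𝟘 ≡ true
      H-𝟘 = H-intro 𝟘 (λ x ax → subst (λ t → A t ≡ true) (sym (⊞-idʳ x)) ax)
      H-closed : Closed H
      H-closed g h hg hh = H-intro (g ⊞ h) (λ x ax → subst (λ t → A t ≡ true) (⊞-assoc x g h)
        (H-elim h hh _ (H-elim g hg x ax)))
      B≤H : size B ≤ size H
      B≤H = ≤-trans (≤-reflexive (trans (sym (size-translate B (⊟ b))) (∑-cong els (λ x → cong (⟨_⟩ ∘ B) (grp (x ∷ b ∷ []) (gv 0 :+ :- (:- (gv 1))) (gv 0 :+ gv 1) refl)))))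
              (size-mono {λ x → B (x ⊞ b)} {H} (λ y hy → H-intro y (λ x ax →
                 subst (λ t → A t ≡ true) (grp (x ∷ y ∷ b ∷ []) (gv 0 :+ (gv 1 :+ gv 2 :+ :- (gv 2))) (gv 0 :+ gv 1) refl) (shift x (y ⊞ b) ax hy))))
      A≤Z : size A ≤ size Z
      A≤Z = size-summand {A} {B} {Z} {b} sum hb
      H-proper : H (z ⊟ b ⊟ a) ≡ false
      H-proper = ¬true⇒false λ t → true≢false (subst (λ t → Z t ≡ true) (grp (a ∷ z ∷ b ∷ []) (gv 0 :+ (gv 1 :+ :- (gv 2) :+ :- (gv 0)) :+ gv 2) (gv 1) refl)
        (sum _ b (H-elim _ t a ha) hb)) hz
      bound : p * (size A + size B) ≤ p * size Z + order
      bound = begin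
        p * (size A + size B)     ≡⟨ *-distribˡ-+ p (size A) (size B) ⟩
        p * size A + p * size B   ≤⟨ +-mono-≤ (*-monoʳ-≤ p A≤Z) (*-monoʳ-≤ p B≤H) ⟩
        p * size Z + p * size H   ≤⟨ +-monoʳ-≤ (p * size Z) (proper-index {H} {z ⊟ b ⊟ a} H-𝟘 H-closed H-proper) ⟩
        p * size Z + order        ∎
        where open ≤-Reasoning

-- The prime field and its vector spaces

countTrue≡∑ : ∀ {p} {{_ : NonZero p}} {A : Set} (X : A → Bool) (l : List A) → countTrue {p} (map X l) ≡ ∑ l (λ x → ⟨ X x ⟩)
countTrue≡∑ X []       = refl
countTrue≡∑ {p} X (x ∷ xs) with X x
... | true  = cong suc (countTrue≡∑ {p} X xs)
... | false = countTrue≡∑ {p} X xs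

module PrimeField {p : ℕ} {{p-nonZero : NonZero p}} (p-prime : Prime p) where

  𝔽 : Set
  𝔽 = Fin p

  toℕ-[] : ∀ a → toℕ {p} [ a ]ₚ ≡ a % p
  toℕ-[] a = FinP.toℕ-fromℕ< (m%n<n a p)

  []-cong : ∀ {a b} → a % p ≡ b % p → [ a ]ₚ ≡ [ b ]ₚ
  []-cong {a} {b} h = FinP.toℕ-injective (trans (toℕ-[] a) (trans h (sym (toℕ-[] b))))

  toℕ-[]< : ∀ {a} → a < p → toℕ {p} [ a ]ₚ ≡ a
  toℕ-[]< {a} h = trans (toℕ-[] a) (m<n⇒m%n≡m h)

  []-toℕ : ∀ (x : 𝔽) → [ toℕ x ]ₚ ≡ x
  []-toℕ x = FinP.toℕ-injective (toℕ-[]< (FinP.toℕ<n x))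

  []-+ : ∀ a b → [ a ]ₚ +F [ b ]ₚ ≡ [ a + b ]ₚ
  []-+ a b = []-cong (trans (cong (_% p) (cong₂ _+_ (toℕ-[] a) (toℕ-[] b))) (sym (%-distribˡ-+ a b p)))

  []-* : ∀ a b → [ a ]ₚ *F [ b ]ₚ ≡ [ a * b ]ₚ
  []-* a b = []-cong (trans (cong (_% p) (cong₂ _*_ (toℕ-[] a) (toℕ-[] b))) (sym (%-distribˡ-* a b p)))

  []-mod : ∀ a k → [ a + k * p ]ₚ ≡ [ a ]ₚ
  []-mod a k = []-cong ([m+kn]%n≡m%n a k p)

  []-+p : ∀ a → [ a + p ]ₚ ≡ [ a ]ₚ
  []-+p a = []-cong ([m+n]%n≡m%n a p)

  []-p : [ p ]ₚ ≡ [ 0 ]ₚ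
  []-p = []-+p 0

  []-inj : ∀ {a b} → a < p → b < p → [ a ]ₚ ≡ [ b ]ₚ → a ≡ b
  []-inj ha hb e = trans (sym (toℕ-[]< ha)) (trans (cong toℕ e) (toℕ-[]< hb))

  +F-comm : ∀ (x y : 𝔽) → x +F y ≡ y +F x
  +F-comm x y = cong [_]ₚ (+-comm (toℕ x) (toℕ y))

  +F-assoc : ∀ (x y z : 𝔽) → (x +F y) +F z ≡ x +F (y +F z)
  +F-assoc x y z = begin
    (x +F y) +F z                   ≡⟨ cong ((x +F y) +F_) (sym ([]-toℕ z)) ⟩
    [ X + Y ]ₚ +F [ Z ]ₚ            ≡⟨ []-+ (X + Y) Z ⟩
    [ X + Y + Z ]ₚ                  ≡⟨ cong [_]ₚ (+-assoc X Y Z) ⟩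
    [ X + (Y + Z) ]ₚ                ≡⟨ sym ([]-+ X (Y + Z)) ⟩
    [ X ]ₚ +F (y +F z)              ≡⟨ cong (_+F (y +F z)) ([]-toℕ x) ⟩
    x +F (y +F z)                   ∎
    where open ≡-Reasoning
          X = toℕ x
          Y = toℕ y
          Z = toℕ z

  +F-idˡ : ∀ (x : 𝔽) → [ 0 ]ₚ +F x ≡ x
  +F-idˡ x = trans (cong ([ 0 ]ₚ +F_) (sym ([]-toℕ x))) (trans ([]-+ 0 (toℕ x)) ([]-toℕ x))

  +F-invʳ : ∀ (x : 𝔽) → x +F (-F x) ≡ [ 0 ]ₚ
  +F-invʳ x = begin
    x +F (-F x)                     ≡⟨ cong (_+F (-F x)) (sym ([]-toℕ x)) ⟩
    [ toℕ x ]ₚ +F [ p ∸ toℕ x ]ₚ    ≡⟨ []-+ (toℕ x) (p ∸ toℕ x) ⟩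
    [ toℕ x + (p ∸ toℕ x) ]ₚ        ≡⟨ cong [_]ₚ (m+[n∸m]≡n (<⇒≤ (FinP.toℕ<n x))) ⟩
    [ p ]ₚ                          ≡⟨ []-p ⟩
    [ 0 ]ₚ                          ∎
    where open ≡-Reasoning

  *F-comm : ∀ (x y : 𝔽) → x *F y ≡ y *F x
  *F-comm x y = cong [_]ₚ (*-comm (toℕ x) (toℕ y))

  *F-assoc : ∀ (x y z : 𝔽) → (x *F y) *F z ≡ x *F (y *F z)
  *F-assoc x y z = begin
    (x *F y) *F z                   ≡⟨ cong ((x *F y) *F_) (sym ([]-toℕ z)) ⟩
    [ X * Y ]ₚ *F [ Z ]ₚ            ≡⟨ []-* (X * Y) Z ⟩
    [ X * Y * Z ]ₚ                  ≡⟨ cong [_]ₚ (*-assoc X Y Z) ⟩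
    [ X * (Y * Z) ]ₚ                ≡⟨ sym ([]-* X (Y * Z)) ⟩
    [ X ]ₚ *F (y *F z)              ≡⟨ cong (_*F (y *F z)) ([]-toℕ x) ⟩
    x *F (y *F z)                   ∎
    where open ≡-Reasoning
          X = toℕ x
          Y = toℕ y
          Z = toℕ z

  *F-idˡ : ∀ (x : 𝔽) → [ 1 ]ₚ *F x ≡ x
  *F-idˡ x = trans (cong ([ 1 ]ₚ *F_) (sym ([]-toℕ x))) (trans ([]-* 1 (toℕ x)) (trans (cong [_]ₚ (+-identityʳ (toℕ x))) ([]-toℕ x)))

  *F-distribˡ : ∀ (x y z : 𝔽) → x *F (y +F z) ≡ x *F y +F x *F z
  *F-distribˡ x y z = begin
    x *F (y +F z)                   ≡⟨ cong (_*F (y +F z)) (sym ([]-toℕ x)) ⟩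
    [ X ]ₚ *F [ Y + Z ]ₚ            ≡⟨ []-* X (Y + Z) ⟩
    [ X * (Y + Z) ]ₚ                ≡⟨ cong [_]ₚ (*-distribˡ-+ X Y Z) ⟩
    [ X * Y + X * Z ]ₚ              ≡⟨ sym ([]-+ (X * Y) (X * Z)) ⟩
    x *F y +F x *F z                ∎
    where open ≡-Reasoning
          X = toℕ x
          Y = toℕ y
          Z = toℕ z

  *F-zeroˡ : ∀ (x : 𝔽) → [ 0 ]ₚ *F x ≡ [ 0 ]ₚ
  *F-zeroˡ x = trans (cong ([ 0 ]ₚ *F_) (sym ([]-toℕ x))) ([]-* 0 (toℕ x))

  *F-zeroʳ : ∀ (x : 𝔽) → x *F [ 0 ]ₚ ≡ [ 0 ]ₚ
  *F-zeroʳ x = trans (*F-comm x [ 0 ]ₚ) (*F-zeroˡ x)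

  *F-distribʳ : ∀ (x y z : 𝔽) → (y +F z) *F x ≡ y *F x +F z *F x
  *F-distribʳ x y z = trans (*F-comm (y +F z) x) (trans (*F-distribˡ x y z) (cong₂ _+F_ (*F-comm x y) (*F-comm x z)))

  multiple≡ : ∀ n (x : 𝔽) → fold-multiple _+F_ [ 0 ]ₚ n x ≡ [ n ]ₚ *F x
  multiple≡ zero    x = sym (*F-zeroˡ x)
  multiple≡ (suc n) x = trans (cong (x +F_) (multiple≡ n x))
    (trans (cong (_+F [ n ]ₚ *F x) (sym (*F-idˡ x)))
    (trans (sym (*F-distribʳ x [ 1 ]ₚ [ n ]ₚ)) (cong (_*F x) ([]-+ 1 n))))

  𝔽-group : Grp p
  𝔽-group = record
    { fin = finType p ; _⊞_ = _+F_ ; 𝟘 = [ 0 ]ₚ ; ⊟_ = λ x → -F x ; ⊞-assoc = +F-assoc ; ⊞-comm = +F-comm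
    ; ⊞-idˡ = +F-idˡ ; ⊞-invʳ = +F-invʳ
    ; torsion = λ x → trans (multiple≡ p x) (trans (cong (_*F x) []-p) (*F-zeroˡ x)) }

  module Fp = Group p-prime 𝔽-group

  card1≡size : ∀ (X : 𝔽 → Bool) → card1 X ≡ Fp.size X
  card1≡size X = countTrue≡∑ {p} X (allFin p)

  order-𝔽 : Fp.order ≡ p
  order-𝔽 = length-allFin p

  *F-neg : ∀ (x y : 𝔽) → x *F (-F y) ≡ -F (x *F y)
  *F-neg x y = Fp.⊞-cancelʳ (x *F y) (trans (sym (*F-distribˡ x (-F y) y))
    (trans (cong (x *F_) (Fp.grp (y ∷ []) (:- (gv 0) :+ gv 0) g0 refl)) (trans (*F-zeroʳ x) (Fp.grp (z ∷ []) g0 (:- (gv 0) :+ gv 0) refl))))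
    where z = x *F y

  nonzero-pos : ∀ (x : 𝔽) → x ≢ [ 0 ]ₚ → 0 < toℕ x
  nonzero-pos x h with toℕ x in eq
  ... | zero  = ⊥-elim (h (trans (sym ([]-toℕ x)) (cong [_]ₚ eq)))
  ... | suc _ = s≤s z≤n

  inverse : ∀ (x : 𝔽) → x ≢ [ 0 ]ₚ → ∃[ y ] y *F x ≡ [ 1 ]ₚ
  inverse x h with Fp.unmultiple (toℕ x) [ 1 ]ₚ (nonzero-pos x h) (FinP.toℕ<n x)
  ... | u , e = [ u ]ₚ , sym (trans e (trans (multiple≡ u _) (cong ([ u ]ₚ *F_)
        (trans (multiple≡ (toℕ x) [ 1 ]ₚ) (trans (cong (_*F [ 1 ]ₚ) ([]-toℕ x)) (trans (*F-comm x [ 1 ]ₚ) (*F-idˡ x)))))))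

  *F-cancelˡ : ∀ {x y z : 𝔽} → x ≢ [ 0 ]ₚ → x *F y ≡ x *F z → y ≡ z
  *F-cancelˡ {x} {y} {z} h e with inverse x h
  ... | u , ux = trans (sym (undo y)) (trans (cong (u *F_) e) (undo z))
    where undo : ∀ w → u *F (x *F w) ≡ w
          undo w = trans (sym (*F-assoc u x w)) (trans (cong (_*F w) ux) (*F-idˡ w))

  *F-nonzero : ∀ {x y : 𝔽} → x ≢ [ 0 ]ₚ → y ≢ [ 0 ]ₚ → x *F y ≢ [ 0 ]ₚ
  *F-nonzero {x} hx hy e = hy (*F-cancelˡ hx (trans e (sym (*F-zeroʳ x))))

  1<p : 1 < p
  1<p = Data.Nat.nonTrivial⇒n>1 p {{prime⇒nonTrivial p-prime}}

  1≢0 : [ 1 ]ₚ ≢ [ 0 ]ₚ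
  1≢0 e with []-inj 1<p (<⇒≤ 1<p) e
  ... | ()

  private
    *-monoid : CommutativeMonoid _ _
    *-monoid = record { Carrier = 𝔽 ; _≈_ = _≡_ ; _∙_ = _*F_ ; ε = [ 1 ]ₚ ; isCommutativeMonoid = record
      { isMonoid = record { isSemigroup = record { isMagma = record { isEquivalence = isEquivalence ; ∙-cong = cong₂ _*F_ }
          ; assoc = *F-assoc } ; identity = *F-idˡ , (λ x → trans (*F-comm x [ 1 ]ₚ) (*F-idˡ x)) } ; comm = *F-comm } }
    open ProductOf *-monoid using () renaming (sum to product; sum-permute to product-permute; ∑-distrib-+ to product-distrib)

    unitOr : 𝔽 → 𝔽 → 𝔽
    unitOr c y with y FinP.≟ [ 0 ]ₚ
    ... | yes _ = [ 1 ]ₚ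
    ... | no  _ = c

    product-nonzero : ∀ {n} (f : Fin n → 𝔽) → (∀ i → f i ≢ [ 0 ]ₚ) → product f ≢ [ 0 ]ₚ
    product-nonzero {zero}  f h = 1≢0
    product-nonzero {suc n} f h = *F-nonzero (h Data.Fin.zero) (product-nonzero (λ i → f (Data.Fin.suc i)) (λ i → h (Data.Fin.suc i)))

    product-const : ∀ n x → product {n} (λ _ → x) ≡ [ toℕ x ^ n ]ₚ
    product-const zero    x = refl
    product-const (suc n) x = trans (cong (x *F_) (product-const n x))
      (trans (cong (_*F [ toℕ x ^ n ]ₚ) (sym ([]-toℕ x))) ([]-* (toℕ x) (toℕ x ^ n)))

    -- the zero index contributes the factor 1
    product-unitOr : ∀ {n} (g : Fin n → 𝔽) x → (∀ i → toℕ (g i) ≡ toℕ i) → 1 ≤ n → product (λ i → unitOr x (g i)) ≡ [ toℕ x ^ (n ∸ 1) ]ₚ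
    product-unitOr {suc n} g x hg _ = trans (cong₂ _*F_ first (trans (rest n (λ i → g (Data.Fin.suc i)) (λ i → hg (Data.Fin.suc i))) (product-const n x))) (*F-idˡ _)
      where
      first : unitOr x (g Data.Fin.zero) ≡ [ 1 ]ₚ
      first with g Data.Fin.zero FinP.≟ [ 0 ]ₚ
      ... | yes _ = refl
      ... | no  h = ⊥-elim (h (FinP.toℕ-injective (trans (hg Data.Fin.zero) (sym (toℕ-[]< (<⇒≤ 1<p))))))
      rest : ∀ n (g : Fin n → 𝔽) → (∀ i → toℕ (g i) ≡ suc (toℕ i)) → product (λ i → unitOr x (g i)) ≡ product {n} (λ _ → x)
      rest n g hg = ProductOf.sum-cong-≋ *-monoid one
        where
        one : ∀ i → unitOr x (g i) ≡ x
        one i with g i FinP.≟ [ 0 ]ₚ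
        ... | no _ = refl
        ... | yes e with trans (sym (hg i)) (trans (cong toℕ e) (toℕ-[]< (<⇒≤ 1<p)))
        ...   | ()

  -- Multiplication by x permutes the nonzero residues, so their product absorbs the factor x^(p -
  -- 1). It is required because `invF` is defined as a power; inverses elsewhere come from Bézout
  -- through `inverse`.
  fermat : ∀ (x : 𝔽) → x ≢ [ 0 ]ₚ → [ toℕ x ^ (p ∸ 1) ]ₚ ≡ [ 1 ]ₚ
  fermat x hx with inverse x hx
  ... | u , ux = *F-cancelˡ (product-nonzero f f≢0) (begin
    product f *F [ toℕ x ^ (p ∸ 1) ]ₚ     ≡⟨ *F-comm (product f) _ ⟩
    [ toℕ x ^ (p ∸ 1) ]ₚ *F product f     ≡⟨ cong (_*F product f) (sym (product-unitOr (λ i → i) x (λ _ → refl) (<⇒≤ 1<p))) ⟩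
    product (unitOr x) *F product f       ≡⟨ sym (product-distrib (unitOr x) f) ⟩
    product (λ y → unitOr x y *F f y)     ≡⟨ ProductOf.sum-cong-≋ *-monoid fx ⟩
    product (λ y → f (x *F y))            ≡⟨ sym (product-permute f π) ⟩
    product f                             ≡⟨ trans (sym (*F-idˡ (product f))) (*F-comm [ 1 ]ₚ (product f)) ⟩
    product f *F [ 1 ]ₚ                   ∎)
    where
    open ≡-Reasoning
    f : 𝔽 → 𝔽
    f y = unitOr y y
    f≢0 : ∀ y → f y ≢ [ 0 ]ₚ
    f≢0 y with y FinP.≟ [ 0 ]ₚ
    ... | yes _ = 1≢0
    ... | no  h = h
    undo : ∀ u x → u *F x ≡ [ 1 ]ₚ → ∀ y → u *F (x *F y) ≡ y
    undo u x e y = trans (sym (*F-assoc u x y)) (trans (cong (_*F y) e) (*F-idˡ y))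
    π = Perm.permutation (x *F_) (u *F_) (undo x u (trans (*F-comm x u) ux)) (undo u x ux)
    fx : ∀ y → unitOr x y *F f y ≡ f (x *F y)
    fx y with y FinP.≟ [ 0 ]ₚ | x *F y FinP.≟ [ 0 ]ₚ
    ... | yes _    | yes _ = *F-idˡ _
    ... | yes refl | no  h = ⊥-elim (h (*F-zeroʳ x))
    ... | no  h    | yes e = ⊥-elim (*F-nonzero hx h e)
    ... | no  _    | no  _ = refl

  invF-spec : ∀ (x : 𝔽) → x ≢ [ 0 ]ₚ → x *F invF x ≡ [ 1 ]ₚ
  invF-spec x hx = trans (cong (_*F invF x) (sym ([]-toℕ x))) (trans ([]-* (toℕ x) (toℕ x ^ (p ∸ 2)))
    (trans (cong (λ k → [ toℕ x ^ k ]ₚ) (sym (+-∸-assoc 1 1<p))) (fermat x hx)))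


  vec-once : ∀ {n} (a : Vec 𝔽 n) → ∑ (allVecs n) (λ y → ⟨ does (VecP.≡-dec FinP._≟_ y a) ⟩) ≡ 1
  vec-once Vec.[] = refl
  vec-once {suc n} (a Vec.∷ as) = trans (∑-concatMap _ (allFin p) _) (trans (∑-cong (allFin p) inner)
    (trans (∑-cong (allFin p) (λ x → trans (cong (⟨ does (x FinP.≟ a) ⟩ *_) (vec-once as)) (*-identityʳ _))) (fin-once a)))
    where
    split : ∀ b c → ⟨ b ∧ c ⟩ ≡ ⟨ b ⟩ * ⟨ c ⟩
    split true  c = sym (+-identityʳ _)
    split false c = refl
    inner : ∀ x → ∑ (map (x Vec.∷_) (allVecs n)) (λ y → ⟨ does (VecP.≡-dec FinP._≟_ y (a Vec.∷ as)) ⟩) ≡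
                  ⟨ does (x FinP.≟ a) ⟩ * ∑ (allVecs n) (λ y → ⟨ does (VecP.≡-dec FinP._≟_ y as) ⟩)
    inner x = trans (∑-map (x Vec.∷_) (allVecs n) _) (trans (∑-cong (allVecs n) (λ y → split (does (x FinP.≟ a)) _)) (∑-*ˡ (allVecs n) ⟨ does (x FinP.≟ a) ⟩ (λ y → ⟨ does (VecP.≡-dec FinP._≟_ y as) ⟩)))

  vecType : ℕ → FinType
  vecType n = record { C = Vec 𝔽 n ; els = allVecs n ; _≡?_ = VecP.≡-dec FinP._≟_ ; once = vec-once }

  ∑-allVecs : ∀ n (f : Vec 𝔽 (suc n) → ℕ) → ∑ (allVecs (suc n)) f ≡ ∑ (allFin p) (λ x → ∑ (allVecs n) (λ w → f (x Vec.∷ w)))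
  ∑-allVecs n f = trans (∑-concatMap _ (allFin p) f) (∑-cong (allFin p) (λ x → ∑-map (x Vec.∷_) (allVecs n) f))

  length-allVecs : ∀ n → length (allVecs {p} n) ≡ p ^ n
  length-allVecs n = trans (sym (trans (∑-const (allVecs n) 1) (*-identityʳ _))) (go n)
    where
    go : ∀ n → ∑ (allVecs n) (λ _ → 1) ≡ p ^ n
    go zero    = refl
    go (suc n) = trans (∑-allVecs n _) (trans (∑-cong (allFin p) (λ _ → go n))
      (trans (∑-const (allFin p) (p ^ n)) (cong (_* p ^ n) (length-allFin p))))

  infix 8 -V_
  -V_ : ∀ {n} → Vec 𝔽 n → Vec 𝔽 n
  -V_ = Vec.map (λ x → -F x)

  𝕍-group : ℕ → Grp p
  𝕍-group n = record
    { fin = vecType n ; _⊞_ = _+V_ ; 𝟘 = 0V ; ⊟_ = λ v → -V v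
    ; ⊞-assoc = VecP.zipWith-assoc +F-assoc ; ⊞-comm = VecP.zipWith-comm +F-comm
    ; ⊞-idˡ = VecP.zipWith-identityˡ +F-idˡ ; ⊞-invʳ = VecP.zipWith-inverseʳ +F-invʳ
    ; torsion = tors }
    where
    comp : ∀ {n} k (x : 𝔽) (v : Vec 𝔽 n) → fold-multiple _+V_ 0V k (x Vec.∷ v) ≡ fold-multiple _+F_ [ 0 ]ₚ k x Vec.∷ fold-multiple _+V_ 0V k v
    comp zero    x v = refl
    comp (suc k) x v = cong ((x Vec.∷ v) +V_) (comp k x v)
    tors : ∀ {n} (v : Vec 𝔽 n) → fold-multiple _+V_ 0V p v ≡ 0V
    tors Vec.[] = nil p
      where nil : ∀ k → fold-multiple _+V_ 0V k Vec.[] ≡ Vec.[]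
            nil zero    = refl
            nil (suc k) = cong (Vec.[] +V_) (nil k)
    tors (x Vec.∷ v) = trans (comp p x v) (cong₂ Vec._∷_ (Fp.torsion x) (tors v))

  module V n = Group p-prime (𝕍-group n)

  card≡size : ∀ {n} (X : Vec 𝔽 n → Bool) → card X ≡ V.size n X
  card≡size {n} X = countTrue≡∑ {p} X (allVecs n)

-- A linear functional with a large fibre

module Functionals {p : ℕ} {{p-nonZero : NonZero p}} (p-prime : Prime p) where
  open PrimeField p-prime

  dot : ∀ {n} → Vec 𝔽 n → Vec 𝔽 n → 𝔽
  dot Vec.[]       Vec.[]       = [ 0 ]ₚ
  dot (c Vec.∷ cs) (x Vec.∷ xs) = c *F x +F dot cs xs

  dot-+ : ∀ {n} (c x y : Vec 𝔽 n) → dot c (x +V y) ≡ dot c x +F dot c y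
  dot-+ Vec.[] Vec.[] Vec.[] = sym (+F-idˡ _)
  dot-+ (c Vec.∷ cs) (x Vec.∷ xs) (y Vec.∷ ys) =
    trans (cong₂ _+F_ (*F-distribˡ c x y) (dot-+ cs xs ys)) (Fp.interchange (c *F x) (c *F y) (dot cs xs) (dot cs ys))

  dot-0ˡ : ∀ {n} (x : Vec 𝔽 n) → dot 0V x ≡ [ 0 ]ₚ
  dot-0ˡ Vec.[]       = refl
  dot-0ˡ (x Vec.∷ xs) = trans (cong₂ _+F_ (*F-zeroˡ x) (dot-0ˡ xs)) (+F-idˡ _)

  is0 : 𝔽 → Bool
  is0 x = does (x FinP.≟ [ 0 ]ₚ)

  annihilators : ∀ {n} → Vec 𝔽 n → ℕ
  annihilators {n} v = ∑ (allVecs n) (λ c → ⟨ is0 (dot c v) ⟩)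

  annihilators-0 : ∀ {n} → annihilators {n} 0V ≡ p ^ n
  annihilators-0 {n} = trans (∑-cong (allVecs n) (λ c → cong ⟨_⟩ (does-intro (dot c 0V FinP.≟ [ 0 ]ₚ) (dot-0ʳ c))))
      (trans (∑-const (allVecs n) 1) (trans (*-identityʳ _) (length-allVecs n)))
    where
    dot-0ʳ : ∀ {n} (c : Vec 𝔽 n) → dot c 0V ≡ [ 0 ]ₚ
    dot-0ʳ Vec.[]       = refl
    dot-0ʳ (c Vec.∷ cs) = trans (cong₂ _+F_ (*F-zeroʳ c) (dot-0ʳ cs)) (+F-idˡ _)

  -- In place of orthogonality of characters: the number of functionals vanishing at v tells v = 0
  -- from v ≠ 0. If the head of v is nonzero, the first coefficient is determined by the others;
  -- otherwise the claim descends to the tail.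
  annihilators-≢0 : ∀ {d} (v : Vec 𝔽 (suc d)) → v ≢ 0V → annihilators v ≡ p ^ d
  annihilators-≢0 {d} (x Vec.∷ w) h with x FinP.≟ [ 0 ]ₚ
  annihilators-≢0 {d} (x Vec.∷ w) h | no x≢0 with inverse x x≢0
  ... | u , ux = begin
    annihilators (x Vec.∷ w)
      ≡⟨ ∑-allVecs d _ ⟩
    ∑ (allFin p) (λ c → ∑ (allVecs d) (λ cs → ⟨ is0 (c *F x +F dot cs w) ⟩))
      ≡⟨ ∑-swap (allFin p) (allVecs d) _ ⟩
    ∑ (allVecs d) (λ cs → ∑ (allFin p) (λ c → ⟨ is0 (c *F x +F dot cs w) ⟩))
      ≡⟨ ∑-cong (allVecs d) (λ cs → trans (∑-cong (allFin p) (pt cs)) (fin-once (u *F (-F dot cs w)))) ⟩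
    ∑ (allVecs d) (λ _ → 1)
      ≡⟨ trans (∑-const (allVecs d) 1) (trans (*-identityʳ _) (length-allVecs d)) ⟩
    p ^ d ∎
    where
    open ≡-Reasoning
    xu : ∀ y → (u *F y) *F x ≡ y
    xu y = trans (cong (_*F x) (*F-comm u y)) (trans (*F-assoc y u x) (trans (cong (y *F_) ux) (trans (*F-comm y _) (*F-idˡ y))))
    ux′ : ∀ c → u *F (c *F x) ≡ c
    ux′ c = trans (cong (u *F_) (*F-comm c x)) (trans (sym (*F-assoc u x c)) (trans (cong (_*F c) ux) (*F-idˡ c)))
    pt : ∀ cs c → ⟨ is0 (c *F x +F dot cs w) ⟩ ≡ ⟨ does (c FinP.≟ u *F (-F dot cs w)) ⟩
    pt cs c = ⟨⟩-cong
      (λ e → does-intro (c FinP.≟ _) (trans (sym (ux′ c)) (cong (u *F_)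
         (trans (Fp.grp (cx ∷ t ∷ []) (gv 0) (gv 0 :+ gv 1 :+ :- (gv 1)) refl) (trans (cong (_-F t) (does-elim (cx +F t FinP.≟ [ 0 ]ₚ) e)) (+F-idˡ _))))))
      (λ e → does-intro (cx +F t FinP.≟ [ 0 ]ₚ) (trans (cong (λ a → a *F x +F t) (does-elim (c FinP.≟ _) e))
         (trans (cong (_+F t) (xu _)) (Fp.grp (t ∷ []) (:- (gv 0) :+ gv 0) g0 refl))))
      where cx = c *F x
            t  = dot cs w
  annihilators-≢0 {zero}  (x Vec.∷ Vec.[]) h | yes refl = ⊥-elim (h refl)
  annihilators-≢0 {suc d} (x Vec.∷ w) h | yes refl = begin
    annihilators (x Vec.∷ w)
      ≡⟨ ∑-allVecs (suc d) _ ⟩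
    ∑ (allFin p) (λ c → ∑ (allVecs (suc d)) (λ cs → ⟨ is0 (c *F x +F dot cs w) ⟩))
      ≡⟨ ∑-cong (allFin p) (λ c → trans (∑-cong (allVecs (suc d)) (λ cs → cong (λ t → ⟨ is0 t ⟩)
           (trans (cong (_+F dot cs w) (*F-zeroʳ c)) (+F-idˡ _)))) (annihilators-≢0 w (λ e → h (cong (x Vec.∷_) e)))) ⟩
    ∑ (allFin p) (λ c → p ^ d)
      ≡⟨ trans (∑-const (allFin p) (p ^ d)) (cong (_* p ^ d) (length-allFin p)) ⟩
    p ^ suc d ∎
    where open ≡-Reasoning

  am-gm : ∀ x y → 2 * (x * y) ≤ x * x + y * y
  am-gm x y with ≤-total x y
  ... | inj₁ h with m≤n⇒∃[o]m+o≡n h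
  ...   | k , refl = (lin (x ∷ k ∷ []) [] 1 (# 2 ⊗ (v0 ⊗ (v0 ⊕ v1))) (v0 ⊗ v0 ⊕ (v0 ⊕ v1) ⊗ (v0 ⊕ v1)))
  am-gm x y | inj₂ h with m≤n⇒∃[o]m+o≡n h
  ...   | k , refl = (lin (y ∷ k ∷ []) [] 1 (# 2 ⊗ ((v0 ⊕ v1) ⊗ v0)) ((v0 ⊕ v1) ⊗ (v0 ⊕ v1) ⊕ v0 ⊗ v0))

  -- Summed over k, the inequality (M - aₖ)(E - cₖ) ≥ 0 for the convolution c of a with itself and E = Σ a².
  triple-count : ∀ (a : 𝔽 → ℕ) M τ → (∀ i → a i ≤ M) → let N = ∑ (allFin p) a ; E = ∑ (allFin p) (λ i → a i * a i) in
    M * (N * N) + N * E ≤ ∑ (allFin p) (λ i → a i * ∑ (allFin p) (λ j → a j * a ((i +F j) +F τ))) + (p * M) * E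
  triple-count a M τ a≤M = begin
    M * (N * N) + N * E
      ≡⟨ cong₂ _+_ (trans (cong (M *_) (sym ∑c)) (sym (∑-*ˡ els M c))) (sym (∑-*ʳ els a E)) ⟩
    ∑ els (λ k → M * c k) + ∑ els (λ k → a k * E)
      ≡⟨ sym (∑-+ els _ _) ⟩
    ∑ els (λ k → M * c k + a k * E)
      ≤⟨ ∑-mono els (λ k → cross (a≤M k) (c≤E k)) ⟩
    ∑ els (λ k → a k * c k + M * E)
      ≡⟨ ∑-+ els _ _ ⟩
    ∑ els (λ k → a k * c k) + ∑ els (λ _ → M * E)
      ≡⟨ cong₂ _+_ reindex (trans (∑-const els (M * E)) (trans (cong (_* (M * E)) (length-allFin p)) (sym (*-assoc p M E)))) ⟩
    ∑ els (λ i → a i * ∑ els (λ j → a j * a ((i +F j) +F τ))) + (p * M) * E ∎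
    where
    open ≤-Reasoning
    els = allFin p
    N = ∑ els a
    E = ∑ els (λ i → a i * a i)
    c : 𝔽 → ℕ
    c k = ∑ els (λ i → a i * a (k -F (i +F τ)))
    cross : ∀ {x y M E} → x ≤ M → y ≤ E → M * y + x * E ≤ x * y + M * E
    cross {x} {y} h k with m≤n⇒∃[o]m+o≡n h | m≤n⇒∃[o]m+o≡n k
    ... | s , refl | t , refl = (lin (x ∷ s ∷ y ∷ t ∷ []) [] 1 ((v0 ⊕ v1) ⊗ v2 ⊕ v0 ⊗ (v2 ⊕ v3)) (v0 ⊗ v2 ⊕ (v0 ⊕ v1) ⊗ (v2 ⊕ v3)))
    ∑c : ∑ els c ≡ N * N
    ∑c = trans (∑-swap els els _) (trans (∑-cong els (λ i → trans (∑-*ˡ els (a i) _)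
           (cong (a i *_) (bijection-∑ (finType p) (finType p) (_-F (i +F τ)) (_+F (i +F τ))
             (λ x → (Fp.grp (x ∷ i ∷ τ ∷ []) (gv 0 :+ :- (gv 1 :+ gv 2) :+ (gv 1 :+ gv 2)) (gv 0) refl)) (λ x → (Fp.grp (x ∷ i ∷ τ ∷ []) (gv 0 :+ (gv 1 :+ gv 2) :+ :- (gv 1 :+ gv 2)) (gv 0) refl)) a))))
           (∑-*ʳ els a N))
    c≤E : ∀ k → c k ≤ E
    c≤E k = *-cancelˡ-≤ 2 (begin
      2 * c k
        ≡⟨ sym (∑-*ˡ els 2 _) ⟩
      ∑ els (λ i → 2 * (a i * a (k -F (i +F τ))))
        ≤⟨ ∑-mono els (λ i → am-gm (a i) _) ⟩
      ∑ els (λ i → a i * a i + a (k -F (i +F τ)) * a (k -F (i +F τ)))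
        ≡⟨ ∑-+ els _ _ ⟩
      E + ∑ els (λ i → a (k -F (i +F τ)) * a (k -F (i +F τ)))
        ≡⟨ cong (E +_) (bijection-∑ (finType p) (finType p) (λ i → k -F (i +F τ)) (λ i → k -F (i +F τ))
             (λ x → (Fp.grp (k ∷ x ∷ τ ∷ []) (gv 0 :+ :- (gv 0 :+ :- (gv 1 :+ gv 2) :+ gv 2)) (gv 1) refl)) (λ x → (Fp.grp (k ∷ x ∷ τ ∷ []) (gv 0 :+ :- (gv 0 :+ :- (gv 1 :+ gv 2) :+ gv 2)) (gv 1) refl)) (λ i → a i * a i)) ⟩
      E + E
        ≡⟨ cong (E +_) (sym (+-identityʳ E)) ⟩
      2 * E ∎)
    reindex : ∑ els (λ k → a k * c k) ≡ ∑ els (λ i → a i * ∑ els (λ j → a j * a ((i +F j) +F τ)))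
    reindex = trans (∑-cong els (λ k → sym (∑-*ˡ els (a k) _))) (trans (∑-swap els els _) (∑-cong els (λ i →
      trans (sym (bijection-∑ (finType p) (finType p) (λ j → (i +F j) +F τ) (λ k → k -F (i +F τ))
        (λ x → (Fp.grp (i ∷ x ∷ τ ∷ []) (gv 0 :+ gv 1 :+ gv 2 :+ :- (gv 0 :+ gv 2)) (gv 1) refl)) (λ x → (Fp.grp (i ∷ x ∷ τ ∷ []) (gv 0 :+ (gv 1 :+ :- (gv 0 :+ gv 2)) :+ gv 2) (gv 1) refl)) _))
      (trans (∑-cong els (λ j → trans (cong (λ t → a ((i +F j) +F τ) * (a i * a t)) (Fp.grp (i ∷ j ∷ τ ∷ []) (gv 0 :+ gv 1 :+ gv 2 :+ :- (gv 0 :+ gv 2)) (gv 1) refl))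
         (rearr (a ((i +F j) +F τ)) (a i) (a j)))) (∑-*ˡ els (a i) _)))))
      where rearr : ∀ x y z → x * (y * z) ≡ y * (z * x)
            rearr = solve-∀

  module Fibres {d : ℕ} (A : Vec 𝔽 (suc d) → Bool) where
    private
      vs = allVecs {p} (suc d)
      n  = suc d

    fibre : Vec 𝔽 n → 𝔽 → ℕ
    fibre c i = ∑ vs (λ x → ⟨ A x ⟩ * ⟨ does (dot c x FinP.≟ i) ⟩)

    fibre-∑ : ∀ c (g : 𝔽 → ℕ) → ∑ vs (λ x → ⟨ A x ⟩ * g (dot c x)) ≡ ∑ (allFin p) (λ i → fibre c i * g i)
    fibre-∑ c g = begin
      ∑ vs (λ x → ⟨ A x ⟩ * g (dot c x))
        ≡⟨ ∑-cong vs (λ x → cong (⟨ A x ⟩ *_) (sym (delta (dot c x)))) ⟩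
      ∑ vs (λ x → ⟨ A x ⟩ * ∑ (allFin p) (λ i → ⟨ does (dot c x FinP.≟ i) ⟩ * g i))
        ≡⟨ ∑-cong vs (λ x → trans (sym (∑-*ˡ (allFin p) ⟨ A x ⟩ _)) (∑-cong (allFin p) (λ i → sym (*-assoc ⟨ A x ⟩ _ (g i))))) ⟩
      ∑ vs (λ x → ∑ (allFin p) (λ i → ⟨ A x ⟩ * ⟨ does (dot c x FinP.≟ i) ⟩ * g i))
        ≡⟨ ∑-swap vs (allFin p) _ ⟩
      ∑ (allFin p) (λ i → ∑ vs (λ x → ⟨ A x ⟩ * ⟨ does (dot c x FinP.≟ i) ⟩ * g i))
        ≡⟨ ∑-cong (allFin p) (λ i → ∑-*ʳ vs _ (g i)) ⟩
      ∑ (allFin p) (λ i → fibre c i * g i) ∎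
      where
      open ≡-Reasoning
      pt : ∀ k i → ⟨ does (k FinP.≟ i) ⟩ * g i ≡ ⟨ does (i FinP.≟ k) ⟩ * g k
      pt k i with k FinP.≟ i | i FinP.≟ k
      ... | yes refl | yes _ = refl
      ... | yes refl | no  h = ⊥-elim (h refl)
      ... | no  h    | yes e = ⊥-elim (h (sym e))
      ... | no  _    | no  _ = refl
      delta : ∀ k → ∑ (allFin p) (λ i → ⟨ does (k FinP.≟ i) ⟩ * g i) ≡ g k
      delta k = trans (∑-cong (allFin p) (pt k)) (trans (∑-*ʳ (allFin p) _ (g k)) (trans (cong (_* g k) (fin-once k)) (+-identityʳ _)))

    fibre-total : ∀ c → ∑ (allFin p) (fibre c) ≡ V.size n A
    fibre-total c = trans (∑-cong (allFin p) (λ i → sym (*-identityʳ _))) (trans (sym (fibre-∑ c (λ _ → 1))) (∑-cong vs (λ x → *-identityʳ _)))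

    module _ (sum-free : ∀ x y z → A x ≡ true → A y ≡ true → A z ≡ true → ¬ (A ((x +V y) +V z) ≡ true))
             (z : Vec 𝔽 n) (hz : A z ≡ true) (M : ℕ) (bounded : ∀ c i → c ≢ 0V → fibre c i ≤ M)
             (p′ : ℕ) (p≡ : p ≡ suc p′) where
      private
        N = V.size n A
        q = p ^ d
        -- `𝔼 c` counts the pairs in A with equal values of c, `𝕋 c` the triples (x, y, w) in A with
        -- c·(x + y + z) = c·w. The third summand z stays fixed; sum-freeness enters through A + A +
        -- z.
        𝔼 𝕋 : Vec 𝔽 n → ℕ
        𝔼 c = ∑ vs (λ x → ⟨ A x ⟩ * fibre c (dot c x))
        𝕋 c = ∑ vs (λ x → ⟨ A x ⟩ * ∑ vs (λ y → ⟨ A y ⟩ * fibre c ((dot c x +F dot c y) +F dot c z)))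

        fibre-0 : ∀ i → i ≡ [ 0 ]ₚ → fibre 0V i ≡ N
        fibre-0 i refl = ∑-cong vs (λ x → trans (cong (λ t → ⟨ A x ⟩ * ⟨ t ⟩) (does-intro (dot 0V x FinP.≟ [ 0 ]ₚ) (dot-0ˡ x))) (*-identityʳ _))

        𝔼-0 : 𝔼 0V ≡ N * N
        𝔼-0 = trans (∑-cong vs (λ x → cong (⟨ A x ⟩ *_) (fibre-0 _ (dot-0ˡ x)))) (∑-*ʳ vs _ N)

        𝕋-0 : 𝕋 0V ≡ N * (N * N)
        𝕋-0 = trans (∑-cong vs (λ x → cong (⟨ A x ⟩ *_) (trans (∑-cong vs (λ y → cong (⟨ A y ⟩ *_) (fibre-0 _ (zero3 x y)))) (∑-*ʳ vs _ N)))) (∑-*ʳ vs _ (N * N))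
          where zero3 : ∀ x y → (dot 0V x +F dot 0V y) +F dot 0V z ≡ [ 0 ]ₚ
                zero3 x y = trans (cong₂ _+F_ (trans (cong₂ _+F_ (dot-0ˡ x) (dot-0ˡ y)) (+F-idˡ _)) (dot-0ˡ z)) (+F-idˡ _)

        is0V : Vec 𝔽 n → Bool
        is0V c = does (VecP.≡-dec FinP._≟_ c 0V)

        -- For c ≠ 0 this is `triple-count`. At c = 0 all of A is a single fibre, which M need not
        -- bound; there the left side is increased by exactly the amount that turns the inequality
        -- into an equality.
        pointwise : ∀ c → M * (N * N) + N * 𝔼 c + ⟨ is0V c ⟩ * (p′ * (M * (N * N))) ≤ 𝕋 c + (p * M) * 𝔼 c
        pointwise c with VecP.≡-dec FinP._≟_ c 0V
        ... | yes refl rewrite 𝔼-0 | 𝕋-0 =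
          (lin (p′ ∷ M ∷ N ∷ p ∷ []) (eqr 1 (v3 ⊗ (v1 ⊗ (v2 ⊗ v2))) ((# 1 ⊕ v0) ⊗ (v1 ⊗ (v2 ⊗ v2))) (cong (_* (M * (N * N))) p≡) ∷ []) 1 (v1 ⊗ (v2 ⊗ v2) ⊕ v2 ⊗ (v2 ⊗ v2) ⊕ # 1 ⊗ (v0 ⊗ (v1 ⊗ (v2 ⊗ v2)))) (v2 ⊗ (v2 ⊗ v2) ⊕ v3 ⊗ v1 ⊗ (v2 ⊗ v2)))
        ... | no c≢0 = ≤-trans (≤-reflexive (+-identityʳ _)) (subst₂ _≤_
            (cong₂ _+_ (cong (λ t → M * (t * t)) (fibre-total c)) (cong₂ _*_ (fibre-total c) (sym (fibre-∑ c (fibre c)))))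
            (cong₂ _+_ (sym conv) (cong ((p * M) *_) (sym (fibre-∑ c (fibre c)))))
            (triple-count (fibre c) M (dot c z) (λ i → bounded c i c≢0)))
          where
          conv : 𝕋 c ≡ ∑ (allFin p) (λ i → fibre c i * ∑ (allFin p) (λ j → fibre c j * fibre c ((i +F j) +F dot c z)))
          conv = trans (∑-cong vs (λ x → cong (⟨ A x ⟩ *_) (fibre-∑ c (λ j → fibre c ((dot c x +F j) +F dot c z)))))
                       (fibre-∑ c (λ i → ∑ (allFin p) (λ j → fibre c j * fibre c ((i +F j) +F dot c z))))

        ∑-is0V : ∑ vs (λ c → ⟨ is0V c ⟩) ≡ 1
        ∑-is0V = vec-once {n} 0V

        same⇔zero : ∀ c x y → ⟨ does (dot c y FinP.≟ dot c x) ⟩ ≡ ⟨ is0 (dot c (x +V (-V y))) ⟩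
        same⇔zero c x y = ⟨⟩-cong
          (λ e → does-intro (dot c (x +V (-V y)) FinP.≟ [ 0 ]ₚ) (Fp.⊞-cancelʳ (dot c y) (trans key (trans (sym (does-elim (dot c y FinP.≟ dot c x) e)) (sym (+F-idˡ _))))))
          (λ e → does-intro (dot c y FinP.≟ dot c x) (sym (trans (sym key) (trans (cong (_+F dot c y) (does-elim (dot c (x +V (-V y)) FinP.≟ [ 0 ]ₚ) e)) (+F-idˡ _)))))
          where
          key : dot c (x +V (-V y)) +F dot c y ≡ dot c x
          key = trans (sym (dot-+ c (x +V (-V y)) y)) (cong (dot c) (V.grp n (x ∷ y ∷ []) (gv 0 :+ :- gv 1 :+ gv 1) (gv 0) refl))

        ∑-fibre : ∀ (g : Vec 𝔽 n → 𝔽) (w : Vec 𝔽 n) → (∀ c → g c ≡ dot c w) →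
                  ∑ vs (λ c → fibre c (g c)) ≡ ∑ vs (λ y → ⟨ A y ⟩ * annihilators (w +V (-V y)))
        ∑-fibre g w hg = trans (∑-swap vs vs _) (∑-cong vs (λ y → trans (∑-*ˡ vs ⟨ A y ⟩ _) (cong (⟨ A y ⟩ *_)
          (∑-cong vs (λ c → trans (cong (λ t → ⟨ does (dot c y FinP.≟ t) ⟩) (hg c)) (same⇔zero c w y))))))

        ∑𝔼 : ∑ vs 𝔼 ≡ q * (N * N) + p′ * q * N
        ∑𝔼 = begin
          ∑ vs 𝔼
            ≡⟨ ∑-swap vs vs _ ⟩
          ∑ vs (λ x → ∑ vs (λ c → ⟨ A x ⟩ * fibre c (dot c x)))
            ≡⟨ ∑-cong vs (λ x → trans (∑-*ˡ vs ⟨ A x ⟩ _) (cong (⟨ A x ⟩ *_) (trans (∑-fibre (λ c → dot c x) x (λ _ → refl)) refl))) ⟩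
          ∑ vs (λ x → ⟨ A x ⟩ * ∑ vs (λ y → ⟨ A y ⟩ * annihilators (x +V (-V y))))
            ≡⟨ ∑-cong vs inner ⟩
          ∑ vs (λ x → ⟨ A x ⟩ * (q * N) + ⟨ A x ⟩ * (p′ * q))
            ≡⟨ ∑-+ vs _ _ ⟩
          ∑ vs (λ x → ⟨ A x ⟩ * (q * N)) + ∑ vs (λ x → ⟨ A x ⟩ * (p′ * q))
            ≡⟨ cong₂ _+_ (∑-*ʳ vs _ (q * N)) (∑-*ʳ vs _ (p′ * q)) ⟩
          N * (q * N) + N * (p′ * q)
            ≡⟨ rearr N q p′ ⟩
          q * (N * N) + p′ * q * N ∎
          where
          open ≡-Reasoning
          rearr : ∀ N q p′ → N * (q * N) + N * (p′ * q) ≡ q * (N * N) + p′ * q * N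
          rearr = solve-∀
          value : ∀ x y → annihilators (x +V (-V y)) ≡ q + ⟨ does (VecP.≡-dec FinP._≟_ y x) ⟩ * (p′ * q)
          value x y with VecP.≡-dec FinP._≟_ y x
          ... | yes refl = trans (cong annihilators (V.⊞-invʳ n x)) (trans annihilators-0 (trans (cong (_* q) p≡) (cong (q +_) (sym (+-identityʳ _)))))
          ... | no  h    = trans (annihilators-≢0 _ (λ e → h (V.⊞-cancelʳ n (-V y) (trans (V.⊞-invʳ n y) (sym e))))) (sym (+-identityʳ q))
          inner : ∀ x → ⟨ A x ⟩ * ∑ vs (λ y → ⟨ A y ⟩ * annihilators (x +V (-V y))) ≡ ⟨ A x ⟩ * (q * N) + ⟨ A x ⟩ * (p′ * q)
          inner x with A x in hx
          ... | false = refl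
          ... | true  = begin
            1 * ∑ vs (λ y → ⟨ A y ⟩ * annihilators (x +V (-V y)))
              ≡⟨ +-identityʳ _ ⟩
            ∑ vs (λ y → ⟨ A y ⟩ * annihilators (x +V (-V y)))
              ≡⟨ ∑-cong vs (λ y → trans (cong (⟨ A y ⟩ *_) (value x y)) (trans (*-distribˡ-+ ⟨ A y ⟩ q _) (cong (⟨ A y ⟩ * q +_) (atx y)))) ⟩
            ∑ vs (λ y → ⟨ A y ⟩ * q + ⟨ does (VecP.≡-dec FinP._≟_ y x) ⟩ * (p′ * q))
              ≡⟨ ∑-+ vs _ _ ⟩
            ∑ vs (λ y → ⟨ A y ⟩ * q) + ∑ vs (λ y → ⟨ does (VecP.≡-dec FinP._≟_ y x) ⟩ * (p′ * q))
              ≡⟨ cong₂ _+_ (trans (∑-*ʳ vs _ q) (*-comm N q)) (trans (∑-*ʳ vs _ (p′ * q)) (cong (_* (p′ * q)) (vec-once x))) ⟩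
            q * N + 1 * (p′ * q)
              ≡⟨ cong (_+ 1 * (p′ * q)) (sym (+-identityʳ (q * N))) ⟩
            1 * (q * N) + 1 * (p′ * q) ∎
            where
            atx : ∀ y → ⟨ A y ⟩ * (⟨ does (VecP.≡-dec FinP._≟_ y x) ⟩ * (p′ * q)) ≡ ⟨ does (VecP.≡-dec FinP._≟_ y x) ⟩ * (p′ * q)
            atx y with VecP.≡-dec FinP._≟_ y x
            ... | yes refl rewrite hx = +-identityʳ _
            ... | no _ = *-zeroʳ ⟨ A y ⟩

        -- The vector x + y + z - w never vanishes for x, y, w in A, so each triple is seen by
        -- exactly q of the functionals.
        ∑𝕋 : ∑ vs 𝕋 ≡ q * (N * (N * N))
        ∑𝕋 = begin
          ∑ vs 𝕋
            ≡⟨ ∑-swap vs vs _ ⟩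
          ∑ vs (λ x → ∑ vs (λ c → ⟨ A x ⟩ * ∑ vs (λ y → ⟨ A y ⟩ * fibre c ((dot c x +F dot c y) +F dot c z))))
            ≡⟨ ∑-cong vs (λ x → trans (∑-*ˡ vs ⟨ A x ⟩ _) (cong (⟨ A x ⟩ *_) (trans (∑-swap vs vs _) (∑-cong vs (λ y →
                 trans (∑-*ˡ vs ⟨ A y ⟩ _) (cong (⟨ A y ⟩ *_) (∑-fibre _ ((x +V y) +V z) (λ c → sym (trans (dot-+ c (x +V y) z) (cong (_+F dot c z) (dot-+ c x y)))))))))))⟩
          ∑ vs (λ x → ⟨ A x ⟩ * ∑ vs (λ y → ⟨ A y ⟩ * ∑ vs (λ w → ⟨ A w ⟩ * annihilators (((x +V y) +V z) +V (-V w)))))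
            ≡⟨ ∑-cong vs (λ x → guard (A x) (λ hx → trans (∑-cong vs (λ y → guard (A y) (λ hy → trans (∑-cong vs (λ w → guard (A w) (λ hw →
                 annihilators-≢0 _ (λ e → sum-free x y z hx hy hz (subst (λ t → A t ≡ true) (sym (V.⊞-cancelʳ n (-V w) (trans e (sym (V.⊞-invʳ n w))))) hw)))))
                   (∑-*ʳ vs _ q)))) (∑-*ʳ vs _ (N * q)))) ⟩
          ∑ vs (λ x → ⟨ A x ⟩ * (N * (N * q)))
            ≡⟨ ∑-*ʳ vs _ (N * (N * q)) ⟩
          N * (N * (N * q))
            ≡⟨ rearr N q ⟩
          q * (N * (N * N)) ∎
          where
          open ≡-Reasoning
          rearr : ∀ N q → N * (N * (N * q)) ≡ q * (N * (N * N))
          rearr = solve-∀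
          guard : ∀ b {s t} → (b ≡ true → s ≡ t) → ⟨ b ⟩ * s ≡ ⟨ b ⟩ * t
          guard true  h = cong (1 *_) (h refl)
          guard false h = refl

      -- Summed over all c, the terms pqMN² and qN³ occur on both sides of `pointwise`; what remains
      -- has the common factor (p - 1)N.
      large-fibre-bound : q * N + M * N ≤ p * q * M
      large-fibre-bound = *-cancelˡ-≤ N {{Data.Nat.>-nonZero (V.size-pos n {A} hz)}}
        (*-cancelˡ-≤ p′ {{Data.Nat.>-nonZero (≤-pred (subst (2 ≤_) p≡ 1<p))}} goal)
        where
        Q = p * q
        lhs : ∑ vs (λ c → M * (N * N) + N * 𝔼 c + ⟨ is0V c ⟩ * (p′ * (M * (N * N)))) ≡
              Q * (M * (N * N)) + N * (q * (N * N) + p′ * q * N) + p′ * (M * (N * N))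
        lhs = trans (∑-+ vs _ _) (cong₂ _+_ (trans (∑-+ vs _ _) (cong₂ _+_
                (trans (∑-const vs _) (cong (_* (M * (N * N))) (length-allVecs n)))
                (trans (∑-*ˡ vs N 𝔼) (cong (N *_) ∑𝔼))))
                (trans (∑-*ʳ vs _ (p′ * (M * (N * N)))) (trans (cong (_* (p′ * (M * (N * N)))) ∑-is0V) (+-identityʳ _))))
        rhs : ∑ vs (λ c → 𝕋 c + (p * M) * 𝔼 c) ≡ q * (N * (N * N)) + (p * M) * (q * (N * N) + p′ * q * N)
        rhs = trans (∑-+ vs _ _) (cong₂ _+_ ∑𝕋 (trans (∑-*ˡ vs (p * M) 𝔼) (cong ((p * M) *_) ∑𝔼)))
        total : Q * (M * (N * N)) + N * (q * (N * N) + p′ * q * N) + p′ * (M * (N * N)) ≤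
                q * (N * (N * N)) + (p * M) * (q * (N * N) + p′ * q * N)
        total = subst₂ _≤_ lhs rhs (∑-mono vs pointwise)
        goal : p′ * (N * (q * N + M * N)) ≤ p′ * (N * (p * q * M))
        goal = (lin (p ∷ q ∷ M ∷ N ∷ p′ ∷ []) (hyp 1 (v0 ⊗ v1 ⊗ (v2 ⊗ (v3 ⊗ v3)) ⊕ v3 ⊗ (v1 ⊗ (v3 ⊗ v3) ⊕ v4 ⊗ v1 ⊗ v3) ⊕ v4 ⊗ (v2 ⊗ (v3 ⊗ v3))) (v1 ⊗ (v3 ⊗ (v3 ⊗ v3)) ⊕ v0 ⊗ v2 ⊗ (v1 ⊗ (v3 ⊗ v3) ⊕ v4 ⊗ v1 ⊗ v3)) total ∷ []) 1 (v4 ⊗ (v3 ⊗ (v1 ⊗ v3 ⊕ v2 ⊗ v3))) (v4 ⊗ (v3 ⊗ (v0 ⊗ v1 ⊗ v2))))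

    large-fibre : ∀ m → p ≡ 3 + 4 * m → 1 ≤ m →
      (∀ x y z → A x ≡ true → A y ≡ true → A z ≡ true → ¬ (A ((x +V y) +V z) ≡ true)) →
      (∃[ z ] A z ≡ true) → m * p ^ d ≤ V.size n A →
      ∃[ c ] ∃[ i ] c ≢ 0V × m * p ^ d ≤ (3 * m + 3) * fibre c i
    large-fibre m p≡ 1≤m sum-free (z , hz) large
      with V.search n (λ c → not (does (VecP.≡-dec FinP._≟_ c 0V)) ∧ any (λ i → does (m * p ^ d ≤? (3 * m + 3) * fibre c i)) (allFin p))
    ... | inj₁ (c , h) with any⇒∃ _ (allFin p) (proj₂ (∧-elim {not (does (VecP.≡-dec FinP._≟_ c 0V))} h))
    ...   | i , hi = c , i , (λ e → true≢false (does-intro (VecP.≡-dec FinP._≟_ c 0V) e) (not-elim (proj₁ (∧-elim h)))) ,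
                     does-elim (m * p ^ d ≤? (3 * m + 3) * fibre c i) hi
    large-fibre m p≡ 1≤m sum-free (z , hz) large | inj₂ none = ⊥-elim absurd
      where
      q = p ^ d
      -- This is p - m: with N ≥ mq, the bound qN + MN ≤ pqM becomes mq ≤ (p - m)M.
      k = 3 * m + 3
      instance
        k≢0 : NonZero k
        k≢0 = Data.Nat.>-nonZero (lin (m ∷ []) [] 1 (# 1 ⊕ # 0) (# 3 ⊗ v0 ⊕ # 3))
      -- The largest M with (3m + 3)M < mq; it bounds all fibres if none is as large as claimed.
      M = (m * q ∸ 1) / k
      N = V.size n A
      1≤q : 1 ≤ q
      1≤q = m^n>0 p d
      mq-pos : 1 ≤ m * q
      mq-pos = *-mono-≤ 1≤m 1≤q
      small : ∀ c i → c ≢ 0V → fibre c i ≤ M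
      small c i c≢0 = ≤-trans (≤-reflexive (sym (m*n/n≡m (fibre c i) k))) (/-monoˡ-≤ k (≤-pred (≤-trans lt (≤-reflexive (sym (m+[n∸m]≡n mq-pos))))))
        where
        lt : suc (fibre c i * k) ≤ m * q
        lt with m * q ≤? k * fibre c i
        ... | no  h = subst (λ t → suc t ≤ m * q) (*-comm k (fibre c i)) (≰⇒> h)
        ... | yes h = ⊥-elim (true≢false (∧-intro (not-intro (does-not (VecP.≡-dec FinP._≟_ c 0V) c≢0))
                        (Fp.any-intro {λ i → does (m * q ≤? k * fibre c i)} (does-intro (m * q ≤? k * fibre c i) h))) (none c))
      Mk : M * k + 1 ≤ m * q
      Mk = ≤-trans (+-monoˡ-≤ 1 (m/n*n≤m (m * q ∸ 1) k)) (≤-reflexive (trans (+-comm _ 1) (m+[n∸m]≡n mq-pos)))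
      key : q * N + M * N ≤ p * q * M
      key = large-fibre-bound sum-free z hz M small (2 + 4 * m) p≡
      absurd : ⊥
      absurd = 1+n≰n (≤-trans (≤-reflexive (+-comm 1 _)) (≤-trans Mk (*-cancelˡ-≤ q {{Data.Nat.>-nonZero 1≤q}} step)))
        where
        step : q * (m * q) ≤ q * (M * k)
        step = (lin (q ∷ N ∷ M ∷ p ∷ m ∷ []) (hyp 1 (v0 ⊗ v1 ⊕ v2 ⊗ v1) (v3 ⊗ v0 ⊗ v2) key ∷ hyp 1 ((v0 ⊕ v2) ⊗ (v4 ⊗ v0)) ((v0 ⊕ v2) ⊗ v1) (*-monoʳ-≤ (q + M) large) ∷ eql 1 (v3 ⊗ v0 ⊗ v2) ((# 3 ⊕ # 4 ⊗ v4) ⊗ v0 ⊗ v2) (cong (λ t → t * q * M) p≡) ∷ []) 1 (v0 ⊗ (v4 ⊗ v0)) (v0 ⊗ (v2 ⊗ (# 3 ⊗ v4 ⊕ # 3))))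

-- Automorphisms and subspaces

module Automorphisms {p : ℕ} {{p-nonZero : NonZero p}} (p-prime : Prime p) where
  open PrimeField p-prime
  open Functionals p-prime

  idAut : ∀ {n} → Aut {p} n
  idAut = record { φ = λ x → x ; ψ = λ x → x ; ψφ = λ _ → refl ; φψ = λ _ → refl ; φ-add = λ _ _ → refl }

  _then_ : ∀ {n} → Aut {p} n → Aut {p} n → Aut {p} n
  f then g = record
    { φ = λ x → φ g (φ f x) ; ψ = λ y → ψ f (ψ g y)
    ; ψφ = λ x → trans (cong (ψ f) (ψφ g _)) (ψφ f x) ; φψ = λ y → trans (cong (φ g) (φψ f _)) (φψ g y)
    ; φ-add = λ x y → trans (cong (φ g) (φ-add f x y)) (φ-add g _ _) }

  ψ-add : ∀ {n} (f : Aut {p} n) x y → ψ f (x +V y) ≡ ψ f x +V ψ f y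
  ψ-add f x y = trans (cong (ψ f) (cong₂ _+V_ (sym (φψ f x)) (sym (φψ f y))))
    (trans (cong (ψ f) (sym (φ-add f (ψ f x) (ψ f y)))) (ψφ f _))

  φ-0 : ∀ {n} (f : Aut {p} n) → φ f 0V ≡ 0V
  φ-0 {n} f = V.⊞-cancelʳ n (φ f 0V) (trans (sym (φ-add f 0V 0V)) (trans (cong (φ f) (V.⊞-idˡ n 0V)) (sym (V.⊞-idˡ n (φ f 0V)))))

  transport : ∀ {n} → (Vec 𝔽 n → Bool) → Aut {p} n → Vec 𝔽 n → Bool
  transport A f y = A (ψ f y)

  size-transport : ∀ {n} (A : Vec 𝔽 n → Bool) f → V.size n (transport A f) ≡ V.size n A
  size-transport {n} A f = bijection-∑ (vecType n) (vecType n) (ψ f) (φ f) (φψ f) (ψφ f) (λ x → ⟨ A x ⟩)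

  SumFree : ∀ {n} → (Vec 𝔽 n → Bool) → Set
  SumFree A = ∀ x y z → A x ≡ true → A y ≡ true → A z ≡ true → ¬ (A ((x +V y) +V z) ≡ true)

  sumFree-transport : ∀ {n} (A : Vec 𝔽 n → Bool) f → SumFree A → SumFree (transport A f)
  sumFree-transport A f h x y z hx hy hz hw = h _ _ _ hx hy hz
    (subst (λ t → A t ≡ true) (trans (ψ-add f (x +V y) z) (cong (_+V ψ f z) (ψ-add f x y))) hw)

  iso-transport : ∀ {n} (A : Vec 𝔽 n → Bool) f {B : Vec 𝔽 n → Set} → Isomorphic (transport A f) B → Isomorphic A B
  iso-transport A f (g , h) = f then g , λ x →
    (λ ax → proj₁ (h (φ f x)) (subst (λ t → A t ≡ true) (sym (ψφ f x)) ax)) ,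
    (λ b → subst (λ t → A t ≡ true) (ψφ f x) (proj₂ (h (φ f x)) b))

  isoToSubset-transport : ∀ {n} (A : Vec 𝔽 n → Bool) f {B : Vec 𝔽 n → Set} → IsoToSubset (transport A f) B → IsoToSubset A B
  isoToSubset-transport A f (g , h) = f then g , λ x ax → h (φ f x) (subst (λ t → A t ≡ true) (sym (ψφ f x)) ax)

  negAut : ∀ {n} → Aut {p} n
  negAut {n} = record { φ = -V_ ; ψ = -V_ ; ψφ = inv ; φψ = inv
    ; φ-add = λ x y → V.grp n (x ∷ y ∷ []) (:- (gv 0 :+ gv 1)) (:- gv 0 :+ :- gv 1) refl }
    where inv : ∀ x → -V (-V x) ≡ x
          inv x = V.grp n (x ∷ []) (:- (:- gv 0)) (gv 0) refl

  private
    headtail : ∀ {n} (x : Vec 𝔽 (suc n)) → head x Vec.∷ tail x ≡ x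
    headtail (_ Vec.∷ _) = refl

    undo : ∀ u x → u *F x ≡ [ 1 ]ₚ → ∀ y → u *F (x *F y) ≡ y
    undo u x e y = trans (sym (*F-assoc u x y)) (trans (cong (_*F y) e) (*F-idˡ y))

  onTail : ∀ {n} → Aut {p} n → Aut {p} (suc n)
  onTail f = record
    { φ = λ { (x Vec.∷ w) → x Vec.∷ φ f w } ; ψ = λ { (x Vec.∷ w) → x Vec.∷ ψ f w }
    ; ψφ = λ { (x Vec.∷ w) → cong (x Vec.∷_) (ψφ f w) } ; φψ = λ { (x Vec.∷ w) → cong (x Vec.∷_) (φψ f w) }
    ; φ-add = λ { (x Vec.∷ w) (y Vec.∷ u) → cong ((x +F y) Vec.∷_) (φ-add f w u) } }

  scaleHead : ∀ {n} (x : 𝔽) → x ≢ [ 0 ]ₚ → Aut {p} (suc n)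
  scaleHead x h = let (u , ux) = inverse x h in record
    { φ = λ { (y Vec.∷ w) → x *F y Vec.∷ w } ; ψ = λ { (y Vec.∷ w) → u *F y Vec.∷ w }
    ; ψφ = λ { (y Vec.∷ w) → cong (Vec._∷ w) (undo u x ux y) }
    ; φψ = λ { (y Vec.∷ w) → cong (Vec._∷ w) (undo x u (trans (*F-comm x u) ux) y) }
    ; φ-add = λ { (y Vec.∷ w) (z Vec.∷ u) → cong (Vec._∷ (w +V u)) (*F-distribˡ x y z) } }

  ·V-+ : ∀ {n} (a b : 𝔽) (v : Vec 𝔽 n) → (a +F b) ·V v ≡ (a ·V v) +V (b ·V v)
  ·V-+ a b Vec.[]       = refl
  ·V-+ a b (x Vec.∷ v) = cong₂ Vec._∷_ (*F-distribʳ x a b) (·V-+ a b v)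

  ·V-1 : ∀ {n} (v : Vec 𝔽 n) → [ 1 ]ₚ ·V v ≡ v
  ·V-1 Vec.[]       = refl
  ·V-1 (x Vec.∷ v) = cong₂ Vec._∷_ (*F-idˡ x) (·V-1 v)

  ·V-* : ∀ {n} (a b : 𝔽) (v : Vec 𝔽 n) → (a *F b) ·V v ≡ a ·V (b ·V v)
  ·V-* a b Vec.[]       = refl
  ·V-* a b (x Vec.∷ v) = cong₂ Vec._∷_ (*F-assoc a b x) (·V-* a b v)

  ·V-0 : ∀ {n} (v : Vec 𝔽 n) → [ 0 ]ₚ ·V v ≡ 0V
  ·V-0 Vec.[]       = refl
  ·V-0 (x Vec.∷ v) = cong₂ Vec._∷_ (*F-zeroˡ x) (·V-0 v)

  multipleV≡ : ∀ {n} k (v : Vec 𝔽 n) → fold-multiple _+V_ 0V k v ≡ [ k ]ₚ ·V v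
  multipleV≡ zero    v = sym (·V-0 v)
  multipleV≡ (suc k) v = trans (cong₂ _+V_ (sym (·V-1 v)) (multipleV≡ k v)) (trans (sym (·V-+ [ 1 ]ₚ [ k ]ₚ v)) (cong (_·V v) ([]-+ 1 k)))

  closed-·V : ∀ {n} {H : Vec 𝔽 n → Bool} → H 0V ≡ true → V.Closed n H → ∀ c x → H x ≡ true → H (c ·V x) ≡ true
  closed-·V {n} {H} z cl c x hx = subst (λ t → H t ≡ true) (trans (multipleV≡ (toℕ c) x) (cong (_·V x) ([]-toℕ c))) (V.closed-· n {H} z cl (toℕ c) x hx)

  shear : ∀ {n} → Vec 𝔽 n → Aut {p} (suc n)
  shear {n} τ = record
    { φ = λ { (x Vec.∷ w) → x Vec.∷ (w +V (x ·V τ)) } ; ψ = λ { (x Vec.∷ w) → x Vec.∷ (w +V (-V (x ·V τ))) }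
    ; ψφ = λ { (x Vec.∷ w) → cong (x Vec.∷_) (V.grp n (w ∷ x ·V τ ∷ []) (gv 0 :+ gv 1 :+ :- gv 1) (gv 0) refl) }
    ; φψ = λ { (x Vec.∷ w) → cong (x Vec.∷_) (V.grp n (w ∷ x ·V τ ∷ []) (gv 0 :+ :- gv 1 :+ gv 1) (gv 0) refl) }
    ; φ-add = λ { (x Vec.∷ w) (y Vec.∷ u) → cong ((x +F y) Vec.∷_) (trans (cong ((w +V u) +V_) (·V-+ x y τ))
        (V.interchange n w u (x ·V τ) (y ·V τ))) } }

  -- Makes c the first coordinate, so that fibres of c become slices. If the first coefficient of c
  -- is nonzero, the old first coordinate can be solved for; if it vanishes, recursion treats the
  -- tail and the two leading coordinates change places.
  functionalAut : ∀ {d} (c : Vec 𝔽 (suc d)) → c ≢ 0V → Σ (Aut {p} (suc d)) λ f → ∀ x → head (φ f x) ≡ dot c x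
  functionalAut {d} (c Vec.∷ cs) h with c FinP.≟ [ 0 ]ₚ
  functionalAut {d} (c Vec.∷ cs) h | no c≢0 with inverse c c≢0
  ... | u , uc = record
    { φ = λ { (x Vec.∷ w) → (c *F x +F dot cs w) Vec.∷ w } ; ψ = λ { (y Vec.∷ w) → u *F (y -F dot cs w) Vec.∷ w }
    ; ψφ = λ { (x Vec.∷ w) → cong (Vec._∷ w) (trans (cong (u *F_) (strip₁ (c *F x) (dot cs w))) (undo u c uc x)) }
    ; φψ = λ { (y Vec.∷ w) → cong (Vec._∷ w) (trans (cong (_+F dot cs w) (undo c u (trans (*F-comm c u) uc) _)) (strip₂ y (dot cs w))) }
    ; φ-add = λ { (x Vec.∷ w) (y Vec.∷ v) → cong (Vec._∷ (w +V v)) (dot-+ (c Vec.∷ cs) (x Vec.∷ w) (y Vec.∷ v)) } } , λ { (x Vec.∷ w) → refl }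
    where
    strip₁ : ∀ a b → a +F b -F b ≡ a
    strip₁ a b = (Fp.grp (a ∷ b ∷ []) (gv 0 :+ gv 1 :+ :- (gv 1)) (gv 0) refl)
    strip₂ : ∀ a b → a -F b +F b ≡ a
    strip₂ a b = (Fp.grp (a ∷ b ∷ []) (gv 0 :+ :- (gv 1) :+ gv 1) (gv 0) refl)
  functionalAut {zero} (c Vec.∷ Vec.[]) h | yes refl = ⊥-elim (h refl)
  functionalAut {suc d} (c Vec.∷ cs) h | yes refl with functionalAut cs (λ e → h (cong (c Vec.∷_) e))
  ... | f , hf = record
    { φ = λ { (x Vec.∷ w) → head (φ f w) Vec.∷ x Vec.∷ tail (φ f w) }
    ; ψ = λ { (y Vec.∷ x Vec.∷ w) → x Vec.∷ ψ f (y Vec.∷ w) }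
    ; ψφ = λ { (x Vec.∷ w) → cong (x Vec.∷_) (trans (cong (ψ f) (headtail (φ f w))) (ψφ f w)) }
    ; φψ = λ { (y Vec.∷ x Vec.∷ w) → cong (λ t → head t Vec.∷ x Vec.∷ tail t) (φψ f (y Vec.∷ w)) }
    ; φ-add = λ { (x Vec.∷ w) (y Vec.∷ v) → trans (cong (λ t → head t Vec.∷ (x +F y) Vec.∷ tail t) (φ-add f w v)) (split x y (φ f w) (φ f v)) } } ,
    λ { (x Vec.∷ w) → trans (hf w) (sym (trans (cong (_+F dot cs w) (*F-zeroˡ x)) (+F-idˡ _))) }
    where
    split : ∀ x y (a b : Vec 𝔽 (suc d)) → head (a +V b) Vec.∷ (x +F y) Vec.∷ tail (a +V b) ≡
                       (head a Vec.∷ x Vec.∷ tail a) +V (head b Vec.∷ y Vec.∷ tail b)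
    split x y (_ Vec.∷ _) (_ Vec.∷ _) = refl

  -- If H lies in the hyperplane of head 0, the first coordinate will do. Otherwise H contains some
  -- (a, w) with a ≠ 0; the slice of H at head 0 is still proper, and a functional c killing it
  -- extends to H with the leading coefficient -c·(w/a).
  annihilator : ∀ {d} (H : Vec 𝔽 d → Bool) → H 0V ≡ true → V.Closed d H → ∀ x → H x ≡ false →
                ∃[ c ] c ≢ 0V × (∀ h → H h ≡ true → dot c h ≡ [ 0 ]ₚ)
  annihilator {zero}  H h0 cl Vec.[] hx = ⊥-elim (true≢false h0 hx)
  annihilator {suc d} H h0 cl x hx with V.search (suc d) (λ v → H v ∧ not (is0 (head v)))
  ... | inj₂ none = [ 1 ]ₚ Vec.∷ 0V , (λ e → 1≢0 (cong head e)) , λ { (a Vec.∷ w) hh →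
          trans (cong₂ _+F_ (trans (*F-idˡ a) (zero-head a w hh)) (dot-0ˡ w)) (+F-idˡ _) }
    where
    zero-head : ∀ a w → H (a Vec.∷ w) ≡ true → a ≡ [ 0 ]ₚ
    zero-head a w hh with a FinP.≟ [ 0 ]ₚ in e
    ... | yes r = r
    ... | no  _ = ⊥-elim (true≢false (∧-intro hh (not-intro (cong does e))) (none (a Vec.∷ w)))
  ... | inj₁ (a Vec.∷ w , ha) with inverse a (λ e → true≢false (does-intro (a FinP.≟ [ 0 ]ₚ) e) (not-elim (proj₂ (∧-elim {H (a Vec.∷ w)} ha))))
  ...   | u , ua with V.search d (λ w → not (H ([ 0 ]ₚ Vec.∷ w)))
  ...     | inj₂ all = ⊥-elim (everything x hx)
    where
    everything : ∀ x → H x ≡ false → ⊥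
    everything (b Vec.∷ v) hx = true≢false (subst (λ t → H t ≡ true) eq
        (cl _ _ (closed-·V {H = H} h0 cl (b *F u) (a Vec.∷ w) (proj₁ (∧-elim ha)))
                (not-false (all (v +V (-V ((b *F u) ·V w))))))) hx
      where
      not-false : ∀ {c} → not c ≡ false → c ≡ true
      not-false {true} _ = refl
      eq : ((b *F u) ·V (a Vec.∷ w)) +V ([ 0 ]ₚ Vec.∷ (v +V (-V ((b *F u) ·V w)))) ≡ b Vec.∷ v
      eq = cong₂ Vec._∷_ (trans (cong (_+F [ 0 ]ₚ) (trans (*F-assoc b u a) (trans (cong (b *F_) ua) (trans (*F-comm b _) (*F-idˡ b))))) (Fp.⊞-idʳ b))
             (V.grp d ((b *F u) ·V w ∷ v ∷ []) (gv 0 :+ (gv 1 :+ :- gv 0)) (gv 1) refl)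
  ...     | inj₁ (y , hy) with annihilator (λ w → H ([ 0 ]ₚ Vec.∷ w)) h0
                (λ x y hx hy → subst (λ t → H (t Vec.∷ (x +V y)) ≡ true) (+F-idˡ _) (cl _ _ hx hy)) y (not-elim hy)
  ...       | c , c≢0 , kill = (-F dot c (u ·V w)) Vec.∷ c , (λ e → c≢0 (cong tail e)) , λ { (b Vec.∷ v) hh → ann b v hh }
    where
    dot-· : ∀ {n} (c : Vec 𝔽 n) b v → dot c (b ·V v) ≡ b *F dot c v
    dot-· Vec.[] b Vec.[] = sym (*F-zeroʳ b)
    dot-· (c Vec.∷ cs) b (x Vec.∷ v) = trans (cong₂ _+F_ (trans (sym (*F-assoc c b x)) (trans (cong (_*F x) (*F-comm c b)) (*F-assoc b c x))) (dot-· cs b v))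
      (sym (*F-distribˡ b (c *F x) (dot cs v)))
    ann : ∀ b v → H (b Vec.∷ v) ≡ true → (-F dot c (u ·V w)) *F b +F dot c v ≡ [ 0 ]ₚ
    ann b v hh = trans (cong (_+F dot c v) (trans (*F-comm _ b) (trans (*F-neg b _) (cong (λ t → -F t) (trans (sym (dot-· c b (u ·V w))) refl)))))
      (trans (cong (-F dot c r +F_) (trans (cong (dot c) (V.grp d (v ∷ r ∷ []) (gv 0) (gv 0 :+ :- gv 1 :+ gv 1) refl)) (trans (dot-+ c _ r) (cong (_+F dot c r) (kill _ member)))))
      (trans (cong (-F dot c r +F_) (+F-idˡ _)) (trans (+F-comm (-F dot c r) (dot c r)) (+F-invʳ (dot c r)))))
      where
      r = b ·V (u ·V w)
      scaled : H ((-F b) ·V (u ·V (a Vec.∷ w))) ≡ true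
      scaled = closed-·V {H = H} h0 cl (-F b) _ (closed-·V {H = H} h0 cl u _ (proj₁ (∧-elim ha)))
      neg-· : ∀ {n} (x : Vec 𝔽 n) → (-F b) ·V x ≡ -V (b ·V x)
      neg-· Vec.[] = refl
      neg-· (x Vec.∷ xs) = cong₂ Vec._∷_ (trans (*F-comm (-F b) x) (trans (*F-neg x b) (cong (λ t → -F t) (*F-comm x b)))) (neg-· xs)
      member : H ([ 0 ]ₚ Vec.∷ (v +V (-V r))) ≡ true
      member = subst (λ t → H t ≡ true) (cong₂ Vec._∷_
          (trans (cong (λ t → b +F (-F b) *F t) ua) (trans (cong (b +F_) (trans (*F-comm (-F b) [ 1 ]ₚ) (*F-idˡ (-F b)))) (+F-invʳ b)))
          (cong (v +V_) (neg-· (u ·V w)))) (cl _ _ hh scaled)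

  -- The number s is the codimension of H: `annihilator` splits off one coordinate that vanishes on
  -- H, and the recursion continues in the slice. It produces the factor F_p^s of type 5, on which
  -- the set P lives.
  flatten : ∀ {d} (H : Vec 𝔽 d → Bool) → H 0V ≡ true → V.Closed d H →
            Σ ℕ λ s → Σ ℕ λ t → Σ (s + t ≡ d) λ e → Σ (Aut {p} d) λ θ →
            ∀ w → (H w ≡ true → take s (cast (sym e) (φ θ w)) ≡ 0V) × (take s (cast (sym e) (φ θ w)) ≡ 0V → H w ≡ true)
  flatten {d} H h0 cl with V.search d (λ w → not (H w))
  ... | inj₂ all = 0 , d , refl , idAut , λ w → (λ _ → refl) , (λ _ → not-false (all w))
    where
    not-false : ∀ {c} → not c ≡ false → c ≡ true
    not-false {true} _ = refl
  flatten {zero}  H h0 cl | inj₁ (Vec.[] , hx) = ⊥-elim (true≢false h0 (not-elim hx))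
  flatten {suc d} H h0 cl | inj₁ (x , hx) with annihilator H h0 cl x (not-elim hx)
  ... | c , c≢0 , kill with functionalAut c c≢0
  ...   | g , hg with flatten (λ w → H (ψ g ([ 0 ]ₚ Vec.∷ w)))
              (subst (λ t → H t ≡ true) (trans (sym (ψφ g 0V)) (cong (ψ g) (φ-0 g))) h0)
              (λ x y hx hy → subst (λ t → H t ≡ true) (trans (sym (ψ-add g _ _)) (cong (λ t → ψ g (t Vec.∷ (x +V y))) (+F-idˡ _))) (cl _ _ hx hy))
  ...     | s , t , e , θ , hθ = suc s , t , cong suc e , (g then onTail θ) , equiv
    where
    unhead : ∀ (y : Vec 𝔽 (suc d)) → y ≡ head y Vec.∷ tail y
    unhead (_ Vec.∷ _) = refl
    shape : ∀ (y : Vec 𝔽 (suc d)) → take (suc s) (cast (sym (cong suc e)) (φ (onTail θ) y)) ≡ head y Vec.∷ take s (cast (sym e) (φ θ (tail y)))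
    shape (_ Vec.∷ _) = refl
    equiv : ∀ w → (H w ≡ true → take (suc s) (cast (sym (cong suc e)) (φ (onTail θ) (φ g w))) ≡ 0V) ×
                  (take (suc s) (cast (sym (cong suc e)) (φ (onTail θ) (φ g w))) ≡ 0V → H w ≡ true)
    equiv w =
      (λ hw → let h0 = trans (hg w) (kill w hw) in trans (shape (φ g w)) (cong₂ Vec._∷_ h0
         (proj₁ (hθ (tail (φ g w))) (subst (λ t → H t ≡ true) (trans (sym (ψφ g w)) (cong (ψ g) (trans (unhead (φ g w)) (cong (Vec._∷ tail (φ g w)) h0)))) hw)))) ,
      (λ e0 → let e1 = trans (sym (shape (φ g w))) e0 in
         subst (λ t → H t ≡ true) (trans (cong (ψ g) (trans (cong (Vec._∷ tail (φ g w)) (sym (cong head e1))) (sym (unhead (φ g w))))) (ψφ g w))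
           (proj₂ (hθ (tail (φ g w))) (cong tail e1)))

-- Level sets of the fibre sizes

∑< : ℕ → (ℕ → ℕ) → ℕ
∑< zero    f = 0
∑< (suc n) f = ∑< n f + f n

∑<-cong : ∀ n {f g} → (∀ i → i < n → f i ≡ g i) → ∑< n f ≡ ∑< n g
∑<-cong zero    h = refl
∑<-cong (suc n) h = cong₂ _+_ (∑<-cong n (λ i i<n → h i (m≤n⇒m≤1+n i<n))) (h n ≤-refl)

∑<-mono : ∀ n {f g} → (∀ i → i < n → f i ≤ g i) → ∑< n f ≤ ∑< n g
∑<-mono zero    h = z≤n
∑<-mono (suc n) h = +-mono-≤ (∑<-mono n (λ i i<n → h i (m≤n⇒m≤1+n i<n))) (h n ≤-refl)

∑<-const : ∀ n k → ∑< n (λ _ → k) ≡ n * k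
∑<-const zero    k = refl
∑<-const (suc n) k = trans (cong (_+ k) (∑<-const n k)) (+-comm (n * k) k)

∑<-bound : ∀ n {f} k → (∀ i → i < n → f i ≤ k) → ∑< n f ≤ n * k
∑<-bound n k h = ≤-trans (∑<-mono n h) (≤-reflexive (∑<-const n k))

∑<-+ : ∀ n f g → ∑< n (λ i → f i + g i) ≡ ∑< n f + ∑< n g
∑<-+ zero    f g = refl
∑<-+ (suc n) f g rewrite ∑<-+ n f g = rearr (∑< n f) (∑< n g) (f n) (g n)
  where rearr : ∀ a b c d → a + b + (c + d) ≡ a + c + (b + d)
        rearr = solve-∀

∑<-split : ∀ a b f → ∑< (a + b) f ≡ ∑< a f + ∑< b (λ i → f (a + i))
∑<-split a zero    f = trans (cong (λ n → ∑< n f) (+-identityʳ a)) (sym (+-identityʳ _))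
∑<-split a (suc b) f = trans (cong (λ n → ∑< n f) (+-suc a b))
  (trans (cong (_+ f (a + b)) (∑<-split a b f)) (+-assoc (∑< a f) _ _))

∑<-first : ∀ n f → ∑< (suc n) f ≡ f 0 + ∑< n (λ i → f (suc i))
∑<-first n f = ∑<-split 1 n f

∑<-reverse : ∀ n f → ∑< n f ≡ ∑< n (λ i → f (n ∸ 1 ∸ i))
∑<-reverse zero    f = refl
∑<-reverse (suc n) f = sym (trans (∑<-first n (λ i → f (n ∸ i)))
  (trans (+-comm (f n) _) (cong (_+ f n) (trans (∑<-cong n (λ i i<n → cong f (sym (∸-+-assoc n 1 i)))) (sym (∑<-reverse n f))))))

∑<-pairs : ∀ n f k → (∀ i j → i + j + 1 ≡ n → f i + f j ≤ k) → 2 * ∑< n f ≤ n * k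
∑<-pairs n f k h = begin
  2 * ∑< n f                              ≡⟨ cong (∑< n f +_) (+-identityʳ _) ⟩
  ∑< n f + ∑< n f                         ≡⟨ cong (∑< n f +_) (∑<-reverse n f) ⟩
  ∑< n f + ∑< n (λ i → f (n ∸ 1 ∸ i))     ≡⟨ sym (∑<-+ n f _) ⟩
  ∑< n (λ i → f i + f (n ∸ 1 ∸ i))        ≤⟨ ∑<-bound n k (λ i i<n → h i _ (idx n i i<n)) ⟩
  n * k ∎
  where
  open ≤-Reasoning
  idx : ∀ n i → i < n → i + (n ∸ 1 ∸ i) + 1 ≡ n
  idx (suc n) i (s≤s le) = trans (cong (_+ 1) (m+[n∸m]≡n le)) (+-comm n 1)

∑-∑<-swap : ∀ {A : Set} (l : List A) n (f : A → ℕ → ℕ) → ∑ l (λ x → ∑< n (f x)) ≡ ∑< n (λ t → ∑ l (λ x → f x t))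
∑-∑<-swap l zero    f = trans (∑-const l 0) (*-zeroʳ (length l))
∑-∑<-swap l (suc n) f = trans (∑-+ l _ _) (cong (_+ ∑ l (λ x → f x n)) (∑-∑<-swap l n f))

-- Layer-cake formula: it converts the sum of the fibre sizes into the sum of the sizes of the level
-- sets.
layers : ∀ n a → a ≤ n → ∑< n (λ t → ⟨ does (t <? a) ⟩) ≡ a
layers zero    .zero z≤n = refl
layers (suc n) a h with n <? a
... | yes n<a = trans (cong₂ _+_
        (trans (∑<-cong n (λ i i<n → cong ⟨_⟩ (does-intro (i <? a) (<-trans i<n n<a)))) (trans (∑<-const n 1) (*-identityʳ n)))
        (cong ⟨_⟩ (does-intro (n <? a) n<a))) (trans (+-comm n 1) (≤-antisym n<a h))
... | no  n≮a = trans (cong (∑< n _ +_) (cong ⟨_⟩ (does-not (n <? a) n≮a))) (trans (+-identityʳ _) (layers n a (≮⇒≥ n≮a)))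

maximum : ∀ {n} (f : Fin (suc n) → ℕ) → ∃[ i ] ∀ j → f j ≤ f i
maximum {zero}  f = Data.Fin.zero , λ { Data.Fin.zero → ≤-refl }
maximum {suc n} f with maximum (λ i → f (Data.Fin.suc i))
... | i , h with ≤-total (f Data.Fin.zero) (f (Data.Fin.suc i))
...   | inj₁ le = Data.Fin.suc i , λ { Data.Fin.zero → le ; (Data.Fin.suc j) → h j }
...   | inj₂ ge = Data.Fin.zero , λ { Data.Fin.zero → ≤-refl ; (Data.Fin.suc j) → ≤-trans (h j) ge }

-- N t is the number of fibres with more than t elements; 2h = q + 2c + 1.
level-dichotomy : ∀ m q c M h (N : ℕ → ℕ) → 13 ≤ m → 1 ≤ c → q ≡ (3 + 4 * m) * c → 2 * h ≡ q + 2 * c + 1 →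
  (∀ t → N t ≤ 3 + 4 * m) →
  (∀ t t′ → t < M → t′ < M → q + 2 * c < 2 * t + 2 * t′ + 4 → N t + N t′ ≤ 2 * m + 2) →
  m * q ≤ ∑< M N → m * q ≤ (3 * m + 3) * M → m * q ≤ M * (m + 1)
level-dichotomy m q c M zero N m≥ c≥ q≡ h≡ N≤ pair total dense = ⊥-elim (refute (q ∷ c ∷ []) (eqr 1 (# 2 ⊗ (# 0)) (v0 ⊕ # 2 ⊗ v1 ⊕ # 1) h≡ ∷ []))
level-dichotomy m q c M h@(suc h′) N m≥ c≥ q≡ h≡ N≤ pair total dense with h′ ≤? M
-- Below h′ the levels are paired by t + t′ = h′ - 1, where 2t + 2t′ + 4 = 2h exceeds q + 2c by one;
-- from h′ on a level may be paired with itself. The average of N over all levels is then at most m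
-- + 1.
... | yes h′≤M with m≤n⇒∃[o]m+o≡n h′≤M
...   | o , refl = ≤-trans total (*-cancelˡ-≤ 2 (begin
        2 * ∑< (h′ + o) N                     ≡⟨ cong (2 *_) (∑<-split h′ o N) ⟩
        2 * (∑< h′ N + U)                     ≤⟨ (lin ((∑< h′ N) ∷ h′ ∷ m ∷ U ∷ o ∷ []) (hyp 1 (# 2 ⊗ v0) (v1 ⊗ (# 2 ⊗ v2 ⊕ # 2)) lower ∷ hyp 2 v3 (v4 ⊗ (v2 ⊕ # 1)) upper ∷ []) 1 (# 2 ⊗ (v0 ⊕ v3)) (# 2 ⊗ ((v1 ⊕ v4) ⊗ (v2 ⊕ # 1)))) ⟩
        2 * ((h′ + o) * (m + 1))              ∎))
  where
  open ≤-Reasoning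
  U = ∑< o (λ i → N (h′ + i))
  lower : 2 * ∑< h′ N ≤ h′ * (2 * m + 2)
  lower = ∑<-pairs h′ N (2 * m + 2) (λ i j e → pair i j
    (lin (i ∷ j ∷ h′ ∷ o ∷ []) (eql 1 (v0 ⊕ v1 ⊕ # 1) v2 e ∷ []) 1 (# 1 ⊕ v0) (v2 ⊕ v3)) (lin (i ∷ j ∷ h′ ∷ o ∷ []) (eql 1 (v0 ⊕ v1 ⊕ # 1) v2 e ∷ []) 1 (# 1 ⊕ v1) (v2 ⊕ v3))
    (lin (h′ ∷ i ∷ j ∷ q ∷ c ∷ []) (eqr 2 (v1 ⊕ v2 ⊕ # 1) v0 e ∷ eqr 1 (# 2 ⊗ (# 1 ⊕ v0)) (v3 ⊕ # 2 ⊗ v4 ⊕ # 1) h≡ ∷ []) 1 (# 1 ⊕ (v3 ⊕ # 2 ⊗ v4)) (# 2 ⊗ v1 ⊕ # 2 ⊗ v2 ⊕ # 4)))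
  upper : U ≤ o * (m + 1)
  upper = ∑<-bound o (m + 1) (λ i i<o → *-cancelˡ-≤ 2 (≤-trans (≤-reflexive (cong (N (h′ + i) +_) (+-identityʳ _)))
    (≤-trans (pair (h′ + i) (h′ + i) (+-monoʳ-< h′ i<o) (+-monoʳ-< h′ i<o)
      (lin (q ∷ c ∷ h′ ∷ i ∷ []) (eqr 1 (# 2 ⊗ (# 1 ⊕ v2)) (v0 ⊕ # 2 ⊗ v1 ⊕ # 1) h≡ ∷ []) 1 (# 1 ⊕ (v0 ⊕ # 2 ⊗ v1)) (# 2 ⊗ (v2 ⊕ v3) ⊕ # 2 ⊗ (v2 ⊕ v3) ⊕ # 4)))
      (≤-reflexive (dbl m)))))
    where dbl : ∀ m → 2 * m + 2 ≡ 2 * (m + 1)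
          dbl = solve-∀
-- With M below h′ the lowest h′ - M levels have no partner, and only N ≤ p is known for them. As M
-- is at least about q/3, the total stays near 5mq/6, short of mq; the bound 13 ≤ m absorbs the
-- lower order terms.
level-dichotomy m q c M h@(suc h′) N m≥ c≥ q≡ h≡ N≤ pair total dense | no h′≰M with m≤n⇒∃[o]m+o≡n (≰⇒> h′≰M)
... | o , eo with h′ ≤? 2 * M
...   | no h′≰2M = ⊥-elim (refute (m ∷ q ∷ M ∷ h′ ∷ c ∷ []) (hyp 676 (v0 ⊗ v1) ((# 3 ⊗ v0 ⊕ # 3) ⊗ v2) dense ∷ hyp 338 ((# 3 ⊗ v0 ⊕ # 3) ⊗ (# 1 ⊕ # 2 ⊗ v2)) ((# 3 ⊗ v0 ⊕ # 3) ⊗ v3) (*-monoʳ-≤ (3 * m + 3) (≰⇒> h′≰2M)) ∷ eql 169 ((# 3 ⊗ v0 ⊕ # 3) ⊗ (# 2 ⊗ (# 1 ⊕ v3))) ((# 3 ⊗ v0 ⊕ # 3) ⊗ (v1 ⊕ # 2 ⊗ v4 ⊕ # 1)) (cong ((3 * m + 3) *_) h≡) ∷ eqr 169 (v0 ⊗ v1) (v0 ⊗ ((# 3 ⊕ # 4 ⊗ v0) ⊗ v4)) (cong (m *_) q≡) ∷ eql 507 v1 ((# 3 ⊕ # 4 ⊗ v0) ⊗ v4) q≡ ∷ hyp 195 (# 13 ⊗ v4) (v0 ⊗ v4) (*-monoˡ-≤ c m≥) ∷ hyp 210 (v0 ⊗ (# 13 ⊗ v4)) (v0 ⊗ (v0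 ⊗ v4)) (*-monoʳ-≤ m (*-monoˡ-≤ c m≥)) ∷ []))
...   | yes h′≤2M with m≤n⇒∃[o]m+o≡n h′≤2M
...     | n , en = ⊥-elim (refute (m ∷ q ∷ c ∷ M ∷ o ∷ n ∷ []) (eql 1 ((# 3 ⊗ v0 ⊕ # 3) ⊗ (v1 ⊕ # 2 ⊗ v2 ⊕ # 1)) ((# 3 ⊗ v0 ⊕ # 3) ⊗ (# 2 ⊗ (v3 ⊕ v4 ⊕ # 2))) (cong ((3 * m + 3) *_) sub) ∷ hyp 4 ((# 3 ⊗ v0 ⊕ # 3) ⊗ (# 2 ⊗ (v0 ⊗ v1))) ((# 3 ⊗ v0 ⊕ # 3) ⊗ (# 2 ⊗ ((# 1 ⊕ v4) ⊗ (# 3 ⊕ # 4 ⊗ v0)) ⊕ v5 ⊗ (# 2 ⊗ v0 ⊕ # 2))) (*-monoʳ-≤ (3 * m + 3) bound) ∷ eqr 3 ((# 3 ⊗ v0 ⊕ # 3) ⊗ ((v1 ⊕ # 2 ⊗ v2 ⊕ # 1) ⊗ (# 3 ⊕ # 4 ⊗ v0))) ((# 3 ⊗ v0 ⊕ # 3) ⊗ (# 2 ⊗ (v3 ⊕ v4 ⊕ # 2) ⊗ (# 3 ⊕ # 4 ⊗ v0))) (cong (λ x → (3 * m + 3) * (x * (3 + 4 * m))) sub) ∷ eql 4 ((# 3 ⊗ v0 ⊕ # 3) ⊗ ((# 1 ⊕ v3 ⊕ v4 ⊕ v5) ⊗ (# 2 ⊗ v0 ⊕ # 2))) ((# 3 ⊗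 v0 ⊕ # 3) ⊗ (# 2 ⊗ v3 ⊗ (# 2 ⊗ v0 ⊕ # 2))) (cong (λ x → (3 * m + 3) * (x * (2 * m + 2))) nsub) ∷ hyp 4 ((# 4 ⊗ v0 ⊕ # 2) ⊗ (v0 ⊗ v1)) ((# 4 ⊗ v0 ⊕ # 2) ⊗ ((# 3 ⊗ v0 ⊕ # 3) ⊗ v3)) (*-monoʳ-≤ (4 * m + 2) dense) ∷ eql 24 v1 ((# 3 ⊕ # 4 ⊗ v0) ⊗ v2) q≡ ∷ eql 28 (v0 ⊗ v1) (v0 ⊗ ((# 3 ⊕ # 4 ⊗ v0) ⊗ v2)) (cong (m *_) q≡) ∷ eqr 4 (v0 ⊗ (v0 ⊗ v1)) (v0 ⊗ (v0 ⊗ ((# 3 ⊕ # 4 ⊗ v0) ⊗ v2))) (cong (λ x → m * (m * x)) q≡) ∷ hyp 168 (# 13 ⊗ v2) (v0 ⊗ v2) (*-monoˡ-≤ c m≥) ∷ hyp 36 (v0 ⊗ (# 13 ⊗ v2)) (v0 ⊗ (v0 ⊗ v2)) (*-monoʳ-≤ m (*-monoˡ-≤ c m≥)) ∷ hyp 16 (v0 ⊗ (v0 ⊗ (# 13 ⊗ v2))) (v0 ⊗ (v0 ⊗ (v0 ⊗ v2))) (*-monoʳ-≤ m (*-monoʳ-≤ m (*-monoˡ-≤ c m≥))) ∷ hyp 2064 (# 1) v2 c≥ ∷ []))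
  where
  sub : q + 2 * c + 1 ≡ 2 * (M + o + 2)
  sub = (lin≡ (q ∷ c ∷ h′ ∷ M ∷ o ∷ []) (eqn 1 (v0 ⊕ # 2 ⊗ v1 ⊕ # 1) (# 2 ⊗ (# 1 ⊕ v2)) (sym h≡) ∷ eqn 2 v2 (# 1 ⊕ v3 ⊕ v4) (sym eo) ∷ []) (v0 ⊕ # 2 ⊗ v1 ⊕ # 1) (# 2 ⊗ (v3 ⊕ v4 ⊕ # 2)))
  nsub : suc M + o + n ≡ 2 * M
  nsub = (lin≡ (M ∷ o ∷ h′ ∷ n ∷ []) (eqn 1 (# 1 ⊕ v0 ⊕ v1) v2 eo ∷ eqn 1 (v2 ⊕ v3) (# 2 ⊗ v0) en ∷ []) (# 1 ⊕ v0 ⊕ v1 ⊕ v3) (# 2 ⊗ v0))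
  M≡ : suc o + n ≡ M
  M≡ = (lin≡ (M ∷ o ∷ h′ ∷ n ∷ []) (eqn 1 (# 1 ⊕ v0 ⊕ v1) v2 eo ∷ eqn 1 (v2 ⊕ v3) (# 2 ⊗ v0) en ∷ []) (# 1 ⊕ v1 ⊕ v3) v0)
  tail-bound : 2 * ∑< n (λ i → N (suc o + i)) ≤ n * (2 * m + 2)
  tail-bound = ∑<-pairs n _ (2 * m + 2) (λ i j e → pair (suc o + i) (suc o + j)
    (lin (i ∷ j ∷ n ∷ o ∷ M ∷ []) (eql 1 (v0 ⊕ v1 ⊕ # 1) v2 e ∷ eql 1 (# 1 ⊕ v3 ⊕ v2) v4 M≡ ∷ []) 1 (# 1 ⊕ (# 1 ⊕ v3 ⊕ v0)) v4) (lin (i ∷ j ∷ n ∷ o ∷ M ∷ []) (eql 1 (v0 ⊕ v1 ⊕ # 1) v2 e ∷ eql 1 (# 1 ⊕ v3 ⊕ v2) v4 M≡ ∷ []) 1 (# 1 ⊕ (# 1 ⊕ v3 ⊕ v1)) v4)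
    (lin (n ∷ i ∷ j ∷ M ∷ o ∷ h′ ∷ q ∷ c ∷ []) (eqr 2 (v1 ⊕ v2 ⊕ # 1) v0 e ∷ eqr 2 (# 1 ⊕ v4 ⊕ v0) v3 M≡ ∷ eqr 2 (# 1 ⊕ v3 ⊕ v4) v5 eo ∷ eqr 1 (# 2 ⊗ (# 1 ⊕ v5)) (v6 ⊕ # 2 ⊗ v7 ⊕ # 1) h≡ ∷ []) 1 (# 1 ⊕ (v6 ⊕ # 2 ⊗ v7)) (# 2 ⊗ (# 1 ⊕ v4 ⊕ v1) ⊕ # 2 ⊗ (# 1 ⊕ v4 ⊕ v2) ⊕ # 4)))
  bound : 2 * (m * q) ≤ 2 * (suc o * (3 + 4 * m)) + n * (2 * m + 2)
  bound = ≤-trans (*-monoʳ-≤ 2 (≤-trans total (≤-reflexive (trans (cong (λ k → ∑< k N) (sym M≡)) (∑<-split (suc o) n N)))))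
    (≤-trans (≤-reflexive (*-distribˡ-+ 2 (∑< (suc o) N) _)) (+-mono-≤ (*-monoʳ-≤ 2 (∑<-bound (suc o) (3 + 4 * m) (λ t _ → N≤ t))) tail-bound))

odd-power : ∀ p k d → p ≡ 1 + 2 * k → ∃[ l ] p ^ d ≡ 1 + 2 * l
odd-power p k zero    e = 0 , refl
odd-power p k (suc d) e with odd-power p k d e
... | l , el = k + l + 2 * (k * l) , trans (cong₂ _*_ e el) (expand k l)
  where expand : ∀ k l → (1 + 2 * k) * (1 + 2 * l) ≡ 1 + 2 * (k + l + 2 * (k * l))
        expand = solve-∀

-- Sumset inequalities in F_p and in its vector spaces; difference sets

module CauchyDavenport {p : ℕ} {{p-nonZero : NonZero p}} (p-prime : Prime p) where
  open PrimeField p-prime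

  cauchy-davenport : ∀ {A B Z a b z} → A Fp.⊹ B ⊆ Z → A a ≡ true → B b ≡ true → Z z ≡ false →
                     Fp.size A + Fp.size B ≤ Fp.size Z + 1
  cauchy-davenport {A} {B} {Z} h ha hb hz = *-cancelˡ-≤ p (≤-trans (Fp.kneser {A} {B} {Z} h ha hb hz)
    (≤-reflexive (trans (cong (p * Fp.size Z +_) (trans order-𝔽 (sym (*-identityʳ p)))) (sym (*-distribˡ-+ p (Fp.size Z) 1)))))

  kneser-V : ∀ d {A B Z a b z} → V._⊹_⊆_ (suc d) A B Z → A a ≡ true → B b ≡ true → Z z ≡ false →
             V.size (suc d) A + V.size (suc d) B ≤ V.size (suc d) Z + p ^ d
  kneser-V d {A} {B} {Z} h ha hb hz = *-cancelˡ-≤ p (≤-trans (V.kneser (suc d) {A} {B} {Z} h ha hb hz)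
    (≤-reflexive (trans (cong (p * V.size (suc d) Z +_) (length-allVecs (suc d))) (sym (*-distribˡ-+ p (V.size (suc d) Z) (p ^ d))))))

  -- Kneser twice: for X and Y, then for X + Y and Z inside the complement of U. Each time p^e is
  -- lost. A point of U keeps X + Y from being everything.
  kneser-quad : ∀ d e → d ≡ suc e → (X Y Z U : Vec 𝔽 d → Bool) →
    (∃[ x ] X x ≡ true) → (∃[ x ] Y x ≡ true) → (∃[ x ] Z x ≡ true) → (∃[ x ] U x ≡ true) →
    (∀ x y z → X x ≡ true → Y y ≡ true → Z z ≡ true → U ((x +V y) +V z) ≡ false) →
    V.size d X + V.size d Y + V.size d Z + V.size d U ≤ p ^ d + 2 * p ^ e
  kneser-quad d@(suc e) .e refl X Y Z U (x , hx) (y , hy) (z , hz) (u , hu) free =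
    (lin ((V.size d X) ∷ (V.size d Y) ∷ (V.size d XY) ∷ (p ^ e) ∷ (V.size d Z) ∷ (V.size d (V.∁ d U)) ∷ (V.size d U) ∷ (V.order d) ∷ (p ^ d) ∷ []) (hyp 1 (v0 ⊕ v1) (v2 ⊕ v3) first ∷ hyp 1 (v2 ⊕ v4) (v5 ⊕ v3) second ∷ eql 1 (v6 ⊕ v5) v7 (V.size-∁ d U) ∷ eql 1 v7 v8 (length-allVecs d) ∷ []) 1 (v0 ⊕ v1 ⊕ v4 ⊕ v6) (v8 ⊕ # 2 ⊗ v3))
    where
    XY = V._⊹_ d X Y
    first : V.size d X + V.size d Y ≤ V.size d XY + p ^ e
    first = kneser-V e {X} {Y} {XY} {x} {y} {u +V (-V z)} (λ _ _ → V.⊹-intro d {X} {Y}) hx hy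
      (¬true⇒false λ h → let (x′ , y′ , hx′ , hy′ , eq) = V.⊹-elim d {X} {Y} h in
        true≢false (subst (λ t → U t ≡ true) (trans (V.grp d (u ∷ z ∷ []) (gv 0) (gv 0 :+ :- gv 1 :+ gv 1) refl) (cong (_+V z) eq)) hu) (free x′ y′ z hx′ hy′ hz))
    second : V.size d XY + V.size d Z ≤ V.size d (V.∁ d U) + p ^ e
    second = kneser-V e {XY} {Z} {V.∁ d U} {x +V y} {z} {u}
      (λ s z′ hs hz′ → let (x′ , y′ , hx′ , hy′ , eq) = V.⊹-elim d {X} {Y} hs in
        not-intro (subst (λ t → U (t +V z′) ≡ false) (sym eq) (free x′ y′ z′ hx′ hy′ hz′)))
      (V.⊹-intro d {X} {Y} hx hy) hz (cong not hu)

  size-Fp-∁ : ∀ X → Fp.size X + Fp.size (Fp.∁ X) ≡ p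
  size-Fp-∁ X = trans (Fp.size-∁ X) order-𝔽

  subset-of-size : ∀ k X → k ≤ Fp.size X → ∃[ Y ] Y Fp.⊆ X × Fp.size Y ≡ k
  subset-of-size k X h = go (Fp.size X ∸ k) X (m∸n+n≡m h)
    where
    go : ∀ n X → n + k ≡ Fp.size X → ∃[ Y ] Y Fp.⊆ X × Fp.size Y ≡ k
    go zero    X e = X , (λ _ h → h) , sym e
    go (suc n) X e = let (x , hx) = Fp.size-elem {X} (≤-trans (s≤s z≤n) (≤-reflexive e))
                         (Y , Y⊆ , eY) = go n (X Fp.∖ Fp.｛ x ｝) (suc-injective (trans e (sym (Fp.size-∖single {X} hx))))
                     in Y , (λ y hy → proj₁ (∧-elim (Y⊆ y hy))) , eY

  negate : (𝔽 → Bool) → 𝔽 → Bool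
  negate S x = S (-F x)

  infix 8 Δ_
  Δ_ : (𝔽 → Bool) → 𝔽 → Bool
  Δ S = S Fp.⊹ negate S

  Δ-intro : ∀ {S : 𝔽 → Bool} {x y} → S x ≡ true → S y ≡ true → (Δ S) (x -F y) ≡ true
  Δ-intro {S} {x} {y} hx hy = Fp.⊹-intro {S} {negate S} hx (subst (λ t → S t ≡ true) (Fp.grp (y ∷ []) (gv 0) (:- (:- (gv 0))) refl) hy)

  Δ-elim : ∀ {S : 𝔽 → Bool} {z} → (Δ S) z ≡ true → ∃[ x ] ∃[ y ] S x ≡ true × S y ≡ true × z ≡ x -F y
  Δ-elim {S} {z} h = conv (Fp.⊹-elim {S} {negate S} h)
    where
    sub-neg : ∀ x y → x +F y ≡ x -F (-F y)
    sub-neg x y = cong (x +F_) (Fp.grp (y ∷ []) (gv 0) (:- (:- (gv 0))) refl)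
    conv : (∃[ x ] ∃[ y ] S x ≡ true × negate S y ≡ true × z ≡ x +F y) → ∃[ x ] ∃[ y ] S x ≡ true × S y ≡ true × z ≡ x -F y
    conv (x , y , hx , hy , e) = x , -F y , hx , hy , trans e (sub-neg x y)

  size-negate : ∀ S → Fp.size (negate S) ≡ Fp.size S
  size-negate S = bijection-∑ (finType p) (finType p) (λ x → -F x) (λ x → -F x)
    (λ x → (Fp.grp (x ∷ []) (:- (:- (gv 0))) (gv 0) refl)) (λ x → (Fp.grp (x ∷ []) (:- (:- (gv 0))) (gv 0) refl)) (λ x → ⟨ S x ⟩)

  size-Δ : ∀ {S : 𝔽 → Bool} {x z} → S x ≡ true → (Δ S) z ≡ false → 2 * Fp.size S ≤ Fp.size (Δ S) + 1
  size-Δ {S} {x} {z} hx hz = ≤-trans (≤-reflexive (cong (Fp.size S +_) (trans (+-identityʳ _) (sym (size-negate S)))))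
    (cauchy-davenport {S} {negate S} {Δ S} {x} { -F x} {z} (λ a b ha hb → Fp.⊹-intro {S} {negate S} ha hb) hx
      (subst (λ t → S t ≡ true) (Fp.grp (x ∷ []) (gv 0) (:- (:- (gv 0))) refl) hx) hz)

-- What the fibres over a well-chosen functional leave to be studied inside F_p:
-- S is the support, and X consists of elements whose fibres have more than half the full size.
record Config {p : ℕ} {{p-nonZero : NonZero p}} (p-prime : Prime p) (m : ℕ) (S : Fin p → Bool) : Set where
  open PrimeField p-prime
  open CauchyDavenport p-prime
  field
    X     : 𝔽 → Bool
    X⊆S   : X Fp.⊆ S
    apart : ∀ x y → X x ≡ true → X y ≡ true → (Δ S) (x +F y) ≡ false
    Δ≤    : Fp.size (Δ S) ≤ 2 * m + 4
    sizes : (Fp.size S ≡ m × Fp.size X ≡ m) ⊎ (Fp.size S ≡ m + 1 × Fp.size X ≡ m) ⊎ (Fp.size S ≡ m + 2 × Fp.size X + 1 ≡ m)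

-- The levels over a functional and the size of its support

module FibreStructure {p : ℕ} {{p-nonZero : NonZero p}} (p-prime : Prime p) (m : ℕ) (p≡ : p ≡ 3 + 4 * m) (m≥ : 23 ≤ m)
                      {d : ℕ} (A : Vec (Fin p) (suc d) → Bool) where
  open PrimeField p-prime
  open Functionals p-prime
  open Automorphisms p-prime
  open CauchyDavenport p-prime

  B : 𝔽 → Vec 𝔽 d → Bool
  B i w = A (i Vec.∷ w)

  a : 𝔽 → ℕ
  a i = V.size d (B i)

  q : ℕ
  q = p ^ d

  1≤q : 1 ≤ q
  1≤q = m^n>0 p d

  S : 𝔽 → Bool
  S i = does (0 <? a i)

  a≤q : ∀ i → a i ≤ q
  a≤q i = ≤-trans (V.size≤order d (B i)) (≤-reflexive (length-allVecs d))

  a-total : ∑ (allFin p) a ≡ V.size (suc d) A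
  a-total = sym (∑-allVecs d _)

  S-intro : ∀ {i w} → B i w ≡ true → S i ≡ true
  S-intro {i} h = does-intro (0 <? a i) (V.size-pos d {B i} h)

  S-elim : ∀ {i} → S i ≡ true → ∃[ w ] B i w ≡ true
  S-elim {i} h = V.size-elem d {B i} (does-elim (0 <? a i) h)

  module _ (sum-free : SumFree A) where

    B-free : ∀ {i j k l u v w} → (i +F j) +F k ≡ l → B i u ≡ true → B j v ≡ true → B k w ≡ true → B l ((u +V v) +V w) ≡ false
    B-free refl hu hv hw = ¬true⇒false (sum-free _ _ _ hu hv hw)

    pigeonhole : ∀ {i j} → q < a i + a j → ∀ w → ∃[ u ] ∃[ v ] B i u ≡ true × B j v ≡ true × w ≡ u +V v
    pigeonhole {i} {j} h w = conv (V.search d (λ u → B i u ∧ B j (w +V (-V u))))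
      where
      open ≤-Reasoning
      conv : (∃[ u ] B i u ∧ B j (w +V (-V u)) ≡ true) ⊎ (∀ u → B i u ∧ B j (w +V (-V u)) ≡ false) → ∃[ u ] ∃[ v ] B i u ≡ true × B j v ≡ true × w ≡ u +V v
      conv (inj₁ (u , hu)) = u , _ , proj₁ (∧-elim hu) , proj₂ (∧-elim {B i u} hu) , V.grp d (w ∷ u ∷ []) (gv 0) (gv 1 :+ (gv 0 :+ :- gv 1)) refl
      conv (inj₂ none) = ⊥-elim (<⇒≱ h (begin
        a i + a j
          ≡⟨ cong (a i +_) (sym (V.size-reflect d (B j) w)) ⟩
        a i + V.size d (λ u → B j (w +V (-V u)))
          ≤⟨ V.size-disjoint d {B i} {λ u → B j (w +V (-V u))} {λ _ → true} (λ _ _ → refl) (λ _ _ → refl) (λ u hu hv → true≢false (∧-intro hu hv) (none u)) ⟩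
        V.size d (λ _ → true)
          ≤⟨ ≤-trans (V.size≤order d (λ _ → true)) (≤-reflexive (length-allVecs d)) ⟩
        q ∎))

    -- More than q elements in two levels make their sum the whole space. If moreover i + j = x - y
    -- with nonempty levels x and y, that sum meets B x - B y, against sum-freeness.
    good-apart : ∀ {i j} → q < a i + a j → (Δ S) (i +F j) ≡ false
    good-apart {i} {j} h = ¬true⇒false λ e → absurd (Δ-elim {S} e)
      where
      clash : ∀ x y {v w} → i +F j ≡ x -F y → B x w ≡ true → B y v ≡ true → (∃[ u ] ∃[ u′ ] B i u ≡ true × B j u′ ≡ true × w +V (-V v) ≡ u +V u′) → ⊥
      clash x y {v} {w} e hw hv (u , u′ , hu , hu′ , eq) = true≢false (subst (λ t → B x t ≡ true) (V.grp d (w ∷ v ∷ []) (gv 0) (gv 0 :+ :- gv 1 :+ gv 1) refl) hw)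
        (subst (λ t → B x (t +V v) ≡ false) (sym eq) (B-free {i} {j} {y} {x} (trans (cong (_+F y) e) (Fp.grp (x ∷ y ∷ []) (gv 0 :+ :- (gv 1) :+ gv 1) (gv 0) refl)) hu hu′ hv))
      absurd : (∃[ x ] ∃[ y ] S x ≡ true × S y ≡ true × i +F j ≡ x -F y) → ⊥
      absurd (x , y , hx , hy , e) = let (w , hw) = S-elim {x} hx ; (v , hv) = S-elim {y} hy in clash x y e hw hv (pigeonhole {i} {j} h (w +V (-V v)))

    module _ (i₀ : 𝔽) (max : ∀ j → a j ≤ a i₀) (dense : m * q ≤ (3 * m + 3) * a i₀) (large : m * q ≤ V.size (suc d) A) where
      private
        M = a i₀
        L : ℕ → 𝔽 → Bool
        L t i = does (t <? a i)
        N : ℕ → ℕ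
        N t = Fp.size (L t)
        top : ∀ {t} → t < M → L t i₀ ≡ true
        top {t} h = does-intro (t <? M) h

      ∑N : ∑< M N ≡ V.size (suc d) A
      ∑N = trans (sym (∑-∑<-swap (allFin p) M _)) (trans (∑-cong (allFin p) (λ i → layers M (a i) (max i))) a-total)

      -- The lower bound mq/(m + 1) for the largest fibre. In dimension one any nonempty fibre is
      -- enough; otherwise the level sets satisfy the hypotheses of `level-dichotomy`.
      concentrated : m * q ≤ M * (m + 1)
      concentrated = by-cases d refl
        where
        by-cases : ∀ e → d ≡ e → m * q ≤ M * (m + 1)
        by-cases zero d≡ = (lin (m ∷ M ∷ (p ^ d) ∷ []) (hyp 1 (# 1 ⊗ (v0 ⊕ # 1)) (v1 ⊗ (v0 ⊕ # 1)) (*-monoˡ-≤ (m + 1) M≥1) ∷ eql 1 (v0 ⊗ v2) (v0 ⊗ (# 1)) (cong (λ t → m * (p ^ t)) d≡) ∷ []) 1 (v0 ⊗ v2) (v1 ⊗ (v0 ⊕ # 1)))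
          where
          M≥1 : 1 ≤ M
          M≥1 = n≢0⇒n>0 λ e → (refute (m ∷ (p ^ d) ∷ M ∷ []) (hyp 1 (v0 ⊗ v1) ((# 3 ⊗ v0 ⊕ # 3) ⊗ v2) dense ∷ eql 1 ((# 3 ⊗ v0 ⊕ # 3) ⊗ v2) ((# 3 ⊗ v0 ⊕ # 3) ⊗ (# 0)) (cong ((3 * m + 3) *_) e) ∷ eqr 1 (v0 ⊗ v1) (v0 ⊗ (# 1)) (cong (λ t → m * (p ^ t)) d≡) ∷ hyp 1 (# 23) v0 m≥ ∷ []))
        by-cases (suc e) d≡ = let (l , el) = odd-power p (1 + 2 * m) d (trans p≡ (odd m)) in level-dichotomy m q c M (l + c + 1) N (≤-trans (m≤m+n 13 10) m≥) (m^n>0 p e) q≡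
                         (lin≡ (l ∷ q ∷ c ∷ []) (eqn 1 (# 1 ⊕ # 2 ⊗ v0) v1 (sym el) ∷ []) (# 2 ⊗ (v0 ⊕ v2 ⊕ # 1)) (v1 ⊕ # 2 ⊗ v2 ⊕ # 1))
                         (λ t → ≤-trans (Fp.size≤order (L t)) (≤-reflexive (trans order-𝔽 p≡))) pair
                         (≤-trans large (≤-reflexive (sym ∑N))) dense
          where
          odd : ∀ m → 3 + 4 * m ≡ 1 + 2 * (1 + 2 * m)
          odd = solve-∀
          c = p ^ e
          q≡ : q ≡ (3 + 4 * m) * c
          q≡ = trans (cong (p ^_) d≡) (cong (_* c) p≡)
          -- L t + L t + L t′ misses L t′, since four levels of that kind have at least 2t + 2t′ + 4
          -- elements, more than `kneser-quad` permits. Two uses of Cauchy-Davenport give 2 N t + 2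
          -- N t′ ≤ p + 2, and p + 2 is odd.
          pair : ∀ t t′ → t < M → t′ < M → q + 2 * c < 2 * t + 2 * t′ + 4 → N t + N t′ ≤ 2 * m + 2
          pair t t′ ht ht′ big = ≮⇒≥ λ lt →
            (refute ((N t) ∷ (Fp.size Z) ∷ (N t′) ∷ (Fp.size (Fp.∁ (L t′))) ∷ p ∷ m ∷ []) (hyp 1 (v0 ⊕ v0) (v1 ⊕ # 1) first ∷ hyp 1 (v1 ⊕ v2) (v3 ⊕ # 1) second ∷ eql 1 (v2 ⊕ v3) v4 (size-Fp-∁ (L t′)) ∷ eql 1 v4 (# 3 ⊕ # 4 ⊗ v5) p≡ ∷ hyp 2 (# 1 ⊕ (# 2 ⊗ v5 ⊕ # 2)) (v0 ⊕ v2) lt ∷ []))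
            where
            Z = L t Fp.⊹ L t
            avoid : ∀ {i j k} → L t i ≡ true → L t j ≡ true → L t′ k ≡ true → L t′ ((i +F j) +F k) ≡ false
            avoid {i} {j} {k} hi hj hk = ¬true⇒false λ hl →
              (refute ((a i) ∷ (a j) ∷ (a k) ∷ (a ((i +F j) +F k)) ∷ (p ^ d) ∷ (p ^ e) ∷ t ∷ t′ ∷ []) (hyp 1 (v0 ⊕ v1 ⊕ v2 ⊕ v3) (v4 ⊕ # 2 ⊗ v5) (kneser-quad d e d≡ (B i) (B j) (B k) (B ((i +F j) +F k)) (ne hi) (ne hj) (ne hk) (ne hl) (λ _ _ _ → B-free {i} {j} {k} refl)) ∷ hyp 1 (# 1 ⊕ v6) v0 (does-elim (t <? a i) hi) ∷ hyp 1 (# 1 ⊕ v6) v1 (does-elim (t <? a j) hj) ∷ hyp 1 (# 1 ⊕ v7) v2 (does-elim (t′ <? a k) hk) ∷ hyp 1 (# 1 ⊕ v7) v3 (does-elim (t′ <? a ((i +F j) +F k)) hl) ∷ hyp 1 (# 1 ⊕ (v4 ⊕ # 2 ⊗ v5)) (# 2 ⊗ v6 ⊕ # 2 ⊗ v7 ⊕ # 4) big ∷ []))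
              where
              ne : ∀ {s i} → L s i ≡ true → ∃[ w ] B i w ≡ true
              ne {s} {i} h = V.size-elem d {B i} (≤-trans (s≤s z≤n) (does-elim (s <? a i) h))
            first : N t + N t ≤ Fp.size Z + 1
            first = cauchy-davenport {L t} {L t} {Z} {i₀} {i₀} {[ 0 ]ₚ} (λ _ _ → Fp.⊹-intro {L t} {L t}) (top ht) (top ht)
              (¬true⇒false λ h → let (i , j , hi , hj , eq) = Fp.⊹-elim {L t} {L t} h in
                true≢false (subst (λ s → L t′ s ≡ true) (trans (sym (+F-idˡ i₀)) (cong (_+F i₀) eq)) (top ht′)) (avoid {i} {j} {i₀} hi hj (top ht′)))
            second : Fp.size Z + N t′ ≤ Fp.size (Fp.∁ (L t′)) + 1
            second = cauchy-davenport {Z} {L t′} {Fp.∁ (L t′)} {i₀ +F i₀} {i₀} {i₀}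
              (λ s k hs hk → let (i , j , hi , hj , eq) = Fp.⊹-elim {L t} {L t} hs in
                not-intro (subst (λ s → L t′ (s +F k) ≡ false) (sym eq) (avoid {i} {j} {k} hi hj hk)))
              (Fp.⊹-intro {L t} {L t} (top ht) (top ht)) (top ht′) (cong not (top ht′))

      private
        2M>q : q < M + M
        2M>q = *-cancelˡ-< (m + 1) q (M + M) (lin (m ∷ q ∷ M ∷ []) (hyp 46 (v0 ⊗ v1) (v2 ⊗ (v0 ⊕ # 1)) concentrated ∷ hyp 22 (# 23 ⊗ (# 1)) (v0 ⊗ v1) (*-mono-≤ m≥ 1≤q) ∷ hyp 1 (# 23 ⊗ v1) (v0 ⊗ v1) (*-monoˡ-≤ q m≥) ∷ []) 23 (# 1 ⊕ (v0 ⊕ # 1) ⊗ v1) ((v0 ⊕ # 1) ⊗ (v2 ⊕ v2)))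

        -- The sums i + j of two levels with more than q elements together. They all lie outside S -
        -- S, so a lower bound for `Gd` is an upper bound for S - S.
        Gd : 𝔽 → Bool
        Gd g = any (λ i → does (q <? a i + a (g -F i))) (allFin p)

        Gd-intro : ∀ {i j} → q < a i + a j → Gd (i +F j) ≡ true
        Gd-intro {i} {j} h = Fp.any-intro {λ i′ → does (q <? a i′ + a ((i +F j) -F i′))} {i}
          (does-intro (q <? _) (subst (λ t → q < a i + a t) (Fp.grp (j ∷ i ∷ []) (gv 0) (gv 1 :+ gv 0 :+ :- (gv 1)) refl) h))

        Gd-apart : ∀ g → Gd g ≡ true → (Δ S) g ≡ true → ⊥
        Gd-apart g h h′ = let (i , hi) = any⇒∃ (λ i → does (q <? a i + a (g -F i))) (allFin p) h in true≢false h′ (subst (λ t → (Δ S) t ≡ false) (Fp.grp (i ∷ g ∷ []) (gv 0 :+ (gv 1 :+ :- (gv 0))) (gv 1) refl) (good-apart {i} {g -F i} (does-elim (q <? _) hi)))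

        S-i₀ : S i₀ ≡ true
        S-i₀ = does-intro (0 <? M) (lin (q ∷ M ∷ []) (hyp 1 (# 1 ⊕ v0) (v1 ⊕ v1) 2M>q ∷ []) 2 (# 1 ⊕ # 0) v1)

        0∈Δ : (Δ S) [ 0 ]ₚ ≡ true
        0∈Δ = subst (λ t → (Δ S) t ≡ true) (+F-invʳ i₀) (Δ-intro {S} S-i₀ S-i₀)

        Gd+Δ : Fp.size Gd + Fp.size (Δ S) ≤ p
        Gd+Δ = ≤-trans (Fp.size-disjoint {Gd} {Δ S} {λ _ → true} (λ _ _ → refl) (λ _ _ → refl) Gd-apart)
                 (≤-trans (Fp.size≤order (λ _ → true)) (≤-reflexive order-𝔽))

        2S≤Δ : 2 * Fp.size S ≤ Fp.size (Δ S) + 1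
        2S≤Δ = size-Δ {S} {i₀} {i₀ +F i₀} S-i₀ (¬true⇒false (Gd-apart (i₀ +F i₀) (Gd-intro 2M>q)))

        Gd≥1 : 1 ≤ Fp.size Gd
        Gd≥1 = Fp.size-pos {Gd} (Gd-intro {i₀} {i₀} 2M>q)

        pair-Gd : ∀ t t′ → t < M → t′ < M → t + t′ + 1 ≡ q → N t + N t′ ≤ Fp.size Gd + 1
        pair-Gd t t′ ht ht′ e = cauchy-davenport {L t} {L t′} {Gd} {i₀} {i₀} {[ 0 ]ₚ}
          (λ i j hi hj → Gd-intro {i} {j} (lin (t ∷ (a i) ∷ t′ ∷ (a j) ∷ q ∷ []) (hyp 1 (# 1 ⊕ v0) v1 (does-elim (t <? a i) hi) ∷ hyp 1 (# 1 ⊕ v2) v3 (does-elim (t′ <? a j) hj) ∷ eqr 1 (v0 ⊕ v2 ⊕ # 1) v4 e ∷ []) 1 (# 1 ⊕ v4) (v1 ⊕ v3)))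
          (top ht) (top ht′) (¬true⇒false λ h → Gd-apart [ 0 ]ₚ h 0∈Δ)

        N≤S : ∀ t → N t ≤ Fp.size S
        N≤S t = Fp.size-mono {L t} {S} (λ i h → does-intro (0 <? a i) (≤-trans (s≤s z≤n) (does-elim (t <? a i) h)))

      -- With o = q - M, the levels from o to M - 1 pair off by t + t′ + 1 = q, and `pair-Gd` bounds
      -- each pair by |Gd| + 1; the o levels below are bounded by |S|, which is at most p/2. Were
      -- |Gd| ≤ 2m - 2, the total mq would force q ≤ 5o, whereas o ≤ q/(m + 1).
      Gd-large : 2 * m ≤ Fp.size Gd + 1
      Gd-large = ≮⇒≥ λ small → absurd small (m≤n⇒∃[o]m+o≡n (a≤q i₀))
        where
        G = Fp.size Gd
        D = Fp.size (Δ S)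
        s = Fp.size S
        absurd : G + 1 < 2 * m → (∃[ o ] M + o ≡ q) → ⊥
        absurd small (o , eo) = final (m≤n⇒∃[o]m+o≡n {o} {M} (lin (q ∷ M ∷ o ∷ []) (hyp 1 (# 1 ⊕ v0) (v1 ⊕ v1) 2M>q ∷ eql 1 (v1 ⊕ v2) v0 eo ∷ []) 1 v2 v1))
          where
          final : (∃[ n ] o + n ≡ M) → ⊥
          final (n , en) = (refute (m ∷ q ∷ o ∷ s ∷ n ∷ G ∷ []) (hyp 24 (# 2 ⊗ (v0 ⊗ v1)) (# 2 ⊗ (v2 ⊗ v3) ⊕ v4 ⊗ (v5 ⊕ # 1)) total ∷ hyp 24 (v4 ⊗ (# 1 ⊕ (v5 ⊕ # 1))) (v4 ⊗ (# 2 ⊗ v0)) (*-monoʳ-≤ n small) ∷ hyp 24 (v2 ⊗ (# 2 ⊗ v3)) (v2 ⊗ (# 3 ⊕ # 4 ⊗ v0)) (*-monoʳ-≤ o s≤) ∷ eqr 48 (v0 ⊗ v1) (v0 ⊗ (# 2 ⊗ v2 ⊕ v4)) (cong (m *_) q≡) ∷ eql 24 v1 (# 2 ⊗ v2 ⊕ v4) q≡ ∷ hyp 5 ((v0 ⊕ # 1) ⊗ v2) v1 o-small ∷ hyp 5 (# 23 ⊗ v2) (v0 ⊗ v2) (*-monoˡ-≤ o m≥) ∷ hyp 19 (# 1) v1 1≤q ∷ []))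
            where
            q≡ : q ≡ 2 * o + n
            q≡ = (lin≡ (q ∷ M ∷ o ∷ n ∷ []) (eqn 1 v0 (v1 ⊕ v2) (sym eo) ∷ eqn 1 v1 (v2 ⊕ v3) (sym en) ∷ []) v0 (# 2 ⊗ v2 ⊕ v3))
            s≤ : 2 * s ≤ 3 + 4 * m
            s≤ = (lin (s ∷ D ∷ G ∷ p ∷ m ∷ []) (hyp 1 (# 2 ⊗ v0) (v1 ⊕ # 1) 2S≤Δ ∷ hyp 1 (v2 ⊕ v1) v3 Gd+Δ ∷ hyp 1 (# 1) v2 Gd≥1 ∷ eql 1 v3 (# 3 ⊕ # 4 ⊗ v4) p≡ ∷ []) 1 (# 2 ⊗ v0) (# 3 ⊕ # 4 ⊗ v4))
            o-small : (m + 1) * o ≤ q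
            o-small = (lin (m ∷ q ∷ M ∷ o ∷ []) (hyp 1 (v0 ⊗ v1) (v2 ⊗ (v0 ⊕ # 1)) concentrated ∷ eql 1 ((v0 ⊕ # 1) ⊗ (v2 ⊕ v3)) ((v0 ⊕ # 1) ⊗ v1) (cong ((m + 1) *_) eo) ∷ []) 1 ((v0 ⊕ # 1) ⊗ v3) v1)
            total : 2 * (m * q) ≤ 2 * (o * s) + n * (G + 1)
            total = ≤-trans (*-monoʳ-≤ 2 (≤-trans large (≤-reflexive (trans (sym ∑N) (trans (cong (λ k → ∑< k N) (sym en)) (∑<-split o n N))))))
              (≤-trans (≤-reflexive (*-distribˡ-+ 2 (∑< o N) _)) (+-mono-≤ (*-monoʳ-≤ 2 (∑<-bound o s (λ t _ → N≤S t)))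
                (∑<-pairs n _ (G + 1) (λ i j e → pair-Gd (o + i) (o + j)
                   (lin (i ∷ j ∷ n ∷ o ∷ M ∷ []) (eql 1 (v0 ⊕ v1 ⊕ # 1) v2 e ∷ eql 1 (v3 ⊕ v2) v4 en ∷ []) 1 (# 1 ⊕ (v3 ⊕ v0)) v4) (lin (i ∷ j ∷ n ∷ o ∷ M ∷ []) (eql 1 (v0 ⊕ v1 ⊕ # 1) v2 e ∷ eql 1 (v3 ⊕ v2) v4 en ∷ []) 1 (# 1 ⊕ (v3 ⊕ v1)) v4)
                   (lin≡ (i ∷ j ∷ n ∷ o ∷ q ∷ []) (eqn 1 (v0 ⊕ v1 ⊕ # 1) v2 e ∷ eqn 1 (# 2 ⊗ v3 ⊕ v2) v4 (sym q≡) ∷ []) (v3 ⊕ v0 ⊕ (v3 ⊕ v1) ⊕ # 1) v4)))))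

      private
        X₀ : 𝔽 → Bool
        X₀ i = does (q <? a i + a i)

        X₀⊆S : X₀ Fp.⊆ S
        X₀⊆S i h = does-intro (0 <? a i) (n≢0⇒n>0 λ e → (refute (q ∷ (a i) ∷ []) (hyp 1 (# 1 ⊕ v0) (v1 ⊕ v1) (does-elim (q <? a i + a i) h) ∷ eql 2 v1 (# 0) e ∷ [])))

        X₀-apart : ∀ x y → X₀ x ≡ true → X₀ y ≡ true → (Δ S) (x +F y) ≡ false
        X₀-apart x y hx hy = good-apart {x} {y} (*-cancelˡ-< 2 q (a x + a y)
          (lin (q ∷ (a x) ∷ (a y) ∷ []) (hyp 1 (# 1 ⊕ v0) (v1 ⊕ v1) (does-elim (q <? a x + a x) hx) ∷ hyp 1 (# 1 ⊕ v0) (v2 ⊕ v2) (does-elim (q <? a y + a y) hy) ∷ []) 1 (# 1 ⊕ # 2 ⊗ v0) (# 2 ⊗ (v1 ⊕ v2))))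

        Δ≤ : Fp.size (Δ S) ≤ 2 * m + 4
        Δ≤ = (lin (m ∷ (Fp.size Gd) ∷ (Fp.size (Δ S)) ∷ p ∷ []) (hyp 1 (# 2 ⊗ v0) (v1 ⊕ # 1) Gd-large ∷ hyp 1 (v1 ⊕ v2) v3 Gd+Δ ∷ eql 1 v3 (# 3 ⊕ # 4 ⊗ v0) p≡ ∷ []) 1 v2 (# 2 ⊗ v0 ⊕ # 4))

        -- 2 aᵢ ≤ q - 1 off X₀, as q is odd
        mass : 2 * (m * q) ≤ 2 * q * Fp.size X₀ + (q ∸ 1) * Fp.size (S Fp.∖ X₀)
        mass = ≤-trans (*-monoʳ-≤ 2 (≤-trans large (≤-reflexive (sym a-total)))) (≤-trans (≤-reflexive (sym (∑-*ˡ (allFin p) 2 a)))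
          (≤-trans (∑-mono (allFin p) pt) (≤-reflexive (trans (∑-+ (allFin p) _ _) (cong₂ _+_ (∑-*ˡ (allFin p) (2 * q) _) (∑-*ˡ (allFin p) (q ∸ 1) _))))))
          where
          pt : ∀ i → 2 * a i ≤ 2 * q * ⟨ X₀ i ⟩ + (q ∸ 1) * ⟨ S i ∧ not (X₀ i) ⟩
          pt i = pt-dec (q <? a i + a i)
            where
            odd : ∀ m → 3 + 4 * m ≡ 1 + 2 * (1 + 2 * m)
            odd = solve-∀
            half : ∀ x l → x + x ≤ 1 + 2 * l → x ≤ l
            half x l h = ≮⇒≥ λ lt → (refute (x ∷ l ∷ []) (hyp 1 (v0 ⊕ v0) (# 1 ⊕ # 2 ⊗ v1) h ∷ hyp 2 (# 1 ⊕ v1) v0 lt ∷ []))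
            halved : ¬ (q < a i + a i) → (∃[ l ] q ≡ 1 + 2 * l) → 2 * a i ≤ 2 * q * 0 + (q ∸ 1) * 1
            halved h (l , el) = ≤-trans (*-monoʳ-≤ 2 (half (a i) l (≤-trans (≮⇒≥ h) (≤-reflexive el))))
              (≤-reflexive (trans (cong (_∸ 1) (sym el)) (sym (trans (cong (_+ (q ∸ 1) * 1) (*-zeroʳ (2 * q))) (*-identityʳ (q ∸ 1))))))
            small : ¬ (q < a i + a i) → ∀ b → S i ≡ b → 2 * a i ≤ 2 * q * 0 + (q ∸ 1) * ⟨ b ∧ true ⟩
            small h false e = ≤-trans (≤-reflexive (cong (2 *_) (n≤0⇒n≡0 (≮⇒≥ λ pos → true≢false (does-intro (0 <? a i) pos) e)))) z≤n
            small h true  e = halved h (odd-power p (1 + 2 * m) d (trans p≡ (odd m)))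
            pt-dec : Dec (q < a i + a i) → 2 * a i ≤ 2 * q * ⟨ X₀ i ⟩ + (q ∸ 1) * ⟨ S i ∧ not (X₀ i) ⟩
            pt-dec (yes h) = ≤-trans (*-monoʳ-≤ 2 (a≤q i)) (subst (λ t → 2 * q ≤ 2 * q * ⟨ t ⟩ + (q ∸ 1) * ⟨ S i ∧ not t ⟩) (sym (does-intro (q <? a i + a i) h))
                          (≤-trans (≤-reflexive (sym (*-identityʳ (2 * q)))) (m≤m+n _ _)))
            pt-dec (no h) = subst (λ t → 2 * a i ≤ 2 * q * ⟨ t ⟩ + (q ∸ 1) * ⟨ S i ∧ not t ⟩) (sym (does-not (q <? a i + a i) h)) (small h (S i) refl)

        S-split : Fp.size X₀ + Fp.size (S Fp.∖ X₀) ≡ Fp.size S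
        S-split = trans (cong (_+ Fp.size (S Fp.∖ X₀)) (Fp.size-cong {X₀} {S Fp.∩ X₀} (λ i h → ∧-intro (X₀⊆S i h) h) (λ i h → proj₂ (∧-elim {S i} h)))) (Fp.size-∩∖ S X₀)

      config : Config p-prime m S
      config = build (m≤n⇒∃[o]m+o≡n m≤S)
        where
        s = Fp.size S
        x = Fp.size X₀
        r = Fp.size (S Fp.∖ X₀)
        m≤S : m ≤ s
        m≤S = *-cancelʳ-≤ m s q {{Data.Nat.>-nonZero 1≤q}} (≤-trans large (≤-trans (≤-reflexive (sym a-total))
          (≤-trans (∑-mono (allFin p) pt) (≤-reflexive (∑-*ʳ (allFin p) _ q)))))
          where
          pt : ∀ i → a i ≤ ⟨ S i ⟩ * q
          pt i = pt-dec (0 <? a i)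
            where
            pt-dec : Dec (0 < a i) → a i ≤ ⟨ S i ⟩ * q
            pt-dec (yes h) = subst (λ t → a i ≤ ⟨ t ⟩ * q) (sym (does-intro (0 <? a i) h)) (≤-trans (a≤q i) (≤-reflexive (sym (+-identityʳ q))))
            pt-dec (no h) = ≤-trans (≮⇒≥ h) z≤n
        mass′ : 2 * (m * q) + r ≤ 2 * q * x + q * r
        mass′ = ≤-trans (+-monoˡ-≤ r mass) (≤-reflexive (trans (+-assoc (2 * q * x) _ r) (cong (2 * q * x +_) (trans (+-comm _ r) (cong (_* r) (m+[n∸m]≡n 1≤q))))))
        make : ∀ k → k ≤ x → (∀ Y → Fp.size Y ≡ k → (s ≡ m × Fp.size Y ≡ m) ⊎ (s ≡ m + 1 × Fp.size Y ≡ m) ⊎ (s ≡ m + 2 × Fp.size Y + 1 ≡ m)) → Config p-prime m S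
        make k k≤x h = let (Y , Y⊆ , eY) = subset-of-size k X₀ k≤x in record { X = Y ; X⊆S = λ i hi → X₀⊆S i (Y⊆ i hi) ; apart = λ i j hi hj → X₀-apart i j (Y⊆ i hi) (Y⊆ j hj) ; Δ≤ = Δ≤ ; sizes = h Y eY }
        -- An element of S outside `X₀` wastes more than half a level, and only k full levels can be
        -- wasted.
        few : ∀ k → s ≡ m + k → r < 2 * k ⊎ r ≡ 0
        few k e = decide (r <? 2 * k) (r ≟ 0)
          where
          decide : Dec (r < 2 * k) → Dec (r ≡ 0) → r < 2 * k ⊎ r ≡ 0
          decide (yes h) _       = inj₁ h
          decide (no _)  (yes h) = inj₂ h
          decide (no h)  (no h′) = ⊥-elim (refute (m ∷ q ∷ r ∷ x ∷ s ∷ k ∷ []) (hyp 1 (# 2 ⊗ (v0 ⊗ v1) ⊕ v2) (# 2 ⊗ v1 ⊗ v3 ⊕ v1 ⊗ v2) mass′ ∷ eql 1 (# 2 ⊗ v1 ⊗ (v3 ⊕ v2)) (# 2 ⊗ v1 ⊗ v4) (cong (2 * q *_) S-split) ∷ eql 1 (# 2 ⊗ v1 ⊗ v4) (# 2 ⊗ v1 ⊗ (v0 ⊕ v5)) (cong (2 * q *_) e) ∷ hyp 1 (v1 ⊗ (# 2 ⊗ v5)) (v1 ⊗ v2) (*-monoʳ-≤ q (≮⇒≥ h)) ∷ hyp 1 (# 1 ⊕ # 0) v2 (n≢0⇒n>0 h′) ∷ []))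
        build : (∃[ k ] m + k ≡ s) → Config p-prime m S
        build (0 , e) = make m (≤-trans (≤-reflexive (trans (trans (sym (+-identityʳ m)) (trans e (sym S-split))) (trans (cong (x +_) (r≡0 (few 0 (sym e)))) (+-identityʳ x)))) ≤-refl)
                          (λ Y eY → inj₁ (trans (sym e) (+-identityʳ m) , eY))
          where r≡0 : r < 0 ⊎ r ≡ 0 → r ≡ 0
                r≡0 (inj₂ e) = e
        build (1 , e) = make m (case (few 1 (sym e))) (λ Y eY → inj₂ (inj₁ (sym e , eY)))
          where case : r < 2 ⊎ r ≡ 0 → m ≤ x
                case (inj₁ h) = (lin (r ∷ s ∷ x ∷ m ∷ []) (hyp 1 (# 1 ⊕ v0) (# 2) h ∷ eqr 1 (v2 ⊕ v0) v1 S-split ∷ eql 1 (v3 ⊕ # 1) v1 e ∷ []) 1 v3 v2)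
                case (inj₂ h) = (lin (r ∷ s ∷ x ∷ m ∷ []) (eql 1 v0 (# 0) h ∷ eqr 1 (v2 ⊕ v0) v1 S-split ∷ eql 1 (v3 ⊕ # 1) v1 e ∷ []) 1 v3 v2)
        build (2 , e) = make (m ∸ 1) (case (few 2 (sym e))) (λ Y eY → inj₂ (inj₂ (sym e , trans (cong (_+ 1) eY) (m∸n+n≡m (≤-trans (s≤s z≤n) m≥)))))
          where case : r < 4 ⊎ r ≡ 0 → m ∸ 1 ≤ x
                case (inj₁ h) = m≤n+o⇒m∸n≤o m 1 (lin (r ∷ s ∷ x ∷ m ∷ []) (hyp 1 (# 1 ⊕ v0) (# 4) h ∷ eqr 1 (v2 ⊕ v0) v1 S-split ∷ eql 1 (v3 ⊕ # 2) v1 e ∷ []) 1 v3 (# 1 ⊕ v2))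
                case (inj₂ h) = m≤n+o⇒m∸n≤o m 1 (lin (r ∷ s ∷ x ∷ m ∷ []) (eql 1 v0 (# 0) h ∷ eqr 1 (v2 ⊕ v0) v1 S-split ∷ eql 1 (v3 ⊕ # 2) v1 e ∷ []) 1 v3 (# 1 ⊕ v2))
        -- 2|S| - 1 ≤ |S - S| ≤ 2m + 4 rules out m + 3 elements.
        build (suc (suc (suc k)) , e) = ⊥-elim (refute (s ∷ (Fp.size (Δ S)) ∷ m ∷ k ∷ []) (hyp 1 (# 2 ⊗ v0) (v1 ⊕ # 1) 2S≤Δ ∷ hyp 1 v1 (# 2 ⊗ v2 ⊕ # 4) Δ≤ ∷ eql 2 (v2 ⊕ (# 1 ⊕ (# 1 ⊕ (# 1 ⊕ v3)))) v0 e ∷ []))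

-- Critical pairs in F_p

module Critical {p : ℕ} {{p-nonZero : NonZero p}} (p-prime : Prime p) where
  open PrimeField p-prime
  open CauchyDavenport p-prime

  -- For δ = 1 this is the number of maximal runs of Z.
  ∂ : 𝔽 → (𝔽 → Bool) → ℕ
  ∂ δ Z = Fp.size (λ z → Z z ∧ not (Z (z +F δ)))

  ∂-bound : ∀ {δ Z U} → U Fp.⊆ Z → (∀ u → U u ≡ true → Z (u +F δ) ≡ true) → ∂ δ Z + Fp.size U ≤ Fp.size Z
  ∂-bound {δ} {Z} {U} U⊆Z h = Fp.size-disjoint {λ z → Z z ∧ not (Z (z +F δ))} {U} {Z} (λ z e → proj₁ (∧-elim e)) U⊆Z
    (λ z e u → true≢false (h z u) (not-elim (proj₂ (∧-elim {Z z} e))))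

  -- X + y lies in Z together with its translate X + y′; the points of X + y are therefore not ends
  -- of runs.
  ∂-shift : ∀ {δ X Y Z y y′} → X Fp.⊹ Y ⊆ Z → Y y ≡ true → Y y′ ≡ true → δ ≡ y′ -F y → ∂ δ Z + Fp.size X ≤ Fp.size Z
  ∂-shift {δ} {X} {Y} {Z} {y} {y′} sum hy hy′ e = ≤-trans (≤-reflexive (cong (∂ δ Z +_) (sym (Fp.size-translate X y))))
    (∂-bound {δ} {Z} {Fp.translate X y}
      (λ z hz → subst (λ t → Z t ≡ true) (Fp.grp (z ∷ y ∷ []) (gv 0 :+ :- (gv 1) :+ gv 1) (gv 0) refl) (sum _ _ hz hy))
      (λ z hz → subst (λ t → Z t ≡ true) (trans (Fp.grp (z ∷ y ∷ y′ ∷ []) (gv 0 :+ :- (gv 1) :+ gv 2) (gv 0 :+ (gv 2 :+ :- (gv 1))) refl) (cong (z +F_) (sym e))) (sum _ _ hz hy′)))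

  -- δ generates F_p: the element y is reached from x after (y - x)/δ steps.
  stable-all : ∀ {δ} (Z : 𝔽 → Bool) → δ ≢ [ 0 ]ₚ → (∀ z → Z z ≡ true → Z (z +F δ) ≡ true) → ∀ {x} → Z x ≡ true → ∀ y → Z y ≡ true
  stable-all {δ} Z δ≢0 st {x} hx y = reach (inverse δ δ≢0)
    where
    climb : ∀ n → Z (x +F [ n ]ₚ *F δ) ≡ true
    climb zero    = subst (λ t → Z t ≡ true) (sym (trans (cong (x +F_) (*F-zeroˡ δ)) (Fp.⊞-idʳ x))) hx
    climb (suc n) = subst (λ t → Z t ≡ true) (trans (+F-assoc x _ δ) (cong (x +F_) (trans (+F-comm _ δ)
      (trans (cong (_+F [ n ]ₚ *F δ) (sym (*F-idˡ δ))) (trans (sym (*F-distribʳ δ [ 1 ]ₚ [ n ]ₚ)) (cong (_*F δ) ([]-+ 1 n))))))) (st _ (climb n))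
    reach : (∃[ u ] u *F δ ≡ [ 1 ]ₚ) → Z y ≡ true
    reach (u , uδ) = subst (λ t → Z t ≡ true) (trans (cong (x +F_) eq) (Fp.grp (x ∷ y ∷ []) (gv 0 :+ (gv 1 :+ :- (gv 0))) (gv 1) refl)) (climb (toℕ ((y -F x) *F u)))
      where eq : [ toℕ ((y -F x) *F u) ]ₚ *F δ ≡ y -F x
            eq = trans (cong (_*F δ) ([]-toℕ _)) (trans (*F-assoc (y -F x) u δ) (trans (cong ((y -F x) *F_) uδ) (trans (*F-comm _ [ 1 ]ₚ) (*F-idˡ _))))

  ∂-pos : ∀ {δ Z x y} → δ ≢ [ 0 ]ₚ → Z x ≡ true → Z y ≡ false → 1 ≤ ∂ δ Z
  ∂-pos {δ} {Z} {x} {y} δ≢0 hx hy = found (Fp.search (λ z → Z z ∧ not (Z (z +F δ))))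
    where
    found : (∃[ z ] (Z z ∧ not (Z (z +F δ))) ≡ true) ⊎ (∀ z → (Z z ∧ not (Z (z +F δ))) ≡ false) → 1 ≤ ∂ δ Z
    found (inj₁ (z , h)) = Fp.size-pos {λ z → Z z ∧ not (Z (z +F δ))} {z} h
    found (inj₂ none) = ⊥-elim (true≢false (stable-all Z δ≢0 (λ z hz → step z hz (Z (z +F δ)) refl) hx y) hy)
      where step : ∀ z → Z z ≡ true → ∀ b → Z (z +F δ) ≡ b → b ≡ true
            step z hz true  e = refl
            step z hz false e = ⊥-elim (true≢false (∧-intro hz (not-intro e)) (none z))

  thicken : 𝔽 → (𝔽 → Bool) → 𝔽 → Bool
  thicken δ Z z = Z z ∨ Z (z -F δ)

  size-thicken : ∀ δ Z → Fp.size (thicken δ Z) ≡ Fp.size Z + ∂ δ Z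
  size-thicken δ Z = +-cancelʳ-≡ (Fp.size both) (Fp.size (thicken δ Z)) (Fp.size Z + ∂ δ Z) (begin
    Fp.size (thicken δ Z) + Fp.size both   ≡⟨ Fp.size-∪∩ Z (Fp.translate Z δ) ⟩
    Fp.size Z + Fp.size (Fp.translate Z δ) ≡⟨ cong (Fp.size Z +_) (Fp.size-translate Z δ) ⟩
    Fp.size Z + Fp.size Z                  ≡⟨ cong (Fp.size Z +_) (sym (Fp.size-∩∖ Z next)) ⟩
    Fp.size Z + (Fp.size (Z Fp.∩ next) + ∂ δ Z) ≡⟨ cong (λ t → Fp.size Z + (t + ∂ δ Z)) (trans (sym (Fp.size-translate (Z Fp.∩ next) δ)) same) ⟩
    Fp.size Z + (Fp.size both + ∂ δ Z)     ≡⟨ cong (Fp.size Z +_) (+-comm _ (∂ δ Z)) ⟩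
    Fp.size Z + (∂ δ Z + Fp.size both)     ≡⟨ sym (+-assoc (Fp.size Z) _ _) ⟩
    Fp.size Z + ∂ δ Z + Fp.size both       ∎)
    where
    open ≡-Reasoning
    next both : 𝔽 → Bool
    next z = Z (z +F δ)
    both = Z Fp.∩ Fp.translate Z δ
    same : Fp.size (Fp.translate (Z Fp.∩ next) δ) ≡ Fp.size both
    same = Fp.size-cong
      (λ z h → ∧-intro (subst (λ t → Z t ≡ true) (Fp.grp (z ∷ δ ∷ []) (gv 0 :+ :- (gv 1) :+ gv 1) (gv 0) refl) (proj₂ (∧-elim {Z (z -F δ)} h))) (proj₁ (∧-elim h)))
      (λ z h → ∧-intro (proj₂ (∧-elim {Z z} h)) (subst (λ t → Z t ≡ true) (Fp.grp (z ∷ δ ∷ []) (gv 0) (gv 0 :+ :- (gv 1) :+ gv 1) refl) (proj₁ (∧-elim h))))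

  -- The case κ = 1 is equality in Cauchy-Davenport, and `Thin κ` is the Vosper type conclusion that
  -- Z consists of at most κ progressions with one difference. Dyson transforms with two points left
  -- in Y preserve all fields: Z is fixed and X only grows. `κ<X` will make the set `full` nonempty.
  record Crit (κ : ℕ) (X Y Z : 𝔽 → Bool) : Set where
    field
      sum  : X Fp.⊹ Y ⊆ Z
      2≤Y  : 2 ≤ Fp.size Y
      κ<X  : κ < Fp.size X
      size : Fp.size Z + 2 ≤ Fp.size X + Fp.size Y + κ
      miss : ∃[ z ] Z z ≡ false

  Thin : ℕ → (𝔽 → Bool) → Set
  Thin κ Z = ∃[ δ ] δ ≢ [ 0 ]ₚ × ∂ δ Z ≤ κ

  elem : ∀ {Y : 𝔽 → Bool} → 2 ≤ Fp.size Y → ∃[ y ] Y y ≡ true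
  elem {Y} h = Fp.size-elem {Y} (≤-trans (s≤s z≤n) h)

  miss-X : ∀ {κ X Y Z} → Crit κ X Y Z → ∃[ x ] X x ≡ false
  miss-X {κ} {X} {Y} {Z} c = let (y , hy) = elem {Y} (Crit.2≤Y c) ; (z , hz) = Crit.miss c in
    z -F y , ¬true⇒false λ h → true≢false (subst (λ t → Z t ≡ true) (strip z y) (Crit.sum c _ _ h hy)) hz
    where strip : ∀ z y → z -F y +F y ≡ z
          strip z y = (Fp.grp (z ∷ y ∷ []) (gv 0 :+ :- (gv 1) :+ gv 1) (gv 0) refl)

  -- If Y = {y, y′}, take δ = y′ - y; by `∂-shift` the number of runs of Z is at most |Z| - |X|.
  pair-thin : ∀ {κ X Y Z} → Crit κ X Y Z → Fp.size Y ≤ 2 → Thin κ Z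
  pair-thin {κ} {X} {Y} {Z} c Y≤2 =
    let (y , hy) = elem {Y} 2≤Y ; (y′ , hy′ , y′≢y) = Fp.size-two {Y} {y} hy 2≤Y ; sh = ∂-shift {_} {X} {Y} {Z} {y} {y′} sum hy hy′ refl in
    y′ -F y , (λ e → y′≢y (sub-zero y′ y e)) , bound sh
    where
    open Crit c
    sub-zero : ∀ a b → a -F b ≡ [ 0 ]ₚ → a ≡ b
    sub-zero a b e = Fp.⊞-cancelʳ (-F b) (trans e (sym (+F-invʳ b)))
    bound : ∀ {n} → n + Fp.size X ≤ Fp.size Z → n ≤ κ
    bound {n} sh = (lin (n ∷ (Fp.size X) ∷ (Fp.size Z) ∷ (Fp.size Y) ∷ κ ∷ []) (hyp 1 (v0 ⊕ v1) v2 sh ∷ hyp 1 (v2 ⊕ # 2) (v1 ⊕ v3 ⊕ v4) size ∷ hyp 1 v3 (# 2) Y≤2 ∷ []) 1 v0 v4)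

  -- If Y is a progression with difference δ, drop its last element: X + Y° can be shifted by δ inside Z.
  progression-thin : ∀ {κ X Y Z δ} → Crit κ X Y Z → ∂ δ Y ≤ 1 → ∂ δ Z ≤ κ
  progression-thin {κ} {X} {Y} {Z} {δ} c ∂Y≤1 =
    (lin ((∂ δ Z) ∷ (Fp.size W) ∷ (Fp.size Z) ∷ (Fp.size X) ∷ (Fp.size Y°) ∷ (Fp.size Y) ∷ (∂ δ Y) ∷ κ ∷ []) (hyp 1 (v0 ⊕ v1) v2 bd ∷ hyp 1 (v3 ⊕ v4) (v1 ⊕ # 1) cd ∷ eqr 1 (v4 ⊕ v6) v5 (Fp.size-∩∖ Y next) ∷ hyp 1 v6 (# 1) ∂Y≤1 ∷ hyp 1 (v2 ⊕ # 2) (v3 ⊕ v5 ⊕ v7) size ∷ []) 1 v0 v7)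
    where
    open Crit c
    next Y° W : 𝔽 → Bool
    next y = Y (y +F δ)
    Y° = Y Fp.∩ next
    W = X Fp.⊹ Y°
    W⊆Z : W Fp.⊆ Z
    W⊆Z w h = let (x , y , hx , hy , e) = Fp.⊹-elim {X} {Y°} h in subst (λ t → Z t ≡ true) (sym e) (sum x y hx (proj₁ (∧-elim hy)))
    bd : ∂ δ Z + Fp.size W ≤ Fp.size Z
    bd = ∂-bound {δ} {Z} {W} W⊆Z (λ w h → let (x , y , hx , hy , e) = Fp.⊹-elim {X} {Y°} h in
      subst (λ t → Z t ≡ true) (trans (sym (+F-assoc x y δ)) (cong (_+F δ) (sym e))) (sum x (y +F δ) hx (proj₂ (∧-elim {Y y} hy))))
    Y°≥1 : 1 ≤ Fp.size Y°
    Y°≥1 = (lin ((Fp.size Y) ∷ (Fp.size Y°) ∷ (∂ δ Y) ∷ []) (eqr 1 (v1 ⊕ v2) v0 (Fp.size-∩∖ Y next) ∷ hyp 1 v2 (# 1) ∂Y≤1 ∷ hyp 1 (# 2) v0 2≤Y ∷ []) 1 (# 1) v1)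
    cd : Fp.size X + Fp.size Y° ≤ Fp.size W + 1
    cd = let (x , hx) = Fp.size-elem {X} (≤-trans (s≤s z≤n) κ<X) ; (y , hy) = Fp.size-elem {Y°} Y°≥1 ; (z , hz) = miss in
      cauchy-davenport {X} {Y°} {W} {x} {y} {z} (λ _ _ → Fp.⊹-intro {X} {Y°}) hx hy (¬true⇒false λ h → true≢false (W⊆Z z h) hz)

  -- A pair at which the descent stops: a translate of Y is contained in X as soon as it has two
  -- points in X.
  Stuck : (𝔽 → Bool) → (𝔽 → Bool) → Set
  Stuck X Y = ∀ e → 2 ≤ Fp.size (Fp.dyson-B X Y e) → Fp.size Y ≤ Fp.size (Fp.dyson-B X Y e)

  reduce : ∀ X Y → (∃[ e ] 2 ≤ Fp.size (Fp.dyson-B X Y e) × Fp.size (Fp.dyson-B X Y e) < Fp.size Y) ⊎ Stuck X Y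
  reduce X Y = conv (Fp.search (λ e → does (2 ≤? sz e) ∧ does (sz e <? Fp.size Y)))
    where
    sz : 𝔽 → ℕ
    sz e = Fp.size (Fp.dyson-B X Y e)
    conv : (∃[ e ] (does (2 ≤? sz e) ∧ does (sz e <? Fp.size Y)) ≡ true) ⊎ (∀ e → (does (2 ≤? sz e) ∧ does (sz e <? Fp.size Y)) ≡ false) →
           (∃[ e ] 2 ≤ sz e × sz e < Fp.size Y) ⊎ Stuck X Y
    conv (inj₁ (e , h)) = inj₁ (e , does-elim (2 ≤? sz e) (proj₁ (∧-elim h)) , does-elim (sz e <? Fp.size Y) (proj₂ (∧-elim {does (2 ≤? sz e)} h)))
    conv (inj₂ none) = inj₂ λ e h → ≮⇒≥ λ lt → true≢false (∧-intro (does-intro (2 ≤? sz e) h) (does-intro (sz e <? Fp.size Y) lt)) (none e)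

  dyson-crit : ∀ {κ X Y Z} → Crit κ X Y Z → ∀ e → 2 ≤ Fp.size (Fp.dyson-B X Y e) → Crit κ (Fp.dyson-A X Y e) (Fp.dyson-B X Y e) Z
  dyson-crit {κ} {X} {Y} {Z} c e 2≤ = record
    { sum = Fp.dyson-sum {X} {Y} {Z} sum e ; 2≤Y = 2≤ ; miss = miss
    ; κ<X = ≤-trans κ<X (Fp.size-mono {X} {Fp.dyson-A X Y e} (λ x hx → ∨-introˡ hx))
    ; size = ≤-trans size (≤-reflexive (cong (_+ κ) (sym (Fp.dyson-size X Y e)))) }
    where open Crit c

  -- Z never changes, so a difference found for any transformed pair is good for the original one.
  -- The bound b on |X| survives because transforms enlarge X; it is there for the handler.
  descend : ∀ κ b Z → (∀ X Y → b ≤ Fp.size X → Crit κ X Y Z → Stuck X Y → 3 ≤ Fp.size Y → Thin κ Z) →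
            ∀ n X Y → Fp.size Y ≤ n → b ≤ Fp.size X → Crit κ X Y Z → Thin κ Z
  descend κ b Z handler n X Y Y≤n big c = branch (Fp.size Y ≤? 2) (reduce X Y) n Y≤n
    where
    branch : Dec (Fp.size Y ≤ 2) → (∃[ e ] 2 ≤ Fp.size (Fp.dyson-B X Y e) × Fp.size (Fp.dyson-B X Y e) < Fp.size Y) ⊎ Stuck X Y → ∀ n → Fp.size Y ≤ n → Thin κ Z
    branch (yes Y≤2) _ n _ = pair-thin c Y≤2
    branch (no Y>2) (inj₂ stuck) n _ = handler X Y big c stuck (≰⇒> Y>2)
    branch (no Y>2) (inj₁ (e , 2≤ , lt)) zero    Y≤n = ⊥-elim (Y>2 (≤-trans Y≤n z≤n))
    branch (no Y>2) (inj₁ (e , 2≤ , lt)) (suc n) Y≤n = descend κ b Z handler n (Fp.dyson-A X Y e) (Fp.dyson-B X Y e) (≤-pred (≤-trans lt Y≤n))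
      (≤-trans big (Fp.size-mono {X} {Fp.dyson-A X Y e} (λ x hx → ∨-introˡ hx))) (dyson-crit c e 2≤)

  module StuckPair {κ X Y Z} (c : Crit κ X Y Z) (stuck : Stuck X Y) where
    open Crit c

    -- The e with e + Y ⊆ X; in a stuck pair two points suffice for that (`full-intro`). What X
    -- contains beyond `full` + y is `rest y`, whose size does not depend on y in Y.
    full : 𝔽 → Bool
    full e = does (Fp.size Y ≤? Fp.size (Fp.dyson-B X Y e))

    full-elim : ∀ {e y} → full e ≡ true → Y y ≡ true → X (e +F y) ≡ true
    full-elim {e} {y} h hy = proj₂ (∧-elim {Y y} (Fp.size-full⊆ {Fp.dyson-B X Y e} {Y} (λ y h → proj₁ (∧-elim h)) (does-elim (Fp.size Y ≤? _) h) y hy))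

    full-intro : ∀ {e y y′} → y ≢ y′ → Y y ≡ true → Y y′ ≡ true → X (e +F y) ≡ true → X (e +F y′) ≡ true → full e ≡ true
    full-intro {e} {y} {y′} y≢y′ hy hy′ hx hx′ = does-intro (Fp.size Y ≤? _) (stuck e
      (≤-trans (≤-reflexive (cong₂ _+_ (sym (Fp.size-single y)) (sym (Fp.size-single y′))))
        (Fp.size-disjoint {Fp.｛ y ｝} {Fp.｛ y′ ｝} {Fp.dyson-B X Y e} (at y hy hx) (at y′ hy′ hx′)
          (λ t ht ht′ → y≢y′ (trans (sym (does-elim (t FinP.≟ y) ht)) (does-elim (t FinP.≟ y′) ht′))))))
      where at : ∀ y → Y y ≡ true → X (e +F y) ≡ true → Fp.｛ y ｝ Fp.⊆ Fp.dyson-B X Y e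
            at y hy hx t ht = subst (λ s → Fp.dyson-B X Y e s ≡ true) (sym (does-elim (t FinP.≟ y) ht)) (∧-intro hy hx)

    rest : 𝔽 → 𝔽 → Bool
    rest y x = X x ∧ not (full (x -F y))

    rest-size : ∀ {y} → Y y ≡ true → Fp.size full + Fp.size (rest y) ≡ Fp.size X
    rest-size {y} hy = trans (cong (_+ Fp.size (rest y)) (trans (sym (Fp.size-translate full y)) (Fp.size-cong
      (λ x h → ∧-intro (subst (λ t → X t ≡ true) (Fp.grp (x ∷ y ∷ []) (gv 0 :+ :- (gv 1) :+ gv 1) (gv 0) refl) (full-elim {x -F y} {y} h hy)) h) (λ x h → proj₂ (∧-elim {X x} h)))))
      (Fp.size-∩∖ X (Fp.translate full y))

    -- A point x of X is followed by x + (y′ - y) in X exactly when x - y is full. So X has the same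
    -- number of runs, namely |X| - |full|, for every difference of Y.
    ∂-stuck : ∀ {y y′} → y ≢ y′ → Y y ≡ true → Y y′ ≡ true → ∂ (y′ -F y) X ≡ Fp.size (rest y)
    ∂-stuck {y} {y′} y≢y′ hy hy′ = Fp.size-cong
      (λ x h → ∧-intro (proj₁ (∧-elim h)) (not-intro (¬true⇒false λ f →
         true≢false (subst (λ t → X t ≡ true) (move x) (full-elim {x -F y} {y′} f hy′)) (not-elim (proj₂ (∧-elim {X x} h))))))
      (λ x h → ∧-intro (proj₁ (∧-elim h)) (not-intro (¬true⇒false λ hx′ →
         true≢false (full-intro {x -F y} y≢y′ hy hy′ (subst (λ t → X t ≡ true) (back x) (proj₁ (∧-elim h))) (subst (λ t → X t ≡ true) (sym (move x)) hx′))
           (not-elim (proj₂ (∧-elim {X x} h))))))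
      where
      move : ∀ x → x -F y +F y′ ≡ x +F (y′ -F y)
      move x = (Fp.grp (x ∷ y ∷ y′ ∷ []) (gv 0 :+ :- (gv 1) :+ gv 2) (gv 0 :+ (gv 2 :+ :- (gv 1))) refl)
      back : ∀ x → x ≡ x -F y +F y
      back x = (Fp.grp (x ∷ y ∷ []) (gv 0) (gv 0 :+ :- (gv 1) :+ gv 1) refl)

    module _ {y₀} (hy₀ : Y y₀ ≡ true) where
      u : ℕ
      u = Fp.size (rest y₀)

      private
        second : ∃[ y ] Y y ≡ true × y ≢ y₀
        second = Fp.size-two {Y} {y₀} hy₀ 2≤Y

        sub≢0 : ∀ {a b} → a ≢ b → a -F b ≢ [ 0 ]ₚ
        sub≢0 {a} {b} h e = h (Fp.⊞-cancelʳ (-F b) (trans e (sym (+F-invʳ b))))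

      X-elem : ∃[ x ] X x ≡ true
      X-elem = Fp.size-elem {X} (≤-trans (s≤s z≤n) κ<X)

      u-pos : 1 ≤ u
      u-pos = let (y , hy , y≢) = second ; (x , hx) = X-elem ; (x′ , hx′) = miss-X c in
        ≤-trans (∂-pos {y -F y₀} {X} {x} {x′} (sub≢0 y≢) hx hx′) (≤-reflexive (∂-stuck (λ e → y≢ (sym e)) hy₀ hy))

      -- Let U be the e outside `full` with e + y₀ in X. The sum of U and Y minus y₀ avoids X, yet
      -- shifted by y₀ it stays in Z like X + y₀, so that |X| + (u + |Y| - 2) ≤ |Z| by
      -- Cauchy-Davenport.
      u≤κ : u ≤ κ
      u≤κ = let (w , hw) = Fp.size-elem {rest y₀} u-pos ; (y , hy , y≢) = second ; (x , hx) = X-elem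
                cd = cauchy-davenport {U} {Y°} {P} {w -F y₀} {y} {x} (λ _ _ → Fp.⊹-intro {U} {Y°})
                       (subst (λ t → rest y₀ t ≡ true) (Fp.grp (w ∷ y₀ ∷ []) (gv 0) (gv 0 :+ :- (gv 1) :+ gv 1) refl) hw)
                       (∧-intro hy (not-intro (does-not (y FinP.≟ y₀) y≢))) (¬true⇒false λ h → P-apart x h hx)
        in (lin ((Fp.size U) ∷ (Fp.size Y°) ∷ (Fp.size P) ∷ u ∷ (Fp.size Y) ∷ (Fp.size X) ∷ (Fp.size Z) ∷ κ ∷ []) (hyp 1 (v0 ⊕ v1) (v2 ⊕ # 1) cd ∷ eqr 1 v0 v3 U-size ∷ eqr 1 (# 1 ⊕ v1) v4 (Fp.size-∖single {Y} hy₀) ∷ hyp 1 (v5 ⊕ v2) v6 contained ∷ hyp 1 (v6 ⊕ # 2) (v5 ⊕ v4 ⊕ v7) size ∷ []) 1 v3 v7)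
        where
        U Y° P Z′ : 𝔽 → Bool
        U e = rest y₀ (e +F y₀)
        Y° = Y Fp.∖ Fp.｛ y₀ ｝
        P = U Fp.⊹ Y°
        Z′ t = Z (t +F y₀)
        U-size : Fp.size U ≡ u
        U-size = bijection-∑ (finType p) (finType p) (_+F y₀) (_-F y₀) (λ x → (Fp.grp (x ∷ y₀ ∷ []) (gv 0 :+ gv 1 :+ :- (gv 1)) (gv 0) refl)) (λ x → (Fp.grp (x ∷ y₀ ∷ []) (gv 0 :+ :- (gv 1) :+ gv 1) (gv 0) refl)) (λ x → ⟨ rest y₀ x ⟩)
        P-apart : ∀ t → P t ≡ true → X t ≡ true → ⊥
        P-apart t h ht = let (e , y , he , hy , eq) = Fp.⊹-elim {U} {Y°} h in
          true≢false (full-intro {e} {y₀} {y} (λ e₀ → true≢false (does-intro (y FinP.≟ y₀) (sym e₀)) (not-elim (proj₂ (∧-elim {Y y} hy)))) hy₀ (proj₁ (∧-elim hy)) (proj₁ (∧-elim he)) (subst (λ s → X s ≡ true) eq ht))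
            (subst (λ s → full s ≡ false) (Fp.grp (e ∷ y₀ ∷ []) (gv 0 :+ gv 1 :+ :- (gv 1)) (gv 0) refl) (not-elim (proj₂ (∧-elim {X (e +F y₀)} he))))
        contained : Fp.size X + Fp.size P ≤ Fp.size Z
        contained = ≤-trans (Fp.size-disjoint {X} {P} {Z′} (λ x hx → sum x y₀ hx hy₀)
            (λ t h → let (e , y , he , hy , eq) = Fp.⊹-elim {U} {Y°} h in
               subst (λ s → Z s ≡ true) (trans (Fp.grp (e ∷ y₀ ∷ y ∷ []) (gv 0 :+ gv 1 :+ gv 2) (gv 0 :+ gv 2 :+ gv 1) refl) (cong (_+F y₀) (sym eq))) (sum _ y (proj₁ (∧-elim he)) (proj₁ (∧-elim hy))))
            (λ t hx hP → P-apart t hP hx))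
          (≤-reflexive (bijection-∑ (finType p) (finType p) (_+F y₀) (_-F y₀) (λ x → (Fp.grp (x ∷ y₀ ∷ []) (gv 0 :+ gv 1 :+ :- (gv 1)) (gv 0) refl)) (λ x → (Fp.grp (x ∷ y₀ ∷ []) (gv 0 :+ :- (gv 1) :+ gv 1) (gv 0) refl)) (λ x → ⟨ Z x ⟩)))

      full-pos : 1 ≤ Fp.size full
      full-pos = (lin ((Fp.size X) ∷ (Fp.size full) ∷ u ∷ κ ∷ []) (eqr 1 (v1 ⊕ v2) v0 (rest-size hy₀) ∷ hyp 1 v2 v3 u≤κ ∷ hyp 1 (# 1 ⊕ v3) v0 κ<X ∷ []) 1 (# 1) v1)

      full-sum : full Fp.⊹ Y ⊆ X
      full-sum e y he hy = full-elim {e} {y} he hy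

      -- Cauchy-Davenport for `full` + Y ⊆ X.
      k≤u+1 : Fp.size Y ≤ u + 1
      k≤u+1 = let (e , he) = Fp.size-elem {full} full-pos ; (x′ , hx′) = miss-X c
                  cd = cauchy-davenport {full} {Y} {X} {e} {y₀} {x′} full-sum he hy₀ hx′
              in (lin ((Fp.size full) ∷ (Fp.size Y) ∷ (Fp.size X) ∷ u ∷ []) (hyp 1 (v0 ⊕ v1) (v2 ⊕ # 1) cd ∷ eqr 1 (v0 ⊕ v3) v2 (rest-size hy₀) ∷ []) 1 v1 (v3 ⊕ # 1))

  -- Vosper's theorem. A stuck pair would have |Y| ≤ u + 1 ≤ 2, so the descent always ends with a
  -- set Y of two elements.
  thin-1 : ∀ {X Y Z} → Crit 1 X Y Z → Thin 1 Z
  thin-1 {X} {Y} {Z} c = descend 1 0 Z handler (Fp.size Y) X Y ≤-refl z≤n c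
    where
    handler : ∀ X Y → 0 ≤ Fp.size X → Crit 1 X Y Z → Stuck X Y → 3 ≤ Fp.size Y → Thin 1 Z
    handler X Y _ c stuck 3≤Y = let (y , hy) = elem {Y} (Crit.2≤Y c) in
      ⊥-elim (refute ((Fp.size Y) ∷ (StuckPair.u c stuck hy) ∷ []) (hyp 1 v0 (v1 ⊕ # 1) (StuckPair.k≤u+1 c stuck hy) ∷ hyp 1 v1 (# 1) (StuckPair.u≤κ c stuck hy) ∷ hyp 1 (# 3) v0 3≤Y ∷ []))

  -- When |Y| = u + 1, `full` + Y ⊆ X is an equality case, so X is a progression by Vosper. Uniting
  -- X and Y with their δ-translates adds at most one element to X, and to Y as many as it has runs;
  -- Cauchy-Davenport for the enlarged sets leaves room for one run of Y.
  stuck-progression : ∀ {κ X Y Z} (c : Crit κ X Y Z) (stuck : Stuck X Y) {y} (hy : Y y ≡ true) →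
    StuckPair.u c stuck hy + 1 ≡ Fp.size Y → κ + 2 ≤ Fp.size X → Fp.size X + 2 ≤ p → ∃[ δ ] δ ≢ [ 0 ]ₚ × ∂ δ Y ≤ 1
  stuck-progression {κ} {X} {Y} {Z} c stuck {y} hy tight big room =
    let (δ , δ≢0 , ∂X≤1) = thin-1 crit in δ , δ≢0 , bound δ ∂X≤1
    where
    open StuckPair c stuck
    open Crit c using (2≤Y; κ<X)
    crit : Crit 1 full Y X
    crit = record { sum = full-sum hy ; 2≤Y = 2≤Y ; miss = miss-X c
      ; κ<X = (lin ((Fp.size X) ∷ (Fp.size full) ∷ (u hy) ∷ κ ∷ []) (eqr 1 (v1 ⊕ v2) v0 (rest-size hy) ∷ hyp 1 v2 v3 (u≤κ hy) ∷ hyp 1 (v3 ⊕ # 2) v0 big ∷ []) 1 (# 1 ⊕ # 1) v1)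
      ; size = (lin ((Fp.size X) ∷ (Fp.size full) ∷ (u hy) ∷ (Fp.size Y) ∷ []) (eqr 1 (v1 ⊕ v2) v0 (rest-size hy) ∷ eql 1 (v2 ⊕ # 1) v3 tight ∷ []) 1 (v0 ⊕ # 2) (v1 ⊕ v3 ⊕ # 1)) }
    bound : ∀ δ → ∂ δ X ≤ 1 → ∂ δ Y ≤ 1
    bound δ ∂X≤1 = let (e , he) = Fp.size-elem {full} (full-pos hy) ; (x , hx) = outside in
      (lin ((Fp.size full) ∷ (Fp.size (thicken δ Y)) ∷ (Fp.size (thicken δ X)) ∷ (Fp.size Y) ∷ (∂ δ Y) ∷ (Fp.size X) ∷ (∂ δ X) ∷ (u hy) ∷ []) (hyp 1 (v0 ⊕ v1) (v2 ⊕ # 1) (cauchy-davenport {full} {thicken δ Y} {thicken δ X} {e} {y} {x} thick he (∨-introˡ hy) hx) ∷ eqr 1 v1 (v3 ⊕ v4) (size-thicken δ Y) ∷ eql 1 v2 (v5 ⊕ v6) (size-thicken δ X) ∷ hyp 1 v6 (# 1) ∂X≤1 ∷ eqr 1 (v0 ⊕ v7) v5 (rest-size hy) ∷ eql 1 (v7 ⊕ # 1) v3 tight ∷ []) 1 v4 (# 1))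
      where
      thick : full Fp.⊹ thicken δ Y ⊆ thicken δ X
      thick e t he ht = split (∨-elim ht)
        where split : Y t ≡ true ⊎ Y (t -F δ) ≡ true → thicken δ X (e +F t) ≡ true
              split (inj₁ h) = ∨-introˡ (full-elim {e} {t} he h)
              split (inj₂ h) = ∨-introʳ {X (e +F t)} (subst (λ s → X s ≡ true) (sym (+F-assoc e t (-F δ))) (full-elim {e} {t -F δ} he h))
      outside : ∃[ x ] thicken δ X x ≡ false
      outside = let (x , h) = Fp.size-elem {Fp.∁ (thicken δ X)} (lin (p ∷ (Fp.size (thicken δ X)) ∷ (Fp.size (Fp.∁ (thicken δ X))) ∷ (Fp.size X) ∷ (∂ δ X) ∷ []) (eqr 1 (v1 ⊕ v2) v0 (size-Fp-∁ (thicken δ X)) ∷ eql 1 v1 (v3 ⊕ v4) (size-thicken δ X) ∷ hyp 1 v4 (# 1) ∂X≤1 ∷ hyp 1 (v3 ⊕ # 2) v0 room ∷ []) 1 (# 1) v2)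
                in x , not-elim h

  -- For a stuck pair with |Y| ≥ 3 the bounds |Y| ≤ u + 1 ≤ 4 leave two cases: |Y| = u + 1, where Y
  -- is a progression, and |Y| = u = 3. In the second the same analysis is applied to the pair
  -- (`full`, Y) inside X.
  thin : ∀ {κ X Y Z} → κ ≤ 3 → 10 ≤ Fp.size X → Fp.size Z + 2 ≤ p → Crit κ X Y Z → Thin κ Z
  thin {κ} {X} {Y} {Z} κ≤3 big room c = descend κ 10 Z handler (Fp.size Y) X Y ≤-refl big c
    where
    handler : ∀ X Y → 10 ≤ Fp.size X → Crit κ X Y Z → Stuck X Y → 3 ≤ Fp.size Y → Thin κ Z
    handler X Y big c stuck 3≤Y = via (elem {Y} (Crit.2≤Y c))
      where
      open StuckPair c stuck
      X≤Z : Fp.size X ≤ Fp.size Z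
      X≤Z = let (y , hy) = elem {Y} (Crit.2≤Y c) in Fp.size-summand {X} {Y} {Z} {y} (Crit.sum c) hy
      room′ : Fp.size X + 2 ≤ p
      room′ = ≤-trans (+-monoˡ-≤ 2 X≤Z) room
      finish : (∃[ δ ] δ ≢ [ 0 ]ₚ × ∂ δ Y ≤ 1) → Thin κ Z
      finish (δ , δ≢0 , h) = δ , δ≢0 , progression-thin c h
      via : (∃[ y ] Y y ≡ true) → Thin κ Z
      via (y , hy) = decide (u hy + 1 ≟ Fp.size Y)
        where
        decide : Dec (u hy + 1 ≡ Fp.size Y) → Thin κ Z
        decide (yes tight) = finish (stuck-progression c stuck hy tight (lin (κ ∷ (Fp.size X) ∷ []) (hyp 1 v0 (# 3) κ≤3 ∷ hyp 1 (# 10) v1 big ∷ []) 1 (v0 ⊕ # 2) v1) room′)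
        decide (no ¬tight) = inner (reduce full Y)
          where
          k<u+1 : Fp.size Y < u hy + 1
          k<u+1 = ≤∧≢⇒< (k≤u+1 hy) (λ e → ¬tight (sym e))
          k≡3 : Fp.size Y ≡ 3
          k≡3 = ≤-antisym (lin ((Fp.size Y) ∷ (u hy) ∷ κ ∷ []) (hyp 1 (# 1 ⊕ v0) (v1 ⊕ # 1) k<u+1 ∷ hyp 1 v1 v2 (u≤κ hy) ∷ hyp 1 v2 (# 3) κ≤3 ∷ []) 1 v0 (# 3)) 3≤Y
          u≡3 : u hy ≡ 3
          u≡3 = ≤-antisym (≤-trans (u≤κ hy) κ≤3) (lin ((Fp.size Y) ∷ (u hy) ∷ []) (hyp 1 (# 1 ⊕ v0) (v1 ⊕ # 1) k<u+1 ∷ hyp 1 (# 3) v0 3≤Y ∷ []) 1 (# 3) v1)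
          full≡ : Fp.size full + 3 ≡ Fp.size X
          full≡ = trans (cong (Fp.size full +_) (sym u≡3)) (rest-size hy)
          crit : Crit 2 full Y X
          crit = record { sum = full-sum hy ; 2≤Y = Crit.2≤Y c ; miss = miss-X c
            ; κ<X = (lin ((Fp.size X) ∷ (Fp.size full) ∷ []) (eqr 1 (v1 ⊕ # 3) v0 full≡ ∷ hyp 1 (# 10) v0 big ∷ []) 1 (# 1 ⊕ # 2) v1)
            ; size = (lin ((Fp.size X) ∷ (Fp.size full) ∷ (Fp.size Y) ∷ []) (eqr 1 (v1 ⊕ # 3) v0 full≡ ∷ eqr 1 v2 (# 3) k≡3 ∷ []) 1 (v0 ⊕ # 2) (v1 ⊕ v2 ⊕ # 2)) }
          inner : (∃[ e ] 2 ≤ Fp.size (Fp.dyson-B full Y e) × Fp.size (Fp.dyson-B full Y e) < Fp.size Y) ⊎ Stuck full Y → Thin κ Z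
          inner (inj₂ stuck′) = let module R = StuckPair crit stuck′ in finish (stuck-progression crit stuck′ hy
            (≤-antisym (lin ((R.u hy) ∷ (Fp.size Y) ∷ []) (hyp 1 v0 (# 2) (R.u≤κ hy) ∷ eqr 1 v1 (# 3) k≡3 ∷ []) 1 (v0 ⊕ # 1) v1) (R.k≤u+1 hy))
            (lin ((Fp.size X) ∷ (Fp.size full) ∷ []) (eqr 1 (v1 ⊕ # 3) v0 full≡ ∷ hyp 1 (# 10) v0 big ∷ []) 1 (# 2 ⊕ # 2) v1)
            (lin ((Fp.size full) ∷ (Fp.size X) ∷ p ∷ []) (eql 1 (v0 ⊕ # 3) v1 full≡ ∷ hyp 1 (v1 ⊕ # 2) v2 room′ ∷ []) 1 (v0 ⊕ # 2) v2))
          -- A transform reducing Y to two points a, b makes X consist of at most two runs for b -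
          -- a, but `∂-stuck` counts u = 3.
          inner (inj₁ (e , 2≤ , lt)) = ⊥-elim (clash (Fp.size-elem {Y′} (≤-trans (s≤s z≤n) 2≤)))
            where
            F′ Y′ : 𝔽 → Bool
            F′ = Fp.dyson-A full Y e
            Y′ = Fp.dyson-B full Y e
            clash : (∃[ a ] Y′ a ≡ true) → ⊥
            clash (a , ha) = let (b , hb , b≢a) = Fp.size-two {Y′} {a} ha 2≤
                                 eq = ∂-stuck {a} {b} (λ e → b≢a (sym e)) (proj₁ (∧-elim ha)) (proj₁ (∧-elim hb))
                                 sh = ∂-shift {_} {F′} {Y′} {X} {a} {b} (Fp.dyson-sum {full} {Y} {X} (full-sum hy) e) ha hb refl
              in (refute ((Fp.size (rest a)) ∷ (∂ (b -F a) X) ∷ (Fp.size F′) ∷ (Fp.size X) ∷ (Fp.size full) ∷ (Fp.size Y) ∷ (Fp.size Y′) ∷ []) (eqr 1 v1 v0 eq ∷ hyp 1 (v1 ⊕ v2) v3 sh ∷ eqr 1 (v2 ⊕ v6) (v4 ⊕ v5) (Fp.dyson-size full Y e) ∷ hyp 1 (# 1 ⊕ v6) v5 lt ∷ eqr 1 (v4 ⊕ v0) v3 (rest-size {a} (proj₁ (∧-elim ha))) ∷ []))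

-- Sets with at most three runs and a small difference set

∑<-limit : ∀ f {k n} → k ≤ n → ∑< k f ≤ ∑< n f
∑<-limit f {k} h with m≤n⇒∃[o]m+o≡n h
... | o , refl = ≤-trans (m≤m+n _ _) (≤-reflexive (sym (∑<-split k o f)))

-- Intervals are given by their first element and their length.
Cover : (ℕ → Bool) → ℕ → ℕ → List (ℕ × ℕ) → Set
Cover D lo hi []             = lo ≤ hi
Cover D lo hi ((v , n) ∷ is) = lo ≤ v × (∀ i → i < n → D (v + i) ≡ true) × Cover D (v + n) hi is

lengths : List (ℕ × ℕ) → ℕ
lengths []             = 0
lengths ((v , n) ∷ is) = n + lengths is

cover-count : ∀ D lo hi is → Cover D lo hi is → ∑< lo (λ t → ⟨ D t ⟩) + lengths is ≤ ∑< hi (λ t → ⟨ D t ⟩)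
cover-count D lo hi [] h = ≤-trans (≤-reflexive (+-identityʳ _)) (∑<-limit _ h)
cover-count D lo hi ((v , n) ∷ is) (lo≤v , on , rest) = ≤-trans (≤-reflexive (sym (+-assoc (∑< lo (λ t → ⟨ D t ⟩)) n (lengths is))))
  (≤-trans (+-monoˡ-≤ (lengths is) (≤-trans (+-monoˡ-≤ n (∑<-limit _ lo≤v)) (≤-reflexive (trans (cong (∑< v _ +_) ones) (sym (∑<-split v n _))))))
    (cover-count D (v + n) hi is rest))
  where ones : n ≡ ∑< n (λ i → ⟨ D (v + i) ⟩)
        ones = sym (trans (∑<-cong n (λ i h → cong ⟨_⟩ (on i h))) (trans (∑<-const n 1) (*-identityʳ n)))

module Geometry (m p : ℕ) (p≡ : p ≡ 3 + 4 * m) (m≥ : 23 ≤ m) (D : ℕ → Bool)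
                (D-sym : ∀ t t′ → t + t′ ≡ p → D t ≡ true → D t′ ≡ true)
                (small : ∑< p (λ t → ⟨ D t ⟩) ≤ 2 * m + 1) where

  covered : ∀ is → Cover D 0 p is → lengths is ≤ 2 * m + 1
  covered is c = ≤-trans (cover-count D 0 p is c) small

  -- Multiplication by k maps b into an interval of 2m - 2 residues: b lies in a progression of difference 1/k.
  Short : (ℕ → Bool) → Set
  Short b = ∃[ k ] ∃[ c ] (1 ≤ k × k ≤ 3) × (∀ i → i < p → b i ≡ true → ∃[ i′ ] ∃[ e ] (i′ + 3 ≤ 2 * m) × (k * i + c ≡ i′ + e * p))

  -- By symmetry D also contains the mirror image of the initial interval, in total 2w - 1 elements.
  initial : ∀ w → (∀ t → t < w → D t ≡ true) → w ≤ m + 1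
  initial w h = ≮⇒≥ λ lt → (refute (m ∷ []) (hyp 1 (v0 ⊕ # 2 ⊕ (v0 ⊕ # 1 ⊕ # 0)) (# 2 ⊗ v0 ⊕ # 1) (covered ((0 , m + 2) ∷ (3 * m + 2 , m + 1) ∷ []) (z≤n , (λ i hi → h i (lin (i ∷ m ∷ w ∷ []) (hyp 1 (# 1 ⊕ v0) (v1 ⊕ # 2) hi ∷ hyp 1 (# 1 ⊕ (v1 ⊕ # 1)) v2 lt ∷ []) 1 (# 1 ⊕ v0) v2)) , (lin (m ∷ []) (hyp 2 (# 23) v0 m≥ ∷ []) 1 (# 0 ⊕ (v0 ⊕ # 2)) (# 3 ⊗ v0 ⊕ # 2)) , (λ i hi → reflect i hi lt) , (lin (m ∷ p ∷ []) (eqr 1 v1 (# 3 ⊕ # 4 ⊗ v0) p≡ ∷ []) 1 (# 3 ⊗ v0 ⊕ # 2 ⊕ (v0 ⊕ # 1)) v1))) ∷ []))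
    where
    reflect : ∀ i → i < m + 1 → m + 1 < w → D (3 * m + 2 + i) ≡ true
    reflect i hi lt = D-sym (m + 1 ∸ i) (3 * m + 2 + i) (lin≡ ((m + 1 ∸ i) ∷ i ∷ m ∷ p ∷ []) (eqn 1 (v0 ⊕ v1) (v2 ⊕ # 1) (m∸n+n≡m (<⇒≤ hi)) ∷ eqn 1 (# 3 ⊕ # 4 ⊗ v2) v3 (sym p≡) ∷ []) (v0 ⊕ (# 3 ⊗ v2 ⊕ # 2 ⊕ v1)) v3)
      (h _ (≤-<-trans (m∸n≤m (m + 1) i) lt))

  mirror : ∀ v n → v + n ≤ p → (∀ i → i < n → D (v + i) ≡ true) → ∀ v′ → v + n + v′ ≡ suc p → ∀ i → i < n → D (v′ + i) ≡ true
  mirror v n le on v′ e i hi = D-sym (v + (n ∸ suc i)) (v′ + i)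
    (lin≡ ((n ∸ suc i) ∷ i ∷ n ∷ v ∷ v′ ∷ p ∷ []) (eqn 1 (v0 ⊕ (# 1 ⊕ v1)) v2 (m∸n+n≡m hi) ∷ eqn 1 (v3 ⊕ v2 ⊕ v4) (# 1 ⊕ v5) e ∷ []) (v3 ⊕ v0 ⊕ (v4 ⊕ v1)) v5)
    (on _ (lin ((n ∸ suc i) ∷ i ∷ n ∷ []) (eql 1 (v0 ⊕ (# 1 ⊕ v1)) v2 (m∸n+n≡m hi) ∷ []) 1 (# 1 ⊕ v0) v2))

  minus : ∀ a {b} → a ≤ b → ∃[ c ] a + c ≡ b
  minus a h = m≤n⇒∃[o]m+o≡n h

  offset : ∀ v {n t} → v ≤ t → t < v + n → (∀ i → i < n → D (v + i) ≡ true) → D t ≡ true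
  offset v {n} {t} h h′ on with minus v h
  ... | i , refl = on i (+-cancelˡ-< v i n h′)

  -- The initial interval and its mirror image, which ends at p - 1, occupy 2ℓ - 1 elements, 0 being
  -- its own mirror. The remaining budget of 2m + 2 - 2ℓ is for the intervals between them.
  framed : ∀ ℓ → 1 ≤ ℓ → (∀ t → t < ℓ → D t ≡ true) → ∀ o → ℓ + o ≡ suc p → ∀ is → Cover D ℓ o is → 2 * ℓ + lengths is ≤ 2 * m + 2
  framed ℓ ℓ≥ D₀ o eo is cov = let (r , er) = minus 1 ℓ≥ in
    (lin (ℓ ∷ (∑< ℓ f) ∷ (lengths is) ∷ (∑< o f) ∷ r ∷ (∑< p f) ∷ m ∷ []) (hyp 1 (# 0 ⊕ (v0 ⊕ # 0)) v1 (cover-count D 0 ℓ ((0 , ℓ) ∷ []) (z≤n , D₀ , ≤-refl)) ∷ hyp 1 (v1 ⊕ v2) v3 (cover-count D ℓ o is cov) ∷ hyp 1 (v3 ⊕ (v4 ⊕ # 0)) v5 (cover-count D o p ((o , r) ∷ []) (≤-refl , mirror 1 r (lin (r ∷ ℓ ∷ m ∷ p ∷ []) (eql 1 (# 1 ⊕ v0) v1 er ∷ hyp 1 v1 (v2 ⊕ # 1) (initial ℓ D₀) ∷ eqr 1 v3 (# 3 ⊕ # 4 ⊗ v2) p≡ ∷ []) 1 (# 1 ⊕ v0) v3) (λ i hi → D₀ (1 + i) (lin (i ∷ r ∷ ℓ ∷ []) (hyp 1 (# 1 ⊕ v0) v1 hi ∷ eql 1 (# 1 ⊕ v1) v2 er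 ∷ []) 1 (# 1 ⊕ (# 1 ⊕ v0)) v2)) o (lin≡ (r ∷ ℓ ∷ o ∷ p ∷ []) (eqn 1 (# 1 ⊕ v0) v1 er ∷ eqn 1 (v1 ⊕ v2) (# 1 ⊕ v3) eo ∷ []) (# 1 ⊕ v0 ⊕ v2) (# 1 ⊕ v3)) , (lin (r ∷ ℓ ∷ o ∷ p ∷ []) (eql 1 (# 1 ⊕ v0) v1 er ∷ eql 1 (v1 ⊕ v2) (# 1 ⊕ v3) eo ∷ []) 1 (v2 ⊕ v0) v3))) ∷ hyp 1 v5 (# 2 ⊗ v6 ⊕ # 1) small ∷ eqr 1 (# 1 ⊕ v4) v0 er ∷ []) 1 (# 2 ⊗ v0 ⊕ v2) (# 2 ⊗ v6 ⊕ # 2))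
    where f = λ t → ⟨ D t ⟩

  hull : ∀ b H → H + 2 ≤ 2 * m → (∀ i → i < p → b i ≡ true → i < H) → Short b
  hull b H le inH = 1 , 0 , (≤-refl , s≤s z≤n) , λ i i<p hi → i , 0 , (lin (i ∷ H ∷ m ∷ []) (hyp 1 (# 1 ⊕ v0) v1 (inH i i<p hi) ∷ hyp 1 (v1 ⊕ # 2) (# 2 ⊗ v2) le ∷ []) 1 (v0 ⊕ # 3) (# 2 ⊗ v2)) , (lin≡ (i ∷ p ∷ []) [] (# 1 ⊗ v0 ⊕ # 0) (v0 ⊕ # 0 ⊗ v1))

  wrapped-hull : ∀ b ℓ x c → x + c ≡ p → ℓ + c + 2 ≤ 2 * m → (∀ i → i < p → b i ≡ true → i < ℓ ⊎ x ≤ i) → Short b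
  wrapped-hull b ℓ x c e le inH = 1 , c , (≤-refl , s≤s z≤n) , λ i i<p hi → place i i<p (inH i i<p hi)
    where
    place : ∀ i → i < p → i < ℓ ⊎ x ≤ i → ∃[ i′ ] ∃[ e ] (i′ + 3 ≤ 2 * m) × (1 * i + c ≡ i′ + e * p)
    place i i<p (inj₁ h) = i + c , 0 , (lin (i ∷ ℓ ∷ c ∷ m ∷ []) (hyp 1 (# 1 ⊕ v0) v1 h ∷ hyp 1 (v1 ⊕ v2 ⊕ # 2) (# 2 ⊗ v3) le ∷ []) 1 (v0 ⊕ v2 ⊕ # 3) (# 2 ⊗ v3)) , (lin≡ (i ∷ c ∷ p ∷ []) [] (# 1 ⊗ v0 ⊕ v1) (v0 ⊕ v1 ⊕ # 0 ⊗ v2))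
    place i i<p (inj₂ h) = let (o , eo) = minus x h in o , 1 , (lin (x ∷ o ∷ i ∷ p ∷ c ∷ ℓ ∷ m ∷ []) (eql 1 (v0 ⊕ v1) v2 eo ∷ hyp 1 (# 1 ⊕ v2) v3 i<p ∷ eqr 1 (v0 ⊕ v4) v3 e ∷ hyp 1 (v5 ⊕ v4 ⊕ # 2) (# 2 ⊗ v6) le ∷ []) 1 (v1 ⊕ # 3) (# 2 ⊗ v6)) ,
      (lin≡ (i ∷ x ∷ o ∷ c ∷ p ∷ []) (eqn 1 v0 (v1 ⊕ v2) (sym eo) ∷ eqn 1 (v1 ⊕ v3) v4 e ∷ []) (# 1 ⊗ v0 ⊕ v3) (v2 ⊕ # 1 ⊗ v4))

  -- Two clusters, contained in [0, ℓP) and [x, x + ℓQ); a run of length j at one end of the first one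
  -- produces the interval of n differences starting at v.
  two-clusters : ∀ b ℓP x ℓQ j v n ℓ → m ≤ 3 * j → 8 ≤ j → j ≤ ℓP → m ≤ ℓP + ℓQ → ℓP + j ≤ x → x + ℓQ + j ≤ p →
    (∀ i → i < p → b i ≡ true → i < ℓP ⊎ (x ≤ i × i < x + ℓQ)) →
    ℓP ≤ ℓ → ℓQ ≤ ℓ → (∀ t → t < ℓ → D t ≡ true) → n + 1 ≡ ℓQ + j → (∀ i → i < n → D (v + i) ≡ true) →
    (v + j ≡ x + 1) ⊎ (v + ℓP ≡ x + 1) → Short b
  two-clusters b ℓP x ℓQ j v n ℓ 3j j≥ j≤ℓP mass gap₁ gap₂ within ℓP≤ ℓQ≤ D₀ n≡ D₁ ends = step₁ (v ≤? ℓ)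
    where
    ℓ≤ : ℓ ≤ m + 1
    ℓ≤ = initial ℓ D₀
    ℓ≥ : 1 ≤ ℓ
    ℓ≥ = (lin (j ∷ ℓP ∷ ℓ ∷ []) (hyp 1 (# 8) v0 j≥ ∷ hyp 1 v0 v1 j≤ℓP ∷ hyp 1 v1 v2 ℓP≤ ∷ []) 1 (# 1) v2)
    o = proj₁ (minus ℓ {suc p} (lin (ℓ ∷ m ∷ p ∷ []) (hyp 1 v0 (v1 ⊕ # 1) ℓ≤ ∷ eqr 1 v2 (# 3 ⊕ # 4 ⊗ v1) p≡ ∷ []) 1 v0 (# 1 ⊕ v2)))
    eo : ℓ + o ≡ suc p
    eo = proj₂ (minus ℓ {suc p} (lin (ℓ ∷ m ∷ p ∷ []) (hyp 1 v0 (v1 ⊕ # 1) ℓ≤ ∷ eqr 1 v2 (# 3 ⊕ # 4 ⊗ v1) p≡ ∷ []) 1 v0 (# 1 ⊕ v2)))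
    vn≤p : v + n ≤ p
    vn≤p = bound ends
      where bound : (v + j ≡ x + 1) ⊎ (v + ℓP ≡ x + 1) → v + n ≤ p
            bound (inj₁ e) = (lin (v ∷ j ∷ x ∷ n ∷ ℓQ ∷ p ∷ []) (eql 1 (v0 ⊕ v1) (v2 ⊕ # 1) e ∷ eql 1 (v3 ⊕ # 1) (v4 ⊕ v1) n≡ ∷ hyp 1 (v2 ⊕ v4 ⊕ v1) v5 gap₂ ∷ []) 1 (v0 ⊕ v3) v5)
            bound (inj₂ e) = (lin (v ∷ ℓP ∷ x ∷ n ∷ ℓQ ∷ j ∷ p ∷ []) (eql 1 (v0 ⊕ v1) (v2 ⊕ # 1) e ∷ eql 1 (v3 ⊕ # 1) (v4 ⊕ v5) n≡ ∷ hyp 1 (v2 ⊕ v4 ⊕ v5) v6 gap₂ ∷ hyp 1 (# 8) v5 j≥ ∷ hyp 1 v5 v1 j≤ℓP ∷ []) 1 (v0 ⊕ v3) v6)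
    -- Here all of [V, p - V] belongs to D, which fixes the distance x of the clusters near p/2.
    -- Doubling brings them together; the two branches differ in the side of p on which 2x falls.
    step₃ : ∀ V → ℓ < V → V ≤ v → v + n + V ≤ suc p → (∀ t → V ≤ t → t + V ≤ p → D t ≡ true) → Short b
    step₃ V ℓ<V V≤v V≤v′ on = split (p ≤? 2 * x)
      where
      count : 2 * ℓ + p ≤ 2 * V + 2 * m + 1
      count = let (c , ec) = minus (2 * V) {suc p} (lin (V ∷ v ∷ n ∷ p ∷ []) (hyp 1 v0 v1 V≤v ∷ hyp 1 (v1 ⊕ v2 ⊕ v0) (# 1 ⊕ v3) V≤v′ ∷ []) 1 (# 2 ⊗ v0) (# 1 ⊕ v3))
                  cov = framed ℓ ℓ≥ D₀ o eo ((V , c) ∷ []) (<⇒≤ ℓ<V , (λ i hi → on (V + i) (m≤m+n V i) (lin (i ∷ c ∷ V ∷ p ∷ []) (hyp 1 (# 1 ⊕ v0) v1 hi ∷ eql 1 (# 2 ⊗ v2 ⊕ v1) (# 1 ⊕ v3) ec ∷ []) 1 (v2 ⊕ v0 ⊕ v2) v3)) ,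
                     (lin (V ∷ c ∷ p ∷ ℓ ∷ o ∷ []) (eql 1 (# 2 ⊗ v0 ⊕ v1) (# 1 ⊕ v2) ec ∷ eqr 1 (v3 ⊕ v4) (# 1 ⊕ v2) eo ∷ hyp 1 (# 1 ⊕ v3) v0 ℓ<V ∷ []) 1 (v0 ⊕ v1) v4))
              in (lin (ℓ ∷ c ∷ m ∷ p ∷ V ∷ []) (hyp 1 (# 2 ⊗ v0 ⊕ (v1 ⊕ # 0)) (# 2 ⊗ v2 ⊕ # 2) cov ∷ eqr 1 (# 2 ⊗ v4 ⊕ v1) (# 1 ⊕ v3) ec ∷ []) 1 (# 2 ⊗ v0 ⊕ v3) (# 2 ⊗ v4 ⊕ # 2 ⊗ v2 ⊕ # 1))
      lowx : m + 1 + ℓ + j ≤ x + 1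
      lowx = bound ends
        where bound : (v + j ≡ x + 1) ⊎ (v + ℓP ≡ x + 1) → m + 1 + ℓ + j ≤ x + 1
              bound (inj₁ e) = (lin (v ∷ j ∷ x ∷ ℓ ∷ p ∷ V ∷ m ∷ []) (eql 2 (v0 ⊕ v1) (v2 ⊕ # 1) e ∷ hyp 1 (# 2 ⊗ v3 ⊕ v4) (# 2 ⊗ v5 ⊕ # 2 ⊗ v6 ⊕ # 1) count ∷ hyp 2 v5 v0 V≤v ∷ eqr 1 v4 (# 3 ⊕ # 4 ⊗ v6) p≡ ∷ []) 2 (v6 ⊕ # 1 ⊕ v3 ⊕ v1) (v2 ⊕ # 1))
              bound (inj₂ e) = (lin (v ∷ ℓP ∷ x ∷ ℓ ∷ p ∷ V ∷ m ∷ j ∷ []) (eql 2 (v0 ⊕ v1) (v2 ⊕ # 1) e ∷ hyp 1 (# 2 ⊗ v3 ⊕ v4) (# 2 ⊗ v5 ⊕ # 2 ⊗ v6 ⊕ # 1) count ∷ hyp 2 v5 v0 V≤v ∷ eqr 1 v4 (# 3 ⊕ # 4 ⊗ v6) p≡ ∷ hyp 2 v7 v1 j≤ℓP ∷ []) 2 (v6 ⊕ # 1 ⊕ v3 ⊕ v7) (v2 ⊕ # 1))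
      highx : x + ℓQ + m + j ≤ p
      highx = bound ends
        where bound : (v + j ≡ x + 1) ⊎ (v + ℓP ≡ x + 1) → x + ℓQ + m + j ≤ p
              bound (inj₁ e) = (lin (x ∷ v ∷ j ∷ ℓQ ∷ n ∷ ℓ ∷ p ∷ V ∷ m ∷ ℓP ∷ []) (eqr 2 (v1 ⊕ v2) (v0 ⊕ # 1) e ∷ eqr 2 (v4 ⊕ # 1) (v3 ⊕ v2) n≡ ∷ hyp 1 (# 2 ⊗ v5 ⊕ v6) (# 2 ⊗ v7 ⊕ # 2 ⊗ v8 ⊕ # 1) count ∷ hyp 2 (v1 ⊕ v4 ⊕ v7) (# 1 ⊕ v6) V≤v′ ∷ eqr 1 v6 (# 3 ⊕ # 4 ⊗ v8) p≡ ∷ hyp 2 v2 v9 j≤ℓP ∷ hyp 2 v9 v5 ℓP≤ ∷ []) 2 (v0 ⊕ v3 ⊕ v8 ⊕ v2) v6)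
              bound (inj₂ e) = (lin (x ∷ v ∷ ℓP ∷ ℓQ ∷ j ∷ n ∷ ℓ ∷ p ∷ V ∷ m ∷ []) (eqr 2 (v1 ⊕ v2) (v0 ⊕ # 1) e ∷ eqr 2 (v5 ⊕ # 1) (v3 ⊕ v4) n≡ ∷ hyp 1 (# 2 ⊗ v6 ⊕ v7) (# 2 ⊗ v8 ⊕ # 2 ⊗ v9 ⊕ # 1) count ∷ hyp 2 (v1 ⊕ v5 ⊕ v8) (# 1 ⊕ v7) V≤v′ ∷ eqr 1 v7 (# 3 ⊕ # 4 ⊗ v9) p≡ ∷ hyp 2 v2 v6 ℓP≤ ∷ []) 2 (v0 ⊕ v3 ⊕ v9 ⊕ v4) v7)
      width : ℓQ + j + 2 * ℓ ≤ 2 * m + 3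
      width = (lin (ℓQ ∷ j ∷ n ∷ ℓ ∷ p ∷ V ∷ m ∷ v ∷ []) (eqr 1 (v2 ⊕ # 1) (v0 ⊕ v1) n≡ ∷ hyp 1 (# 2 ⊗ v3 ⊕ v4) (# 2 ⊗ v5 ⊕ # 2 ⊗ v6 ⊕ # 1) count ∷ hyp 1 v5 v7 V≤v ∷ hyp 1 (v7 ⊕ v2 ⊕ v5) (# 1 ⊕ v4) V≤v′ ∷ []) 1 (v0 ⊕ v1 ⊕ # 2 ⊗ v3) (# 2 ⊗ v6 ⊕ # 3))
      split : Dec (p ≤ 2 * x) → Short b
      split (yes h) = 2 , 0 , (s≤s z≤n , s≤s (s≤s z≤n)) , λ i i<p hi → place i (within i i<p hi)
        where
        place : ∀ i → i < ℓP ⊎ (x ≤ i × i < x + ℓQ) → ∃[ i′ ] ∃[ e ] (i′ + 3 ≤ 2 * m) × (2 * i + 0 ≡ i′ + e * p)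
        place i (inj₁ hi) = 2 * i , 0 , (lin (i ∷ ℓP ∷ ℓQ ∷ j ∷ ℓ ∷ m ∷ []) (hyp 2 (# 1 ⊕ v0) v1 hi ∷ hyp 2 (v2 ⊕ v3 ⊕ # 2 ⊗ v4) (# 2 ⊗ v5 ⊕ # 3) width ∷ hyp 2 v5 (v1 ⊕ v2) mass ∷ hyp 4 v1 v4 ℓP≤ ∷ hyp 2 (# 8) v3 j≥ ∷ []) 1 (# 2 ⊗ v0 ⊕ # 3) (# 2 ⊗ v5)) , (lin≡ (i ∷ p ∷ []) [] (# 2 ⊗ v0 ⊕ # 0) (# 2 ⊗ v0 ⊕ # 0 ⊗ v1))
        place i (inj₂ (lo , hi)) = let (o , eo) = minus p {2 * i} (lin (p ∷ x ∷ i ∷ []) (hyp 1 v0 (# 2 ⊗ v1) h ∷ hyp 2 v1 v2 lo ∷ []) 1 v0 (# 2 ⊗ v2)) in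
          o , 1 , (lin (p ∷ o ∷ i ∷ x ∷ ℓQ ∷ m ∷ j ∷ []) (eql 1 (v0 ⊕ v1) (# 2 ⊗ v2) eo ∷ hyp 2 (# 1 ⊕ v2) (v3 ⊕ v4) hi ∷ hyp 2 (v3 ⊕ v4 ⊕ v5 ⊕ v6) v0 highx ∷ eql 1 v0 (# 3 ⊕ # 4 ⊗ v5) p≡ ∷ hyp 2 (# 8) v6 j≥ ∷ []) 1 (v1 ⊕ # 3) (# 2 ⊗ v5)) , (lin≡ (i ∷ p ∷ o ∷ []) (eqn 1 (# 2 ⊗ v0) (v1 ⊕ v2) (sym eo) ∷ []) (# 2 ⊗ v0 ⊕ # 0) (v2 ⊕ # 1 ⊗ v1))
      split (no h) = let (c , ec) = minus (2 * x) (≰⇒≥ h) in 2 , c , (s≤s z≤n , s≤s (s≤s z≤n)) , λ i i<p hi → place c ec i (within i i<p hi)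
        where
        place : ∀ c → 2 * x + c ≡ p → ∀ i → i < ℓP ⊎ (x ≤ i × i < x + ℓQ) → ∃[ i′ ] ∃[ e ] (i′ + 3 ≤ 2 * m) × (2 * i + c ≡ i′ + e * p)
        place c ec i (inj₁ hi) = 2 * i + c , 0 , (lin (i ∷ ℓP ∷ x ∷ c ∷ p ∷ m ∷ ℓ ∷ j ∷ []) (hyp 2 (# 1 ⊕ v0) v1 hi ∷ eql 1 (# 2 ⊗ v2 ⊕ v3) v4 ec ∷ hyp 2 (v5 ⊕ # 1 ⊕ v6 ⊕ v7) (v2 ⊕ # 1) lowx ∷ hyp 2 v1 v6 ℓP≤ ∷ hyp 2 (# 8) v7 j≥ ∷ eql 1 v4 (# 3 ⊕ # 4 ⊗ v5) p≡ ∷ []) 1 (# 2 ⊗ v0 ⊕ v3 ⊕ # 3) (# 2 ⊗ v5)) , (lin≡ (i ∷ c ∷ p ∷ []) [] (# 2 ⊗ v0 ⊕ v1) (# 2 ⊗ v0 ⊕ v1 ⊕ # 0 ⊗ v2))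
        place c ec i (inj₂ (lo , hi)) = let (o , eo) = minus x lo in
          2 * o , 1 , (lin (x ∷ o ∷ i ∷ ℓQ ∷ j ∷ ℓ ∷ m ∷ []) (eql 6 (v0 ⊕ v1) v2 eo ∷ hyp 6 (# 1 ⊕ v2) (v0 ⊕ v3) hi ∷ hyp 2 (v3 ⊕ v4 ⊕ # 2 ⊗ v5) (# 2 ⊗ v6 ⊕ # 3) width ∷ hyp 4 v3 v5 ℓQ≤ ∷ hyp 2 (# 8) v4 j≥ ∷ hyp 2 (# 23) v6 m≥ ∷ []) 3 (# 2 ⊗ v1 ⊕ # 3) (# 2 ⊗ v6)) ,
          (lin≡ (i ∷ x ∷ o ∷ c ∷ p ∷ []) (eqn 2 v0 (v1 ⊕ v2) (sym eo) ∷ eqn 1 (# 2 ⊗ v1 ⊕ v3) v4 ec ∷ []) (# 2 ⊗ v0 ⊕ v3) (# 2 ⊗ v2 ⊕ # 1 ⊗ v4))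
    -- The interval of differences lies strictly between the two initial parts. If it were disjoint
    -- from its mirror image, D would have 2(ℓ + n) - 1 elements, too many; so the two overlap
    -- around p/2.
    step₂ : ℓ < v → v + n + ℓ ≤ p → Short b
    step₂ ℓ<v apart = split (2 * (v + n) ≤? suc p) (suc p ≤? 2 * v)
      where
      v₂ = proj₁ (minus (v + n) {suc p} (m≤n⇒m≤1+n vn≤p))
      e₂ : v + n + v₂ ≡ suc p
      e₂ = proj₂ (minus (v + n) {suc p} (m≤n⇒m≤1+n vn≤p))
      D₂ : ∀ i → i < n → D (v₂ + i) ≡ true
      D₂ = mirror v n vn≤p D₁ v₂ e₂
      too-many : 2 * ℓ + (n + (n + 0)) ≤ 2 * m + 2 → ⊥
      too-many h = (refute (ℓ ∷ n ∷ m ∷ ℓQ ∷ j ∷ ℓP ∷ []) (hyp 1 (# 2 ⊗ v0 ⊕ (v1 ⊕ (v1 ⊕ # 0))) (# 2 ⊗ v2 ⊕ # 2) h ∷ eqr 2 (v1 ⊕ # 1) (v3 ⊕ v4) n≡ ∷ hyp 2 v2 (v5 ⊕ v3) mass ∷ hyp 2 v5 v0 ℓP≤ ∷ hyp 2 (# 8) v4 j≥ ∷ []))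
      split : Dec (2 * (v + n) ≤ suc p) → Dec (suc p ≤ 2 * v) → Short b
      split (yes h) _ = ⊥-elim (too-many (framed ℓ ℓ≥ D₀ o eo ((v , n) ∷ (v₂ , n) ∷ [])
        (<⇒≤ ℓ<v , D₁ , (lin (v ∷ n ∷ p ∷ v₂ ∷ []) (hyp 1 (# 2 ⊗ (v0 ⊕ v1)) (# 1 ⊕ v2) h ∷ eqr 1 (v0 ⊕ v1 ⊕ v3) (# 1 ⊕ v2) e₂ ∷ []) 1 (v0 ⊕ v1) v3) , D₂ , (lin (v ∷ n ∷ v₂ ∷ p ∷ ℓ ∷ o ∷ []) (eql 1 (v0 ⊕ v1 ⊕ v2) (# 1 ⊕ v3) e₂ ∷ eqr 1 (v4 ⊕ v5) (# 1 ⊕ v3) eo ∷ hyp 1 (# 1 ⊕ v4) v0 ℓ<v ∷ []) 1 (v2 ⊕ v1) v5))))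
      split (no _) (yes h) = ⊥-elim (too-many (framed ℓ ℓ≥ D₀ o eo ((v₂ , n) ∷ (v , n) ∷ [])
        ((lin (p ∷ v ∷ n ∷ v₂ ∷ ℓ ∷ []) (eqr 1 (v1 ⊕ v2 ⊕ v3) (# 1 ⊕ v0) e₂ ∷ hyp 1 (v1 ⊕ v2 ⊕ v4) v0 apart ∷ []) 1 v4 v3) , D₂ , (lin (p ∷ v ∷ n ∷ v₂ ∷ []) (hyp 1 (# 1 ⊕ v0) (# 2 ⊗ v1) h ∷ eql 1 (v1 ⊕ v2 ⊕ v3) (# 1 ⊕ v0) e₂ ∷ []) 1 (v3 ⊕ v2) v1) , D₁ ,
         (lin (v ∷ n ∷ ℓ ∷ p ∷ o ∷ []) (hyp 1 (v0 ⊕ v1 ⊕ v2) v3 apart ∷ eqr 1 (v2 ⊕ v4) (# 1 ⊕ v3) eo ∷ []) 1 (v0 ⊕ v1) v4))))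
      split (no h) (no h′) = least (v ≤? v₂)
        where
        reflect : ∀ t t′ → t + t′ ≡ p → v ≤ t′ → t′ < v + n → D t ≡ true
        reflect t t′ e lo hi = D-sym t′ t (trans (+-comm t′ t) e) (offset v lo hi D₁)
        least : Dec (v ≤ v₂) → Short b
        least (yes le) = step₃ v ℓ<v ≤-refl (lin (v ∷ v₂ ∷ n ∷ p ∷ []) (hyp 1 v0 v1 le ∷ eql 1 (v0 ⊕ v2 ⊕ v1) (# 1 ⊕ v3) e₂ ∷ []) 1 (v0 ⊕ v2 ⊕ v0) (# 1 ⊕ v3)) on
          where
          on : ∀ t → v ≤ t → t + v ≤ p → D t ≡ true
          on t lo hi = on-dec (t <? v + n)
            where
            on-dec : Dec (t < v + n) → D t ≡ true
            on-dec (yes t<) = offset v lo t< D₁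
            on-dec (no t≮) = let (t′ , e) = minus t {p} (lin (t ∷ v ∷ p ∷ []) (hyp 1 (v0 ⊕ v1) v2 hi ∷ []) 1 v0 v2) in
              reflect t t′ e (lin (p ∷ t ∷ t′ ∷ v ∷ []) (eqr 1 (v1 ⊕ v2) v0 e ∷ hyp 1 (v1 ⊕ v3) v0 hi ∷ []) 1 v3 v2) (lin (t ∷ t′ ∷ p ∷ v ∷ n ∷ []) (eql 1 (v0 ⊕ v1) v2 e ∷ hyp 1 (v3 ⊕ v4) v0 (≮⇒≥ t≮) ∷ hyp 1 (# 1 ⊕ (# 1 ⊕ v2)) (# 2 ⊗ (v3 ⊕ v4)) (≰⇒> h) ∷ []) 1 (# 1 ⊕ v1) (v3 ⊕ v4))
        least (no gt) = step₃ v₂ (lin (p ∷ v ∷ n ∷ v₂ ∷ ℓ ∷ []) (eqr 1 (v1 ⊕ v2 ⊕ v3) (# 1 ⊕ v0) e₂ ∷ hyp 1 (v1 ⊕ v2 ⊕ v4) v0 apart ∷ []) 1 (# 1 ⊕ v4) v3) (≰⇒≥ gt) (≤-reflexive e₂) on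
          where
          on : ∀ t → v₂ ≤ t → t + v₂ ≤ p → D t ≡ true
          on t lo hi = on-dec (v ≤? t)
            where
            on-dec : Dec (v ≤ t) → D t ≡ true
            on-dec (yes ≤t) = offset v ≤t (lin (t ∷ v₂ ∷ p ∷ v ∷ n ∷ []) (hyp 1 (v0 ⊕ v1) v2 hi ∷ eqr 1 (v3 ⊕ v4 ⊕ v1) (# 1 ⊕ v2) e₂ ∷ []) 1 (# 1 ⊕ v0) (v3 ⊕ v4)) D₁
            on-dec (no ≰t) = let (t′ , e) = minus t {p} (lin (t ∷ v₂ ∷ p ∷ []) (hyp 1 (v0 ⊕ v1) v2 hi ∷ []) 1 v0 v2) in
              reflect t t′ e (lin (p ∷ t ∷ t′ ∷ v ∷ []) (eqr 1 (v1 ⊕ v2) v0 e ∷ hyp 1 (# 1 ⊕ v1) v3 (≰⇒> ≰t) ∷ hyp 1 (# 1 ⊕ # 2 ⊗ v3) (# 1 ⊕ v0) (≰⇒> h′) ∷ []) 1 v3 v2) (lin (t ∷ t′ ∷ p ∷ v₂ ∷ v ∷ n ∷ []) (eql 1 (v0 ⊕ v1) v2 e ∷ hyp 1 v3 v0 lo ∷ eqr 1 (v4 ⊕ v5 ⊕ v3) (# 1 ⊕ v2) e₂ ∷ []) 1 (# 1 ⊕ v1) (v4 ⊕ v5))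
    -- If the interval touches the initial one, or at the other end the mirror image of the initial
    -- one, D has a long initial interval, and `initial` bounds the whole extent of the two
    -- clusters.
    step₁ : Dec (v ≤ ℓ) → Short b
    step₁ (yes v≤ℓ) = hull b (x + ℓQ) (bound ends) (λ i i<p hi → inside (within i i<p hi))
      where
      far : v + n ≤ m + 1
      far = initial (v + n) (λ t ht → on t ht (t <? ℓ))
        where on : ∀ t → t < v + n → Dec (t < ℓ) → D t ≡ true
              on t ht (yes h) = D₀ t h
              on t ht (no h)  = offset v (≤-trans v≤ℓ (≮⇒≥ h)) ht D₁
      bound : (v + j ≡ x + 1) ⊎ (v + ℓP ≡ x + 1) → x + ℓQ + 2 ≤ 2 * m
      bound (inj₁ e) = (lin (x ∷ v ∷ j ∷ ℓQ ∷ n ∷ m ∷ []) (eqr 1 (v1 ⊕ v2) (v0 ⊕ # 1) e ∷ eqr 1 (v4 ⊕ # 1) (v3 ⊕ v2) n≡ ∷ hyp 1 (v1 ⊕ v4) (v5 ⊕ # 1) far ∷ hyp 1 (# 23) v5 m≥ ∷ []) 1 (v0 ⊕ v3 ⊕ # 2) (# 2 ⊗ v5))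
      bound (inj₂ e) = (lin (x ∷ v ∷ ℓP ∷ ℓQ ∷ j ∷ n ∷ m ∷ ℓ ∷ []) (eqr 1 (v1 ⊕ v2) (v0 ⊕ # 1) e ∷ eqr 1 (v5 ⊕ # 1) (v3 ⊕ v4) n≡ ∷ hyp 1 (v1 ⊕ v5) (v6 ⊕ # 1) far ∷ hyp 1 v2 v7 ℓP≤ ∷ hyp 1 v7 (v6 ⊕ # 1) ℓ≤ ∷ hyp 1 (# 8) v4 j≥ ∷ []) 1 (v0 ⊕ v3 ⊕ # 2) (# 2 ⊗ v6))
      inside : ∀ {i} → i < ℓP ⊎ (x ≤ i × i < x + ℓQ) → i < x + ℓQ
      inside {i} (inj₁ h) = (lin (i ∷ ℓP ∷ j ∷ x ∷ ℓQ ∷ []) (hyp 1 (# 1 ⊕ v0) v1 h ∷ hyp 1 (v1 ⊕ v2) v3 gap₁ ∷ []) 1 (# 1 ⊕ v0) (v3 ⊕ v4))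
      inside (inj₂ h) = proj₂ h
    step₁ (no v≰ℓ) = right (v + n + ℓ ≤? p)
      where
      right : Dec (v + n + ℓ ≤ p) → Short b
      right (yes h) = step₂ (≰⇒> v≰ℓ) h
      right (no h) = let (c , ec) = minus v {p} (lin (v ∷ n ∷ p ∷ []) (hyp 1 (v0 ⊕ v1) v2 vn≤p ∷ []) 1 v0 v2)
                         (cx , ecx) = minus x {p} (lin (x ∷ ℓQ ∷ j ∷ p ∷ []) (hyp 1 (v0 ⊕ v1 ⊕ v2) v3 gap₂ ∷ []) 1 v0 v3)
                         near = initial (suc c) (λ { zero _ → D₀ 0 ℓ≥ ; (suc t) ht → on c ec (suc t) (≤-pred ht) (s≤s z≤n) })
                     in wrapped-hull b ℓP x cx ecx (bound c ec near cx ecx ends) (λ i i<p hi → side (within i i<p hi))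
        where
        on : ∀ c → v + c ≡ p → ∀ t → t ≤ c → 1 ≤ t → D t ≡ true
        on c ec t ht t≥1 = let (t′ , e) = minus t {p} (lin (t ∷ c ∷ v ∷ p ∷ []) (hyp 1 v0 v1 ht ∷ eql 1 (v2 ⊕ v1) v3 ec ∷ []) 1 v0 v3) in on-dec t′ e (t′ <? v + n)
          where
          on-dec : ∀ t′ → t + t′ ≡ p → Dec (t′ < v + n) → D t ≡ true
          on-dec t′ e (yes lt) = D-sym t′ t (trans (+-comm t′ t) e) (offset v (lin (p ∷ t ∷ t′ ∷ c ∷ v ∷ []) (eqr 1 (v1 ⊕ v2) v0 e ∷ hyp 1 v1 v3 ht ∷ eql 1 (v4 ⊕ v3) v0 ec ∷ []) 1 v4 v2) lt D₁)
          on-dec t′ e (no ge) = D₀ t (lin (t ∷ t′ ∷ p ∷ v ∷ n ∷ ℓ ∷ []) (eql 1 (v0 ⊕ v1) v2 e ∷ hyp 1 (v3 ⊕ v4) v1 (≮⇒≥ ge) ∷ hyp 1 (# 1 ⊕ v2) (v3 ⊕ v4 ⊕ v5) (≰⇒> h) ∷ []) 1 (# 1 ⊕ v0) v5)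
        bound : ∀ c → v + c ≡ p → suc c ≤ m + 1 → ∀ cx → x + cx ≡ p → (v + j ≡ x + 1) ⊎ (v + ℓP ≡ x + 1) → ℓP + cx + 2 ≤ 2 * m
        bound c ec near cx ecx (inj₁ e) = (lin (v ∷ j ∷ x ∷ p ∷ c ∷ m ∷ cx ∷ ℓP ∷ ℓ ∷ []) (eql 1 (v0 ⊕ v1) (v2 ⊕ # 1) e ∷ eqr 1 (v0 ⊕ v4) v3 ec ∷ hyp 1 (# 1 ⊕ v4) (v5 ⊕ # 1) near ∷ eql 1 (v2 ⊕ v6) v3 ecx ∷ hyp 1 v7 v8 ℓP≤ ∷ hyp 1 v8 (v5 ⊕ # 1) ℓ≤ ∷ hyp 1 (# 8) v1 j≥ ∷ []) 1 (v7 ⊕ v6 ⊕ # 2) (# 2 ⊗ v5))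
        bound c ec near cx ecx (inj₂ e) = (lin (v ∷ ℓP ∷ x ∷ p ∷ c ∷ m ∷ cx ∷ []) (eql 1 (v0 ⊕ v1) (v2 ⊕ # 1) e ∷ eqr 1 (v0 ⊕ v4) v3 ec ∷ hyp 1 (# 1 ⊕ v4) (v5 ⊕ # 1) near ∷ eql 1 (v2 ⊕ v6) v3 ecx ∷ hyp 1 (# 23) v5 m≥ ∷ []) 1 (v1 ⊕ v6 ⊕ # 2) (# 2 ⊗ v5))
        side : ∀ {i} → i < ℓP ⊎ (x ≤ i × i < x + ℓQ) → i < ℓP ⊎ x ≤ i
        side (inj₁ h) = inj₁ h
        side (inj₂ h) = inj₂ (proj₁ h)

  min₃ : ∀ a b c → ∃[ V ] V ≤ a × V ≤ b × V ≤ c × (∀ t → V ≤ t → a ≤ t ⊎ b ≤ t ⊎ c ≤ t)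
  min₃ a b c with ≤-total a b
  ... | inj₁ ab with ≤-total a c
  ...   | inj₁ ac = a , ≤-refl , ab , ac , λ t h → inj₁ h
  ...   | inj₂ ca = c , ca , ≤-trans ca ab , ≤-refl , λ t h → inj₂ (inj₂ h)
  min₃ a b c | inj₂ ba with ≤-total b c
  ...   | inj₁ bc = b , ba , ≤-refl , bc , λ t h → inj₂ (inj₁ h)
  ...   | inj₂ cb = c , ≤-trans cb ba , cb , ≤-refl , λ t h → inj₂ (inj₂ h)

  max₃ : ∀ a b c → ∃[ W ] a ≤ W × b ≤ W × c ≤ W × (∀ t → t < W → t < a ⊎ t < b ⊎ t < c)
  max₃ a b c with ≤-total a b
  ... | inj₁ ab with ≤-total b c
  ...   | inj₁ bc = c , ≤-trans ab bc , bc , ≤-refl , λ t h → inj₂ (inj₂ h)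
  ...   | inj₂ cb = b , ab , ≤-refl , cb , λ t h → inj₂ (inj₁ h)
  max₃ a b c | inj₂ ba with ≤-total a c
  ...   | inj₁ ac = c , ac , ≤-trans ba ac , ≤-refl , λ t h → inj₂ (inj₂ h)
  ...   | inj₂ ca = a , ≤-refl , ba , ca , λ t h → inj₁ h

  -- Three runs of lengths jᵢ, whose starting points are yᵢ apart; all gaps have length at least j.
  three-clusters : ∀ b j j₁ j₂ j₃ y₁ y₂ y₃ v₁ n₁ v₂ n₂ v₃ n₃ → m ≤ 3 * j → 3 * j ≤ m + 4 → j₁ ≤ j → j₂ ≤ j → j₃ ≤ j → j₁ + j₂ + j₃ ≡ m →
    j₁ + j ≤ y₁ → j₂ + j ≤ y₂ → j₃ + j ≤ y₃ → y₁ + y₂ + y₃ ≡ p → y₁ ≤ y₂ → y₁ ≤ y₃ →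
    (∀ t → t < j → D t ≡ true) →
    v₁ + j₁ ≡ y₁ + 1 → n₁ + 1 ≡ j₁ + j₂ → (∀ i → i < n₁ → D (v₁ + i) ≡ true) →
    v₂ + j₂ ≡ y₂ + 1 → n₂ + 1 ≡ j₂ + j₃ → (∀ i → i < n₂ → D (v₂ + i) ≡ true) →
    v₃ + j₃ ≡ y₃ + 1 → n₃ + 1 ≡ j₃ + j₁ → (∀ i → i < n₃ → D (v₃ + i) ≡ true) →
    (∀ i → i < p → b i ≡ true → i < j₁ ⊎ (y₁ ≤ i × i < y₁ + j₂) ⊎ (y₁ + y₂ ≤ i × i < y₁ + y₂ + j₃)) → Short b
  three-clusters b j j₁ j₂ j₃ y₁ y₂ y₃ v₁ n₁ v₂ n₂ v₃ n₃ 3j j3 j₁≤ j₂≤ j₃≤ mass gap₁ gap₂ gap₃ circle y₁₂ y₁₃ D₀ ev₁ en₁ D₁ ev₂ en₂ D₂ ev₃ en₃ D₃ within =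
    finish (min₃ v₁ v₂ v₃) (max₃ (v₁ + n₁) (v₂ + n₂) (v₃ + n₃))
    where
    j≥ : 7 ≤ j
    j≥ = ≮⇒≥ λ lt → (refute (j ∷ m ∷ []) (hyp 3 (# 1 ⊕ v0) (# 7) lt ∷ hyp 1 v1 (# 3 ⊗ v0) 3j ∷ hyp 1 (# 23) v1 m≥ ∷ []))
    ℓo = minus j {suc p} (lin (j ∷ m ∷ p ∷ []) (hyp 1 (# 3 ⊗ v0) (v1 ⊕ # 4) j3 ∷ eqr 3 v2 (# 3 ⊕ # 4 ⊗ v1) p≡ ∷ []) 3 v0 (# 1 ⊕ v2))
    o = proj₁ ℓo
    eo : j + o ≡ suc p
    eo = proj₂ ℓo
    frame = framed j (lin (j ∷ []) (hyp 1 (# 7) v0 j≥ ∷ []) 1 (# 1) v0) D₀ o eo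
    -- The smallest distance y₁ is at most p/3, so its interval of differences lies in the lower
    -- half.
    low : 2 * (v₁ + n₁) ≤ suc p
    low = *-cancelˡ-≤ 3 (lin (v₁ ∷ j₁ ∷ y₁ ∷ n₁ ∷ j₂ ∷ y₂ ∷ y₃ ∷ p ∷ j ∷ m ∷ []) (eql 6 (v0 ⊕ v1) (v2 ⊕ # 1) ev₁ ∷ eql 6 (v3 ⊕ # 1) (v1 ⊕ v4) en₁ ∷ eql 2 (v2 ⊕ v5 ⊕ v6) v7 circle ∷ hyp 2 v2 v5 y₁₂ ∷ hyp 2 v2 v6 y₁₃ ∷ hyp 6 v4 v8 j₂≤ ∷ hyp 2 (# 3 ⊗ v8) (v9 ⊕ # 4) j3 ∷ eqr 1 v7 (# 3 ⊕ # 4 ⊗ v9) p≡ ∷ hyp 2 (# 23) v9 m≥ ∷ []) 1 (# 3 ⊗ (# 2 ⊗ (v0 ⊕ v3))) (# 3 ⊗ (# 1 ⊕ v7)))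
    m₁ = minus (v₁ + n₁) {suc p} (lin (v₁ ∷ n₁ ∷ p ∷ []) (hyp 1 (# 2 ⊗ (v0 ⊕ v1)) (# 1 ⊕ v2) low ∷ []) 2 (v0 ⊕ v1) (# 1 ⊕ v2))
    v₁′ = proj₁ m₁
    e₁′ : v₁ + n₁ + v₁′ ≡ suc p
    e₁′ = proj₂ m₁
    D₁′ = mirror v₁ n₁ (lin (v₁ ∷ n₁ ∷ p ∷ y₁ ∷ j₁ ∷ j ∷ []) (hyp 1 (# 2 ⊗ (v0 ⊕ v1)) (# 1 ⊕ v2) low ∷ eqr 1 (v0 ⊕ v4) (v3 ⊕ # 1) ev₁ ∷ hyp 1 (v4 ⊕ v5) v3 gap₁ ∷ hyp 1 (# 7) v5 j≥ ∷ []) 1 (v0 ⊕ v1) v2) D₁ v₁′ e₁′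
    v₁≥ : j ≤ v₁
    v₁≥ = (lin (y₁ ∷ v₁ ∷ j₁ ∷ j ∷ []) (eqr 1 (v1 ⊕ v2) (v0 ⊕ # 1) ev₁ ∷ hyp 1 (v2 ⊕ v3) v0 gap₁ ∷ []) 1 v3 v1)
    -- An interval beyond the first one would, together with the mirror image of the first, exceed
    -- the budget of `framed`. So the three intervals of differences merge into a single one, [V,
    -- W).
    meets : ∀ v n → (∀ i → i < n → D (v + i) ≡ true) → v + n ≤ o → v₁ + n₁ + (v + n) ≤ suc p → m ≤ n + j + 1 → v ≤ v₁ + n₁
    meets v n on v≤o apart long = ≮⇒≥ λ gt → (refute (j ∷ n₁ ∷ n ∷ m ∷ j₁ ∷ j₂ ∷ j₃ ∷ []) (hyp 3 (# 2 ⊗ v0 ⊕ (v1 ⊕ (v2 ⊕ (v1 ⊕ # 0)))) (# 2 ⊗ v3 ⊕ # 2) (frame ((v₁ , n₁) ∷ (v , n) ∷ (v₁′ , n₁) ∷ []) (v₁≥ , D₁ , <⇒≤ gt , on , (lin (v₁ ∷ n₁ ∷ v ∷ n ∷ p ∷ v₁′ ∷ []) (hyp 1 (v0 ⊕ v1 ⊕ (v2 ⊕ v3)) (# 1 ⊕ v4) apart ∷ eqr 1 (v0 ⊕ v1 ⊕ v5) (# 1 ⊕ v4) e₁′ ∷ []) 1 (v2 ⊕ v3) v5) , D₁′ , (lin (v₁ ∷ n₁ ∷ v₁′ ∷ p ∷ j ∷ o ∷ []) (eql 1 (v0 ⊕ v1 ⊕ v2) (# 1 ⊕ v3) e₁′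 ∷ eqr 1 (v4 ⊕ v5) (# 1 ⊕ v3) eo ∷ hyp 1 v4 v0 v₁≥ ∷ []) 1 (v2 ⊕ v1) v5))) ∷ hyp 3 v3 (v2 ⊕ v0 ⊕ # 1) long ∷ eqr 6 (v1 ⊕ # 1) (v4 ⊕ v5) en₁ ∷ eqr 6 (v4 ⊕ v5 ⊕ v6) v3 mass ∷ hyp 6 v6 v0 j₃≤ ∷ hyp 1 (# 3 ⊗ v0) (v3 ⊕ # 4) j3 ∷ hyp 2 (# 23) v3 m≥ ∷ []))
    meet₂ : v₂ ≤ v₁ + n₁
    meet₂ = meets v₂ n₂ D₂ (lin (v₂ ∷ j₂ ∷ y₂ ∷ n₂ ∷ j₃ ∷ p ∷ j ∷ o ∷ y₁ ∷ y₃ ∷ []) (eql 1 (v0 ⊕ v1) (v2 ⊕ # 1) ev₂ ∷ eql 1 (v3 ⊕ # 1) (v1 ⊕ v4) en₂ ∷ eqr 1 (v6 ⊕ v7) (# 1 ⊕ v5) eo ∷ eql 1 (v8 ⊕ v2 ⊕ v9) v5 circle ∷ hyp 1 (v4 ⊕ v6) v9 gap₃ ∷ []) 1 (v0 ⊕ v3) v7)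
      (lin (v₁ ∷ j₁ ∷ y₁ ∷ n₁ ∷ j₂ ∷ v₂ ∷ y₂ ∷ n₂ ∷ j₃ ∷ y₃ ∷ p ∷ j ∷ []) (eql 1 (v0 ⊕ v1) (v2 ⊕ # 1) ev₁ ∷ eql 1 (v3 ⊕ # 1) (v1 ⊕ v4) en₁ ∷ eql 1 (v5 ⊕ v4) (v6 ⊕ # 1) ev₂ ∷ eql 1 (v7 ⊕ # 1) (v4 ⊕ v8) en₂ ∷ eql 1 (v2 ⊕ v6 ⊕ v9) v10 circle ∷ hyp 1 (v8 ⊕ v11) v9 gap₃ ∷ hyp 1 v4 v11 j₂≤ ∷ []) 1 (v0 ⊕ v3 ⊕ (v5 ⊕ v7)) (# 1 ⊕ v10))
      (lin (j₂ ∷ j₃ ∷ n₂ ∷ m ∷ j₁ ∷ j ∷ []) (eqr 1 (v2 ⊕ # 1) (v0 ⊕ v1) en₂ ∷ eqr 1 (v4 ⊕ v0 ⊕ v1) v3 mass ∷ hyp 1 v4 v5 j₁≤ ∷ []) 1 v3 (v2 ⊕ v5 ⊕ # 1))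
    meet₃ : v₃ ≤ v₁ + n₁
    meet₃ = meets v₃ n₃ D₃ (lin (v₃ ∷ j₃ ∷ y₃ ∷ n₃ ∷ j₁ ∷ p ∷ j ∷ o ∷ y₁ ∷ y₂ ∷ []) (eql 1 (v0 ⊕ v1) (v2 ⊕ # 1) ev₃ ∷ eql 1 (v3 ⊕ # 1) (v1 ⊕ v4) en₃ ∷ eqr 1 (v6 ⊕ v7) (# 1 ⊕ v5) eo ∷ eql 1 (v8 ⊕ v9 ⊕ v2) v5 circle ∷ hyp 1 (v4 ⊕ v6) v8 gap₁ ∷ []) 1 (v0 ⊕ v3) v7)
      (lin (v₁ ∷ j₁ ∷ y₁ ∷ n₁ ∷ j₂ ∷ v₃ ∷ j₃ ∷ y₃ ∷ n₃ ∷ y₂ ∷ p ∷ j ∷ []) (eql 1 (v0 ⊕ v1) (v2 ⊕ # 1) ev₁ ∷ eql 1 (v3 ⊕ # 1) (v1 ⊕ v4) en₁ ∷ eql 1 (v5 ⊕ v6) (v7 ⊕ # 1) ev₃ ∷ eql 1 (v8 ⊕ # 1) (v6 ⊕ v1) en₃ ∷ eql 1 (v2 ⊕ v9 ⊕ v7) v10 circle ∷ hyp 1 (v4 ⊕ v11) v9 gap₂ ∷ hyp 1 v1 v11 j₁≤ ∷ []) 1 (v0 ⊕ v3 ⊕ (v5 ⊕ v8)) (# 1 ⊕ v10))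
      (lin (j₃ ∷ j₁ ∷ n₃ ∷ m ∷ j₂ ∷ j ∷ []) (eqr 1 (v2 ⊕ # 1) (v0 ⊕ v1) en₃ ∷ eqr 1 (v1 ⊕ v4 ⊕ v0) v3 mass ∷ hyp 1 v4 v5 j₂≤ ∷ []) 1 v3 (v2 ⊕ v5 ⊕ # 1))
    v₁≤₂ : v₁ ≤ v₂ + n₂
    v₁≤₂ = (lin (v₁ ∷ j₁ ∷ y₁ ∷ j₂ ∷ j₃ ∷ n₂ ∷ y₂ ∷ v₂ ∷ m ∷ j ∷ []) (eql 3 (v0 ⊕ v1) (v2 ⊕ # 1) ev₁ ∷ eqr 3 (v5 ⊕ # 1) (v3 ⊕ v4) en₂ ∷ eqr 3 (v7 ⊕ v3) (v6 ⊕ # 1) ev₂ ∷ hyp 3 v2 v6 y₁₂ ∷ eqr 3 (v1 ⊕ v3 ⊕ v4) v8 mass ∷ hyp 3 v3 v9 j₂≤ ∷ hyp 1 (# 3 ⊗ v9) (v8 ⊕ # 4) j3 ∷ hyp 2 (# 23) v8 m≥ ∷ []) 3 v0 (v7 ⊕ v5))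
    v₁≤₃ : v₁ ≤ v₃ + n₃
    v₁≤₃ = (lin (v₁ ∷ j₁ ∷ y₁ ∷ j₃ ∷ n₃ ∷ y₃ ∷ v₃ ∷ m ∷ j₂ ∷ j ∷ []) (eql 3 (v0 ⊕ v1) (v2 ⊕ # 1) ev₁ ∷ eqr 3 (v4 ⊕ # 1) (v3 ⊕ v1) en₃ ∷ eqr 3 (v6 ⊕ v3) (v5 ⊕ # 1) ev₃ ∷ hyp 3 v2 v5 y₁₃ ∷ eqr 6 (v1 ⊕ v8 ⊕ v3) v7 mass ∷ hyp 6 v8 v9 j₂≤ ∷ hyp 6 v3 v9 j₃≤ ∷ hyp 4 (# 3 ⊗ v9) (v7 ⊕ # 4) j3 ∷ hyp 2 (# 23) v7 m≥ ∷ []) 3 v0 (v6 ⊕ v4))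
    onC : ∀ t → v₁ ≤ t ⊎ v₂ ≤ t ⊎ v₃ ≤ t → t < v₁ + n₁ ⊎ t < v₂ + n₂ ⊎ t < v₃ + n₃ → D t ≡ true
    onC t lo hi = pick (t <? v₁) (t <? v₁ + n₁) lo hi
      where
      pick : Dec (t < v₁) → Dec (t < v₁ + n₁) → v₁ ≤ t ⊎ v₂ ≤ t ⊎ v₃ ≤ t → t < v₁ + n₁ ⊎ t < v₂ + n₂ ⊎ t < v₃ + n₃ → D t ≡ true
      pick (yes l) _ (inj₁ h) _ = ⊥-elim (<⇒≱ l h)
      pick (yes l) _ (inj₂ (inj₁ h)) _ = offset v₂ h (<-≤-trans l v₁≤₂) D₂
      pick (yes l) _ (inj₂ (inj₂ h)) _ = offset v₃ h (<-≤-trans l v₁≤₃) D₃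
      pick (no l) (yes u) _ _ = offset v₁ (≮⇒≥ l) u D₁
      pick (no l) (no u) _ (inj₁ h) = ⊥-elim (u h)
      pick (no l) (no u) _ (inj₂ (inj₁ h)) = offset v₂ (≤-trans meet₂ (≮⇒≥ u)) h D₂
      pick (no l) (no u) _ (inj₂ (inj₂ h)) = offset v₃ (≤-trans meet₃ (≮⇒≥ u)) h D₃
    finish : (∃[ V ] V ≤ v₁ × V ≤ v₂ × V ≤ v₃ × (∀ t → V ≤ t → v₁ ≤ t ⊎ v₂ ≤ t ⊎ v₃ ≤ t)) →
             (∃[ W ] v₁ + n₁ ≤ W × v₂ + n₂ ≤ W × v₃ + n₃ ≤ W × (∀ t → t < W → t < v₁ + n₁ ⊎ t < v₂ + n₂ ⊎ t < v₃ + n₃)) → Short b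
    -- Since [V, W) has length at most m + 1 - j, the distances are all near p/3 and tripling
    -- collapses the clusters. The shift 14 is the deficit in 3y₁ ≥ p - 14: 6 from the ends of the
    -- intervals and 8 from `j₁≥`.
    finish (V , V≤₁ , V≤₂ , V≤₃ , Vlo) (W , W≥₁ , W≥₂ , W≥₃ , Whi) = 3 , 14 , (s≤s z≤n , ≤-refl) , λ i i<p hi → place i (within i i<p hi)
      where
      3V : 3 * V + m ≤ p + 3
      3V = (lin (V ∷ v₁ ∷ v₂ ∷ v₃ ∷ j₁ ∷ y₁ ∷ j₂ ∷ y₂ ∷ j₃ ∷ y₃ ∷ p ∷ m ∷ []) (hyp 1 v0 v1 V≤₁ ∷ hyp 1 v0 v2 V≤₂ ∷ hyp 1 v0 v3 V≤₃ ∷ eql 1 (v1 ⊕ v4) (v5 ⊕ # 1) ev₁ ∷ eql 1 (v2 ⊕ v6) (v7 ⊕ # 1) ev₂ ∷ eql 1 (v3 ⊕ v8) (v9 ⊕ # 1) ev₃ ∷ eql 1 (v5 ⊕ v7 ⊕ v9) v10 circle ∷ eqr 1 (v4 ⊕ v6 ⊕ v8) v11 mass ∷ []) 1 (# 3 ⊗ v0 ⊕ v11) (v10 ⊕ # 3))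
      3W : p + m ≤ 3 * W
      3W = (lin (v₁ ∷ n₁ ∷ W ∷ v₂ ∷ n₂ ∷ v₃ ∷ n₃ ∷ y₁ ∷ j₁ ∷ y₂ ∷ j₂ ∷ y₃ ∷ j₃ ∷ p ∷ m ∷ []) (hyp 1 (v0 ⊕ v1) v2 W≥₁ ∷ hyp 1 (v3 ⊕ v4) v2 W≥₂ ∷ hyp 1 (v5 ⊕ v6) v2 W≥₃ ∷ eqr 1 (v0 ⊕ v8) (v7 ⊕ # 1) ev₁ ∷ eqr 1 (v3 ⊕ v10) (v9 ⊕ # 1) ev₂ ∷ eqr 1 (v5 ⊕ v12) (v11 ⊕ # 1) ev₃ ∷ eqr 1 (v1 ⊕ # 1) (v8 ⊕ v10) en₁ ∷ eqr 1 (v4 ⊕ # 1) (v10 ⊕ v12) en₂ ∷ eqr 1 (v6 ⊕ # 1) (v12 ⊕ v8) en₃ ∷ eqr 1 (v7 ⊕ v9 ⊕ v11) v13 circle ∷ eqr 1 (v8 ⊕ v10 ⊕ v12) v14 mass ∷ []) 1 (v13 ⊕ v14) (# 3 ⊗ v2))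
      V≥ : j ≤ V
      V≥ = up (Vlo V ≤-refl)
        where up : v₁ ≤ V ⊎ v₂ ≤ V ⊎ v₃ ≤ V → j ≤ V
              up (inj₁ h) = ≤-trans v₁≥ h
              up (inj₂ (inj₁ h)) = (lin (v₂ ∷ V ∷ y₂ ∷ j₂ ∷ j ∷ []) (hyp 1 v0 v1 h ∷ eqr 1 (v0 ⊕ v3) (v2 ⊕ # 1) ev₂ ∷ hyp 1 (v3 ⊕ v4) v2 gap₂ ∷ []) 1 v4 v1)
              up (inj₂ (inj₂ h)) = (lin (v₃ ∷ V ∷ y₃ ∷ j₃ ∷ j ∷ []) (hyp 1 v0 v1 h ∷ eqr 1 (v0 ⊕ v3) (v2 ⊕ # 1) ev₃ ∷ hyp 1 (v3 ⊕ v4) v2 gap₃ ∷ []) 1 v4 v1)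
      -- Otherwise [V, W) and its mirror image would cover [V, p - V], which is too much by
      -- `framed`.
      2W : 2 * W ≤ suc p
      2W = ≮⇒≥ λ big → let (c , ec) = minus (2 * V) {suc p} (lin (V ∷ m ∷ p ∷ []) (hyp 2 (# 3 ⊗ v0 ⊕ v1) (v2 ⊕ # 3) 3V ∷ eqr 1 v2 (# 3 ⊕ # 4 ⊗ v1) p≡ ∷ []) 3 (# 2 ⊗ v0) (# 1 ⊕ v2)) in
        (refute (j ∷ c ∷ m ∷ p ∷ V ∷ []) (hyp 3 (# 2 ⊗ v0 ⊕ (v1 ⊕ # 0)) (# 2 ⊗ v2 ⊕ # 2) (frame ((V , c) ∷ []) (V≥ , (λ i hi → wide big (V + i) (m≤m+n V i) (lin (i ∷ c ∷ V ∷ p ∷ []) (hyp 1 (# 1 ⊕ v0) v1 hi ∷ eql 1 (# 2 ⊗ v2 ⊕ v1) (# 1 ⊕ v3) ec ∷ []) 1 (v2 ⊕ v0 ⊕ v2) v3)) , (lin (V ∷ c ∷ p ∷ j ∷ o ∷ []) (eql 1 (# 2 ⊗ v0 ⊕ v1) (# 1 ⊕ v2) ec ∷ eqr 1 (v3 ⊕ v4) (# 1 ⊕ v2) eo ∷ hyp 1 v3 v0 V≥ ∷ []) 1 (v0 ⊕ v1) v4))) ∷ eqr 3 (# 2 ⊗ v4 ⊕ v1) (# 1 ⊕ v3) ec ∷ hyp 2 (# 3 ⊗ v4 ⊕ v2) (v3 ⊕ # 3) 3V ∷ eqr 1 v3 (# 3 ⊕ # 4 ⊗ v2) p≡ ∷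 hyp 6 (# 7) v0 j≥ ∷ []))
        where
        wide : suc p < 2 * W → ∀ t → V ≤ t → t + V ≤ p → D t ≡ true
        wide big t lo hi = go (t <? W)
          where
          go : Dec (t < W) → D t ≡ true
          go (yes h) = onC t (Vlo t lo) (Whi t h)
          go (no h) = let (t′ , e) = minus t {p} (lin (t ∷ V ∷ p ∷ []) (hyp 1 (v0 ⊕ v1) v2 hi ∷ []) 1 v0 v2) in D-sym t′ t (trans (+-comm t′ t) e)
            (onC t′ (Vlo t′ (lin (p ∷ t ∷ t′ ∷ V ∷ []) (eqr 1 (v1 ⊕ v2) v0 e ∷ hyp 1 (v1 ⊕ v3) v0 hi ∷ []) 1 v3 v2)) (Whi t′ (lin (t ∷ t′ ∷ p ∷ W ∷ []) (eql 1 (v0 ⊕ v1) v2 e ∷ hyp 1 v3 v0 (≮⇒≥ h) ∷ hyp 1 (# 1 ⊕ (# 1 ⊕ v2)) (# 2 ⊗ v3) big ∷ []) 1 (# 1 ⊕ v1) v3)))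
      width : W + j ≤ V + m + 1
      width = let (N , eN) = minus V {W} (≤-trans V≤₁ (≤-trans (m≤m+n v₁ n₁) W≥₁)) ; (V′ , eV′) = minus W {suc p} (lin (W ∷ p ∷ []) (hyp 1 (# 2 ⊗ v0) (# 1 ⊕ v1) 2W ∷ []) 2 v0 (# 1 ⊕ v1))
                  on = λ i (hi : i < N) → onC (V + i) (Vlo (V + i) (m≤m+n V i)) (Whi (V + i) (lin (i ∷ N ∷ V ∷ W ∷ []) (hyp 1 (# 1 ⊕ v0) v1 hi ∷ eql 1 (v2 ⊕ v1) v3 eN ∷ []) 1 (# 1 ⊕ (v2 ⊕ v0)) v3))
              in (lin (j ∷ N ∷ m ∷ W ∷ V ∷ []) (hyp 1 (# 2 ⊗ v0 ⊕ (v1 ⊕ (v1 ⊕ # 0))) (# 2 ⊗ v2 ⊕ # 2) (frame ((V , N) ∷ (V′ , N) ∷ []) (V≥ , on , (lin (V ∷ N ∷ W ∷ p ∷ V′ ∷ []) (eql 1 (v0 ⊕ v1) v2 eN ∷ eqr 1 (v2 ⊕ v4) (# 1 ⊕ v3) eV′ ∷ hyp 1 (# 2 ⊗ v2) (# 1 ⊕ v3) 2W ∷ []) 1 (v0 ⊕ v1) v4) , mirror V N (lin (V ∷ N ∷ W ∷ p ∷ j ∷ []) (eql 2 (v0 ⊕ v1) v2 eN ∷ hyp 1 (# 2 ⊗ v2) (# 1 ⊕ v3) 2W ∷ hyp 1 v4 v0 V≥ ∷ hyp 1 (# 7) v4 j≥ ∷ []) 1 (v0 ⊕ v1) v3) on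 V′ (lin≡ (V ∷ N ∷ W ∷ V′ ∷ p ∷ []) (eqn 1 (v0 ⊕ v1) v2 eN ∷ eqn 1 (v2 ⊕ v3) (# 1 ⊕ v4) eV′ ∷ []) (v0 ⊕ v1 ⊕ v3) (# 1 ⊕ v4)) , (lin (V ∷ N ∷ W ∷ V′ ∷ p ∷ j ∷ o ∷ []) (eql 1 (v0 ⊕ v1) v2 eN ∷ eql 1 (v2 ⊕ v3) (# 1 ⊕ v4) eV′ ∷ eqr 1 (v5 ⊕ v6) (# 1 ⊕ v4) eo ∷ hyp 1 v5 v0 V≥ ∷ []) 1 (v3 ⊕ v1) v6))) ∷ eqr 2 (v4 ⊕ v1) v3 eN ∷ []) 2 (v3 ⊕ v0) (v4 ⊕ v2 ⊕ # 1))
      j₁≥ : m ≤ 3 * j₁ + 8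
      j₁≥ = (lin (m ∷ j₁ ∷ j₂ ∷ j₃ ∷ j ∷ []) (eqr 3 (v1 ⊕ v2 ⊕ v3) v0 mass ∷ hyp 3 v2 v4 j₂≤ ∷ hyp 3 v3 v4 j₃≤ ∷ hyp 2 (# 3 ⊗ v4) (v0 ⊕ # 4) j3 ∷ []) 1 v0 (# 3 ⊗ v1 ⊕ # 8))
      place : ∀ i → i < j₁ ⊎ (y₁ ≤ i × i < y₁ + j₂) ⊎ (y₁ + y₂ ≤ i × i < y₁ + y₂ + j₃) → ∃[ i′ ] ∃[ e ] (i′ + 3 ≤ 2 * m) × (3 * i + 14 ≡ i′ + e * p)
      place i (inj₁ h) = 3 * i + 14 , 0 , (lin (i ∷ j₁ ∷ j ∷ m ∷ []) (hyp 3 (# 1 ⊕ v0) v1 h ∷ hyp 3 v1 v2 j₁≤ ∷ hyp 1 (# 3 ⊗ v2) (v3 ⊕ # 4) j3 ∷ hyp 1 (# 23) v3 m≥ ∷ []) 1 (# 3 ⊗ v0 ⊕ # 14 ⊕ # 3) (# 2 ⊗ v3)) , (lin≡ (i ∷ p ∷ []) [] (# 3 ⊗ v0 ⊕ # 14) (# 3 ⊗ v0 ⊕ # 14 ⊕ # 0 ⊗ v1))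
      place i (inj₂ (inj₁ (lo , hi))) = let (i′ , e) = minus p {3 * i + 14} (lin (y₁ ∷ i ∷ v₁ ∷ j₁ ∷ V ∷ W ∷ j ∷ m ∷ p ∷ []) (hyp 3 v0 v1 lo ∷ eql 3 (v2 ⊕ v3) (v0 ⊕ # 1) ev₁ ∷ hyp 3 v4 v2 V≤₁ ∷ hyp 3 (v5 ⊕ v6) (v4 ⊕ v7 ⊕ # 1) width ∷ hyp 1 (v8 ⊕ v7) (# 3 ⊗ v5) 3W ∷ hyp 1 v7 (# 3 ⊗ v6) 3j ∷ hyp 1 v7 (# 3 ⊗ v3 ⊕ # 8) j₁≥ ∷ []) 1 v8 (# 3 ⊗ v1 ⊕ # 14)) in
        i′ , 1 , (lin (p ∷ i′ ∷ i ∷ y₁ ∷ j₂ ∷ v₁ ∷ n₁ ∷ W ∷ j₁ ∷ j ∷ V ∷ m ∷ []) (eql 1 (v0 ⊕ v1) (# 3 ⊗ v2 ⊕ # 14) e ∷ hyp 3 (# 1 ⊕ v2) (v3 ⊕ v4) hi ∷ hyp 3 (v5 ⊕ v6) v7 W≥₁ ∷ eqr 3 (v5 ⊕ v8) (v3 ⊕ # 1) ev₁ ∷ eqr 3 (v6 ⊕ # 1) (v8 ⊕ v4) en₁ ∷ hyp 3 (v7 ⊕ v9) (v10 ⊕ v11 ⊕ # 1) width ∷ hyp 1 (# 3 ⊗ v10 ⊕ v11) (v0 ⊕ # 3) 3V ∷ hyp 1 v11 (# 3 ⊗ v9) 3j ∷ hyp 1 (# 23) v11 m≥ ∷ []) 1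 (v1 ⊕ # 3) (# 2 ⊗ v11)) ,
        (lin≡ (i ∷ p ∷ i′ ∷ []) (eqn 1 (# 3 ⊗ v0 ⊕ # 14) (v1 ⊕ v2) (sym e) ∷ []) (# 3 ⊗ v0 ⊕ # 14) (v2 ⊕ # 1 ⊗ v1))
      place i (inj₂ (inj₂ (lo , hi))) = let (i′ , e) = minus (2 * p) {3 * i + 14} (lin (y₁ ∷ y₂ ∷ i ∷ p ∷ y₃ ∷ v₃ ∷ j₃ ∷ j₁ ∷ n₃ ∷ W ∷ j ∷ V ∷ m ∷ []) (hyp 3 (v0 ⊕ v1) v2 lo ∷ eqr 3 (v0 ⊕ v1 ⊕ v4) v3 circle ∷ eqr 3 (v5 ⊕ v6) (v4 ⊕ # 1) ev₃ ∷ eqr 3 (v8 ⊕ # 1) (v6 ⊕ v7) en₃ ∷ hyp 3 (v5 ⊕ v8) v9 W≥₃ ∷ hyp 3 (v9 ⊕ v10) (v11 ⊕ v12 ⊕ # 1) width ∷ hyp 1 (# 3 ⊗ v11 ⊕ v12) (v3 ⊕ # 3) 3V ∷ hyp 1 v12 (# 3 ⊗ v10) 3j ∷ hyp 1 v12 (# 3 ⊗ v7 ⊕ # 8) j₁≥ ∷ []) 1 (# 2 ⊗ v3) (# 3 ⊗ v2 ⊕ # 14)) in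
        i′ , 2 , (lin (p ∷ i′ ∷ i ∷ y₁ ∷ y₂ ∷ j₃ ∷ y₃ ∷ v₃ ∷ V ∷ W ∷ j ∷ m ∷ []) (eql 1 (# 2 ⊗ v0 ⊕ v1) (# 3 ⊗ v2 ⊕ # 14) e ∷ hyp 3 (# 1 ⊕ v2) (v3 ⊕ v4 ⊕ v5) hi ∷ eql 3 (v3 ⊕ v4 ⊕ v6) v0 circle ∷ eql 3 (v7 ⊕ v5) (v6 ⊕ # 1) ev₃ ∷ hyp 3 v8 v7 V≤₃ ∷ hyp 3 (v9 ⊕ v10) (v8 ⊕ v11 ⊕ # 1) width ∷ hyp 1 (v0 ⊕ v11) (# 3 ⊗ v9) 3W ∷ hyp 1 v11 (# 3 ⊗ v10) 3j ∷ hyp 1 (# 23) v11 m≥ ∷ []) 1 (v1 ⊕ # 3) (# 2 ⊗ v11)) ,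
        (lin≡ (i ∷ p ∷ i′ ∷ []) (eqn 1 (# 3 ⊗ v0 ⊕ # 14) (# 2 ⊗ v1 ⊕ v2) (sym e) ∷ []) (# 3 ⊗ v0 ⊕ # 14) (v2 ⊕ # 2 ⊗ v1))

  record Runs (b : ℕ → Bool) : Set where
    field
      j₁ g₁ j₂ g₂ j₃ g₃ : ℕ
      total : j₁ + g₁ + j₂ + g₂ + j₃ + g₃ ≡ p
      on₁   : ∀ i → i < j₁ → b i ≡ true
      on₂   : ∀ i → i < j₂ → b (j₁ + g₁ + i) ≡ true
      on₃   : ∀ i → i < j₃ → b (j₁ + g₁ + j₂ + g₂ + i) ≡ true
      only  : ∀ i → i < p → b i ≡ true → i < j₁ ⊎ (∃[ o ] o < j₂ × i ≡ j₁ + g₁ + o) ⊎ (∃[ o ] o < j₃ × i ≡ j₁ + g₁ + j₂ + g₂ + o)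
      -- absent runs are followed by empty gaps
      void₁ : j₁ ≡ 0 → g₁ ≡ 0
      void₂ : j₂ ≡ 0 → g₂ ≡ 0
      void₃ : j₃ ≡ 0 → g₃ ≡ 0

  Periodic : (ℕ → Bool) → Set
  Periodic b = ∀ i → b (i + p) ≡ b i

  rotate : ∀ {b} → Periodic b → (R : Runs b) → Runs (λ i → b (i + (Runs.j₁ R + Runs.g₁ R)))
  rotate {b} per R = record
    { j₁ = j₂ ; g₁ = g₂ ; j₂ = j₃ ; g₂ = g₃ ; j₃ = j₁ ; g₃ = g₁
    ; total = (lin≡ (j₁ ∷ g₁ ∷ j₂ ∷ g₂ ∷ j₃ ∷ g₃ ∷ p ∷ []) (eqn 1 (v0 ⊕ v1 ⊕ v2 ⊕ v3 ⊕ v4 ⊕ v5) v6 total ∷ []) (v2 ⊕ v3 ⊕ v4 ⊕ v5 ⊕ v0 ⊕ v1) v6)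
    ; on₁ = λ i h → subst (λ t → b t ≡ true) (lin≡ (j₁ ∷ g₁ ∷ i ∷ []) [] (v0 ⊕ v1 ⊕ v2) (v2 ⊕ (v0 ⊕ v1))) (on₂ i h)
    ; on₂ = λ i h → subst (λ t → b t ≡ true) (lin≡ (j₁ ∷ g₁ ∷ j₂ ∷ g₂ ∷ i ∷ []) [] (v0 ⊕ v1 ⊕ v2 ⊕ v3 ⊕ v4) (v2 ⊕ v3 ⊕ v4 ⊕ (v0 ⊕ v1))) (on₃ i h)
    ; on₃ = λ i h → subst (λ t → b t ≡ true) (lin≡ (p ∷ j₁ ∷ g₁ ∷ j₂ ∷ g₂ ∷ j₃ ∷ g₃ ∷ i ∷ []) (eqn 1 v0 (v1 ⊕ v2 ⊕ v3 ⊕ v4 ⊕ v5 ⊕ v6) (sym total) ∷ []) (v7 ⊕ v0) (v3 ⊕ v4 ⊕ v5 ⊕ v6 ⊕ v7 ⊕ (v1 ⊕ v2))) (trans (per i) (on₁ i h))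
    ; only = λ i i<p hi → place i i<p hi (i + (j₁ + g₁) <? p)
    ; void₁ = void₂ ; void₂ = void₃ ; void₃ = void₁ }
    where
    open Runs R
    place : ∀ i → i < p → b (i + (j₁ + g₁)) ≡ true → Dec (i + (j₁ + g₁) < p) →
            i < j₂ ⊎ (∃[ o ] o < j₃ × i ≡ j₂ + g₂ + o) ⊎ (∃[ o ] o < j₁ × i ≡ j₂ + g₂ + j₃ + g₃ + o)
    place i i<p hi (yes lt) = conv (only _ lt hi)
      where
      conv : i + (j₁ + g₁) < j₁ ⊎ (∃[ o ] o < j₂ × i + (j₁ + g₁) ≡ j₁ + g₁ + o) ⊎ (∃[ o ] o < j₃ × i + (j₁ + g₁) ≡ j₁ + g₁ + j₂ + g₂ + o) →
             i < j₂ ⊎ (∃[ o ] o < j₃ × i ≡ j₂ + g₂ + o) ⊎ (∃[ o ] o < j₁ × i ≡ j₂ + g₂ + j₃ + g₃ + o)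
      conv (inj₁ h) = ⊥-elim (refute (i ∷ j₁ ∷ g₁ ∷ []) (hyp 1 (# 1 ⊕ (v0 ⊕ (v1 ⊕ v2))) v1 h ∷ []))
      conv (inj₂ (inj₁ (o , ho , e))) = inj₁ (lin (o ∷ j₂ ∷ i ∷ j₁ ∷ g₁ ∷ []) (hyp 1 (# 1 ⊕ v0) v1 ho ∷ eql 1 (v2 ⊕ (v3 ⊕ v4)) (v3 ⊕ v4 ⊕ v0) e ∷ []) 1 (# 1 ⊕ v2) v1)
      conv (inj₂ (inj₂ (o , ho , e))) = inj₂ (inj₁ (o , ho , (lin≡ (i ∷ j₁ ∷ g₁ ∷ j₂ ∷ g₂ ∷ o ∷ []) (eqn 1 (v0 ⊕ (v1 ⊕ v2)) (v1 ⊕ v2 ⊕ v3 ⊕ v4 ⊕ v5) e ∷ []) v0 (v3 ⊕ v4 ⊕ v5))))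
    place i i<p hi (no ge) = let (o , eo) = minus p (≮⇒≥ ge) in conv o eo (only o (lin (p ∷ o ∷ i ∷ j₁ ∷ g₁ ∷ j₂ ∷ g₂ ∷ j₃ ∷ g₃ ∷ []) (eql 1 (v0 ⊕ v1) (v2 ⊕ (v3 ⊕ v4)) eo ∷ hyp 1 (# 1 ⊕ v2) v0 i<p ∷ eql 1 (v3 ⊕ v4 ⊕ v5 ⊕ v6 ⊕ v7 ⊕ v8) v0 total ∷ []) 1 (# 1 ⊕ v1) v0)
         (trans (sym (per o)) (subst (λ t → b t ≡ true) (trans (sym eo) (+-comm p o)) hi)))
      where
      conv : ∀ o → p + o ≡ i + (j₁ + g₁) → o < j₁ ⊎ (∃[ r ] r < j₂ × o ≡ j₁ + g₁ + r) ⊎ (∃[ r ] r < j₃ × o ≡ j₁ + g₁ + j₂ + g₂ + r) →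
             i < j₂ ⊎ (∃[ o ] o < j₃ × i ≡ j₂ + g₂ + o) ⊎ (∃[ o ] o < j₁ × i ≡ j₂ + g₂ + j₃ + g₃ + o)
      conv o eo (inj₁ h) = inj₂ (inj₂ (o , h , (lin≡ (i ∷ j₁ ∷ g₁ ∷ p ∷ o ∷ j₂ ∷ g₂ ∷ j₃ ∷ g₃ ∷ []) (eqn 1 (v0 ⊕ (v1 ⊕ v2)) (v3 ⊕ v4) (sym eo) ∷ eqn 1 v3 (v1 ⊕ v2 ⊕ v5 ⊕ v6 ⊕ v7 ⊕ v8) (sym total) ∷ []) v0 (v5 ⊕ v6 ⊕ v7 ⊕ v8 ⊕ v4))))
      conv o eo (inj₂ (inj₁ (r , _ , e))) = ⊥-elim (refute (j₁ ∷ g₁ ∷ r ∷ o ∷ p ∷ i ∷ []) (eqr 1 v3 (v0 ⊕ v1 ⊕ v2) e ∷ eql 1 (v4 ⊕ v3) (v5 ⊕ (v0 ⊕ v1)) eo ∷ hyp 1 (# 1 ⊕ v5) v4 i<p ∷ []))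
      conv o eo (inj₂ (inj₂ (r , _ , e))) = ⊥-elim (refute (j₁ ∷ g₁ ∷ j₂ ∷ g₂ ∷ r ∷ o ∷ p ∷ i ∷ []) (eqr 1 v5 (v0 ⊕ v1 ⊕ v2 ⊕ v3 ⊕ v4) e ∷ eql 1 (v6 ⊕ v5) (v7 ⊕ (v0 ⊕ v1)) eo ∷ hyp 1 (# 1 ⊕ v7) v6 i<p ∷ []))

  Differences : (ℕ → Bool) → Set
  Differences b = ∀ i t → b i ≡ true → b (i + t) ≡ true → D t ≡ true

  Longest : ∀ {b} → Runs b → Set
  Longest R = Runs.j₂ R ≤ Runs.j₁ R × Runs.j₃ R ≤ Runs.j₁ R

  ShortUpTo : (ℕ → Bool) → Set
  ShortUpTo b = ∃[ r ] Short (λ i → b (i + r))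

  module _ {b : ℕ → Bool} (per : Periodic b) (diff : Differences b) where

    run-right : ∀ s j → (∀ i → i < j → b (s + i) ≡ true) → ∀ a t → b a ≡ true → s + t ≤ a → a < s + t + j → D t ≡ true
    run-right s j on a t ha lo hi = let (i , e) = minus (s + t) lo in
      diff (s + i) t (on i (lin (s ∷ t ∷ i ∷ a ∷ j ∷ []) (eql 1 (v0 ⊕ v1 ⊕ v2) v3 e ∷ hyp 1 (# 1 ⊕ v3) (v0 ⊕ v1 ⊕ v4) hi ∷ []) 1 (# 1 ⊕ v2) v4)) (subst (λ x → b x ≡ true) (lin≡ (a ∷ s ∷ t ∷ i ∷ []) (eqn 1 v0 (v1 ⊕ v2 ⊕ v3) (sym e) ∷ []) v0 (v1 ⊕ v3 ⊕ v2)) ha)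

    run-left : ∀ s j → (∀ i → i < j → b (s + i) ≡ true) → ∀ a t → b a ≡ true → s ≤ a + t → a + t < s + j → D t ≡ true
    run-left s j on a t ha lo hi = let (i , e) = minus s lo in
      diff a t ha (subst (λ x → b x ≡ true) e (on i (lin (s ∷ i ∷ a ∷ t ∷ j ∷ []) (eql 1 (v0 ⊕ v1) (v2 ⊕ v3) e ∷ hyp 1 (# 1 ⊕ (v2 ⊕ v3)) (v0 ⊕ v4) hi ∷ []) 1 (# 1 ⊕ v1) v4)))

    -- Two runs of lengths α and β whose starts are y apart differ by the α + β - 1 consecutive
    -- values from y - α + 1 to y + β - 1. The smaller ones are seen from the first point of the
    -- second run, the others from its later points.
    run-diff : ∀ s α β y → (∀ i → i < α → b (s + i) ≡ true) → (∀ i → i < β → b (s + y + i) ≡ true) → ∀ v n → v + α ≡ y + 1 → n + 1 ≡ α + β → 1 ≤ α → 1 ≤ β →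
               ∀ i → i < n → D (v + i) ≡ true
    run-diff s α β y onα onβ v n ev en α≥ β≥ i hi = go (i <? α)
      where
      go : Dec (i < α) → D (v + i) ≡ true
      go (yes h) = run-right s α onα (s + y + 0) (v + i) (onβ 0 β≥) (lin (v ∷ α ∷ y ∷ i ∷ s ∷ []) (eql 1 (v0 ⊕ v1) (v2 ⊕ # 1) ev ∷ hyp 1 (# 1 ⊕ v3) v1 h ∷ []) 1 (v4 ⊕ (v0 ⊕ v3)) (v4 ⊕ v2 ⊕ # 0)) (lin (y ∷ v ∷ α ∷ s ∷ i ∷ []) (eqr 1 (v1 ⊕ v2) (v0 ⊕ # 1) ev ∷ []) 1 (# 1 ⊕ (v3 ⊕ v0 ⊕ # 0)) (v3 ⊕ (v1 ⊕ v4) ⊕ v2))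
      go (no h) = let (o , e) = minus α (≮⇒≥ h) in run-right s α onα (s + y + suc o) (v + i) (onβ (suc o) (lin (α ∷ o ∷ i ∷ n ∷ β ∷ []) (eql 1 (v0 ⊕ v1) v2 e ∷ hyp 1 (# 1 ⊕ v2) v3 hi ∷ eql 1 (v3 ⊕ # 1) (v0 ⊕ v4) en ∷ []) 1 (# 1 ⊕ (# 1 ⊕ v1)) v4))
        (lin (i ∷ α ∷ o ∷ v ∷ y ∷ s ∷ []) (eqr 1 (v1 ⊕ v2) v0 e ∷ eql 1 (v3 ⊕ v1) (v4 ⊕ # 1) ev ∷ []) 1 (v5 ⊕ (v3 ⊕ v0)) (v5 ⊕ v4 ⊕ (# 1 ⊕ v2))) (lin (α ∷ o ∷ i ∷ y ∷ v ∷ s ∷ []) (eql 1 (v0 ⊕ v1) v2 e ∷ eqr 1 (v4 ⊕ v0) (v3 ⊕ # 1) ev ∷ hyp 1 (# 1) v0 α≥ ∷ []) 1 (# 1 ⊕ (v5 ⊕ v3 ⊕ (# 1 ⊕ v1))) (v5 ⊕ (v4 ⊕ v2) ⊕ v0))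

  module Classify {b : ℕ → Bool} (per : Periodic b) (diff : Differences b) (R : Runs b) (mass : Runs.j₁ R + Runs.j₂ R + Runs.j₃ R ≡ m) (longest : Longest R) where
    open Runs R
    private
      3j : m ≤ 3 * j₁
      3j = (lin (m ∷ j₁ ∷ j₂ ∷ j₃ ∷ []) (eqr 1 (v1 ⊕ v2 ⊕ v3) v0 mass ∷ hyp 1 v2 v1 (proj₁ longest) ∷ hyp 1 v3 v1 (proj₂ longest) ∷ []) 1 v0 (# 3 ⊗ v1))
      -- The longest of three runs has at least 23/3 elements.
      j≥ : 8 ≤ j₁
      j≥ = ≮⇒≥ λ lt → (refute (j₁ ∷ m ∷ []) (hyp 3 (# 1 ⊕ v0) (# 8) lt ∷ hyp 1 v1 (# 3 ⊗ v0) 3j ∷ hyp 1 (# 23) v1 m≥ ∷ []))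
      j≤m : j₁ ≤ m
      j≤m = (lin (j₁ ∷ j₂ ∷ j₃ ∷ m ∷ []) (eql 1 (v0 ⊕ v1 ⊕ v2) v3 mass ∷ []) 1 v0 v3)
      x₂ = j₁ + g₁
      x₃ = j₁ + g₁ + j₂ + g₂
      pos : ∀ {j g} → (j ≡ 0 → g ≡ 0) → j₁ ≤ g → 1 ≤ j
      pos {j} {g} void big = n≢0⇒n>0 λ e → (refute (g ∷ j₁ ∷ []) (eql 1 v0 (# 0) (void e) ∷ hyp 1 v1 v0 big ∷ hyp 1 (# 8) v1 j≥ ∷ []))
      on₁p : ∀ i → i < j₁ → b (p + i) ≡ true
      on₁p i h = subst (λ t → b t ≡ true) (+-comm i p) (trans (per i) (on₁ i h))
      D-run : ∀ t → t < j₁ → D t ≡ true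
      D-run t h = diff 0 t (on₁ 0 (lin (j₁ ∷ []) (hyp 1 (# 8) v0 j≥ ∷ []) 1 (# 1 ⊕ # 0) v0)) (on₁ t h)

      -- a small gap after the longest run is bridged by it
      D-right₂ : g₁ < j₁ → 1 ≤ j₂ → ∀ t → t < x₂ + j₂ → D t ≡ true
      D-right₂ small j₂≥ t h = go (t <? j₁) (t <? x₂)
        where
        go : Dec (t < j₁) → Dec (t < x₂) → D t ≡ true
        go (yes l) _ = D-run t l
        go (no l) (yes u) = run-right per diff 0 j₁ on₁ (x₂ + 0) t (on₂ 0 j₂≥) (lin (t ∷ j₁ ∷ g₁ ∷ []) (hyp 1 (# 1 ⊕ v0) (v1 ⊕ v2) u ∷ []) 1 (# 0 ⊕ v0) (v1 ⊕ v2 ⊕ # 0)) (lin (j₁ ∷ t ∷ g₁ ∷ []) (hyp 1 v0 v1 (≮⇒≥ l) ∷ hyp 1 (# 1 ⊕ v2) v0 small ∷ []) 1 (# 1 ⊕ (v0 ⊕ v2 ⊕ # 0)) (# 0 ⊕ v1 ⊕ v0))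
        go (no l) (no u) = let (o , e) = minus x₂ (≮⇒≥ u) in diff 0 t (on₁ 0 (lin (j₁ ∷ []) (hyp 1 (# 8) v0 j≥ ∷ []) 1 (# 1 ⊕ # 0) v0)) (subst (λ y → b y ≡ true) e (on₂ o (+-cancelˡ-< x₂ o j₂ (subst (_< x₂ + j₂) (sym e) h))))

      D-right₃ : g₁ < j₁ → g₂ < j₁ → 1 ≤ j₃ → ∀ t → t < x₃ + j₃ → D t ≡ true
      D-right₃ small₁ small₂ j₃≥ t h = go (j₂ ≟ 0) (t <? x₂ + j₂) (t <? x₃)
        where
        last : x₃ ≤ t → D t ≡ true
        last u = let (o , e) = minus x₃ u in diff 0 t (on₁ 0 (lin (j₁ ∷ []) (hyp 1 (# 8) v0 j≥ ∷ []) 1 (# 1 ⊕ # 0) v0)) (subst (λ y → b y ≡ true) e (on₃ o (+-cancelˡ-< x₃ o j₃ (subst (_< x₃ + j₃) (sym e) h))))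
        bridge : j₁ ≤ t → t < x₃ → x₃ < t + j₁ → D t ≡ true
        bridge l u w = run-right per diff 0 j₁ on₁ (x₃ + 0) t (on₃ 0 j₃≥) (lin (t ∷ x₃ ∷ []) (hyp 1 (# 1 ⊕ v0) v1 u ∷ []) 1 (# 0 ⊕ v0) (v1 ⊕ # 0)) (lin (x₃ ∷ t ∷ j₁ ∷ []) (hyp 1 (# 1 ⊕ v0) (v1 ⊕ v2) w ∷ []) 1 (# 1 ⊕ (v0 ⊕ # 0)) (# 0 ⊕ v1 ⊕ v2))
        go : Dec (j₂ ≡ 0) → Dec (t < x₂ + j₂) → Dec (t < x₃) → D t ≡ true
        go (no j₂≢0) (yes l) _ = D-right₂ small₁ (n≢0⇒n>0 j₂≢0) t l
        go (no j₂≢0) (no l) (yes u) = bridge (lin (j₁ ∷ g₁ ∷ j₂ ∷ t ∷ []) (hyp 1 (v0 ⊕ v1 ⊕ v2) v3 (≮⇒≥ l) ∷ []) 1 v0 v3) u (lin (j₁ ∷ g₁ ∷ j₂ ∷ t ∷ g₂ ∷ []) (hyp 1 (v0 ⊕ v1 ⊕ v2) v3 (≮⇒≥ l) ∷ hyp 1 (# 1 ⊕ v4) v0 small₂ ∷ []) 1 (# 1 ⊕ (v0 ⊕ v1 ⊕ v2 ⊕ v4)) (v3 ⊕ v0))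
        go (no _) _ (no u) = last (≮⇒≥ u)
        go (yes e) _ (no u) = last (≮⇒≥ u)
        go (yes e) _ (yes u) = first (t <? j₁)
          where first : Dec (t < j₁) → D t ≡ true
                first (yes l) = D-run t l
                first (no l) = bridge (≮⇒≥ l) u (lin (j₁ ∷ t ∷ g₁ ∷ j₂ ∷ g₂ ∷ []) (hyp 1 v0 v1 (≮⇒≥ l) ∷ hyp 1 (# 1 ⊕ v2) v0 small₁ ∷ eql 1 v3 (# 0) e ∷ eql 1 v4 (# 0) (void₂ e) ∷ []) 1 (# 1 ⊕ (v0 ⊕ v2 ⊕ v3 ⊕ v4)) (v1 ⊕ v0))

      -- ... and so is one before it
      D-left₃ : g₃ < j₁ → ∀ t → t < j₃ + g₃ + j₁ → D t ≡ true
      D-left₃ small t h = go (j₃ ≟ 0) (t <? j₁) (t <? j₁ + g₃)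
        where
        go : Dec (j₃ ≡ 0) → Dec (t < j₁) → Dec (t < j₁ + g₃) → D t ≡ true
        go _ (yes l) _ = D-run t l
        go (yes e) (no l) _ = ⊥-elim (l (lin (t ∷ j₃ ∷ g₃ ∷ j₁ ∷ []) (hyp 1 (# 1 ⊕ v0) (v1 ⊕ v2 ⊕ v3) h ∷ eql 1 v1 (# 0) e ∷ eql 1 v2 (# 0) (void₃ e) ∷ []) 1 (# 1 ⊕ v0) v3))
        go (no j₃≢0) (no l) (yes u) = let (o , e) = minus 1 (n≢0⇒n>0 j₃≢0) in
          run-left per diff p j₁ on₁p (x₃ + o) t (on₃ o (lin (o ∷ j₃ ∷ []) (eql 1 (# 1 ⊕ v0) v1 e ∷ []) 1 (# 1 ⊕ v0) v1))
            (lin (j₃ ∷ o ∷ p ∷ j₁ ∷ g₁ ∷ j₂ ∷ g₂ ∷ g₃ ∷ t ∷ []) (eqr 1 (# 1 ⊕ v1) v0 e ∷ eqr 1 (v3 ⊕ v4 ⊕ v5 ⊕ v6 ⊕ v0 ⊕ v7) v2 total ∷ hyp 1 v3 v8 (≮⇒≥ l) ∷ hyp 1 (# 1 ⊕ v7) v3 small ∷ []) 1 v2 (v3 ⊕ v4 ⊕ v5 ⊕ v6 ⊕ v1 ⊕ v8))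
            (lin (o ∷ j₃ ∷ j₁ ∷ g₁ ∷ j₂ ∷ g₂ ∷ g₃ ∷ p ∷ t ∷ []) (eql 1 (# 1 ⊕ v0) v1 e ∷ eql 1 (v2 ⊕ v3 ⊕ v4 ⊕ v5 ⊕ v1 ⊕ v6) v7 total ∷ hyp 1 (# 1 ⊕ v8) (v2 ⊕ v6) u ∷ []) 1 (# 1 ⊕ (v2 ⊕ v3 ⊕ v4 ⊕ v5 ⊕ v0 ⊕ v8)) (v7 ⊕ v2))
        go (no j₃≢0) (no l) (no u) = let (c , ec) = minus (suc t) h in
          run-left per diff p j₁ on₁p (x₃ + c) t (on₃ c (lin (t ∷ c ∷ j₃ ∷ g₃ ∷ j₁ ∷ []) (eql 1 (# 1 ⊕ v0 ⊕ v1) (v2 ⊕ v3 ⊕ v4) ec ∷ hyp 1 (v4 ⊕ v3) v0 (≮⇒≥ u) ∷ []) 1 (# 1 ⊕ v1) v2))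
            (lin (j₃ ∷ g₃ ∷ j₁ ∷ t ∷ c ∷ p ∷ g₁ ∷ j₂ ∷ g₂ ∷ []) (eqr 1 (# 1 ⊕ v3 ⊕ v4) (v0 ⊕ v1 ⊕ v2) ec ∷ eqr 1 (v2 ⊕ v6 ⊕ v7 ⊕ v8 ⊕ v0 ⊕ v1) v5 total ∷ hyp 1 (# 8) v2 j≥ ∷ []) 1 v5 (v2 ⊕ v6 ⊕ v7 ⊕ v8 ⊕ v4 ⊕ v3))
            (lin (t ∷ c ∷ j₃ ∷ g₃ ∷ j₁ ∷ g₁ ∷ j₂ ∷ g₂ ∷ p ∷ []) (eql 1 (# 1 ⊕ v0 ⊕ v1) (v2 ⊕ v3 ⊕ v4) ec ∷ eql 1 (v4 ⊕ v5 ⊕ v6 ⊕ v7 ⊕ v2 ⊕ v3) v8 total ∷ []) 1 (# 1 ⊕ (v4 ⊕ v5 ⊕ v6 ⊕ v7 ⊕ v1 ⊕ v0)) (v8 ⊕ v4))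

      D-left₂ : g₂ < j₁ → g₃ < j₁ → ∀ t → t < j₂ + g₂ + j₃ + g₃ + j₁ → D t ≡ true
      D-left₂ small₂ small₃ t h = go (t <? j₃ + g₃ + j₁) (j₂ ≟ 0)
        where
        go : Dec (t < j₃ + g₃ + j₁) → Dec (j₂ ≡ 0) → D t ≡ true
        go (yes l) _ = D-left₃ small₃ t l
        go (no l) (yes e) = ⊥-elim (l (lin (t ∷ j₂ ∷ g₂ ∷ j₃ ∷ g₃ ∷ j₁ ∷ []) (hyp 1 (# 1 ⊕ v0) (v1 ⊕ v2 ⊕ v3 ⊕ v4 ⊕ v5) h ∷ eql 1 v1 (# 0) e ∷ eql 1 v2 (# 0) (void₂ e) ∷ []) 1 (# 1 ⊕ v0) (v3 ⊕ v4 ⊕ v5)))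
        go (no l) (no j₂≢0) = inner (t <? j₃ + g₃ + j₁ + g₂)
          where
          inner : Dec (t < j₃ + g₃ + j₁ + g₂) → D t ≡ true
          inner (yes u) = let (o , e) = minus 1 (n≢0⇒n>0 j₂≢0) in
            run-left per diff p j₁ on₁p (x₂ + o) t (on₂ o (lin (o ∷ j₂ ∷ []) (eql 1 (# 1 ⊕ v0) v1 e ∷ []) 1 (# 1 ⊕ v0) v1))
              (lin (j₂ ∷ o ∷ p ∷ j₁ ∷ g₁ ∷ g₂ ∷ j₃ ∷ g₃ ∷ t ∷ []) (eqr 1 (# 1 ⊕ v1) v0 e ∷ eqr 1 (v3 ⊕ v4 ⊕ v0 ⊕ v5 ⊕ v6 ⊕ v7) v2 total ∷ hyp 1 (v6 ⊕ v7 ⊕ v3) v8 (≮⇒≥ l) ∷ hyp 1 (# 1 ⊕ v5) v3 small₂ ∷ []) 1 v2 (v3 ⊕ v4 ⊕ v1 ⊕ v8))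
              (lin (o ∷ j₂ ∷ j₁ ∷ g₁ ∷ g₂ ∷ j₃ ∷ g₃ ∷ p ∷ t ∷ []) (eql 1 (# 1 ⊕ v0) v1 e ∷ eql 1 (v2 ⊕ v3 ⊕ v1 ⊕ v4 ⊕ v5 ⊕ v6) v7 total ∷ hyp 1 (# 1 ⊕ v8) (v5 ⊕ v6 ⊕ v2 ⊕ v4) u ∷ []) 1 (# 1 ⊕ (v2 ⊕ v3 ⊕ v0 ⊕ v8)) (v7 ⊕ v2))
          inner (no u) = let (c , ec) = minus (suc t) h in
            run-left per diff p j₁ on₁p (x₂ + c) t (on₂ c (lin (t ∷ c ∷ j₂ ∷ g₂ ∷ j₃ ∷ g₃ ∷ j₁ ∷ []) (eql 1 (# 1 ⊕ v0 ⊕ v1) (v2 ⊕ v3 ⊕ v4 ⊕ v5 ⊕ v6) ec ∷ hyp 1 (v4 ⊕ v5 ⊕ v6 ⊕ v3) v0 (≮⇒≥ u) ∷ []) 1 (# 1 ⊕ v1) v2))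
              (lin (j₂ ∷ g₂ ∷ j₃ ∷ g₃ ∷ j₁ ∷ t ∷ c ∷ p ∷ g₁ ∷ []) (eqr 1 (# 1 ⊕ v5 ⊕ v6) (v0 ⊕ v1 ⊕ v2 ⊕ v3 ⊕ v4) ec ∷ eqr 1 (v4 ⊕ v8 ⊕ v0 ⊕ v1 ⊕ v2 ⊕ v3) v7 total ∷ hyp 1 (# 8) v4 j≥ ∷ []) 1 v7 (v4 ⊕ v8 ⊕ v6 ⊕ v5))
              (lin (t ∷ c ∷ j₂ ∷ g₂ ∷ j₃ ∷ g₃ ∷ j₁ ∷ g₁ ∷ p ∷ []) (eql 1 (# 1 ⊕ v0 ⊕ v1) (v2 ⊕ v3 ⊕ v4 ⊕ v5 ⊕ v6) ec ∷ eql 1 (v6 ⊕ v7 ⊕ v2 ⊕ v3 ⊕ v4 ⊕ v5) v8 total ∷ []) 1 (# 1 ⊕ (v6 ⊕ v7 ⊕ v1 ⊕ v0)) (v8 ⊕ v6))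

      at-0 : Short b → ShortUpTo b
      at-0 (k , c , hk , h) = 0 , k , c , hk , λ i i<p hi → h i i<p (subst (λ t → b t ≡ true) (+-identityʳ i) hi)

      R′ = rotate per R
      per′ : Periodic (λ i → b (i + (j₁ + g₁)))
      per′ i = trans (cong b (lin≡ (i ∷ p ∷ j₁ ∷ g₁ ∷ []) [] (v0 ⊕ v1 ⊕ (v2 ⊕ v3)) (v0 ⊕ (v2 ⊕ v3) ⊕ v1))) (per _)
      R″ = rotate per′ R′
      at-1 : Short (λ i → b (i + (j₁ + g₁))) → ShortUpTo b
      at-1 s = j₁ + g₁ , s
      at-2 : Short (λ i → b (i + (j₂ + g₂) + (j₁ + g₁))) → ShortUpTo b
      at-2 (k , c , hk , h) = j₂ + g₂ + (j₁ + g₁) , k , c , hk , λ i i<p hi → h i i<p (subst (λ t → b t ≡ true) (sym (+-assoc i (j₂ + g₂) (j₁ + g₁))) hi)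

    -- A gap shorter than the longest run is bridged in the difference set, so only gaps of length
    -- at least j₁ separate clusters. With at most one such gap everything lies in a short interval,
    -- with two there are two clusters, with three the runs stay apart.
    classify : ShortUpTo b
    classify = decide (g₁ <? j₁) (g₂ <? j₁) (g₃ <? j₁)
      where
      decide : Dec (g₁ < j₁) → Dec (g₂ < j₁) → Dec (g₃ < j₁) → ShortUpTo b
      decide (yes s₁) (yes s₂) _ = at-0 (hull b (x₃ + j₃) (lin (j₁ ∷ g₁ ∷ j₂ ∷ g₂ ∷ j₃ ∷ m ∷ []) (hyp 1 (v0 ⊕ v1 ⊕ v2 ⊕ v3 ⊕ v4) (v5 ⊕ # 1) (initial (x₃ + j₃) (D-right₃ s₁ s₂ j₃≥)) ∷ hyp 1 (# 23) v5 m≥ ∷ []) 1 (v0 ⊕ v1 ⊕ v2 ⊕ v3 ⊕ v4 ⊕ # 2) (# 2 ⊗ v5)) (λ i i<p hi → inside (only i i<p hi)))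
        where
        j₃≥ : 1 ≤ j₃
        j₃≥ = n≢0⇒n>0 λ e → (refute (p ∷ j₁ ∷ g₁ ∷ j₂ ∷ g₂ ∷ j₃ ∷ g₃ ∷ m ∷ []) (eqr 1 (v1 ⊕ v2 ⊕ v3 ⊕ v4 ⊕ v5 ⊕ v6) v0 total ∷ eql 1 v6 (# 0) (void₃ e) ∷ hyp 2 (# 1 ⊕ v2) v1 s₁ ∷ hyp 1 (# 1 ⊕ v4) v1 s₂ ∷ eql 4 (v1 ⊕ v3 ⊕ v5) v7 mass ∷ eqr 1 v0 (# 3 ⊕ # 4 ⊗ v7) p≡ ∷ []))
        inside : ∀ {i} → i < j₁ ⊎ (∃[ o ] o < j₂ × i ≡ j₁ + g₁ + o) ⊎ (∃[ o ] o < j₃ × i ≡ j₁ + g₁ + j₂ + g₂ + o) → i < x₃ + j₃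
        inside {i} (inj₁ h) = (lin (i ∷ j₁ ∷ g₁ ∷ j₂ ∷ g₂ ∷ j₃ ∷ []) (hyp 1 (# 1 ⊕ v0) v1 h ∷ []) 1 (# 1 ⊕ v0) (v1 ⊕ v2 ⊕ v3 ⊕ v4 ⊕ v5))
        inside {i} (inj₂ (inj₁ (o , h , e))) = (lin (o ∷ j₂ ∷ i ∷ j₁ ∷ g₁ ∷ g₂ ∷ j₃ ∷ []) (hyp 1 (# 1 ⊕ v0) v1 h ∷ eql 1 v2 (v3 ⊕ v4 ⊕ v0) e ∷ []) 1 (# 1 ⊕ v2) (v3 ⊕ v4 ⊕ v1 ⊕ v5 ⊕ v6))
        inside {i} (inj₂ (inj₂ (o , h , e))) = (lin (o ∷ j₃ ∷ i ∷ j₁ ∷ g₁ ∷ j₂ ∷ g₂ ∷ []) (hyp 1 (# 1 ⊕ v0) v1 h ∷ eql 1 v2 (v3 ⊕ v4 ⊕ v5 ⊕ v6 ⊕ v0) e ∷ []) 1 (# 1 ⊕ v2) (v3 ⊕ v4 ⊕ v5 ⊕ v6 ⊕ v1))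
      decide (no b₁) (yes s₂) (yes s₃) = at-1 (hull _ H (lin (j₂ ∷ g₂ ∷ j₃ ∷ g₃ ∷ j₁ ∷ m ∷ []) (hyp 1 (v0 ⊕ v1 ⊕ v2 ⊕ v3 ⊕ v4) (v5 ⊕ # 1) (initial H (D-left₂ s₂ s₃)) ∷ hyp 1 (# 23) v5 m≥ ∷ []) 1 (v0 ⊕ v1 ⊕ v2 ⊕ v3 ⊕ v4 ⊕ # 2) (# 2 ⊗ v5)) (λ i i<p hi → inside (Runs.only R′ i i<p hi)))
        where
        H = j₂ + g₂ + j₃ + g₃ + j₁
        inside : ∀ {i} → i < j₂ ⊎ (∃[ o ] o < j₃ × i ≡ j₂ + g₂ + o) ⊎ (∃[ o ] o < j₁ × i ≡ j₂ + g₂ + j₃ + g₃ + o) → i < H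
        inside {i} (inj₁ h) = (lin (i ∷ j₂ ∷ g₂ ∷ j₃ ∷ g₃ ∷ j₁ ∷ []) (hyp 1 (# 1 ⊕ v0) v1 h ∷ []) 1 (# 1 ⊕ v0) (v1 ⊕ v2 ⊕ v3 ⊕ v4 ⊕ v5))
        inside {i} (inj₂ (inj₁ (o , h , e))) = (lin (o ∷ j₃ ∷ i ∷ j₂ ∷ g₂ ∷ g₃ ∷ j₁ ∷ []) (hyp 1 (# 1 ⊕ v0) v1 h ∷ eql 1 v2 (v3 ⊕ v4 ⊕ v0) e ∷ []) 1 (# 1 ⊕ v2) (v3 ⊕ v4 ⊕ v1 ⊕ v5 ⊕ v6))
        inside {i} (inj₂ (inj₂ (o , h , e))) = (lin (o ∷ j₁ ∷ i ∷ j₂ ∷ g₂ ∷ j₃ ∷ g₃ ∷ []) (hyp 1 (# 1 ⊕ v0) v1 h ∷ eql 1 v2 (v3 ⊕ v4 ⊕ v5 ⊕ v6 ⊕ v0) e ∷ []) 1 (# 1 ⊕ v2) (v3 ⊕ v4 ⊕ v5 ⊕ v6 ⊕ v1))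
      -- Both sides, measured from the longest run, have length at most m + 1; they share its j₁ ≥ 8
      -- elements, hence the total is below 2m.
      decide (yes s₁) (no b₂) (yes s₃) = at-2 (hull _ H
          (lin (j₁ ∷ g₁ ∷ j₂ ∷ m ∷ j₃ ∷ g₃ ∷ []) (hyp 1 (v0 ⊕ v1 ⊕ v2) (v3 ⊕ # 1) (initial (x₂ + j₂) (D-right₂ s₁ (pos void₂ (≮⇒≥ b₂)))) ∷ hyp 1 (v4 ⊕ v5 ⊕ v0) (v3 ⊕ # 1) (initial (j₃ + g₃ + j₁) (D-left₃ s₃)) ∷ hyp 1 (# 8) v0 j≥ ∷ []) 1 (v4 ⊕ v5 ⊕ v0 ⊕ v1 ⊕ v2 ⊕ # 2) (# 2 ⊗ v3)) (λ i i<p hi → inside (Runs.only R″ i i<p hi)))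
        where
        H = j₃ + g₃ + j₁ + g₁ + j₂
        inside : ∀ {i} → i < j₃ ⊎ (∃[ o ] o < j₁ × i ≡ j₃ + g₃ + o) ⊎ (∃[ o ] o < j₂ × i ≡ j₃ + g₃ + j₁ + g₁ + o) → i < H
        inside {i} (inj₁ h) = (lin (i ∷ j₃ ∷ g₃ ∷ j₁ ∷ g₁ ∷ j₂ ∷ []) (hyp 1 (# 1 ⊕ v0) v1 h ∷ []) 1 (# 1 ⊕ v0) (v1 ⊕ v2 ⊕ v3 ⊕ v4 ⊕ v5))
        inside {i} (inj₂ (inj₁ (o , h , e))) = (lin (o ∷ j₁ ∷ i ∷ j₃ ∷ g₃ ∷ g₁ ∷ j₂ ∷ []) (hyp 1 (# 1 ⊕ v0) v1 h ∷ eql 1 v2 (v3 ⊕ v4 ⊕ v0) e ∷ []) 1 (# 1 ⊕ v2) (v3 ⊕ v4 ⊕ v1 ⊕ v5 ⊕ v6))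
        inside {i} (inj₂ (inj₂ (o , h , e))) = (lin (o ∷ j₂ ∷ i ∷ j₃ ∷ g₃ ∷ j₁ ∷ g₁ ∷ []) (hyp 1 (# 1 ⊕ v0) v1 h ∷ eql 1 v2 (v3 ⊕ v4 ⊕ v5 ⊕ v6 ⊕ v0) e ∷ []) 1 (# 1 ⊕ v2) (v3 ⊕ v4 ⊕ v5 ⊕ v6 ⊕ v1))
      decide (yes s₁) (no b₂) (no b₃) = at-0 (let (n , en) = minus 1 {j₃ + j₁} (lin (j₁ ∷ j₃ ∷ []) (hyp 1 (# 8) v0 j≥ ∷ []) 1 (# 1) (v1 ⊕ v0)) ; (v , ev) = minus j₁ {x₃ + 1} (lin (j₁ ∷ g₁ ∷ j₂ ∷ g₂ ∷ []) [] 1 v0 (v0 ⊕ v1 ⊕ v2 ⊕ v3 ⊕ # 1)) in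
          two-clusters b (x₂ + j₂) x₃ j₃ j₁ v n (x₂ + j₂) 3j j≥ (lin (j₁ ∷ g₁ ∷ j₂ ∷ []) [] 1 v0 (v0 ⊕ v1 ⊕ v2)) (lin (m ∷ j₁ ∷ j₂ ∷ j₃ ∷ g₁ ∷ []) (eqr 1 (v1 ⊕ v2 ⊕ v3) v0 mass ∷ []) 1 v0 (v1 ⊕ v4 ⊕ v2 ⊕ v3))
            (lin (j₁ ∷ g₂ ∷ g₁ ∷ j₂ ∷ []) (hyp 1 v0 v1 (≮⇒≥ b₂) ∷ []) 1 (v0 ⊕ v2 ⊕ v3 ⊕ v0) (v0 ⊕ v2 ⊕ v3 ⊕ v1)) (lin (j₁ ∷ g₃ ∷ g₁ ∷ j₂ ∷ g₂ ∷ j₃ ∷ p ∷ []) (hyp 1 v0 v1 (≮⇒≥ b₃) ∷ eql 1 (v0 ⊕ v2 ⊕ v3 ⊕ v4 ⊕ v5 ⊕ v1) v6 total ∷ []) 1 (v0 ⊕ v2 ⊕ v3 ⊕ v4 ⊕ v5 ⊕ v0) v6)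
            (λ i i<p hi → inside (only i i<p hi)) ≤-refl (lin (j₃ ∷ j₁ ∷ g₁ ∷ j₂ ∷ []) (hyp 1 v0 v1 (proj₂ longest) ∷ []) 1 v0 (v1 ⊕ v2 ⊕ v3)) (D-right₂ s₁ (pos void₂ (≮⇒≥ b₂))) (trans (+-comm n 1) en)
            (run-diff per diff 0 j₁ j₃ x₃ on₁ on₃ v n (trans (+-comm v j₁) ev) (trans (+-comm n 1) (trans en (+-comm j₃ j₁))) (lin (j₁ ∷ []) (hyp 1 (# 8) v0 j≥ ∷ []) 1 (# 1) v0) (pos void₃ (≮⇒≥ b₃)))
            (inj₁ (trans (+-comm v j₁) ev)))
        where
        inside : ∀ {i} → i < j₁ ⊎ (∃[ o ] o < j₂ × i ≡ j₁ + g₁ + o) ⊎ (∃[ o ] o < j₃ × i ≡ j₁ + g₁ + j₂ + g₂ + o) → i < x₂ + j₂ ⊎ (x₃ ≤ i × i < x₃ + j₃)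
        inside {i} (inj₁ h) = inj₁ (lin (i ∷ j₁ ∷ g₁ ∷ j₂ ∷ []) (hyp 1 (# 1 ⊕ v0) v1 h ∷ []) 1 (# 1 ⊕ v0) (v1 ⊕ v2 ⊕ v3))
        inside {i} (inj₂ (inj₁ (o , h , e))) = inj₁ (lin (o ∷ j₂ ∷ i ∷ j₁ ∷ g₁ ∷ []) (hyp 1 (# 1 ⊕ v0) v1 h ∷ eql 1 v2 (v3 ⊕ v4 ⊕ v0) e ∷ []) 1 (# 1 ⊕ v2) (v3 ⊕ v4 ⊕ v1))
        inside {i} (inj₂ (inj₂ (o , h , e))) = inj₂ ((lin (j₁ ∷ g₁ ∷ j₂ ∷ g₂ ∷ o ∷ i ∷ []) (eqr 1 v5 (v0 ⊕ v1 ⊕ v2 ⊕ v3 ⊕ v4) e ∷ []) 1 (v0 ⊕ v1 ⊕ v2 ⊕ v3) v5) , (lin (o ∷ j₃ ∷ i ∷ j₁ ∷ g₁ ∷ j₂ ∷ g₂ ∷ []) (hyp 1 (# 1 ⊕ v0) v1 h ∷ eql 1 v2 (v3 ⊕ v4 ⊕ v5 ⊕ v6 ⊕ v0) e ∷ []) 1 (# 1 ⊕ v2) (v3 ⊕ v4 ⊕ v5 ⊕ v6 ⊕ v1)))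
      decide (no b₁) (no b₂) (yes s₃) = at-2 (let (n , en) = minus 1 {j₂ + j₁} (lin (j₁ ∷ j₂ ∷ []) (hyp 1 (# 8) v0 j≥ ∷ []) 1 (# 1) (v1 ⊕ v0)) in
          two-clusters _ ℓP (ℓP + g₁) j₂ j₁ (g₁ + 1) n ℓP 3j j≥ (lin (j₁ ∷ j₃ ∷ g₃ ∷ []) [] 1 v0 (v1 ⊕ v2 ⊕ v0)) (lin (m ∷ j₁ ∷ j₂ ∷ j₃ ∷ g₃ ∷ []) (eqr 1 (v1 ⊕ v2 ⊕ v3) v0 mass ∷ []) 1 v0 (v3 ⊕ v4 ⊕ v1 ⊕ v2))
            (lin (j₁ ∷ g₁ ∷ j₃ ∷ g₃ ∷ []) (hyp 1 v0 v1 (≮⇒≥ b₁) ∷ []) 1 (v2 ⊕ v3 ⊕ v0 ⊕ v0) (v2 ⊕ v3 ⊕ v0 ⊕ v1)) (lin (j₁ ∷ g₂ ∷ g₁ ∷ j₂ ∷ j₃ ∷ g₃ ∷ p ∷ []) (hyp 1 v0 v1 (≮⇒≥ b₂) ∷ eql 1 (v0 ⊕ v2 ⊕ v3 ⊕ v1 ⊕ v4 ⊕ v5) v6 total ∷ []) 1 (v4 ⊕ v5 ⊕ v0 ⊕ v2 ⊕ v3 ⊕ v0) v6)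
            (λ i i<p hi → inside (Runs.only R″ i i<p hi)) ≤-refl (lin (j₂ ∷ j₁ ∷ j₃ ∷ g₃ ∷ []) (hyp 1 v0 v1 (proj₁ longest) ∷ []) 1 v0 (v2 ⊕ v3 ⊕ v1)) (D-left₃ s₃) (trans (+-comm n 1) en)
            (run-diff per diff 0 j₁ j₂ x₂ on₁ on₂ (g₁ + 1) n (lin≡ (g₁ ∷ j₁ ∷ []) [] (v0 ⊕ # 1 ⊕ v1) (v1 ⊕ v0 ⊕ # 1)) (trans (+-comm n 1) (trans en (+-comm j₂ j₁))) (lin (j₁ ∷ []) (hyp 1 (# 8) v0 j≥ ∷ []) 1 (# 1) v0) (pos void₂ (≮⇒≥ b₂)))
            (inj₂ (lin≡ (g₁ ∷ j₃ ∷ g₃ ∷ j₁ ∷ []) [] (v0 ⊕ # 1 ⊕ (v1 ⊕ v2 ⊕ v3)) (v1 ⊕ v2 ⊕ v3 ⊕ v0 ⊕ # 1))))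
        where
        ℓP = j₃ + g₃ + j₁
        inside : ∀ {i} → i < j₃ ⊎ (∃[ o ] o < j₁ × i ≡ j₃ + g₃ + o) ⊎ (∃[ o ] o < j₂ × i ≡ j₃ + g₃ + j₁ + g₁ + o) → i < ℓP ⊎ (ℓP + g₁ ≤ i × i < ℓP + g₁ + j₂)
        inside {i} (inj₁ h) = inj₁ (lin (i ∷ j₃ ∷ g₃ ∷ j₁ ∷ []) (hyp 1 (# 1 ⊕ v0) v1 h ∷ []) 1 (# 1 ⊕ v0) (v1 ⊕ v2 ⊕ v3))
        inside {i} (inj₂ (inj₁ (o , h , e))) = inj₁ (lin (o ∷ j₁ ∷ i ∷ j₃ ∷ g₃ ∷ []) (hyp 1 (# 1 ⊕ v0) v1 h ∷ eql 1 v2 (v3 ⊕ v4 ⊕ v0) e ∷ []) 1 (# 1 ⊕ v2) (v3 ⊕ v4 ⊕ v1))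
        inside {i} (inj₂ (inj₂ (o , h , e))) = inj₂ ((lin (j₃ ∷ g₃ ∷ j₁ ∷ g₁ ∷ o ∷ i ∷ []) (eqr 1 v5 (v0 ⊕ v1 ⊕ v2 ⊕ v3 ⊕ v4) e ∷ []) 1 (v0 ⊕ v1 ⊕ v2 ⊕ v3) v5) , (lin (o ∷ j₂ ∷ i ∷ j₃ ∷ g₃ ∷ j₁ ∷ g₁ ∷ []) (hyp 1 (# 1 ⊕ v0) v1 h ∷ eql 1 v2 (v3 ⊕ v4 ⊕ v5 ⊕ v6 ⊕ v0) e ∷ []) 1 (# 1 ⊕ v2) (v3 ⊕ v4 ⊕ v5 ⊕ v6 ⊕ v1)))
      decide (no b₁) (yes s₂) (no b₃) = at-0 (widest (ℓQ ≤? j₁))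
        where
        ℓQ = j₂ + g₂ + j₃
        j₃≥ : 1 ≤ j₃
        j₃≥ = pos void₃ (≮⇒≥ b₃)
        inside : ∀ {i} → i < j₁ ⊎ (∃[ o ] o < j₂ × i ≡ j₁ + g₁ + o) ⊎ (∃[ o ] o < j₃ × i ≡ j₁ + g₁ + j₂ + g₂ + o) → i < j₁ ⊎ (x₂ ≤ i × i < x₂ + ℓQ)
        inside {i} (inj₁ h) = inj₁ h
        inside {i} (inj₂ (inj₁ (o , h , e))) = inj₂ ((lin (j₁ ∷ g₁ ∷ o ∷ i ∷ []) (eqr 1 v3 (v0 ⊕ v1 ⊕ v2) e ∷ []) 1 (v0 ⊕ v1) v3) , (lin (o ∷ j₂ ∷ i ∷ j₁ ∷ g₁ ∷ g₂ ∷ j₃ ∷ []) (hyp 1 (# 1 ⊕ v0) v1 h ∷ eql 1 v2 (v3 ⊕ v4 ⊕ v0) e ∷ []) 1 (# 1 ⊕ v2) (v3 ⊕ v4 ⊕ (v1 ⊕ v5 ⊕ v6))))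
        inside {i} (inj₂ (inj₂ (o , h , e))) = inj₂ ((lin (j₁ ∷ g₁ ∷ j₂ ∷ g₂ ∷ o ∷ i ∷ []) (eqr 1 v5 (v0 ⊕ v1 ⊕ v2 ⊕ v3 ⊕ v4) e ∷ []) 1 (v0 ⊕ v1) v5) , (lin (o ∷ j₃ ∷ i ∷ j₁ ∷ g₁ ∷ j₂ ∷ g₂ ∷ []) (hyp 1 (# 1 ⊕ v0) v1 h ∷ eql 1 v2 (v3 ⊕ v4 ⊕ v5 ⊕ v6 ⊕ v0) e ∷ []) 1 (# 1 ⊕ v2) (v3 ⊕ v4 ⊕ (v5 ⊕ v6 ⊕ v1))))
        -- The cluster of the second and third run may have a hole, but one shorter than j₁: every
        -- position is followed within j₁ steps by a point of the cluster, so its differences with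
        -- the longest run still form an interval.
        first : ∀ o → o < ℓQ → ∃[ a ] o ≤ a × a < o + j₁ × b (x₂ + a) ≡ true
        first o h = go (o <? j₂) (o <? j₂ + g₂)
          where
          go : Dec (o < j₂) → Dec (o < j₂ + g₂) → ∃[ a ] o ≤ a × a < o + j₁ × b (x₂ + a) ≡ true
          go (yes l) _ = o , ≤-refl , (lin (j₁ ∷ o ∷ []) (hyp 1 (# 8) v0 j≥ ∷ []) 1 (# 1 ⊕ v1) (v1 ⊕ v0)) , on₂ o l
          go (no l) (yes u) = j₂ + g₂ , <⇒≤ u , (lin (j₂ ∷ o ∷ g₂ ∷ j₁ ∷ []) (hyp 1 v0 v1 (≮⇒≥ l) ∷ hyp 1 (# 1 ⊕ v2) v3 s₂ ∷ []) 1 (# 1 ⊕ (v0 ⊕ v2)) (v1 ⊕ v3)) , subst (λ t → b t ≡ true) (lin≡ (j₁ ∷ g₁ ∷ j₂ ∷ g₂ ∷ []) [] (v0 ⊕ v1 ⊕ v2 ⊕ v3 ⊕ # 0) (v0 ⊕ v1 ⊕ (v2 ⊕ v3))) (on₃ 0 j₃≥)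
          go (no l) (no u) = let (r , e) = minus (j₂ + g₂) (≮⇒≥ u) in o , ≤-refl , (lin (j₁ ∷ o ∷ []) (hyp 1 (# 8) v0 j≥ ∷ []) 1 (# 1 ⊕ v1) (v1 ⊕ v0)) ,
            subst (λ t → b t ≡ true) (lin≡ (j₂ ∷ g₂ ∷ r ∷ o ∷ j₁ ∷ g₁ ∷ []) (eqn 1 (v0 ⊕ v1 ⊕ v2) v3 e ∷ []) (v4 ⊕ v5 ⊕ v0 ⊕ v1 ⊕ v2) (v4 ⊕ v5 ⊕ v3)) (on₃ r (lin (j₂ ∷ g₂ ∷ r ∷ o ∷ j₃ ∷ []) (eql 1 (v0 ⊕ v1 ⊕ v2) v3 e ∷ hyp 1 (# 1 ⊕ v3) (v0 ⊕ v1 ⊕ v4) h ∷ []) 1 (# 1 ⊕ v2) v4))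
        D₁ : ∀ v n → v + j₁ ≡ x₂ + 1 → n + 1 ≡ ℓQ + j₁ → ∀ i → i < n → D (v + i) ≡ true
        D₁ v n ev en i hi = go (i <? j₁)
          where
          go : Dec (i < j₁) → D (v + i) ≡ true
          go (yes l) = run-right per diff 0 j₁ on₁ (x₂ + 0) (v + i) (begin-run (j₂ ≟ 0)) (lin (v ∷ j₁ ∷ g₁ ∷ i ∷ []) (eql 1 (v0 ⊕ v1) (v1 ⊕ v2 ⊕ # 1) ev ∷ hyp 1 (# 1 ⊕ v3) v1 l ∷ []) 1 (# 0 ⊕ (v0 ⊕ v3)) (v1 ⊕ v2 ⊕ # 0)) (lin (j₁ ∷ g₁ ∷ v ∷ i ∷ []) (eqr 1 (v2 ⊕ v0) (v0 ⊕ v1 ⊕ # 1) ev ∷ []) 1 (# 1 ⊕ (v0 ⊕ v1 ⊕ # 0)) (# 0 ⊕ (v2 ⊕ v3) ⊕ v0))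
            where begin-run : Dec (j₂ ≡ 0) → b (x₂ + 0) ≡ true
                  begin-run (no h) = on₂ 0 (n≢0⇒n>0 h)
                  begin-run (yes h) = subst (λ t → b t ≡ true) (lin≡ (j₂ ∷ g₂ ∷ j₁ ∷ g₁ ∷ []) (eqn 1 v0 (# 0) h ∷ eqn 1 v1 (# 0) (void₂ h) ∷ []) (v2 ⊕ v3 ⊕ v0 ⊕ v1 ⊕ # 0) (v2 ⊕ v3 ⊕ # 0)) (on₃ 0 j₃≥)
          go (no l) = let (o , e) = minus j₁ (≮⇒≥ l) ; (a , lo , lt , ha) = first (suc o) (lin (j₁ ∷ o ∷ i ∷ n ∷ j₂ ∷ g₂ ∷ j₃ ∷ []) (eql 1 (v0 ⊕ v1) v2 e ∷ hyp 1 (# 1 ⊕ v2) v3 hi ∷ eql 1 (v3 ⊕ # 1) (v4 ⊕ v5 ⊕ v6 ⊕ v0) en ∷ []) 1 (# 1 ⊕ (# 1 ⊕ v1)) (v4 ⊕ v5 ⊕ v6)) in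
            run-right per diff 0 j₁ on₁ (x₂ + a) (v + i) ha (lin (i ∷ j₁ ∷ o ∷ v ∷ g₁ ∷ a ∷ []) (eqr 1 (v1 ⊕ v2) v0 e ∷ eql 1 (v3 ⊕ v1) (v1 ⊕ v4 ⊕ # 1) ev ∷ hyp 1 (# 1 ⊕ v2) v5 lo ∷ []) 1 (# 0 ⊕ (v3 ⊕ v0)) (v1 ⊕ v4 ⊕ v5)) (lin (j₁ ∷ o ∷ i ∷ g₁ ∷ v ∷ a ∷ []) (eql 1 (v0 ⊕ v1) v2 e ∷ eqr 1 (v4 ⊕ v0) (v0 ⊕ v3 ⊕ # 1) ev ∷ hyp 1 (# 1 ⊕ v5) (# 1 ⊕ v1 ⊕ v0) lt ∷ []) 1 (# 1 ⊕ (v0 ⊕ v3 ⊕ v5)) (# 0 ⊕ (v4 ⊕ v2) ⊕ v0))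
        apply : ∀ ℓ → j₁ ≤ ℓ → ℓQ ≤ ℓ → (∀ t → t < ℓ → D t ≡ true) → Short b
        apply ℓ ℓP≤ ℓQ≤ D₀ = let (n , en) = minus 1 {ℓQ + j₁} (lin (j₁ ∷ j₂ ∷ g₂ ∷ j₃ ∷ []) (hyp 1 (# 8) v0 j≥ ∷ []) 1 (# 1) (v1 ⊕ v2 ⊕ v3 ⊕ v0)) ; (v , ev) = minus j₁ {x₂ + 1} (lin (j₁ ∷ g₁ ∷ []) [] 1 v0 (v0 ⊕ v1 ⊕ # 1)) in
          two-clusters b j₁ x₂ ℓQ j₁ v n ℓ 3j j≥ ≤-refl (lin (m ∷ j₁ ∷ j₂ ∷ j₃ ∷ g₂ ∷ []) (eqr 1 (v1 ⊕ v2 ⊕ v3) v0 mass ∷ []) 1 v0 (v1 ⊕ (v2 ⊕ v4 ⊕ v3))) (lin (j₁ ∷ g₁ ∷ []) (hyp 1 v0 v1 (≮⇒≥ b₁) ∷ []) 1 (v0 ⊕ v0) (v0 ⊕ v1))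
            (lin (j₁ ∷ g₃ ∷ g₁ ∷ j₂ ∷ g₂ ∷ j₃ ∷ p ∷ []) (hyp 1 v0 v1 (≮⇒≥ b₃) ∷ eql 1 (v0 ⊕ v2 ⊕ v3 ⊕ v4 ⊕ v5 ⊕ v1) v6 total ∷ []) 1 (v0 ⊕ v2 ⊕ (v3 ⊕ v4 ⊕ v5) ⊕ v0) v6) (λ i i<p hi → inside (only i i<p hi)) ℓP≤ ℓQ≤ D₀
            (trans (+-comm n 1) en) (D₁ v n (trans (+-comm v j₁) ev) (trans (+-comm n 1) en)) (inj₁ (trans (+-comm v j₁) ev))
        widest : Dec (ℓQ ≤ j₁) → Short b
        widest (yes le) = apply j₁ ≤-refl le D-run
        widest (no gt) = apply ℓQ (≰⇒≥ gt) ≤-refl D₀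
          where
          j₂≥ : 1 ≤ j₂
          j₂≥ = n≢0⇒n>0 λ e → gt (lin (j₂ ∷ g₂ ∷ j₃ ∷ j₁ ∷ []) (eql 1 v0 (# 0) e ∷ eql 1 v1 (# 0) (void₂ e) ∷ hyp 1 v2 v3 (proj₂ longest) ∷ []) 1 (v0 ⊕ v1 ⊕ v2) v3)
          D₀ : ∀ t → t < ℓQ → D t ≡ true
          D₀ t h = go (t <? j₁) (t <? j₂ + g₂)
            where
            go : Dec (t < j₁) → Dec (t < j₂ + g₂) → D t ≡ true
            go (yes l) _ = D-run t l
            go (no l) (yes u) = run-right per diff x₂ j₂ on₂ (x₃ + 0) t (on₃ 0 j₃≥) (lin (t ∷ j₂ ∷ g₂ ∷ j₁ ∷ g₁ ∷ []) (hyp 1 (# 1 ⊕ v0) (v1 ⊕ v2) u ∷ []) 1 (v3 ⊕ v4 ⊕ v0) (v3 ⊕ v4 ⊕ v1 ⊕ v2 ⊕ # 0)) (lin (j₁ ∷ t ∷ g₂ ∷ g₁ ∷ j₂ ∷ []) (hyp 1 v0 v1 (≮⇒≥ l) ∷ hyp 1 (# 1 ⊕ v2) v0 s₂ ∷ []) 1 (# 1 ⊕ (v0 ⊕ v3 ⊕ v4 ⊕ v2 ⊕ # 0)) (v0 ⊕ v3 ⊕ v1 ⊕ v4))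
            go (no l) (no u) = let (r , e) = minus (j₂ + g₂) (≮⇒≥ u) in run-right per diff x₂ j₂ on₂ (x₃ + r) t (on₃ r (lin (j₂ ∷ g₂ ∷ r ∷ t ∷ j₃ ∷ []) (eql 1 (v0 ⊕ v1 ⊕ v2) v3 e ∷ hyp 1 (# 1 ⊕ v3) (v0 ⊕ v1 ⊕ v4) h ∷ []) 1 (# 1 ⊕ v2) v4))
              (lin (t ∷ j₂ ∷ g₂ ∷ r ∷ j₁ ∷ g₁ ∷ []) (eqr 1 (v1 ⊕ v2 ⊕ v3) v0 e ∷ []) 1 (v4 ⊕ v5 ⊕ v0) (v4 ⊕ v5 ⊕ v1 ⊕ v2 ⊕ v3)) (lin (j₂ ∷ g₂ ∷ r ∷ t ∷ j₁ ∷ g₁ ∷ []) (eql 1 (v0 ⊕ v1 ⊕ v2) v3 e ∷ hyp 1 (# 1) v0 j₂≥ ∷ []) 1 (# 1 ⊕ (v4 ⊕ v5 ⊕ v0 ⊕ v1 ⊕ v2)) (v4 ⊕ v5 ⊕ v3 ⊕ v0))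
      decide (no b₁) (no b₂) (no b₃) = closest (min₃ (j₁ + g₁) (j₂ + g₂) (j₃ + g₃))
        where
        G₁ : j₁ ≤ g₁
        G₁ = ≮⇒≥ b₁
        G₂ : j₁ ≤ g₂
        G₂ = ≮⇒≥ b₂
        G₃ : j₁ ≤ g₃
        G₃ = ≮⇒≥ b₃
        j₂≥ : 1 ≤ j₂
        j₂≥ = pos void₂ G₂
        j₃≥ : 1 ≤ j₃
        j₃≥ = pos void₃ G₃
        j₁≥ : 1 ≤ j₁
        j₁≥ = (lin (j₁ ∷ []) (hyp 1 (# 8) v0 j≥ ∷ []) 1 (# 1) v0)
        between : ∀ α β → 1 ≤ α → ∃[ n ] n + 1 ≡ α + β
        between α β h = let (n , e) = minus 1 {α + β} (≤-trans h (m≤m+n α β)) in n , trans (+-comm n 1) e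
        n₁ = proj₁ (between j₁ j₂ j₁≥)
        n₂ = proj₁ (between j₂ j₃ j₂≥)
        n₃ = proj₁ (between j₃ j₁ j₃≥)
        en₁ : n₁ + 1 ≡ j₁ + j₂
        en₁ = proj₂ (between j₁ j₂ j₁≥)
        en₂ : n₂ + 1 ≡ j₂ + j₃
        en₂ = proj₂ (between j₂ j₃ j₂≥)
        en₃ : n₃ + 1 ≡ j₃ + j₁
        en₃ = proj₂ (between j₃ j₁ j₃≥)
        slide : ∀ j g → g + 1 + j ≡ j + g + 1
        slide j g = (lin≡ (g ∷ j ∷ []) [] (v0 ⊕ # 1 ⊕ v1) (v1 ⊕ v0 ⊕ # 1))
        E₁ = run-diff per diff 0 j₁ j₂ x₂ on₁ on₂ (g₁ + 1) n₁ (slide j₁ g₁) en₁ j₁≥ j₂≥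
        E₂ = run-diff per diff x₂ j₂ j₃ (j₂ + g₂) on₂ (λ i h → subst (λ t → b t ≡ true) (cong (_+ i) (+-assoc x₂ j₂ g₂)) (on₃ i h)) (g₂ + 1) n₂ (slide j₂ g₂) en₂ j₂≥ j₃≥
        E₃ = run-diff per diff x₃ j₃ j₁ (j₃ + g₃) on₃ (λ i h → subst (λ t → b t ≡ true) (lin≡ (p ∷ j₁ ∷ g₁ ∷ j₂ ∷ g₂ ∷ j₃ ∷ g₃ ∷ i ∷ []) (eqn 1 v0 (v1 ⊕ v2 ⊕ v3 ⊕ v4 ⊕ v5 ⊕ v6) (sym total) ∷ []) (v0 ⊕ v7) (v1 ⊕ v2 ⊕ v3 ⊕ v4 ⊕ (v5 ⊕ v6) ⊕ v7)) (on₁p i h)) (g₃ + 1) n₃ (slide j₃ g₃) en₃ j₃≥ j₁≥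
        -- The longest run differs from the two others by j₁ + j₂ - 1 and j₁ + j₃ - 1 consecutive
        -- values; with 2j₁ for the run itself, `framed` gives 3j₁ + m - 2 ≤ 2m + 2.
        j3 : 3 * j₁ ≤ m + 4
        j3 = let (o , eo) = minus j₁ {suc p} (lin (j₁ ∷ m ∷ p ∷ []) (hyp 1 v0 v1 j≤m ∷ eqr 1 v2 (# 3 ⊕ # 4 ⊗ v1) p≡ ∷ []) 1 v0 (# 1 ⊕ v2))
                 (v , ev) = minus j₁ {x₃ + 1} (lin (j₁ ∷ g₁ ∷ j₂ ∷ g₂ ∷ []) [] 1 v0 (v0 ⊕ v1 ⊕ v2 ⊕ v3 ⊕ # 1)) ; (n , en) = between j₁ j₃ j₁≥
                 cov = framed j₁ j₁≥ D-run o eo ((g₁ + 1 , n₁) ∷ (v , n) ∷ [])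
                   ((lin (j₁ ∷ g₁ ∷ []) (hyp 1 v0 v1 G₁ ∷ []) 1 v0 (v1 ⊕ # 1)) , E₁ , (lin (n₁ ∷ j₁ ∷ j₂ ∷ g₁ ∷ g₂ ∷ v ∷ []) (eql 1 (v0 ⊕ # 1) (v1 ⊕ v2) en₁ ∷ eqr 1 (v1 ⊕ v5) (v1 ⊕ v3 ⊕ v2 ⊕ v4 ⊕ # 1) ev ∷ hyp 1 v1 v4 G₂ ∷ []) 1 (v3 ⊕ # 1 ⊕ v0) v5) ,
                    run-diff per diff 0 j₁ j₃ x₃ on₁ on₃ v n (trans (+-comm v j₁) ev) en j₁≥ j₃≥ ,
                    (lin (n ∷ j₁ ∷ j₃ ∷ v ∷ g₁ ∷ j₂ ∷ g₂ ∷ p ∷ o ∷ g₃ ∷ []) (eql 1 (v0 ⊕ # 1) (v1 ⊕ v2) en ∷ eql 1 (v1 ⊕ v3) (v1 ⊕ v4 ⊕ v5 ⊕ v6 ⊕ # 1) ev ∷ eqr 1 (v1 ⊕ v8) (# 1 ⊕ v7) eo ∷ eql 1 (v1 ⊕ v4 ⊕ v5 ⊕ v6 ⊕ v2 ⊕ v9) v7 total ∷ hyp 1 v1 v9 G₃ ∷ []) 1 (v3 ⊕ v0) v8))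
             in (lin (j₁ ∷ n₁ ∷ n ∷ m ∷ j₂ ∷ j₃ ∷ []) (hyp 1 (# 2 ⊗ v0 ⊕ (v1 ⊕ (v2 ⊕ # 0))) (# 2 ⊗ v3 ⊕ # 2) cov ∷ eqr 1 (v1 ⊕ # 1) (v0 ⊕ v4) en₁ ∷ eqr 1 (v2 ⊕ # 1) (v0 ⊕ v5) en ∷ eqr 1 (v0 ⊕ v4 ⊕ v5) v3 mass ∷ []) 1 (# 3 ⊗ v0) (v3 ⊕ # 4))
        spread : ∀ {j g j′ g′ j″ i} → i < j ⊎ (∃[ o ] o < j′ × i ≡ j + g + o) ⊎ (∃[ o ] o < j″ × i ≡ j + g + j′ + g′ + o) →
                 i < j ⊎ (j + g ≤ i × i < j + g + j′) ⊎ (j + g + (j′ + g′) ≤ i × i < j + g + (j′ + g′) + j″)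
        spread (inj₁ h) = inj₁ h
        spread {j} {g} {j′} {g′} {j″} {i} (inj₂ (inj₁ (o , h , e))) = inj₂ (inj₁ ((lin (j ∷ g ∷ o ∷ i ∷ []) (eqr 1 v3 (v0 ⊕ v1 ⊕ v2) e ∷ []) 1 (v0 ⊕ v1) v3) , (lin (o ∷ j′ ∷ i ∷ j ∷ g ∷ []) (hyp 1 (# 1 ⊕ v0) v1 h ∷ eql 1 v2 (v3 ⊕ v4 ⊕ v0) e ∷ []) 1 (# 1 ⊕ v2) (v3 ⊕ v4 ⊕ v1))))
        spread {j} {g} {j′} {g′} {j″} {i} (inj₂ (inj₂ (o , h , e))) = inj₂ (inj₂ ((lin (j ∷ g ∷ j′ ∷ g′ ∷ o ∷ i ∷ []) (eqr 1 v5 (v0 ⊕ v1 ⊕ v2 ⊕ v3 ⊕ v4) e ∷ []) 1 (v0 ⊕ v1 ⊕ (v2 ⊕ v3)) v5) , (lin (o ∷ j″ ∷ i ∷ j ∷ g ∷ j′ ∷ g′ ∷ []) (hyp 1 (# 1 ⊕ v0) v1 h ∷ eql 1 v2 (v3 ⊕ v4 ⊕ v5 ⊕ v6 ⊕ v0) e ∷ []) 1 (# 1 ⊕ v2) (v3 ⊕ v4 ⊕ (v5 ⊕ v6) ⊕ v1))))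
        closest : (∃[ V ] V ≤ j₁ + g₁ × V ≤ j₂ + g₂ × V ≤ j₃ + g₃ × (∀ t → V ≤ t → j₁ + g₁ ≤ t ⊎ j₂ + g₂ ≤ t ⊎ j₃ + g₃ ≤ t)) → ShortUpTo b
        closest (V , V₁ , V₂ , V₃ , att) = pick (att V ≤-refl)
          where
          pick : j₁ + g₁ ≤ V ⊎ j₂ + g₂ ≤ V ⊎ j₃ + g₃ ≤ V → ShortUpTo b
          pick (inj₁ h) = at-0 (three-clusters b j₁ j₁ j₂ j₃ (j₁ + g₁) (j₂ + g₂) (j₃ + g₃) (g₁ + 1) n₁ (g₂ + 1) n₂ (g₃ + 1) n₃ 3j j3 ≤-refl (proj₁ longest) (proj₂ longest) mass
            (+-monoʳ-≤ j₁ G₁) (+-monoʳ-≤ j₂ G₂) (+-monoʳ-≤ j₃ G₃) (lin≡ (j₁ ∷ g₁ ∷ j₂ ∷ g₂ ∷ j₃ ∷ g₃ ∷ p ∷ []) (eqn 1 (v0 ⊕ v1 ⊕ v2 ⊕ v3 ⊕ v4 ⊕ v5) v6 total ∷ []) (v0 ⊕ v1 ⊕ (v2 ⊕ v3) ⊕ (v4 ⊕ v5)) v6) (≤-trans h V₂) (≤-trans h V₃)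
            D-run (slide j₁ g₁) en₁ E₁ (slide j₂ g₂) en₂ E₂ (slide j₃ g₃) en₃ E₃ (λ i i<p hi → spread (only i i<p hi)))
          pick (inj₂ (inj₁ h)) = at-1 (three-clusters _ j₁ j₂ j₃ j₁ (j₂ + g₂) (j₃ + g₃) (j₁ + g₁) (g₂ + 1) n₂ (g₃ + 1) n₃ (g₁ + 1) n₁ 3j j3 (proj₁ longest) (proj₂ longest) ≤-refl (lin≡ (j₁ ∷ j₂ ∷ j₃ ∷ m ∷ []) (eqn 1 (v0 ⊕ v1 ⊕ v2) v3 mass ∷ []) (v1 ⊕ v2 ⊕ v0) v3)
            (+-monoʳ-≤ j₂ G₂) (+-monoʳ-≤ j₃ G₃) (+-monoʳ-≤ j₁ G₁) (lin≡ (j₁ ∷ g₁ ∷ j₂ ∷ g₂ ∷ j₃ ∷ g₃ ∷ p ∷ []) (eqn 1 (v0 ⊕ v1 ⊕ v2 ⊕ v3 ⊕ v4 ⊕ v5) v6 total ∷ []) (v2 ⊕ v3 ⊕ (v4 ⊕ v5) ⊕ (v0 ⊕ v1)) v6) (≤-trans h V₃) (≤-trans h V₁)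
            D-run (slide j₂ g₂) en₂ E₂ (slide j₃ g₃) en₃ E₃ (slide j₁ g₁) en₁ E₁ (λ i i<p hi → spread (Runs.only R′ i i<p hi)))
          pick (inj₂ (inj₂ h)) = at-2 (three-clusters _ j₁ j₃ j₁ j₂ (j₃ + g₃) (j₁ + g₁) (j₂ + g₂) (g₃ + 1) n₃ (g₁ + 1) n₁ (g₂ + 1) n₂ 3j j3 (proj₂ longest) ≤-refl (proj₁ longest) (lin≡ (j₁ ∷ j₂ ∷ j₃ ∷ m ∷ []) (eqn 1 (v0 ⊕ v1 ⊕ v2) v3 mass ∷ []) (v2 ⊕ v0 ⊕ v1) v3)
            (+-monoʳ-≤ j₃ G₃) (+-monoʳ-≤ j₁ G₁) (+-monoʳ-≤ j₂ G₂) (lin≡ (j₁ ∷ g₁ ∷ j₂ ∷ g₂ ∷ j₃ ∷ g₃ ∷ p ∷ []) (eqn 1 (v0 ⊕ v1 ⊕ v2 ⊕ v3 ⊕ v4 ⊕ v5) v6 total ∷ []) (v4 ⊕ v5 ⊕ (v0 ⊕ v1) ⊕ (v2 ⊕ v3)) v6) (≤-trans h V₁) (≤-trans h V₂)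
            D-run (slide j₃ g₃) en₃ E₃ (slide j₁ g₁) en₁ E₁ (slide j₂ g₂) en₂ E₂ (λ i i<p hi → spread (Runs.only R″ i i<p hi)))

-- The support is a short progression

∑<-pairs-≥ : ∀ n f g → (∀ i j → i + j + 1 ≡ n → g i ≤ f i + f j) → ∑< n g ≤ 2 * ∑< n f
∑<-pairs-≥ n f g h = begin
  ∑< n g                                  ≤⟨ ∑<-mono n (λ i i<n → h i _ (idx n i i<n)) ⟩
  ∑< n (λ i → f i + f (n ∸ 1 ∸ i))        ≡⟨ ∑<-+ n f _ ⟩
  ∑< n f + ∑< n (λ i → f (n ∸ 1 ∸ i))     ≡⟨ cong (∑< n f +_) (sym (∑<-reverse n f)) ⟩
  ∑< n f + ∑< n f                         ≡⟨ cong (∑< n f +_) (sym (+-identityʳ _)) ⟩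
  2 * ∑< n f                              ∎
  where
  open ≤-Reasoning
  idx : ∀ n i → i < n → i + (n ∸ 1 ∸ i) + 1 ≡ n
  idx (suc n) i (s≤s le) = trans (cong (_+ 1) (m+[n∸m]≡n le)) (+-comm n 1)

∑-allFin : ∀ n (f : ℕ → ℕ) → ∑ (allFin n) (λ i → f (toℕ i)) ≡ ∑< n f
∑-allFin zero    f = refl
∑-allFin (suc n) f = trans (cong (f 0 +_) (trans (∑-tabulate {n} Data.Fin.suc (λ i → f (toℕ i))) (∑-allFin n (λ i → f (suc i))))) (sym (∑<-first n f))

prefix : ∀ c (f : ℕ → Bool) n → ∃[ j ] j ≤ n × (∀ i → i < j → f i ≡ c) × (j < n → f j ≢ c)
prefix c f zero    = 0 , z≤n , (λ _ ()) , λ ()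
prefix c f (suc n) with f 0 Data.Bool.≟ c
... | no h  = 0 , z≤n , (λ _ ()) , λ _ → h
... | yes h with prefix c (λ i → f (suc i)) n
...   | j , j≤n , on , stop = suc j , s≤s j≤n , (λ { zero _ → h ; (suc i) (s≤s lt) → on i lt }) , λ { (s≤s lt) → stop lt }

≢false : ∀ {a} → a ≢ false → a ≡ true
≢false {true}  _ = refl
≢false {false} h = ⊥-elim (h refl)

run-gap : ∀ (f : ℕ → Bool) n → 1 ≤ n → f 0 ≡ true → f (n ∸ 1) ≡ false →
  ∃[ j ] ∃[ g ] ∃[ r ] (1 ≤ j) × (1 ≤ g) × (j + g + r ≡ n) × (∀ i → i < j → f i ≡ true) × (∀ i → i < g → f (j + i) ≡ false) × (1 ≤ r → f (j + g) ≡ true)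
run-gap f n n≥ h0 hn with prefix true f n
... | j , j≤n , on , stop with m≤n⇒∃[o]m+o≡n j≤n
...   | k , refl with prefix false (λ i → f (j + i)) k
...     | g , g≤k , off , stop′ with m≤n⇒∃[o]m+o≡n g≤k
...       | r , refl = j , g , r , j≥ j refl , g≥ g refl , +-assoc j g r , on , off , λ r≥ → ≢false (stop′ (lin (r ∷ g ∷ []) (hyp 1 (# 1) v0 r≥ ∷ []) 1 (# 1 ⊕ v1) (v1 ⊕ v0)))
  where
  last : ∀ n → 1 ≤ n → f (n ∸ 1) ≡ false → n ≡ j → ⊥
  last n n≥ hn refl = true≢false (on (j ∸ 1) (≤-reflexive (m+[n∸m]≡n n≥))) hn
  j≥ : ∀ i → i ≡ j → 1 ≤ j
  j≥ zero    refl = ⊥-elim (stop (lin (g ∷ r ∷ []) (hyp 1 (# 1) (# 0 ⊕ (v0 ⊕ v1)) n≥ ∷ []) 1 (# 1 ⊕ # 0) (# 0 ⊕ (v0 ⊕ v1))) h0)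
  j≥ (suc _) refl = s≤s z≤n
  g≥ : ∀ i → i ≡ g → 1 ≤ g
  g≥ (suc _) refl = s≤s z≤n
  g≥ zero    refl = ⊥-elim (done r refl)
    where
    done : ∀ s → s ≡ r → ⊥
    done zero    refl = last (j + 0) n≥ hn (+-identityʳ j)
    done (suc _) refl = stop (m<m+n j (s≤s z≤n)) (subst (λ t → f t ≡ true) (+-identityʳ j) (≢false (stop′ (s≤s z≤n))))

module OneDim {p : ℕ} {{p-nonZero : NonZero p}} (p-prime : Prime p) where
  open PrimeField p-prime
  open CauchyDavenport p-prime
  open Critical p-prime

  AP : 𝔽 → 𝔽 → ℕ → 𝔽
  AP x δ i = x +F [ i ]ₚ *F δ

  AP-+ : ∀ x δ i j → AP x δ (i + j) ≡ AP (AP x δ i) δ j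
  AP-+ x δ i j = trans (cong (x +F_) (trans (cong (_*F δ) (sym ([]-+ i j))) (*F-distribʳ δ [ i ]ₚ [ j ]ₚ))) (sym (+F-assoc x _ _))

  AP-0 : ∀ x δ → AP x δ 0 ≡ x
  AP-0 x δ = trans (cong (x +F_) (*F-zeroˡ δ)) (Fp.⊞-idʳ x)

  AP-1 : ∀ x δ → AP x δ 1 ≡ x +F δ
  AP-1 x δ = cong (x +F_) (*F-idˡ δ)

  AP-suc : ∀ x δ i → AP x δ (i + 1) ≡ AP x δ i +F δ
  AP-suc x δ i = trans (AP-+ x δ i 1) (AP-1 _ δ)

  AP-p : ∀ x δ i → AP x δ (i + p) ≡ AP x δ i
  AP-p x δ i = cong (λ t → x +F t *F δ) ([]-+p i)

  AP-diff : ∀ x δ i t → AP x δ (i + t) -F AP x δ i ≡ AP [ 0 ]ₚ δ t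
  AP-diff x δ i t = trans (cong (_-F AP x δ i) (AP-+ x δ i t)) (cancel (AP x δ i) ([ t ]ₚ *F δ))
    where cancel : ∀ a b → a +F b -F a ≡ [ 0 ]ₚ +F b
          cancel a b = (Fp.grp (a ∷ b ∷ []) (gv 0 :+ gv 1 :+ :- (gv 0)) (g0 :+ gv 1) refl)

  module _ {δ : 𝔽} (δ≢0 : δ ≢ [ 0 ]ₚ) where
    private
      δ⁻¹ = proj₁ (inverse δ δ≢0)
      δ⁻¹δ : δ⁻¹ *F δ ≡ [ 1 ]ₚ
      δ⁻¹δ = proj₂ (inverse δ δ≢0)

    AP-inj : ∀ x i j → i < p → j < p → AP x δ i ≡ AP x δ j → i ≡ j
    AP-inj x i j hi hj e = []-inj hi hj (*F-cancelˡ δ≢0 (trans (*F-comm δ _) (trans (Fp.⊞-cancelʳ x (trans (+F-comm _ x) (trans e (+F-comm x _)))) (*F-comm _ δ))))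

    index : 𝔽 → 𝔽 → ℕ
    index x y = toℕ ((y -F x) *F δ⁻¹)

    index<p : ∀ x y → index x y < p
    index<p x y = FinP.toℕ<n _

    AP-index : ∀ x y → AP x δ (index x y) ≡ y
    AP-index x y = trans (cong (x +F_) (trans (cong (_*F δ) ([]-toℕ _)) (trans (*F-assoc (y -F x) δ⁻¹ δ) (trans (cong ((y -F x) *F_) δ⁻¹δ) (trans (*F-comm (y -F x) [ 1 ]ₚ) (*F-idˡ (y -F x))))))) (back x y)
      where back : ∀ x y → x +F (y -F x) ≡ y
            back x y = (Fp.grp (x ∷ y ∷ []) (gv 0 :+ (gv 1 :+ :- (gv 0))) (gv 1) refl)

    size-index : ∀ x (X : 𝔽 → Bool) → Fp.size X ≡ ∑< p (λ i → ⟨ X (AP x δ i) ⟩)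
    size-index x X = trans (sym (bijection-∑ (finType p) (finType p) (λ i → AP x δ (toℕ i)) (λ y → (y -F x) *F δ⁻¹)
      (λ i → FinP.toℕ-injective (AP-inj x _ _ (FinP.toℕ<n _) (FinP.toℕ<n i) (AP-index x _))) (λ y → AP-index x y) (λ x → ⟨ X x ⟩))) (∑-allFin p (λ i → ⟨ X (AP x δ i) ⟩))

  Within : (𝔽 → Bool) → 𝔽 → 𝔽 → ℕ → Set
  Within S x δ L = ∀ y → S y ≡ true → ∃[ i ] i ≤ L × y ≡ AP x δ i

  record Hull (S : 𝔽 → Bool) (L : ℕ) : Set where
    field
      x δ    : 𝔽
      δ≢0    : δ ≢ [ 0 ]ₚ
      first  : S x ≡ true
      last   : S (AP x δ L) ≡ true
      within : Within S x δ L

  -- Cuts the progression at both ends until it starts and stops in S, as `freiman` requires.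
  trim : ∀ {S y} L x δ → δ ≢ [ 0 ]ₚ → S y ≡ true → Within S x δ L → ∃[ L′ ] L′ ≤ L × Hull S L′
  trim {S} {y} L x δ δ≢0 hy w = front L x w (S x) refl
    where
    back : ∀ L x → S x ≡ true → Within S x δ L → ∀ b → S (AP x δ L) ≡ b → ∃[ L′ ] L′ ≤ L × Hull S L′
    back L x hx w true  e = L , ≤-refl , record { x = x ; δ = δ ; δ≢0 = δ≢0 ; first = hx ; last = e ; within = w }
    back zero x hx w false e = ⊥-elim (true≢false (subst (λ t → S t ≡ true) (sym (AP-0 x δ)) hx) e)
    back (suc L) x hx w false e = let (L′ , le , H) = back L x hx w′ (S (AP x δ L)) refl in L′ , m≤n⇒m≤1+n le , H
      where
      w′ : Within S x δ L
      w′ z hz = shorten (w z hz)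
        where
        shorten : (∃[ i ] i ≤ suc L × z ≡ AP x δ i) → ∃[ i ] i ≤ L × z ≡ AP x δ i
        shorten (i , le , ez) = pick (i ≟ suc L)
          where pick : Dec (i ≡ suc L) → ∃[ i ] i ≤ L × z ≡ AP x δ i
                pick (yes r) = ⊥-elim (true≢false (subst (λ t → S t ≡ true) (trans ez (cong (AP x δ) r)) hz) e)
                pick (no r) = i , ≤-pred (≤∧≢⇒< le r) , ez
    front : ∀ L x → Within S x δ L → ∀ b → S x ≡ b → ∃[ L′ ] L′ ≤ L × Hull S L′
    front L x w true e = back L x e w (S (AP x δ L)) refl
    front L x w false e = step L (w y hy) w
      where
      nonzero : ∀ z → S z ≡ true → ∀ i → z ≡ AP x δ i → i ≢ 0
      nonzero z hz i ez refl = true≢false (subst (λ t → S t ≡ true) (trans ez (AP-0 x δ)) hz) e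
      step : ∀ L → (∃[ i ] i ≤ L × y ≡ AP x δ i) → Within S x δ L → ∃[ L′ ] L′ ≤ L × Hull S L′
      step zero (i , le , ey) _ = ⊥-elim (nonzero y hy i ey (n≤0⇒n≡0 le))
      step (suc L) _ w = let (L′ , le , H) = front L (AP x δ 1) w′ (S (AP x δ 1)) refl in L′ , m≤n⇒m≤1+n le , H
        where
        w′ : Within S (AP x δ 1) δ L
        w′ z hz = shift (w z hz)
          where shift : (∃[ i ] i ≤ suc L × z ≡ AP x δ i) → ∃[ i ] i ≤ L × z ≡ AP (AP x δ 1) δ i
                shift (zero , _ , ez) = ⊥-elim (nonzero z hz 0 ez refl)
                shift (suc i , s≤s le , ez) = i , le , trans ez (AP-+ x δ 1 i)

  Δ-AP : ∀ {S x δ} i t → S (AP x δ i) ≡ true → S (AP x δ (i + t)) ≡ true → (Δ S) (AP [ 0 ]ₚ δ t) ≡ true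
  Δ-AP {S} {x} {δ} i t hi ht = subst (λ z → (Δ S) z ≡ true) (AP-diff x δ i t) (Δ-intro {S} ht hi)

  Δ-symmetric : ∀ {S δ} t t′ → t + t′ ≡ p → (Δ S) (AP [ 0 ]ₚ δ t) ≡ true → (Δ S) (AP [ 0 ]ₚ δ t′) ≡ true
  Δ-symmetric {S} {δ} t t′ e h = conv (Δ-elim {S} h)
    where
    conv : (∃[ x ] ∃[ y ] S x ≡ true × S y ≡ true × AP [ 0 ]ₚ δ t ≡ x -F y) → (Δ S) (AP [ 0 ]ₚ δ t′) ≡ true
    conv (x , y , hx , hy , eq) = subst (λ z → (Δ S) z ≡ true) (neg (AP [ 0 ]ₚ δ t) (AP [ 0 ]ₚ δ t′) x y eq sum0) (Δ-intro {S} hy hx)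
      where
      neg : ∀ a a′ x y → a ≡ x -F y → a +F a′ ≡ [ 0 ]ₚ → y -F x ≡ a′
      neg a a′ x y e₁ e₂ = Fp.⊞-cancelʳ a (trans (trans (cong (y -F x +F_) e₁) (Fp.grp (y ∷ x ∷ []) (gv 0 :+ :- (gv 1) :+ (gv 1 :+ :- (gv 0))) g0 refl)) (sym (trans (+F-comm a′ a) e₂)))
      sum0 : AP [ 0 ]ₚ δ t +F AP [ 0 ]ₚ δ t′ ≡ [ 0 ]ₚ
      sum0 = trans (cong (AP [ 0 ]ₚ δ t +F_) (+F-idˡ _)) (trans (sym (AP-+ [ 0 ]ₚ δ t t′)) (trans (cong (AP [ 0 ]ₚ δ) e) (trans (AP-p [ 0 ]ₚ δ 0) (AP-0 [ 0 ]ₚ δ))))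

  within-size : ∀ {S L} x δ → δ ≢ [ 0 ]ₚ → Within S x δ L → L < p → Fp.size S ≡ ∑< (suc L) (λ i → ⟨ S (AP x δ i) ⟩)
  within-size {S} {L} x δ δ≢0 within L<p = let (r , er) = m≤n⇒∃[o]m+o≡n L<p in
    trans (size-index δ≢0 x S) (trans (cong (λ n → ∑< n b) (sym er)) (trans (∑<-split (suc L) r b) (trans (cong (∑< (suc L) b +_) (zeros r er)) (+-identityʳ (∑< (suc L) b)))))
    where
    b : ℕ → ℕ
    b i = ⟨ S (AP x δ i) ⟩
    zeros : ∀ r → suc L + r ≡ p → ∑< r (λ i → ⟨ S (AP x δ (suc L + i)) ⟩) ≡ 0
    zeros r er = trans (∑<-cong r (λ i i<r → cong ⟨_⟩ (¬true⇒false λ h → out i i<r (within _ h)))) (trans (∑<-const r 0) (*-zeroʳ r))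
      where out : ∀ i → i < r → (∃[ k ] k ≤ L × AP x δ (suc L + i) ≡ AP x δ k) → ⊥
            out i i<r (k , le , e) = let same = AP-inj δ≢0 x (suc L + i) k (lin (i ∷ r ∷ L ∷ p ∷ []) (hyp 1 (# 1 ⊕ v0) v1 i<r ∷ eql 1 (# 1 ⊕ v2 ⊕ v1) v3 er ∷ []) 1 (# 1 ⊕ (# 1 ⊕ v2 ⊕ v0)) v3) (≤-<-trans le L<p) e in
              (refute (L ∷ i ∷ k ∷ []) (eql 1 (# 1 ⊕ v0 ⊕ v1) v2 same ∷ hyp 1 v2 v0 le ∷ []))

  hull-size : ∀ {S L} (H : Hull S L) → L < p → Fp.size S ≡ ∑< (suc L) (λ i → ⟨ S (AP (Hull.x H) (Hull.δ H) i) ⟩)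
  hull-size {S} {L} H = within-size {S} {L} (Hull.x H) (Hull.δ H) (Hull.δ≢0 H) (Hull.within H)

  -- Freiman: modulo L, a set of more than L/2 residues meets each of its translates.
  freiman : ∀ {S L} → Hull S L → L + 3 ≤ 2 * Fp.size S → 2 * L < p → Fp.size S + L ≤ Fp.size (Δ S)
  freiman {S} {zero} H le lt = ⊥-elim (refute ((Fp.size S) ∷ one ∷ []) (hyp 1 (# 0 ⊕ # 3) (# 2 ⊗ v0) le ∷ eql 2 v0 (# 0 ⊕ v1) (hull-size H (lin (p ∷ []) (hyp 1 (# 1 ⊕ # 2 ⊗ (# 0)) v0 lt ∷ []) 1 (# 1 ⊕ # 0) v0)) ∷ hyp 2 v1 (# 1) (⟨⟩≤1 (S (AP (Hull.x H) (Hull.δ H) 0))) ∷ []))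
    where one = ⟨ S (AP (Hull.x H) (Hull.δ H) 0) ⟩
  freiman {S} {L@(suc L′)} H le lt = let (r , er) = m≤n⇒∃[o]m+o≡n {2 * L + 1} {p} (lin (L ∷ p ∷ []) (hyp 1 (# 1 ⊕ # 2 ⊗ v0) v1 lt ∷ []) 1 (# 2 ⊗ v0 ⊕ # 1) v1) in final r er
    where
    open Hull H
    b d : ℕ → ℕ
    b i = ⟨ S (AP x δ i) ⟩
    d t = ⟨ (Δ S) (AP [ 0 ]ₚ δ t) ⟩
    hit : ∀ i t → S (AP x δ i) ≡ true → S (AP x δ (i + t)) ≡ true → d t ≡ 1
    hit i t hi ht = cong ⟨_⟩ (Δ-AP {S} i t hi ht)
    atx : S (AP x δ 0) ≡ true
    atx = subst (λ t → S t ≡ true) (sym (AP-0 x δ)) first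
    size≡ : Fp.size S ≡ ∑< L b + b L
    size≡ = hull-size H (lin (L′ ∷ p ∷ []) (hyp 1 (# 1 ⊕ # 2 ⊗ (# 1 ⊕ v0)) v1 lt ∷ []) 1 (# 1 ⊕ (# 1 ⊕ v0)) v1)
    bL : b L ≡ 1
    bL = cong ⟨_⟩ last
    b0 : b 0 ≡ 1
    b0 = cong ⟨_⟩ atx
    not-both : ∀ t i → d t ≡ 0 → b i + b (i + t) ≤ 1
    not-both t i dt = go (S (AP x δ i)) refl (S (AP x δ (i + t))) refl
      where
      go : ∀ u → S (AP x δ i) ≡ u → ∀ w → S (AP x δ (i + t)) ≡ w → b i + b (i + t) ≤ 1
      go true  hu true  hw = ⊥-elim (0≢1+n (trans (sym dt) (hit i t hu hw)))
      go true  hu false hw = ≤-reflexive (cong₂ _+_ (cong ⟨_⟩ hu) (cong ⟨_⟩ hw))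
      go false hu w     hw = ≤-trans (≤-reflexive (cong (_+ b (i + t)) (cong ⟨_⟩ hu))) (⟨⟩≤1 _)
    cover : ∀ t t′ → t + t′ ≡ L → 1 ≤ d t + d t′
    cover t t′ e = n≢0⇒n>0 λ z → absurd (m+n≡0⇒m≡0 (d t) z) (m+n≡0⇒n≡0 (d t) z)
      where
      absurd : d t ≡ 0 → d t′ ≡ 0 → ⊥
      absurd dt dt′ = (refute ((∑< t′ b) ∷ (∑< t′ (λ i → b (t + i))) ∷ t′ ∷ (∑< t b) ∷ (∑< t (λ i → b (t′ + i))) ∷ t ∷ (∑< (suc L′) b) ∷ L′ ∷ (Fp.size S) ∷ (b (suc L′)) ∷ []) (hyp 1 (v0 ⊕ v1) (v2 ⊗ (# 1)) p₁ ∷ hyp 1 (v3 ⊕ v4) (v5 ⊗ (# 1)) p₂ ∷ eql 1 v6 (v3 ⊕ v1) s₁ ∷ eql 1 v6 (v0 ⊕ v4) s₂ ∷ eql 1 (v5 ⊕ v2) (# 1 ⊕ v7) e ∷ eql 2 v8 (v6 ⊕ v9) size≡ ∷ eql 2 v9 (# 1) bL ∷ hyp 1 (# 1 ⊕ v7 ⊕ # 3) (# 2 ⊗ v8) le ∷ []))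
        where
        s₁ : ∑< L b ≡ ∑< t b + ∑< t′ (λ i → b (t + i))
        s₁ = trans (cong (λ n → ∑< n b) (sym e)) (∑<-split t t′ b)
        s₂ : ∑< L b ≡ ∑< t′ b + ∑< t (λ i → b (t′ + i))
        s₂ = trans (cong (λ n → ∑< n b) (trans (sym e) (+-comm t t′))) (∑<-split t′ t b)
        p₁ : ∑< t′ b + ∑< t′ (λ i → b (t + i)) ≤ t′ * 1
        p₁ = ≤-trans (≤-reflexive (sym (∑<-+ t′ b _))) (∑<-bound t′ 1 (λ i _ → subst (λ k → b i + b k ≤ 1) (+-comm i t) (not-both t i dt)))
        p₂ : ∑< t b + ∑< t (λ i → b (t′ + i)) ≤ t * 1
        p₂ = ≤-trans (≤-reflexive (sym (∑<-+ t b _))) (∑<-bound t 1 (λ i _ → subst (λ k → b i + b k ≤ 1) (+-comm i t′) (not-both t′ i dt′)))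
    -- A point of S at position t is at distance t from the first point and L - t from the last, so
    -- t and L - t are both differences; for other t `cover` provides one of them.
    inner : ∑< L′ (λ i → 1 + b (1 + i)) ≤ 2 * ∑< L′ (λ i → d (1 + i))
    inner = ∑<-pairs-≥ L′ _ _ (λ i j e → pt i j e (S (AP x δ (1 + i))) refl)
      where
      pt : ∀ i j → i + j + 1 ≡ L′ → ∀ u → S (AP x δ (1 + i)) ≡ u → 1 + b (1 + i) ≤ d (1 + i) + d (1 + j)
      pt i j e false hu = ≤-trans (≤-reflexive (cong (λ t → 1 + ⟨ t ⟩) hu)) (cover (1 + i) (1 + j) (lin≡ (i ∷ j ∷ L′ ∷ []) (eqn 1 (v0 ⊕ v1 ⊕ # 1) v2 e ∷ []) (# 1 ⊕ v0 ⊕ (# 1 ⊕ v1)) (# 1 ⊕ v2)))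
      pt i j e true  hu = ≤-reflexive (trans (cong (λ t → 1 + ⟨ t ⟩) hu) (sym (cong₂ _+_ (hit 0 (1 + i) atx hu)
        (hit (1 + i) (1 + j) hu (subst (λ k → S (AP x δ k) ≡ true) (lin≡ (L′ ∷ i ∷ j ∷ []) (eqn 1 v0 (v1 ⊕ v2 ⊕ # 1) (sym e) ∷ []) (# 1 ⊕ v0) (# 1 ⊕ v1 ⊕ (# 1 ⊕ v2))) last)))))
    Σb : ∑< L′ (λ i → b (1 + i)) + 2 ≡ Fp.size S
    Σb = (lin≡ ((∑< (suc L′) b) ∷ (b (suc L′)) ∷ (Fp.size S) ∷ (b 0) ∷ (∑< L′ (λ i → b (1 + i))) ∷ []) (eqn 1 (v0 ⊕ v1) v2 (sym size≡) ∷ eqn 1 (v3 ⊕ v4) v0 (sym (∑<-first L′ b)) ∷ eqn 1 (# 1) v3 (sym b0) ∷ eqn 1 (# 1) v1 (sym bL) ∷ []) (v4 ⊕ # 2) v2)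
    final : ∀ r → 2 * L + 1 + r ≡ p → Fp.size S + L ≤ Fp.size (Δ S)
    -- Each t in [1, L] and its negative p - t are distinct because 2L < p; `upper` runs over the
    -- negatives.
    final r er = (lin ((∑< L′ (λ i → 1 + b (1 + i))) ∷ Td ∷ (∑< L′ (λ _ → 1)) ∷ Tb ∷ L′ ∷ (Fp.size S) ∷ (∑< (suc L′ + 1) d) ∷ (∑< r mid) ∷ (∑< (suc L′) upper) ∷ (Fp.size (Δ S)) ∷ []) (hyp 1 v0 (# 2 ⊗ v1) inner ∷ eqr 1 v0 (v2 ⊕ v3) (∑<-+ L′ (λ _ → 1) (λ i → b (1 + i))) ∷ eqr 1 v2 (v4 ⊗ (# 1)) (∑<-const L′ 1) ∷ eqr 1 (v3 ⊕ # 2) v5 Σb ∷ eqr 1 v9 (v6 ⊕ v7 ⊕ v8) total ∷ eqr 1 v6 (# 2 ⊕ v1) lower ∷ hyp 1 (v1 ⊕ # 1) v8 tails ∷ []) 1 (v5 ⊕ (# 1 ⊕ v4)) v9)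
      where
      Td = ∑< L′ (λ i → d (1 + i))
      Tb = ∑< L′ (λ i → b (1 + i))
      upper mid : ℕ → ℕ
      mid i = d (L + 1 + i)
      upper i = d (L + 1 + r + i)
      total : Fp.size (Δ S) ≡ ∑< (L + 1) d + ∑< r mid + ∑< L upper
      total = trans (size-index δ≢0 [ 0 ]ₚ (Δ S)) (trans (cong (λ n → ∑< n d) (lin≡ (p ∷ L′ ∷ r ∷ []) (eqn 1 v0 (# 2 ⊗ (# 1 ⊕ v1) ⊕ # 1 ⊕ v2) (sym er) ∷ []) v0 (# 1 ⊕ v1 ⊕ # 1 ⊕ v2 ⊕ (# 1 ⊕ v1))))
        (trans (∑<-split (L + 1 + r) L d) (cong (_+ ∑< L upper) (∑<-split (L + 1) r d))))
      d0 : d 0 ≡ 1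
      d0 = hit 0 0 atx atx
      dL : d L ≡ 1
      dL = hit 0 L atx last
      lower : ∑< (L + 1) d ≡ 2 + Td
      lower = trans (cong (λ n → ∑< n d) (+-comm L 1)) (trans (cong₂ _+_ (trans (∑<-first L′ d) (cong (_+ Td) d0)) dL) (lin≡ (Td ∷ []) [] (# 1 ⊕ v0 ⊕ # 1) (# 2 ⊕ v0)))
      tails : Td + 1 ≤ ∑< L upper
      tails = ≤-trans (≤-reflexive (cong (Td +_) (sym dL))) (≤-trans (∑<-mono L {λ i → d (1 + i)} {λ i → upper (L ∸ 1 ∸ i)} (λ i i<L → ⟨⟩-mono (Δ-symmetric {S} {δ} (1 + i) (L + 1 + r + (L ∸ 1 ∸ i)) (idx i (≤-pred i<L)))))
        (≤-reflexive (sym (∑<-reverse L upper))))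
        where
        idx : ∀ i → i ≤ L′ → 1 + i + (L + 1 + r + (L′ ∸ i)) ≡ p
        idx i le = (lin≡ (i ∷ (L′ ∸ i) ∷ L′ ∷ r ∷ p ∷ []) (eqn 1 (v0 ⊕ v1) v2 (m+[n∸m]≡n le) ∷ eqn 1 (# 2 ⊗ (# 1 ⊕ v2) ⊕ # 1 ⊕ v3) v4 er ∷ []) (# 1 ⊕ v0 ⊕ (# 1 ⊕ v2 ⊕ # 1 ⊕ v3 ⊕ v1)) v4)

-- A nonempty sequence starts with j ≥ 1 values true and g ≥ 1 values false. An empty one yields j =
-- g = r = 0, so that the decomposition can be iterated a fixed number of times even if there are
-- fewer runs.
record Run (f : ℕ → Bool) (n : ℕ) : Set where
  field
    j g r : ℕ
    total : j + g + r ≡ n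
    on    : ∀ i → i < j → f i ≡ true
    off   : ∀ i → i < g → f (j + i) ≡ false
    again : 1 ≤ r → f (j + g) ≡ true
    pos   : 1 ≤ n → 1 ≤ j × 1 ≤ g
    void  : j ≡ 0 → g ≡ 0

  rest : ℕ → Bool
  rest i = f (j + g + i)

firstRun : ∀ f n → (1 ≤ n → f 0 ≡ true) → (1 ≤ n → f (n ∸ 1) ≡ false) → Run f n
firstRun f zero    _ _ = record { j = 0 ; g = 0 ; r = 0 ; total = refl ; on = λ _ () ; off = λ _ () ; again = λ () ; pos = λ () ; void = λ _ → refl }
firstRun f (suc n) h h′ with run-gap f (suc n) (s≤s z≤n) (h (s≤s z≤n)) (h′ (s≤s z≤n))
... | j , g , r , j≥ , g≥ , t , on , off , again = record { j = j ; g = g ; r = r ; total = t ; on = on ; off = off ; again = again ; pos = λ _ → j≥ , g≥ ; void = λ z → ⊥-elim (1+n≰n (subst (1 ≤_) z j≥)) }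

module _ {f n} (R : Run f n) where
  open Run R

  rest-last : (1 ≤ n → f (n ∸ 1) ≡ false) → 1 ≤ r → rest (r ∸ 1) ≡ false
  rest-last h r≥ = subst (λ t → f t ≡ false) (idx n r r≥ total) (h (lin (r ∷ j ∷ g ∷ n ∷ []) (hyp 1 (# 1) v0 r≥ ∷ eql 1 (v1 ⊕ v2 ⊕ v0) v3 total ∷ []) 1 (# 1) v3))
    where idx : ∀ n r → 1 ≤ r → j + g + r ≡ n → n ∸ 1 ≡ j + g + (r ∸ 1)
          idx n (suc r) _ refl = cong (_∸ 1) (+-suc (j + g) r)

  nextRun : (1 ≤ n → f (n ∸ 1) ≡ false) → Run rest r
  nextRun h = firstRun rest r (λ r≥ → subst (λ t → f t ≡ true) (sym (+-identityʳ (j + g))) (again r≥)) (rest-last h)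

  run-end : 1 ≤ n → ∃[ v ] v + 1 ≡ j × f v ∧ not (f (v + 1)) ≡ true
  run-end n≥ = let (v , e) = m≤n⇒∃[o]m+o≡n (proj₁ (pos n≥)) ; e′ = trans (+-comm v 1) e in
    v , e′ , ∧-intro (on v (≤-reflexive e)) (not-intro (subst (λ t → f t ≡ false) (trans (+-identityʳ j) (sym e′)) (off 0 (proj₂ (pos n≥)))))

  run-count : ∑< n (λ i → ⟨ f i ⟩) ≡ j + ∑< r (λ i → ⟨ rest i ⟩)
  run-count = trans (cong (λ n → ∑< n F) (sym total)) (trans (∑<-split (j + g) r F) (cong (_+ ∑< r (λ i → ⟨ rest i ⟩))
    (trans (∑<-split j g F) (trans (cong₂ _+_ (trans (∑<-cong j (λ i h → cong ⟨_⟩ (on i h))) (trans (∑<-const j 1) (*-identityʳ j)))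
      (trans (∑<-cong g (λ i h → cong ⟨_⟩ (off i h))) (trans (∑<-const g 0) (*-zeroʳ g)))) (+-identityʳ j)))))
    where F = λ i → ⟨ f i ⟩

  run-only : ∀ i → i < n → f i ≡ true → i < j ⊎ (∃[ o ] o < r × i ≡ j + g + o × rest o ≡ true)
  run-only i i<n hi = place (i <? j) (i <? j + g)
    where
    place : Dec (i < j) → Dec (i < j + g) → i < j ⊎ (∃[ o ] o < r × i ≡ j + g + o × rest o ≡ true)
    place (yes h) _ = inj₁ h
    place (no h) (yes h′) = let (o , e) = m≤n⇒∃[o]m+o≡n (≮⇒≥ h) in
      ⊥-elim (true≢false (subst (λ t → f t ≡ true) (sym e) hi) (off o (lin (j ∷ o ∷ i ∷ g ∷ []) (eql 1 (v0 ⊕ v1) v2 e ∷ hyp 1 (# 1 ⊕ v2) (v0 ⊕ v3) h′ ∷ []) 1 (# 1 ⊕ v1) v3)))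
    place (no h) (no h′) = let (o , e) = m≤n⇒∃[o]m+o≡n (≮⇒≥ h′) in
      inj₂ (o , (lin (j ∷ g ∷ o ∷ i ∷ n ∷ r ∷ []) (eql 1 (v0 ⊕ v1 ⊕ v2) v3 e ∷ hyp 1 (# 1 ⊕ v3) v4 i<n ∷ eqr 1 (v0 ⊕ v1 ⊕ v5) v4 total ∷ []) 1 (# 1 ⊕ v2) v5) , sym e , subst (λ t → f t ≡ true) (sym e) hi)

ends : (ℕ → Bool) → ℕ → Bool
ends f i = f i ∧ not (f (i + 1))

-- Every run of a nonempty sequence contributes an end; peeling off runs thus bounds their number by
-- ∂.
run-ends : ∀ {f n} (R : Run f n) → 1 ≤ n → 1 + ∑< (Run.r R) (λ i → ⟨ ends (Run.rest R) i ⟩) ≤ ∑< n (λ i → ⟨ ends f i ⟩)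
run-ends {f} {n} R n≥ = let (v , ev , hv) = run-end R n≥ in
  ≤-trans (+-monoˡ-≤ _ (≤-trans (≤-reflexive (cong ⟨_⟩ (sym hv))) (one v ev)))
    (≤-reflexive (trans (cong (∑< (j + g) E +_) (∑<-cong r (λ i _ → cong (λ t → ⟨ f (j + g + i) ∧ not (f t) ⟩) (sym (+-assoc (j + g) i 1))))) (trans (sym (∑<-split (j + g) r E)) (cong (λ n → ∑< n E) total))))
  where
  open Run R
  E = λ i → ⟨ ends f i ⟩
  one : ∀ v → v + 1 ≡ j → E v ≤ ∑< (j + g) E
  one v ev = ≤-trans (m≤n+m (E v) (∑< v E)) (∑<-limit E {suc v} (lin (v ∷ j ∷ g ∷ []) (eql 1 (v0 ⊕ # 1) v1 ev ∷ []) 1 (# 1 ⊕ v0) (v1 ⊕ v2)))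

module Support {p : ℕ} {{p-nonZero : NonZero p}} (p-prime : Prime p) (m : ℕ) (p≡ : p ≡ 3 + 4 * m) (m≥ : 23 ≤ m) where
  open PrimeField p-prime
  open CauchyDavenport p-prime
  open Critical p-prime
  open OneDim p-prime

  -- Along the cycle of steps δ a set is left as often as it is entered.
  ∂-∁ : ∀ δ Z → ∂ δ (Fp.∁ Z) ≡ ∂ δ Z
  ∂-∁ δ Z = +-cancelˡ-≡ (Fp.size (Z Fp.∩ next)) _ _ (trans (cong₂ _+_ (Fp.size-cong {Z Fp.∩ next} {next Fp.∩ Z} swap (λ z h → ∧-intro (proj₂ (∧-elim {next z} h)) (proj₁ (∧-elim h))))
      (Fp.size-cong {λ z → not (Z z) ∧ not (not (Z (z +F δ)))} {next Fp.∖ Z}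
        (λ z h → ∧-intro (¬¬ (proj₂ (∧-elim {not (Z z)} h))) (proj₁ (∧-elim h)))
        (λ z h → ∧-intro (proj₂ (∧-elim {next z} h)) (not-intro (cong not (proj₁ (∧-elim h)))))))
    (trans (Fp.size-∩∖ next Z) (trans shift (sym (Fp.size-∩∖ Z next)))))
    where
    next : 𝔽 → Bool
    next z = Z (z +F δ)
    swap : (Z Fp.∩ next) Fp.⊆ (next Fp.∩ Z)
    swap z h = ∧-intro (proj₂ (∧-elim {Z z} h)) (proj₁ (∧-elim h))
    ¬¬ : ∀ {a} → not (not a) ≡ true → a ≡ true
    ¬¬ {true} _ = refl
    shift : Fp.size next ≡ Fp.size Z
    shift = bijection-∑ (finType p) (finType p) (_+F δ) (_-F δ) (λ x → (Fp.grp (x ∷ δ ∷ []) (gv 0 :+ gv 1 :+ :- (gv 1)) (gv 0) refl)) (λ x → (Fp.grp (x ∷ δ ∷ []) (gv 0 :+ :- (gv 1) :+ gv 1) (gv 0) refl)) (λ x → ⟨ Z x ⟩)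

  -- A point removed from E creates at most one new end of a run, at its predecessor.
  ∂-subset : ∀ {S E} δ → S Fp.⊆ E → ∂ δ S + Fp.size S ≤ ∂ δ E + Fp.size E
  ∂-subset {S} {E} δ S⊆E = ≤-trans (+-monoˡ-≤ (Fp.size S) (≤-trans (Fp.size-mono {λ z → S z ∧ not (S (z +F δ))} {DE Fp.∪ Extra} split) (Fp.size-∪≤ DE Extra)))
      (≤-reflexive (trans (+-assoc (∂ δ E) (Fp.size Extra) (Fp.size S)) (cong (∂ δ E +_) (trans (+-comm (Fp.size Extra) (Fp.size S)) (trans (cong₂ _+_ (Fp.size-cong {S} {E Fp.∩ S} (λ z h → ∧-intro (S⊆E z h) h) (λ z h → proj₂ (∧-elim {E z} h))) shift) (Fp.size-∩∖ E S))))))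
    where
    DE Extra : 𝔽 → Bool
    DE z = E z ∧ not (E (z +F δ))
    Extra z = (E Fp.∖ S) (z +F δ)
    shift : Fp.size Extra ≡ Fp.size (E Fp.∖ S)
    shift = bijection-∑ (finType p) (finType p) (_+F δ) (_-F δ) (λ x → (Fp.grp (x ∷ δ ∷ []) (gv 0 :+ gv 1 :+ :- (gv 1)) (gv 0) refl)) (λ x → (Fp.grp (x ∷ δ ∷ []) (gv 0 :+ :- (gv 1) :+ gv 1) (gv 0) refl)) (λ x → ⟨ (E Fp.∖ S) x ⟩)
    split : (λ z → S z ∧ not (S (z +F δ))) Fp.⊆ (DE Fp.∪ Extra)
    split z h = go (E (z +F δ)) refl
      where go : ∀ b → E (z +F δ) ≡ b → (DE Fp.∪ Extra) z ≡ true
            go false e = ∨-introˡ (∧-intro (S⊆E z (proj₁ (∧-elim h))) (not-intro e))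
            go true  e = ∨-introʳ {DE z} (∧-intro e (proj₂ (∧-elim {S z} h)))

  -- Thinness passes from Z to its complement, which contains S and exceeds it by ε points; each of
  -- them adds at most one run.
  thin-support : ∀ {W S Z s} κ ε → κ ≤ 3 → 10 ≤ Fp.size W → κ < Fp.size W → 2 ≤ Fp.size S → S s ≡ true → W Fp.⊹ S ⊆ Z → (∀ z → Z z ≡ true → S z ≡ false) →
    Fp.size Z + 2 ≤ Fp.size W + Fp.size S + κ → Fp.size S + ε + Fp.size Z ≡ p → Thin (κ + ε) S
  thin-support {W} {S} {Z} {s} κ ε κ≤ W≥ κ<W S≥ hs sum avoid size comp = finish (thin {κ} {W} {S} {Z} κ≤ W≥ room record { sum = sum ; 2≤Y = S≥ ; κ<X = κ<W ; size = size ; miss = s , ¬true⇒false λ h → true≢false hs (avoid s h) })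
    where
    room : Fp.size Z + 2 ≤ p
    room = (lin ((Fp.size S) ∷ ε ∷ (Fp.size Z) ∷ p ∷ []) (eql 1 (v0 ⊕ v1 ⊕ v2) v3 comp ∷ hyp 1 (# 2) v0 S≥ ∷ []) 1 (v2 ⊕ # 2) v3)
    finish : Thin κ Z → Thin (κ + ε) S
    finish (δ , δ≢0 , le) = δ , δ≢0 , (lin ((∂ δ S) ∷ (Fp.size S) ∷ (∂ δ (Fp.∁ Z)) ∷ (Fp.size (Fp.∁ Z)) ∷ (∂ δ Z) ∷ (Fp.size Z) ∷ p ∷ ε ∷ κ ∷ []) (hyp 1 (v0 ⊕ v1) (v2 ⊕ v3) (∂-subset {S} {Fp.∁ Z} δ (λ z h → not-intro (¬true⇒false λ hz → true≢false h (avoid z hz)))) ∷ eql 1 v2 v4 (∂-∁ δ Z) ∷ eql 1 (v5 ⊕ v3) v6 (size-Fp-∁ Z) ∷ eqr 1 (v1 ⊕ v7 ⊕ v5) v6 comp ∷ hyp 1 v4 v8 le ∷ []) 1 v0 (v8 ⊕ v7))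

  record Unrolled (S : 𝔽 → Bool) (δ : 𝔽) : Set where
    field
      x     : 𝔽
      start : S (AP x δ 0) ≡ true
      stop  : S (AP x δ (p ∸ 1)) ≡ false
      count : Fp.size S ≡ ∑< p (λ i → ⟨ S (AP x δ i) ⟩)
      jumps : ∂ δ S ≡ ∑< p (λ i → ⟨ ends (λ i → S (AP x δ i)) i ⟩)

  1≤p : 1 ≤ p
  1≤p = (lin (m ∷ p ∷ []) (eqr 1 v1 (# 3 ⊕ # 4 ⊗ v0) p≡ ∷ []) 1 (# 1) v1)

  AP-last : ∀ x δ → AP x δ (p ∸ 1) ≡ x -F δ
  AP-last x δ = Fp.⊞-cancelʳ δ (trans (sym (AP-suc x δ (p ∸ 1))) (trans (cong (AP x δ) (m∸n+n≡m 1≤p)) (trans (AP-p x δ 0) (trans (AP-0 x δ) (back x δ)))))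
    where back : ∀ x δ → x ≡ x -F δ +F δ
          back x δ = (Fp.grp (x ∷ δ ∷ []) (gv 0) (gv 0 :+ :- (gv 1) :+ gv 1) refl)

  -- The origin x is chosen as the first point of a run, which keeps runs from wrapping around from
  -- p - 1 to 0; it exists by `∂-pos` for -δ.
  unroll : ∀ {S s t δ} → δ ≢ [ 0 ]ₚ → S s ≡ true → S t ≡ false → Unrolled S δ
  unroll {S} {s} {t} {δ} δ≢0 hs ht = make (Fp.size-elem {λ z → S z ∧ not (S (z -F δ))} (∂-pos { -F δ} {S} {s} {t} (λ e → δ≢0 (neg0 δ e)) hs ht))
    where
    neg0 : ∀ δ → -F δ ≡ [ 0 ]ₚ → δ ≡ [ 0 ]ₚ
    neg0 δ e = trans (sym (Fp.⊞-idʳ δ)) (trans (cong (δ +F_) (sym e)) (+F-invʳ δ))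
    make : (∃[ z ] S z ∧ not (S (z -F δ)) ≡ true) → Unrolled S δ
    make (x , h) = record
      { x = x
      ; start = subst (λ t → S t ≡ true) (sym (AP-0 x δ)) (proj₁ (∧-elim h))
      ; stop = subst (λ t → S t ≡ false) (sym (AP-last x δ)) (not-elim (proj₂ (∧-elim {S x} h)))
      ; count = size-index δ≢0 x S
      ; jumps = trans (size-index δ≢0 x (λ z → S z ∧ not (S (z +F δ)))) (∑<-cong p (λ i _ → cong (λ t → ⟨ S (AP x δ i) ∧ not (S t) ⟩) (sym (AP-suc x δ i)))) }

  single-run : ∀ {S s t} → S s ≡ true → S t ≡ false → Thin 1 S → ∃[ L ] L + 1 ≤ Fp.size S × Hull S L
  single-run {S} {s} {t} hs ht (δ , δ≢0 , le) = done r refl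
    where
    U = unroll {S} δ≢0 hs ht
    open Unrolled U
    b : ℕ → Bool
    b i = S (AP x δ i)
    R : Run b p
    R = firstRun b p (λ _ → start) (λ _ → stop)
    open Run R
    done : ∀ k → k ≡ r → ∃[ L ] L + 1 ≤ Fp.size S × Hull S L
    done (suc k) e = ⊥-elim (refute ((∑< r (λ i → ⟨ ends rest i ⟩)) ∷ (∑< p (λ i → ⟨ ends b i ⟩)) ∷ more ∷ (∂ δ S) ∷ []) (hyp 1 (# 1 ⊕ v0) v1 (run-ends R 1≤p) ∷ hyp 1 (# 1 ⊕ v2) v0 (run-ends (nextRun R (λ _ → stop)) (subst (1 ≤_) e (s≤s z≤n))) ∷ eqr 1 v3 v1 jumps ∷ hyp 1 v3 (# 1) le ∷ []))
      where more = ∑< (Run.r (nextRun R (λ _ → stop))) (λ i → ⟨ ends (Run.rest (nextRun R (λ _ → stop))) i ⟩)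
    done zero e = let (v , ev , _) = run-end R 1≤p ; (L , L≤ , H) = trim {S} {s} v x δ δ≢0 hs (w v ev) in
        L , (lin (L ∷ v ∷ j ∷ (∑< p (λ i → ⟨ b i ⟩)) ∷ (Fp.size S) ∷ (∑< r (λ i → ⟨ rest i ⟩)) ∷ []) (hyp 1 v0 v1 L≤ ∷ eql 1 (v1 ⊕ # 1) v2 ev ∷ eqr 1 v4 v3 count ∷ eqr 1 v3 (v2 ⊕ v5) (run-count R) ∷ []) 1 (v0 ⊕ # 1) v4) , H
      where
      w : ∀ v → v + 1 ≡ j → Within S x δ v
      w v ev y hy = at (run-only R (index δ≢0 x y) (index<p δ≢0 x y) (subst (λ t → S t ≡ true) (sym (AP-index δ≢0 x y)) hy))
        where
        at : index δ≢0 x y < j ⊎ (∃[ o ] o < r × index δ≢0 x y ≡ j + g + o × rest o ≡ true) → ∃[ i ] i ≤ v × y ≡ AP x δ i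
        at (inj₁ h) = index δ≢0 x y , ≤-pred (≤-trans h (≤-reflexive (trans (sym ev) (+-comm v 1)))) , sym (AP-index δ≢0 x y)
        at (inj₂ (o , lt , _)) = ⊥-elim (n≮0 (subst (o <_) (sym e) lt))

  short-hull : ∀ {S s t δ} → δ ≢ [ 0 ]ₚ → S s ≡ true → S t ≡ false → ∂ δ S ≤ 3 → Fp.size S ≡ m → Fp.size (Δ S) ≤ 2 * m + 1 →
    ∃[ L ] L + 3 ≤ 2 * m × Hull S L
  short-hull {S} {s} {t} {δ} δ≢0 hs ht le size≡ Δ≤ = finish (sorted (j₂ ≤? j₁) (j₃ ≤? j₁) (j₃ ≤? j₂))
    where
    U = unroll {S} δ≢0 hs ht
    open Unrolled U
    b D : ℕ → Bool
    b i = S (AP x δ i)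
    D t = (Δ S) (AP [ 0 ]ₚ δ t)
    open Geometry m p p≡ m≥ D (Δ-symmetric {S} {δ}) (≤-trans (≤-reflexive (sym (size-index δ≢0 [ 0 ]ₚ (Δ S)))) Δ≤)
    R₁ : Run b p
    R₁ = firstRun b p (λ _ → start) (λ _ → stop)
    R₂ : Run (Run.rest R₁) (Run.r R₁)
    R₂ = nextRun R₁ (λ _ → stop)
    R₃ : Run (Run.rest R₂) (Run.r R₂)
    R₃ = nextRun R₂ (rest-last R₁ (λ _ → stop))
    R₄ : Run (Run.rest R₃) (Run.r R₃)
    R₄ = nextRun R₃ (rest-last R₂ (rest-last R₁ (λ _ → stop)))
    open Run R₁ using () renaming (j to j₁; g to g₁; r to r₁; total to total₁)
    open Run R₂ using () renaming (j to j₂; g to g₂; r to r₂; total to total₂)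
    open Run R₃ using () renaming (j to j₃; g to g₃; r to r₃; total to total₃)
    E : ∀ {n} {f : ℕ → Bool} → Run f n → ℕ
    E R = ∑< (Run.r R) (λ i → ⟨ ends (Run.rest R) i ⟩)
    r₃≡0 : r₃ ≡ 0
    r₃≡0 = n≤0⇒n≡0 (≮⇒≥ λ h₃ → four h₃)
      where
      four : 1 ≤ r₃ → ⊥
      four h₃ = (refute ((E R₁) ∷ (∑< p (λ i → ⟨ ends b i ⟩)) ∷ (E R₂) ∷ (E R₃) ∷ (E R₄) ∷ (∂ δ S) ∷ []) (hyp 1 (# 1 ⊕ v0) v1 (run-ends R₁ 1≤p) ∷ hyp 1 (# 1 ⊕ v2) v0 (run-ends R₂ h₁) ∷ hyp 1 (# 1 ⊕ v3) v2 (run-ends R₃ h₂) ∷ hyp 1 (# 1 ⊕ v4) v3 (run-ends R₄ h₃) ∷ eqr 1 v5 v1 jumps ∷ hyp 1 v5 (# 3) le ∷ []))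
        where
        h₂ : 1 ≤ r₂
        h₂ = (lin (r₃ ∷ j₃ ∷ g₃ ∷ r₂ ∷ []) (hyp 1 (# 1) v0 h₃ ∷ eql 1 (v1 ⊕ v2 ⊕ v0) v3 total₃ ∷ []) 1 (# 1) v3)
        h₁ : 1 ≤ r₁
        h₁ = (lin (r₂ ∷ j₂ ∷ g₂ ∷ r₁ ∷ []) (hyp 1 (# 1) v0 h₂ ∷ eql 1 (v1 ⊕ v2 ⊕ v0) v3 total₂ ∷ []) 1 (# 1) v3)
    runs : Runs b
    runs = record
      { j₁ = j₁ ; g₁ = g₁ ; j₂ = j₂ ; g₂ = g₂ ; j₃ = j₃ ; g₃ = g₃
      ; total = (lin≡ (j₁ ∷ g₁ ∷ r₁ ∷ p ∷ j₂ ∷ g₂ ∷ r₂ ∷ j₃ ∷ g₃ ∷ r₃ ∷ []) (eqn 1 (v0 ⊕ v1 ⊕ v2) v3 total₁ ∷ eqn 1 (v4 ⊕ v5 ⊕ v6) v2 total₂ ∷ eqn 1 (v7 ⊕ v8 ⊕ v9) v6 total₃ ∷ eqn 1 (# 0) v9 (sym r₃≡0) ∷ []) (v0 ⊕ v1 ⊕ v4 ⊕ v5 ⊕ v7 ⊕ v8) v3)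
      ; on₁ = Run.on R₁ ; on₂ = Run.on R₂
      ; on₃ = λ i h → subst (λ t → b t ≡ true) (lin≡ (j₁ ∷ g₁ ∷ j₂ ∷ g₂ ∷ i ∷ []) [] (v0 ⊕ v1 ⊕ (v2 ⊕ v3 ⊕ v4)) (v0 ⊕ v1 ⊕ v2 ⊕ v3 ⊕ v4)) (Run.on R₃ i h)
      ; only = λ i i<p hi → place i (run-only R₁ i i<p hi)
      ; void₁ = Run.void R₁ ; void₂ = Run.void R₂ ; void₃ = Run.void R₃ }
      where
      place : ∀ i → i < j₁ ⊎ (∃[ o ] o < r₁ × i ≡ j₁ + g₁ + o × Run.rest R₁ o ≡ true) → i < j₁ ⊎ (∃[ o ] o < j₂ × i ≡ j₁ + g₁ + o) ⊎ (∃[ o ] o < j₃ × i ≡ j₁ + g₁ + j₂ + g₂ + o)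
      place i (inj₁ h) = inj₁ h
      place i (inj₂ (o , o< , e , ho)) = place₂ (run-only R₂ o o< ho)
        where
        place₂ : o < j₂ ⊎ (∃[ o′ ] o′ < r₂ × o ≡ j₂ + g₂ + o′ × Run.rest R₂ o′ ≡ true) → i < j₁ ⊎ (∃[ o ] o < j₂ × i ≡ j₁ + g₁ + o) ⊎ (∃[ o ] o < j₃ × i ≡ j₁ + g₁ + j₂ + g₂ + o)
        place₂ (inj₁ h) = inj₂ (inj₁ (o , h , e))
        place₂ (inj₂ (o′ , o′< , e′ , ho′)) = place₃ (run-only R₃ o′ o′< ho′)
          where
          place₃ : o′ < j₃ ⊎ (∃[ o″ ] o″ < r₃ × o′ ≡ j₃ + g₃ + o″ × Run.rest R₃ o″ ≡ true) → i < j₁ ⊎ (∃[ o ] o < j₂ × i ≡ j₁ + g₁ + o) ⊎ (∃[ o ] o < j₃ × i ≡ j₁ + g₁ + j₂ + g₂ + o)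
          place₃ (inj₁ h) = inj₂ (inj₂ (o′ , h , (lin≡ (i ∷ j₁ ∷ g₁ ∷ o ∷ j₂ ∷ g₂ ∷ o′ ∷ []) (eqn 1 v0 (v1 ⊕ v2 ⊕ v3) e ∷ eqn 1 v3 (v4 ⊕ v5 ⊕ v6) e′ ∷ []) v0 (v1 ⊕ v2 ⊕ v4 ⊕ v5 ⊕ v6))))
          place₃ (inj₂ (o″ , lt , _)) = ⊥-elim (n≮0 (subst (o″ <_) r₃≡0 lt))
    mass : j₁ + j₂ + j₃ ≡ m
    mass = (lin≡ (j₁ ∷ (C R₁) ∷ (∑< p (λ i → ⟨ b i ⟩)) ∷ j₂ ∷ (C R₂) ∷ j₃ ∷ (C R₃) ∷ (Fp.size S) ∷ m ∷ []) (eqn 1 (v0 ⊕ v1) v2 (sym (run-count R₁)) ∷ eqn 1 (v3 ⊕ v4) v1 (sym (run-count R₂)) ∷ eqn 1 (v5 ⊕ v6) v4 (sym (run-count R₃)) ∷ eqn 1 (# 0) v6 (sym (cong (λ n → ∑< n (λ i → ⟨ Run.rest R₃ i ⟩)) r₃≡0)) ∷ eqn 1 v2 v7 (sym count) ∷ eqn 1 v7 v8 size≡ ∷ []) (v0 ⊕ v3 ⊕ v5) v8)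
      where C : ∀ {n} {f : ℕ → Bool} → Run f n → ℕ
            C R = ∑< (Run.r R) (λ i → ⟨ Run.rest R i ⟩)
    per : Periodic b
    per i = cong S (AP-p x δ i)
    diff : Differences b
    diff = Δ-AP {S} {x} {δ}
    shifted : ∀ r → ShortUpTo (λ i → b (i + r)) → ShortUpTo b
    shifted r (r′ , k , c , hk , h) = r′ + r , k , c , hk , λ i i<p hi → h i i<p (subst (λ t → b t ≡ true) (sym (+-assoc i r′ r)) hi)
    per-at : ∀ r → Periodic (λ i → b (i + r))
    per-at r i = trans (cong b (lin≡ (i ∷ p ∷ r ∷ []) [] (v0 ⊕ v1 ⊕ v2) (v0 ⊕ v2 ⊕ v1))) (per _)
    diff-at : ∀ r → Differences (λ i → b (i + r))
    diff-at r i t hi ht = diff (i + r) t hi (subst (λ t → b t ≡ true) (lin≡ (i ∷ t ∷ r ∷ []) [] (v0 ⊕ v1 ⊕ v2) (v0 ⊕ v2 ⊕ v1)) ht)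
    runs₂ = rotate per runs
    runs₃ = rotate (per-at (j₁ + g₁)) runs₂
    second : j₁ ≤ j₂ → j₃ ≤ j₂ → ShortUpTo b
    second h₁ h₃ = shifted (j₁ + g₁) (Classify.classify (per-at (j₁ + g₁)) (diff-at (j₁ + g₁)) runs₂ (lin≡ (j₁ ∷ j₂ ∷ j₃ ∷ m ∷ []) (eqn 1 (v0 ⊕ v1 ⊕ v2) v3 mass ∷ []) (v1 ⊕ v2 ⊕ v0) v3) (h₃ , h₁))
    third : j₁ ≤ j₃ → j₂ ≤ j₃ → ShortUpTo b
    third h₁ h₂ = shifted (j₁ + g₁) (shifted′ (Classify.classify per″ diff″ runs₃ (lin≡ (j₁ ∷ j₂ ∷ j₃ ∷ m ∷ []) (eqn 1 (v0 ⊕ v1 ⊕ v2) v3 mass ∷ []) (v2 ⊕ v0 ⊕ v1) v3) (h₁ , h₂)))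
      where
      shifted′ : ShortUpTo (λ i → b (i + (j₂ + g₂) + (j₁ + g₁))) → ShortUpTo (λ i → b (i + (j₁ + g₁)))
      shifted′ (r′ , k , c , hk , h) = r′ + (j₂ + g₂) , k , c , hk , λ i i<p hi → h i i<p (subst (λ t → b (t + (j₁ + g₁)) ≡ true) (sym (+-assoc i r′ (j₂ + g₂))) hi)
      per″ : Periodic (λ i → b (i + (j₂ + g₂) + (j₁ + g₁)))
      per″ i = trans (cong b (lin≡ (i ∷ p ∷ j₂ ∷ g₂ ∷ j₁ ∷ g₁ ∷ []) [] (v0 ⊕ v1 ⊕ (v2 ⊕ v3) ⊕ (v4 ⊕ v5)) (v0 ⊕ (v2 ⊕ v3) ⊕ v1 ⊕ (v4 ⊕ v5)))) (per-at (j₁ + g₁) (i + (j₂ + g₂)))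
      diff″ : Differences (λ i → b (i + (j₂ + g₂) + (j₁ + g₁)))
      diff″ i t hi ht = diff-at (j₁ + g₁) (i + (j₂ + g₂)) t hi (subst (λ t → b (t + (j₁ + g₁)) ≡ true) (lin≡ (i ∷ t ∷ j₂ ∷ g₂ ∷ []) [] (v0 ⊕ v1 ⊕ (v2 ⊕ v3)) (v0 ⊕ (v2 ⊕ v3) ⊕ v1)) ht)
    -- `Classify` wants the longest run in front; a rotation puts it there.
    sorted : Dec (j₂ ≤ j₁) → Dec (j₃ ≤ j₁) → Dec (j₃ ≤ j₂) → ShortUpTo b
    sorted (yes h₂) (yes h₃) _ = Classify.classify per diff runs mass (h₂ , h₃)
    sorted (yes h₂) (no h₃) _ = third (≰⇒≥ h₃) (≤-trans h₂ (≰⇒≥ h₃))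
    sorted (no h₂) _ (yes h₃) = second (≰⇒≥ h₂) h₃
    sorted (no h₂) _ (no h₃) = third (≤-trans (≰⇒≥ h₂) (≰⇒≥ h₃)) (≰⇒≥ h₃)
    finish : ShortUpTo b → ∃[ L ] L + 3 ≤ 2 * m × Hull S L
    finish (r , k , c , (k≥ , k≤) , h) = go (inverse [ k ]ₚ k≢0)
      where
      k≢0 : [ k ]ₚ ≢ [ 0 ]ₚ
      k≢0 e = (refute (k ∷ []) (eql 1 v0 (# 0) ([]-inj (lin (k ∷ m ∷ p ∷ []) (hyp 1 v0 (# 3) k≤ ∷ eqr 1 v2 (# 3 ⊕ # 4 ⊗ v1) p≡ ∷ hyp 4 (# 23) v1 m≥ ∷ []) 1 (# 1 ⊕ v0) v2) 1≤p e) ∷ hyp 1 (# 1) v0 k≥ ∷ []))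
      go : (∃[ u ] u *F [ k ]ₚ ≡ [ 1 ]ₚ) → ∃[ L ] L + 3 ≤ 2 * m × Hull S L
      go (u , uk) = let (o , eo) = m≤n⇒∃[o]m+o≡n {3} {2 * m} (lin (m ∷ []) (hyp 2 (# 23) v0 m≥ ∷ []) 1 (# 3) (# 2 ⊗ v0)) ; (L , L≤ , H) = trim {S} {s} o x″ δ′ δ′≢0 hs (w o eo) in
          L , (lin (L ∷ o ∷ m ∷ []) (hyp 1 v0 v1 L≤ ∷ eql 1 (# 3 ⊕ v1) (# 2 ⊗ v2) eo ∷ []) 1 (v0 ⊕ # 3) (# 2 ⊗ v2)) , H
        where
        x′ δ′ x″ : 𝔽
        x′ = AP x δ r
        δ′ = u *F δ
        -- `Short` controls k i + c, so the progression has difference δ/k and its origin is moved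
        -- back by c of the new steps.
        x″ = x′ -F [ c ]ₚ *F δ′
        kδ′ : [ k ]ₚ *F δ′ ≡ δ
        kδ′ = trans (sym (*F-assoc [ k ]ₚ u δ)) (trans (cong (_*F δ) (trans (*F-comm [ k ]ₚ u) uk)) (*F-idˡ δ))
        δ′≢0 : δ′ ≢ [ 0 ]ₚ
        δ′≢0 e = δ≢0 (trans (sym kδ′) (trans (cong ([ k ]ₚ *F_) e) (*F-zeroʳ [ k ]ₚ)))
        w : ∀ o → 3 + o ≡ 2 * m → Within S x″ δ′ o
        w o eo y hy = at (h i (index<p δ≢0 x′ y) (subst (λ t → S t ≡ true) (sym pos) hy))
          where
          i = index δ≢0 x′ y
          pos : AP x δ (i + r) ≡ y
          pos = trans (cong (AP x δ) (+-comm i r)) (trans (AP-+ x δ r i) (AP-index δ≢0 x′ y))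
          at : (∃[ i′ ] ∃[ e ] (i′ + 3 ≤ 2 * m) × (k * i + c ≡ i′ + e * p)) → ∃[ i′ ] i′ ≤ o × y ≡ AP x″ δ′ i′
          at (i′ , e , le′ , eq) = i′ , (lin (i′ ∷ m ∷ o ∷ []) (hyp 1 (v0 ⊕ # 3) (# 2 ⊗ v1) le′ ∷ eqr 1 (# 3 ⊕ v2) (# 2 ⊗ v1) eo ∷ []) 1 v0 v2) , trans (sym (AP-index δ≢0 x′ y)) (trans (shuffle x′ ([ i ]ₚ *F δ) ([ c ]ₚ *F δ′)) (cong (x″ +F_) (sym scaled)))
            where
            shuffle : ∀ a b c → a +F b ≡ a -F c +F (b +F c)
            shuffle a b c = (Fp.grp (a ∷ b ∷ c ∷ []) (gv 0 :+ gv 1) (gv 0 :+ :- (gv 2) :+ (gv 1 :+ gv 2)) refl)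
            scaled : [ i′ ]ₚ *F δ′ ≡ [ i ]ₚ *F δ +F [ c ]ₚ *F δ′
            scaled = trans (cong (_*F δ′) (trans (sym ([]-mod i′ e)) (trans (cong [_]ₚ (sym eq)) (trans (sym ([]-+ (k * i) c)) (cong (_+F [ c ]ₚ) (trans (cong [_]ₚ (*-comm k i)) (sym ([]-* i k))))))))
              (trans (*F-distribʳ δ′ ([ i ]ₚ *F [ k ]ₚ) [ c ]ₚ) (cong (_+F [ c ]ₚ *F δ′) (trans (*F-assoc [ i ]ₚ [ k ]ₚ δ′) (cong ([ i ]ₚ *F_) kδ′))))

-- The cases of small and of large doubling of X

module SupportHull {p : ℕ} {{p-nonZero : NonZero p}} (p-prime : Prime p) (m : ℕ) (p≡ : p ≡ 3 + 4 * m) (m≥ : 23 ≤ m) (bigT : BigEnoughT m)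
                   {S : Fin p → Bool} (C : Config p-prime m S) where
  open PrimeField p-prime
  open CauchyDavenport p-prime
  open Critical p-prime
  open OneDim p-prime
  open Support p-prime m p≡ m≥
  open Config C

  X≤m : Fp.size X ≤ m
  X≤m = go sizes
    where go : _ → Fp.size X ≤ m
          go (inj₁ (_ , e)) = ≤-reflexive e
          go (inj₂ (inj₁ (_ , e))) = ≤-reflexive e
          go (inj₂ (inj₂ (_ , e))) = (lin ((Fp.size X) ∷ m ∷ []) (eql 1 (v0 ⊕ # 1) v1 e ∷ []) 1 v0 v1)

  m≤X+1 : m ≤ Fp.size X + 1
  m≤X+1 = go sizes
    where go : _ → m ≤ Fp.size X + 1
          go (inj₁ (_ , e)) = (lin (m ∷ (Fp.size X) ∷ []) (eqr 1 v1 v0 e ∷ []) 1 v0 (v1 ⊕ # 1))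
          go (inj₂ (inj₁ (_ , e))) = (lin (m ∷ (Fp.size X) ∷ []) (eqr 1 v1 v0 e ∷ []) 1 v0 (v1 ⊕ # 1))
          go (inj₂ (inj₂ (_ , e))) = ≤-reflexive (sym e)

  -- Feasibility is applied with τ = 4/(m - 1), which is below 5/m. As |X| ≥ m - 1, the number (2 +
  -- τ)|X| - 3 is at least 2|X| + 1. The progression then has at most |X| + 2 terms.
  covering : Fp.size (X Fp.⊹ X) ≤ 2 * Fp.size X + 1 → ∃[ a ] ∃[ d ] d ≢ [ 0 ]ₚ × Within X a d (Fp.size X + 1)
  covering small = let (v , ev) = m≤n⇒∃[o]m+o≡n {1} {m} (≤-trans (s≤s z≤n) m≥) in conv (feasible v ev)
    where
    c₁ : card1 X ≡ Fp.size X
    c₁ = card1≡size X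
    c₂ : card1 (sumset X) ≡ Fp.size (X Fp.⊹ X)
    c₂ = card1≡size (sumset X)
    feasible : ∀ v → 1 + v ≡ m → Covering X
    feasible v ev = bigT 4 v (s≤s z≤n) (lin (m ∷ v ∷ []) (eqr 1 (# 1 ⊕ v1) v0 ev ∷ hyp 1 (# 23) v0 m≥ ∷ []) 1 (# 1) v1) (lin (m ∷ v ∷ []) (eqr 5 (# 1 ⊕ v1) v0 ev ∷ hyp 1 (# 23) v0 m≥ ∷ []) 1 (# 1 ⊕ # 4 ⊗ v0) (# 5 ⊗ v1)) p p-prime X
        (subst (λ t → 4 * t ≤ p) (sym c₁) (lin ((Fp.size X) ∷ m ∷ p ∷ []) (hyp 4 v0 v1 X≤m ∷ eqr 1 v2 (# 3 ⊕ # 4 ⊗ v1) p≡ ∷ []) 1 (# 4 ⊗ v0) v2))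
        (subst₂ (λ s t → v * s + 3 * v ≤ (2 * v + 4) * t) (sym c₂) (sym c₁) (≤-trans (+-monoˡ-≤ (3 * v) (*-monoʳ-≤ v small))
          (lin (v ∷ (Fp.size X) ∷ []) (hyp 4 (# 1 ⊕ v0) (v1 ⊕ # 1) (≤-trans (≤-reflexive ev) m≤X+1) ∷ []) 1 (v0 ⊗ (# 2 ⊗ v1 ⊕ # 1) ⊕ # 3 ⊗ v0) ((# 2 ⊗ v0 ⊕ # 4) ⊗ v1))))
    conv : Covering X → ∃[ a ] ∃[ d ] d ≢ [ 0 ]ₚ × Within X a d (Fp.size X + 1)
    conv (a , d , d≢0 , h) = a , d , d≢0 , λ y hy → at y (h y hy)
      where
      at : ∀ y → (∃[ i ] (i < (card1 (sumset X) ∸ card1 X) + 1) × (y ≡ a +F [ i ]ₚ *F d)) → ∃[ i ] i ≤ Fp.size X + 1 × y ≡ AP a d i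
      at y (i , lt , e) = i , ≤-trans (≤-pred (≤-trans lt (≤-reflexive (+-comm (card1 (sumset X) ∸ card1 X) 1)))) (≤-trans (≤-reflexive (cong₂ _∸_ c₂ c₁)) (≤-trans (∸-monoˡ-≤ (Fp.size X) small) (≤-reflexive diff))) , e
        where diff : 2 * Fp.size X + 1 ∸ Fp.size X ≡ Fp.size X + 1
              diff = trans (cong (_∸ Fp.size X) (lin≡ ((Fp.size X) ∷ []) [] (# 2 ⊗ v0 ⊕ # 1) (v0 ⊕ # 1 ⊕ v0))) (m+n∸n≡m (Fp.size X + 1) (Fp.size X))

  X-elem : ∃[ x ] X x ≡ true
  X-elem = Fp.size-elem {X} (lin (m ∷ (Fp.size X) ∷ []) (hyp 1 v0 (v1 ⊕ # 1) m≤X+1 ∷ hyp 1 (# 23) v0 m≥ ∷ []) 1 (# 1) v1)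

  x₀ : 𝔽
  x₀ = proj₁ X-elem
  hx₀ : X x₀ ≡ true
  hx₀ = proj₂ X-elem
  hs₀ : S x₀ ≡ true
  hs₀ = X⊆S x₀ hx₀

  ΔX⊆ΔS : (Δ X) Fp.⊆ (Δ S)
  ΔX⊆ΔS z h = let (x , y , hx , hy , e) = Δ-elim {X} h in subst (λ t → (Δ S) t ≡ true) (sym e) (Δ-intro {S} (X⊆S x hx) (X⊆S y hy))

  -- A point of S far from the progression containing X would produce too many new differences.
  module Near (a d : 𝔽) (d≢0 : d ≢ [ 0 ]ₚ) (w : Within X a d (m + 1)) where

    O : 𝔽 → Bool
    O t = (Δ S) t ∧ not ((Δ X) t)

    -- |S - S| ≤ 2m + 4, while |X - X| ≥ 2(m - 1) - 1.
    O≤7 : Fp.size O ≤ 7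
    O≤7 = (lin ((Fp.size ((Δ S) Fp.∩ (Δ X))) ∷ (Fp.size O) ∷ (Fp.size (Δ S)) ∷ (Fp.size (Δ X)) ∷ (Fp.size X) ∷ m ∷ []) (eql 1 (v0 ⊕ v1) v2 (Fp.size-∩∖ (Δ S) (Δ X)) ∷ hyp 1 v3 v0 (Fp.size-mono {Δ X} {(Δ S) Fp.∩ (Δ X)} (λ t h → ∧-intro (ΔX⊆ΔS t h) h)) ∷ hyp 1 (# 2 ⊗ v4) (v3 ⊕ # 1) (size-Δ {X} {x₀} {x₀ +F x₀} hx₀ (¬true⇒false λ h → true≢false (ΔX⊆ΔS _ h) (apart x₀ x₀ hx₀ hx₀))) ∷ hyp 1 v2 (# 2 ⊗ v5 ⊕ # 4) Δ≤ ∷ hyp 2 v5 (v4 ⊕ # 1) m≤X+1 ∷ []) 1 v1 (# 7))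

    no-difference : ∀ k → m + 2 ≤ k → k + m + 2 ≤ p → (Δ X) (AP [ 0 ]ₚ d k) ≡ false
    no-difference k lo hi = ¬true⇒false λ h → let (x , y , hx , hy , e) = Δ-elim {X} h in clash x y e (w x hx) (w y hy)
      where
      clash : ∀ x y → AP [ 0 ]ₚ d k ≡ x -F y → (∃[ i ] i ≤ m + 1 × x ≡ AP a d i) → (∃[ i ] i ≤ m + 1 × y ≡ AP a d i) → ⊥
      clash x y e (u , u≤ , eu) (v , v≤ , ev) = (refute (v ∷ k ∷ u ∷ m ∷ []) (eql 1 (v0 ⊕ v1) v2 (AP-inj d≢0 a (v + k) u (lin (v ∷ m ∷ k ∷ p ∷ []) (hyp 1 v0 (v1 ⊕ # 1) v≤ ∷ hyp 1 (v2 ⊕ v1 ⊕ # 2) v3 hi ∷ []) 1 (# 1 ⊕ (v0 ⊕ v2)) v3) (lin (u ∷ m ∷ p ∷ []) (hyp 1 v0 (v1 ⊕ # 1) u≤ ∷ eqr 1 v2 (# 3 ⊕ # 4 ⊗ v1) p≡ ∷ hyp 3 (# 23) v1 m≥ ∷ []) 1 (# 1 ⊕ v0) v2) same) ∷ hyp 1 v2 (v3 ⊕ # 1) u≤ ∷ hyp 1 (v3 ⊕ # 2) v1 lo ∷ []))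
        where
        cancel : ∀ a b c → a -F b ≡ c -F b → a ≡ c
        cancel a b c = Fp.⊞-cancelʳ (-F b)
        same : AP a d (v + k) ≡ AP a d u
        same = cancel _ (AP a d v) _ (trans (AP-diff a d v k) (trans e (cong₂ _-F_ eu ev)))

    -- X omits at most 3 of the m + 2 positions of its progression, so 11 consecutive positions
    -- contain 8 points of X. Their differences with z would all be new, one more than `O≤7` allows.
    window : ∀ z o r → o + 11 + r ≡ m + 2 → S z ≡ true → (∀ i → i < 11 → ∃[ k ] m + 2 ≤ k × k + m + 2 ≤ p × z ≡ AP a d (o + i + k)) → ⊥
    window z o r er hz far = (refute ((Fp.size O) ∷ (Fp.size (λ y → O (z -F y))) ∷ (∑< p F) ∷ (∑< (o + 11) F) ∷ (∑< o F) ∷ (∑< 11 (λ i → F (o + i))) ∷ (∑< 11 (λ i → G (o + i))) ∷ (Fp.size X) ∷ (∑< (o + 11) G) ∷ (∑< r (λ i → G (o + 11 + i))) ∷ (∑< o G) ∷ o ∷ r ∷ m ∷ []) (hyp 1 v0 (# 7) O≤7 ∷ eql 1 v1 v0 (Fp.size-reflect O z) ∷ eqr 1 v1 v2 (size-index d≢0 a (λ y → O (z -F y))) ∷ hyp 1 v3 v2 (∑<-limit F {o + 11} (lin (o ∷ r ∷ m ∷ p ∷ []) (eql 1 (v0 ⊕ # 11 ⊕ v1) (v2 ⊕ # 2) er ∷ eqr 1 v3 (# 3 ⊕ # 4 ⊗ v2) p≡ ∷ hyp 3 (# 23) v2 m≥ ∷ []) 1 (v0 ⊕ # 11) v3)) ∷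 eqr 1 v3 (v4 ⊕ v5) (∑<-split o 11 F) ∷ hyp 1 v6 v5 (∑<-mono 11 (λ i i<11 → hit i (far i i<11))) ∷ eql 1 v7 (v8 ⊕ v9) total ∷ eql 1 v8 (v10 ⊕ v6) (∑<-split o 11 G) ∷ hyp 1 v10 (v11 ⊗ (# 1)) (∑<-bound o 1 (λ i _ → ⟨⟩≤1 _)) ∷ hyp 1 v9 (v12 ⊗ (# 1)) (∑<-bound r 1 (λ i _ → ⟨⟩≤1 _)) ∷ eql 1 (v11 ⊕ # 11 ⊕ v12) (v13 ⊕ # 2) er ∷ hyp 1 v13 (v7 ⊕ # 1) m≤X+1 ∷ []))
      where
      F G : ℕ → ℕ
      F i = ⟨ O (z -F AP a d i) ⟩
      G i = ⟨ X (AP a d i) ⟩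
      total : Fp.size X ≡ ∑< (o + 11) G + ∑< r (λ i → G (o + 11 + i))
      total = trans (within-size {X} {m + 1} a d d≢0 w (lin (m ∷ p ∷ []) (eqr 1 v1 (# 3 ⊕ # 4 ⊗ v0) p≡ ∷ hyp 3 (# 23) v0 m≥ ∷ []) 1 (# 1 ⊕ (v0 ⊕ # 1)) v1)) (trans (cong (λ n → ∑< n G) (lin≡ (m ∷ o ∷ r ∷ []) (eqn 1 (v0 ⊕ # 2) (v1 ⊕ # 11 ⊕ v2) (sym er) ∷ []) (# 1 ⊕ (v0 ⊕ # 1)) (v1 ⊕ # 11 ⊕ v2))) (∑<-split (o + 11) r G))
      hit : ∀ i → (∃[ k ] m + 2 ≤ k × k + m + 2 ≤ p × z ≡ AP a d (o + i + k)) → G (o + i) ≤ F (o + i)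
      hit i (k , lo , hi , ez) = ⟨⟩-mono λ hX → ∧-intro (Δ-intro {S} hz (X⊆S _ hX)) (not-intro (subst (λ t → (Δ X) t ≡ false) (sym (trans (cong (_-F AP a d (o + i)) ez) (AP-diff a d (o + i) k))) (no-difference k lo hi)))

    -- S may stick out by 10 on either side: for any farther point there is a window of 11
    -- positions, at the start or at the end of the progression, at distances between m + 2 and p -
    -- m - 2, which are no differences of X.
    near : Within S (AP a d (p ∸ 10)) d (m + 21)
    near z hz = go (j ≤? m + 11) (p ≤? j + 10) (j + m + 2 ≤? p)
      where
      j = index d≢0 a z
      j<p : j < p
      j<p = index<p d≢0 a z
      ez : AP a d j ≡ z
      ez = AP-index d≢0 a z
      10≤p : 10 ≤ p
      10≤p = (lin (m ∷ p ∷ []) (eqr 1 v1 (# 3 ⊕ # 4 ⊗ v0) p≡ ∷ hyp 4 (# 23) v0 m≥ ∷ []) 1 (# 10) v1)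
      back : (p ∸ 10) + 10 ≡ p
      back = m∸n+n≡m 10≤p
      go : Dec (j ≤ m + 11) → Dec (p ≤ j + 10) → Dec (j + m + 2 ≤ p) → ∃[ i ] i ≤ m + 21 × z ≡ AP (AP a d (p ∸ 10)) d i
      go (yes h) _ _ = j + 10 , (lin (j ∷ m ∷ []) (hyp 1 v0 (v1 ⊕ # 11) h ∷ []) 1 (v0 ⊕ # 10) (v1 ⊕ # 21)) , trans (sym ez) (trans (sym (AP-p a d j)) (trans (cong (AP a d) (lin≡ (p ∷ (p ∸ 10) ∷ j ∷ []) (eqn 1 v0 (v1 ⊕ # 10) (sym back) ∷ []) (v2 ⊕ v0) (v1 ⊕ (v2 ⊕ # 10)))) (AP-+ a d (p ∸ 10) (j + 10))))
      go (no _) (yes h) _ = let (o , eo) = m≤n⇒∃[o]m+o≡n {p ∸ 10} {j} (lin (p ∷ j ∷ (p ∸ 10) ∷ []) (hyp 1 v0 (v1 ⊕ # 10) h ∷ eql 1 (v2 ⊕ # 10) v0 back ∷ []) 1 v2 v1) in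
        o , (lin ((p ∸ 10) ∷ o ∷ j ∷ p ∷ m ∷ []) (eql 1 (v0 ⊕ v1) v2 eo ∷ hyp 1 (# 1 ⊕ v2) v3 j<p ∷ eqr 1 (v0 ⊕ # 10) v3 back ∷ []) 1 v1 (v4 ⊕ # 21)) , trans (sym ez) (trans (cong (AP a d) (sym eo)) (AP-+ a d (p ∸ 10) o))
      go (no h) (no h′) (yes h″) = let (r , er) = m≤n⇒∃[o]m+o≡n {11} {m + 2} (lin (m ∷ []) (hyp 1 (# 23) v0 m≥ ∷ []) 1 (# 11) (v0 ⊕ # 2)) in
        ⊥-elim (window z 0 r er hz (λ i i<11 → let (k , ek) = m≤n⇒∃[o]m+o≡n {i} {j} (lin (i ∷ m ∷ j ∷ []) (hyp 1 (# 1 ⊕ v0) (# 11) i<11 ∷ hyp 1 (# 1 ⊕ (v1 ⊕ # 11)) v2 (≰⇒> h) ∷ []) 1 v0 v2) in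
          k , (lin (j ∷ i ∷ k ∷ m ∷ []) (eqr 1 (v1 ⊕ v2) v0 ek ∷ hyp 1 (# 1 ⊕ v1) (# 11) i<11 ∷ hyp 1 (# 1 ⊕ (v3 ⊕ # 11)) v0 (≰⇒> h) ∷ []) 1 (v3 ⊕ # 2) v2) , (lin (i ∷ k ∷ j ∷ m ∷ p ∷ []) (eql 1 (v0 ⊕ v1) v2 ek ∷ hyp 1 (v2 ⊕ v3 ⊕ # 2) v4 h″ ∷ []) 1 (v1 ⊕ v3 ⊕ # 2) v4) , trans (sym ez) (cong (AP a d) (sym ek))))
      go (no h) (no h′) (no h″) = let (o , eo) = m≤n⇒∃[o]m+o≡n {9} {m} (lin (m ∷ []) (hyp 1 (# 23) v0 m≥ ∷ []) 1 (# 9) v0) in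
        ⊥-elim (window z o 0 (lin≡ (o ∷ m ∷ []) (eqn 1 (# 9 ⊕ v0) v1 eo ∷ []) (v0 ⊕ # 11 ⊕ # 0) (v1 ⊕ # 2)) hz (λ i i<11 → let (k , ek) = m≤n⇒∃[o]m+o≡n {o + i} {j} (lin (o ∷ m ∷ i ∷ p ∷ j ∷ []) (eql 3 (# 9 ⊕ v0) v1 eo ∷ hyp 1 (# 1 ⊕ v2) (# 11) i<11 ∷ hyp 1 (# 1 ⊕ v3) (v4 ⊕ v1 ⊕ # 2) (≰⇒> h″) ∷ eqr 1 v3 (# 3 ⊕ # 4 ⊗ v1) p≡ ∷ []) 1 (v0 ⊕ v2) v4) in
          k , (lin (j ∷ o ∷ i ∷ k ∷ m ∷ p ∷ []) (eqr 1 (v1 ⊕ v2 ⊕ v3) v0 ek ∷ eql 2 (# 9 ⊕ v1) v4 eo ∷ hyp 1 (# 1 ⊕ v2) (# 11) i<11 ∷ hyp 1 (# 1 ⊕ v5) (v0 ⊕ v4 ⊕ # 2) (≰⇒> h″) ∷ eqr 1 v5 (# 3 ⊕ # 4 ⊗ v4) p≡ ∷ []) 1 (v4 ⊕ # 2) v3) ,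
          (lin (o ∷ i ∷ k ∷ j ∷ m ∷ p ∷ []) (eql 1 (v0 ⊕ v1 ⊕ v2) v3 ek ∷ eqr 1 (# 9 ⊕ v0) v4 eo ∷ hyp 1 (# 1 ⊕ (v3 ⊕ # 10)) v5 (≰⇒> h′) ∷ []) 1 (v2 ⊕ v4 ⊕ # 2) v5) , trans (sym ez) (cong (AP a d) (sym ek))))

  -- The crude bound m + 21 makes Freiman's estimate applicable; it gives L ≤ |S - S| - |S| ≤ m + 3.
  long : ∀ {L} → Fp.size S ≡ m + 1 ⊎ Fp.size S ≡ m + 2 → L ≤ m + 21 → Hull S L → L ≤ m + 3
  long {L} e L≤ H = (lin ((Fp.size S) ∷ L ∷ (Fp.size (Δ S)) ∷ m ∷ []) (hyp 1 (v0 ⊕ v1) v2 (freiman H (lin (L ∷ m ∷ (Fp.size S) ∷ []) (hyp 1 v0 (v1 ⊕ # 21) L≤ ∷ hyp 2 (v1 ⊕ # 1) v2 lower ∷ hyp 1 (# 23) v1 m≥ ∷ []) 1 (v0 ⊕ # 3) (# 2 ⊗ v2)) (lin (L ∷ m ∷ p ∷ []) (hyp 2 v0 (v1 ⊕ # 21) L≤ ∷ eqr 1 v2 (# 3 ⊕ # 4 ⊗ v1) p≡ ∷ hyp 2 (# 23) v1 m≥ ∷ []) 1 (# 1 ⊕ # 2 ⊗ v0) v2)) ∷ hyp 1 v2 (# 2 ⊗ v3 ⊕ # 4) Δ≤ ∷ hyp 1 (v3 ⊕ # 1) v0 lower ∷ []) 1 v1 (v3 ⊕ # 3))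
    where
    bound : Fp.size S ≡ m + 1 ⊎ Fp.size S ≡ m + 2 → m + 1 ≤ Fp.size S
    bound (inj₁ e) = ≤-reflexive (sym e)
    bound (inj₂ e) = (lin (m ∷ (Fp.size S) ∷ []) (eqr 1 v1 (v0 ⊕ # 2) e ∷ []) 1 (v0 ⊕ # 1) v1)
    lower : m + 1 ≤ Fp.size S
    lower = bound e

  small-doubling : Fp.size (X Fp.⊹ X) ≤ 2 * Fp.size X + 1 → ∃[ L ] L ≤ m + 3 × Hull S L
  small-doubling small = go (covering small) sizes
    where
    go : (∃[ a ] ∃[ d ] d ≢ [ 0 ]ₚ × Within X a d (Fp.size X + 1)) → (Fp.size S ≡ m × Fp.size X ≡ m) ⊎ (Fp.size S ≡ m + 1 × Fp.size X ≡ m) ⊎ (Fp.size S ≡ m + 2 × Fp.size X + 1 ≡ m) → ∃[ L ] L ≤ m + 3 × Hull S L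
    go (a , d , d≢0 , w) (inj₁ (eS , eX)) = let (L , L≤ , H) = trim {S} {x₀} (Fp.size X + 1) a d d≢0 hs₀ (λ y hy → w y (Fp.size-full⊆ {X} {S} X⊆S (≤-reflexive (trans eS (sym eX))) y hy)) in
      L , (lin (L ∷ (Fp.size X) ∷ m ∷ []) (hyp 1 v0 (v1 ⊕ # 1) L≤ ∷ eql 1 v1 v2 eX ∷ []) 1 v0 (v2 ⊕ # 3)) , H
    go (a , d , d≢0 , w) (inj₂ e) = let (L , L≤ , H) = trim {S} {x₀} (m + 21) (AP a d (p ∸ 10)) d d≢0 hs₀ (Near.near a d d≢0 (λ y hy → let (i , i≤ , ei) = w y hy in i , ≤-trans i≤ (+-monoˡ-≤ 1 X≤m) , ei)) in
      L , long (sz e) L≤ H , H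
      where sz : (Fp.size S ≡ m + 1 × Fp.size X ≡ m) ⊎ (Fp.size S ≡ m + 2 × Fp.size X + 1 ≡ m) → Fp.size S ≡ m + 1 ⊎ Fp.size S ≡ m + 2
            sz (inj₁ (e , _)) = inj₁ e
            sz (inj₂ (e , _)) = inj₂ e

  W Z : 𝔽 → Bool
  W = X Fp.⊹ X
  Z = W Fp.⊹ S

  Z-avoid : ∀ z → Z z ≡ true → S z ≡ false
  Z-avoid z hz = ¬true⇒false λ h → let (v , s , hv , hs , e) = Fp.⊹-elim {W} {S} hz ; (x , y , hx , hy , e′) = Fp.⊹-elim {X} {X} hv in
      true≢false (subst (λ t → (Δ S) t ≡ true) (trans (cong (_-F s) e) (trans (drop v s) e′)) (Δ-intro {S} h hs)) (apart x y hx hy)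
    where drop : ∀ v s → v +F s -F s ≡ v
          drop v s = (Fp.grp (v ∷ s ∷ []) (gv 0 :+ gv 1 :+ :- (gv 1)) (gv 0) refl)

  hw₀ : W (x₀ +F x₀) ≡ true
  hw₀ = Fp.⊹-intro {X} {X} hx₀ hx₀

  S-miss : S ((x₀ +F x₀) +F x₀) ≡ false
  S-miss = Z-avoid _ (Fp.⊹-intro {W} {S} hw₀ hs₀)

  WS : Fp.size W + Fp.size S ≤ Fp.size Z + 1
  WS = cauchy-davenport {W} {S} {Z} {x₀ +F x₀} {x₀} {x₀} (λ _ _ → Fp.⊹-intro {W} {S}) hw₀ hs₀ (¬true⇒false λ h → true≢false hs₀ (Z-avoid x₀ h))

  SZ : ∃[ ε ] Fp.size S + ε + Fp.size Z ≡ p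
  SZ = let (ε , e) = m≤n⇒∃[o]m+o≡n (Fp.size-mono {S} {Fp.∁ Z} (λ z h → not-intro (¬true⇒false λ hz → true≢false h (Z-avoid z hz)))) in
    ε , trans (cong (_+ Fp.size Z) e) (trans (+-comm _ (Fp.size Z)) (size-Fp-∁ Z))

  -- S and W + S are disjoint; let ε count the elements in neither. Then |W| ≥ 2|X| + 2 gives |W +
  -- S| ≤ |W| + |S| - 2 + κ with κ = 3 - ε for |S| = m, and with ε = 0, κ = 1 in the two other
  -- cases. So S has at most κ + ε runs.
  large-doubling : 2 * Fp.size X + 2 ≤ Fp.size W → ∃[ L ] L ≤ m + 3 × Hull S L
  large-doubling W≥ = go SZ sizes
    where
    wide : ∀ κ → κ ≤ 3 → 10 ≤ Fp.size W × κ < Fp.size W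
    wide κ κ≤ = (lin ((Fp.size X) ∷ (Fp.size W) ∷ m ∷ []) (hyp 1 (# 2 ⊗ v0 ⊕ # 2) v1 W≥ ∷ hyp 2 v2 (v0 ⊕ # 1) m≤X+1 ∷ hyp 2 (# 23) v2 m≥ ∷ []) 1 (# 10) v1) , (lin (κ ∷ (Fp.size X) ∷ (Fp.size W) ∷ m ∷ []) (hyp 1 v0 (# 3) κ≤ ∷ hyp 1 (# 2 ⊗ v1 ⊕ # 2) v2 W≥ ∷ hyp 2 v3 (v1 ⊕ # 1) m≤X+1 ∷ hyp 2 (# 23) v3 m≥ ∷ []) 1 (# 1 ⊕ v0) v2)
    2≤S : 2 ≤ Fp.size S
    2≤S = (lin ((Fp.size X) ∷ (Fp.size S) ∷ m ∷ []) (hyp 1 v0 v1 (Fp.size-mono {X} {S} X⊆S) ∷ hyp 1 v2 (v0 ⊕ # 1) m≤X+1 ∷ hyp 1 (# 23) v2 m≥ ∷ []) 1 (# 2) v1)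
    thin-S : ∀ κ ε → κ ≤ 3 → Fp.size Z + 2 ≤ Fp.size W + Fp.size S + κ → Fp.size S + ε + Fp.size Z ≡ p → Thin (κ + ε) S
    thin-S κ ε κ≤ size comp = thin-support {W} {S} {Z} {x₀} κ ε κ≤ (proj₁ (wide κ κ≤)) (proj₂ (wide κ κ≤)) 2≤S hs₀ (λ _ _ → Fp.⊹-intro {W} {S}) Z-avoid size comp
    one : Thin 1 S → Fp.size S ≤ m + 2 → ∃[ L ] L ≤ m + 3 × Hull S L
    one th S≤ = let (L , L< , H) = single-run {S} {x₀} {(x₀ +F x₀) +F x₀} hs₀ S-miss th in L , (lin (L ∷ (Fp.size S) ∷ m ∷ []) (hyp 1 (v0 ⊕ # 1) v1 L< ∷ hyp 1 v1 (v2 ⊕ # 2) S≤ ∷ []) 1 v0 (v2 ⊕ # 3)) , H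
    go : (∃[ ε ] Fp.size S + ε + Fp.size Z ≡ p) → (Fp.size S ≡ m × Fp.size X ≡ m) ⊎ (Fp.size S ≡ m + 1 × Fp.size X ≡ m) ⊎ (Fp.size S ≡ m + 2 × Fp.size X + 1 ≡ m) → ∃[ L ] L ≤ m + 3 × Hull S L
    go (ε , comp) (inj₁ (eS , eX)) = three (m≤n⇒∃[o]m+o≡n {ε} {3} (lin ((Fp.size S) ∷ ε ∷ (Fp.size Z) ∷ p ∷ (Fp.size W) ∷ (Fp.size X) ∷ m ∷ []) (eql 1 (v0 ⊕ v1 ⊕ v2) v3 comp ∷ hyp 1 (v4 ⊕ v0) (v2 ⊕ # 1) WS ∷ hyp 1 (# 2 ⊗ v5 ⊕ # 2) v4 W≥ ∷ eqr 2 v0 v6 eS ∷ eqr 2 v5 v6 eX ∷ eql 1 v3 (# 3 ⊕ # 4 ⊗ v6) p≡ ∷ []) 1 v1 (# 3)))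
      where
      -- The general bound 2m + 4 is too weak for `Geometry`. As S - S misses W and |W| ≥ 2m + 2, it
      -- improves to 2m + 1.
      Δ-small : Fp.size (Δ S) ≤ 2 * m + 1
      Δ-small = (lin ((Fp.size (Δ S)) ∷ (Fp.size (Fp.∁ W)) ∷ (Fp.size W) ∷ p ∷ (Fp.size X) ∷ m ∷ []) (hyp 1 v0 v1 (Fp.size-mono {Δ S} {Fp.∁ W} (λ t h → not-intro (¬true⇒false λ hw → let (x , y , hx , hy , e) = Fp.⊹-elim {X} {X} hw in true≢false (subst (λ t → (Δ S) t ≡ true) e h) (apart x y hx hy)))) ∷ eql 1 (v2 ⊕ v1) v3 (size-Fp-∁ W) ∷ hyp 1 (# 2 ⊗ v4 ⊕ # 2) v2 W≥ ∷ eqr 2 v4 v5 eX ∷ eql 1 v3 (# 3 ⊕ # 4 ⊗ v5) p≡ ∷ []) 1 v0 (# 2 ⊗ v5 ⊕ # 1))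
      three : (∃[ κ ] ε + κ ≡ 3) → ∃[ L ] L ≤ m + 3 × Hull S L
      three (κ , e) = fin (thin-S κ ε (lin (ε ∷ κ ∷ []) (eql 1 (v0 ⊕ v1) (# 3) e ∷ []) 1 v1 (# 3)) (lin ((Fp.size S) ∷ ε ∷ (Fp.size Z) ∷ p ∷ (Fp.size X) ∷ (Fp.size W) ∷ m ∷ κ ∷ []) (eql 1 (v0 ⊕ v1 ⊕ v2) v3 comp ∷ hyp 1 (# 2 ⊗ v4 ⊕ # 2) v5 W≥ ∷ eqr 2 v0 v6 eS ∷ eqr 2 v4 v6 eX ∷ eql 1 v3 (# 3 ⊕ # 4 ⊗ v6) p≡ ∷ eqr 1 (v1 ⊕ v7) (# 3) e ∷ []) 1 (v2 ⊕ # 2) (v5 ⊕ v0 ⊕ v7)) comp)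
        where
        fin : Thin (κ + ε) S → ∃[ L ] L ≤ m + 3 × Hull S L
        fin (δ , δ≢0 , le) = let (L , L≤ , H) = short-hull {S} {x₀} {(x₀ +F x₀) +F x₀} δ≢0 hs₀ S-miss (≤-trans le (≤-reflexive (trans (+-comm κ ε) e))) eS Δ-small in
          L , (lin ((Fp.size S) ∷ L ∷ (Fp.size (Δ S)) ∷ m ∷ []) (hyp 1 (v0 ⊕ v1) v2 (freiman H (lin (L ∷ m ∷ (Fp.size S) ∷ []) (hyp 1 (v0 ⊕ # 3) (# 2 ⊗ v1) L≤ ∷ eqr 2 v2 v1 eS ∷ []) 1 (v0 ⊕ # 3) (# 2 ⊗ v2)) (lin (L ∷ m ∷ p ∷ []) (hyp 2 (v0 ⊕ # 3) (# 2 ⊗ v1) L≤ ∷ eqr 1 v2 (# 3 ⊕ # 4 ⊗ v1) p≡ ∷ []) 1 (# 1 ⊕ # 2 ⊗ v0) v2)) ∷ hyp 1 v2 (# 2 ⊗ v3 ⊕ # 1) Δ-small ∷ eqr 1 v0 v3 eS ∷ []) 1 v1 (v3 ⊕ # 3)) , H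
    go (ε , comp) (inj₂ (inj₁ (eS , eX))) = one (subst (λ t → Thin (1 + t) S) ε≡0 (thin-S 1 ε (s≤s z≤n) (lin ((Fp.size S) ∷ ε ∷ (Fp.size Z) ∷ p ∷ (Fp.size X) ∷ (Fp.size W) ∷ m ∷ []) (eql 1 (v0 ⊕ v1 ⊕ v2) v3 comp ∷ hyp 1 (# 2 ⊗ v4 ⊕ # 2) v5 W≥ ∷ eqr 2 v0 (v6 ⊕ # 1) eS ∷ eqr 2 v4 v6 eX ∷ eql 1 v3 (# 3 ⊕ # 4 ⊗ v6) p≡ ∷ []) 1 (v2 ⊕ # 2) (v5 ⊕ v0 ⊕ # 1)) comp)) (lin ((Fp.size S) ∷ m ∷ []) (eql 1 v0 (v1 ⊕ # 1) eS ∷ []) 1 v0 (v1 ⊕ # 2))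
      where ε≡0 : ε ≡ 0
            ε≡0 = n≤0⇒n≡0 (lin ((Fp.size S) ∷ ε ∷ (Fp.size Z) ∷ p ∷ (Fp.size W) ∷ (Fp.size X) ∷ m ∷ []) (eql 1 (v0 ⊕ v1 ⊕ v2) v3 comp ∷ hyp 1 (v4 ⊕ v0) (v2 ⊕ # 1) WS ∷ hyp 1 (# 2 ⊗ v5 ⊕ # 2) v4 W≥ ∷ eqr 2 v0 (v6 ⊕ # 1) eS ∷ eqr 2 v5 v6 eX ∷ eql 1 v3 (# 3 ⊕ # 4 ⊗ v6) p≡ ∷ []) 1 v1 (# 0))
    go (ε , comp) (inj₂ (inj₂ (eS , eX))) = one (subst (λ t → Thin (1 + t) S) ε≡0 (thin-S 1 ε (s≤s z≤n) (lin ((Fp.size S) ∷ ε ∷ (Fp.size Z) ∷ p ∷ (Fp.size X) ∷ (Fp.size W) ∷ m ∷ []) (eql 1 (v0 ⊕ v1 ⊕ v2) v3 comp ∷ hyp 1 (# 2 ⊗ v4 ⊕ # 2) v5 W≥ ∷ eqr 2 v0 (v6 ⊕ # 2) eS ∷ eqr 2 (v4 ⊕ # 1) v6 eX ∷ eql 1 v3 (# 3 ⊕ # 4 ⊗ v6) p≡ ∷ []) 1 (v2 ⊕ # 2) (v5 ⊕ v0 ⊕ # 1)) comp)) (≤-reflexive eS)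
      where ε≡0 : ε ≡ 0
            ε≡0 = n≤0⇒n≡0 (lin ((Fp.size S) ∷ ε ∷ (Fp.size Z) ∷ p ∷ (Fp.size W) ∷ (Fp.size X) ∷ m ∷ []) (eql 1 (v0 ⊕ v1 ⊕ v2) v3 comp ∷ hyp 1 (v4 ⊕ v0) (v2 ⊕ # 1) WS ∷ hyp 1 (# 2 ⊗ v5 ⊕ # 2) v4 W≥ ∷ eqr 2 v0 (v6 ⊕ # 2) eS ∷ eqr 2 (v5 ⊕ # 1) v6 eX ∷ eql 1 v3 (# 3 ⊕ # 4 ⊗ v6) p≡ ∷ []) 1 v1 (# 0))

  support-hull : ∃[ L ] L ≤ m + 3 × Hull S L
  support-hull = go (Fp.size W ≤? 2 * Fp.size X + 1)
    where
    go : Dec (Fp.size W ≤ 2 * Fp.size X + 1) → ∃[ L ] L ≤ m + 3 × Hull S L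
    go (yes h) = small-doubling h
    go (no h)  = large-doubling (lin ((Fp.size X) ∷ (Fp.size W) ∷ []) (hyp 1 (# 1 ⊕ (# 2 ⊗ v0 ⊕ # 1)) v1 (≰⇒> h) ∷ []) 1 (# 2 ⊗ v0 ⊕ # 2) v1)

-- Sets supported on a short interval of fibres

∑<-tight : ∀ n {f} k → (∀ i → i < n → f i ≤ k) → n * k ≤ ∑< n f → ∀ i → i < n → k ≤ f i
∑<-tight (suc n) {f} k h tot i i<n = go (i ≟ n)
  where
  go : Dec (i ≡ n) → k ≤ f i
  go (yes refl) = (lin (k ∷ n ∷ (∑< n f) ∷ (f n) ∷ []) (hyp 1 (v0 ⊕ v1 ⊗ v0) (v2 ⊕ v3) tot ∷ hyp 1 v2 (v1 ⊗ v0) (∑<-bound n k (λ j lt → h j (m≤n⇒m≤1+n lt))) ∷ []) 1 v0 v3)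
  go (no i≢n) = ∑<-tight n k (λ j lt → h j (m≤n⇒m≤1+n lt)) (lin (k ∷ n ∷ (∑< n f) ∷ (f n) ∷ []) (hyp 1 (v0 ⊕ v1 ⊗ v0) (v2 ⊕ v3) tot ∷ hyp 1 v3 v0 (h n ≤-refl) ∷ []) 1 (v1 ⊗ v0) v2) i (≤∧≢⇒< (≤-pred i<n) i≢n)

search< : ∀ (f : ℕ → ℕ) n → (∃[ i ] i < n × 1 ≤ f i) ⊎ (∑< n f ≡ 0)
search< f zero    = inj₂ refl
search< f (suc n) = go (search< f n) (f n) refl
  where
  go : (∃[ i ] i < n × 1 ≤ f i) ⊎ (∑< n f ≡ 0) → ∀ v → f n ≡ v → (∃[ i ] i < suc n × 1 ≤ f i) ⊎ (∑< n f + f n ≡ 0)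
  go (inj₁ (i , lt , h)) _ _ = inj₁ (i , m≤n⇒m≤1+n lt , h)
  go (inj₂ z) zero    e = inj₂ (cong₂ _+_ z e)
  go (inj₂ z) (suc v) e = inj₁ (n , ≤-refl , subst (1 ≤_) (sym e) (s≤s z≤n))

module Frames {p : ℕ} {{p-nonZero : NonZero p}} (p-prime : Prime p) (m : ℕ) (p≡ : p ≡ 3 + 4 * m) (m≥ : 23 ≤ m) where
  open PrimeField p-prime
  open Functionals p-prime
  open Automorphisms p-prime

  sum-from : ∀ x (f : 𝔽 → ℕ) → ∑ (allFin p) f ≡ ∑< p (λ k → f (x +F [ k ]ₚ))
  sum-from x f = trans (sym (bijection-∑ (finType p) (finType p) (λ i → x +F i) (λ y → y -F x) (λ i → (Fp.grp (x ∷ i ∷ []) (gv 0 :+ gv 1 :+ :- (gv 0)) (gv 1) refl)) (λ y → (Fp.grp (x ∷ y ∷ []) (gv 0 :+ (gv 1 :+ :- (gv 0))) (gv 1) refl)) f))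
    (trans (∑-cong (allFin p) (λ i → cong (λ t → f (x +F t)) (sym ([]-toℕ i)))) (∑-allFin p (λ k → f (x +F [ k ]ₚ))))

  pos-inj : ∀ x {k l} → k < p → l < p → x +F [ k ]ₚ ≡ x +F [ l ]ₚ → k ≡ l
  pos-inj x hk hl e = []-inj hk hl (Fp.⊞-cancelʳ x (trans (+F-comm _ x) (trans e (+F-comm x _))))

  -- The relation 2x + t = m + 2 turns sums of three levels into arithmetic of indices:
  -- if F k is the fibre over x + k, then F i + F j + F k avoids F l whenever i + j + k + m + 2 ≡ l + t (mod p).
  record Frame {d : ℕ} (A : Vec 𝔽 (suc d) → Bool) : Set where
    field
      x        : 𝔽
      L r t    : ℕ
      length≡  : L + 1 ≡ m + r
      r≤4      : r ≤ 4
      t<p      : t < p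
      base     : (x +F x) +F [ t ]ₚ ≡ [ m + 2 ]ₚ
      within   : ∀ y w → A (y Vec.∷ w) ≡ true → ∃[ k ] k ≤ L × y ≡ x +F [ k ]ₚ
      first    : ∃[ w ] A ((x +F [ 0 ]ₚ) Vec.∷ w) ≡ true
      last     : ∃[ w ] A ((x +F [ L ]ₚ) Vec.∷ w) ≡ true
      sum-free : SumFree A
      large    : m * p ^ d ≤ V.size (suc d) A

  module InFrame {d : ℕ} {A : Vec 𝔽 (suc d) → Bool} (Fr : Frame A) where
    open Frame Fr public

    q : ℕ
    q = p ^ d

    F : ℕ → Vec 𝔽 d → Bool
    F k w = A ((x +F [ k ]ₚ) Vec.∷ w)

    f : ℕ → ℕ
    f k = V.size d (F k)

    order≡q : V.order d ≡ q
    order≡q = length-allVecs d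

    f≤q : ∀ k → f k ≤ q
    f≤q k = ≤-trans (V.size≤order d (F k)) (≤-reflexive order≡q)

    full : ∀ {k} → q ≤ f k → ∀ w → F k w ≡ true
    full {k} h = V.size-all d {F k} (≤-trans (≤-reflexive order≡q) h)

    1≤q : 1 ≤ q
    1≤q = m^n>0 p d

    L<p : L < p
    L<p = (lin (L ∷ m ∷ r ∷ p ∷ []) (eql 1 (v0 ⊕ # 1) (v1 ⊕ v2) length≡ ∷ hyp 1 v2 (# 4) r≤4 ∷ eqr 1 v3 (# 3 ⊕ # 4 ⊗ v1) p≡ ∷ hyp 3 (# 23) v1 m≥ ∷ []) 1 (# 1 ⊕ v0) v3)

    total : m * q ≤ ∑< (m + r) f
    total = ≤-trans large (≤-reflexive (trans (∑-allVecs d _) (trans (sum-from x (λ y → V.size d (λ w → A (y Vec.∷ w)))) (go (m≤n⇒∃[o]m+o≡n {m + r} {p} (lin (r ∷ m ∷ p ∷ []) (hyp 1 v0 (# 4) r≤4 ∷ eqr 1 v2 (# 3 ⊕ # 4 ⊗ v1) p≡ ∷ hyp 3 (# 23) v1 m≥ ∷ []) 1 (v1 ⊕ v0) v2))))))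
      where
      go : (∃[ o ] m + r + o ≡ p) → ∑< p f ≡ ∑< (m + r) f
      go (o , eo) = trans (cong (λ n → ∑< n f) (sym eo)) (trans (∑<-split (m + r) o f) (trans (cong (∑< (m + r) f +_) (trans (∑<-cong o (λ i i<o → empty i i<o)) (trans (∑<-const o 0) (*-zeroʳ o)))) (+-identityʳ _)))
        where
        empty : ∀ i → i < o → f (m + r + i) ≡ 0
        empty i i<o = n≤0⇒n≡0 (≮⇒≥ λ h → let (w , hw) = V.size-elem d {F (m + r + i)} h in clash (within _ w hw))
          where clash : (∃[ k ] k ≤ L × x +F [ m + r + i ]ₚ ≡ x +F [ k ]ₚ) → ⊥
                clash (k , k≤ , e) = (refute (m ∷ r ∷ i ∷ k ∷ L ∷ []) (eql 1 (v0 ⊕ v1 ⊕ v2) v3 (pos-inj x (lin (i ∷ o ∷ m ∷ r ∷ p ∷ []) (hyp 1 (# 1 ⊕ v0) v1 i<o ∷ eql 1 (v2 ⊕ v3 ⊕ v1) v4 eo ∷ []) 1 (# 1 ⊕ (v2 ⊕ v3 ⊕ v0)) v4) (≤-<-trans k≤ L<p) e) ∷ hyp 1 v3 v4 k≤ ∷ eql 1 (v4 ⊕ # 1) (v0 ⊕ v1) length≡ ∷ []))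

    free : ∀ i j k l e {u v w} → i + j + k + m + 2 ≡ l + t + e * p → F i u ≡ true → F j v ≡ true → F k w ≡ true → F l ((u +V v) +V w) ≡ false
    free i j k l e {u} {v} {w} eq hu hv hw = ¬true⇒false λ h → sum-free _ _ _ hu hv hw (subst (λ y → A (y Vec.∷ ((u +V v) +V w)) ≡ true) (sym head≡) h)
      where
      regroup : ∀ a b c T → (x +F a) +F (x +F b) +F (x +F c) +F T ≡ x +F ((a +F b +F c) +F ((x +F x) +F T))
      regroup a b c T = (Fp.grp (x ∷ a ∷ b ∷ c ∷ T ∷ []) (gv 0 :+ gv 1 :+ (gv 0 :+ gv 2) :+ (gv 0 :+ gv 3) :+ gv 4) (gv 0 :+ (gv 1 :+ gv 2 :+ gv 3 :+ (gv 0 :+ gv 0 :+ gv 4))) refl)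
      sums : ([ i ]ₚ +F [ j ]ₚ +F [ k ]ₚ) +F ((x +F x) +F [ t ]ₚ) ≡ [ l ]ₚ +F [ t ]ₚ
      sums = trans (cong₂ _+F_ (trans (cong (_+F [ k ]ₚ) ([]-+ i j)) ([]-+ (i + j) k)) base) (trans ([]-+ (i + j + k) (m + 2)) (trans (cong [_]ₚ (lin≡ (i ∷ j ∷ k ∷ m ∷ l ∷ t ∷ e ∷ p ∷ []) (eqn 1 (v0 ⊕ v1 ⊕ v2 ⊕ v3 ⊕ # 2) (v4 ⊕ v5 ⊕ v6 ⊗ v7) eq ∷ []) (v0 ⊕ v1 ⊕ v2 ⊕ (v3 ⊕ # 2)) (v4 ⊕ v5 ⊕ v6 ⊗ v7))) (trans ([]-mod (l + t) e) (sym ([]-+ l t)))))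
      head≡ : (x +F [ i ]ₚ) +F (x +F [ j ]ₚ) +F (x +F [ k ]ₚ) ≡ x +F [ l ]ₚ
      head≡ = Fp.⊞-cancelʳ [ t ]ₚ (trans (regroup [ i ]ₚ [ j ]ₚ [ k ]ₚ [ t ]ₚ) (trans (cong (x +F_) sums) (sym (+F-assoc x [ l ]ₚ [ t ]ₚ))))

    -- One point in each of the levels i and j suffices to move level k off level l.
    apart : ∀ i j k l e {u v} → i + j + k + m + 2 ≡ l + t + e * p → F i u ≡ true → F j v ≡ true → f k + f l ≤ q
    apart i j k l e {u} {v} eq hu hv = ≤-trans (≤-reflexive (cong (_+ f l) (sym (V.size-translate d (F k) (u +V v)))))
      (≤-trans (V.size-disjoint d {V.translate d (F k) (u +V v)} {F l} {λ _ → true} (λ _ _ → refl) (λ _ _ → refl)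
        (λ w h h′ → true≢false (subst (λ t → F l t ≡ true) (V.grp d (w ∷ (u +V v) ∷ []) (gv 0) (gv 1 :+ (gv 0 :+ :- gv 1)) refl) h′) (free i j k l e eq hu hv h)))
        (≤-trans (V.size≤order d (λ _ → true)) (≤-reflexive order≡q)))

    complementary : ∀ {G P : Vec 𝔽 d → Bool} → (∀ w → G w ≡ true → P w ≡ false) → q ≤ V.size d G + V.size d P → ∀ w → P w ≡ false → G w ≡ true
    complementary {G} {P} h le w hw = V.size-full⊆ d {G} {V.∁ d P} (λ w hG → not-intro (h w hG))
      (lin (q ∷ (V.size d G) ∷ (V.size d P) ∷ (V.size d (V.∁ d P)) ∷ (V.order d) ∷ []) (hyp 1 v0 (v1 ⊕ v2) le ∷ eql 1 (v2 ⊕ v3) v4 (V.size-∁ d P) ∷ eql 1 v4 v0 order≡q ∷ []) 1 v3 v1) w (not-intro hw)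

    -- As 0 is in K, the sets K and Y are disjoint, and the sizes make Y the full complement of K;
    -- then K + K = K + K + 0 avoids Y, hence lies in K.
    subgroup : ∀ {K Y : Vec 𝔽 d → Bool} → K 0V ≡ true → (∀ {u v w} → K u ≡ true → K v ≡ true → K w ≡ true → Y ((u +V v) +V w) ≡ false) → q ≤ V.size d K + V.size d Y → V.Closed d K
    subgroup {K} {Y} h0 h le u v hu hv = complementary {K} {Y} (λ w hw → subst (λ t → Y t ≡ false) (V.grp d (w ∷ []) (gv 0 :+ g0 :+ g0) (gv 0) refl) (h hw h0 h0)) le (u +V v)
      (subst (λ t → Y t ≡ false) (V.grp d (u ∷ v ∷ []) (gv 0 :+ gv 1 :+ g0) (gv 0 :+ gv 1) refl) (h hu hv h0))

    -- The first r + 1 levels have partners at distance h > r, disjoint from them; each pair loses a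
    -- full level. Of the m + r levels at most m - 1 full ones remain.
    crowded : ∀ h → r + 1 ≤ h → h + 1 ≤ m → (∀ k → f k + f (k + h) ≤ q) → ⊥
    crowded h lo hi pairs = go (m≤n⇒∃[o]m+o≡n lo) (m≤n⇒∃[o]m+o≡n hi)
      where
      go : (∃[ c ] r + 1 + c ≡ h) → (∃[ e ] h + 1 + e ≡ m) → ⊥
      go (c , refl) (e , ee) = (refute (m ∷ q ∷ (∑< (m + r) f) ∷ (∑< (r + 1 + c + (r + 1) + e) f) ∷ (∑< (r + 1 + c + (r + 1)) f) ∷ s₄ ∷ (∑< (r + 1 + c) f) ∷ s₃ ∷ (∑< (r + 1) f) ∷ s₂ ∷ r ∷ c ∷ e ∷ []) (hyp 1 (v0 ⊗ v1) v2 total ∷ eql 1 v2 v3 (cong (λ n → ∑< n f) (lin≡ (m ∷ r ∷ c ∷ e ∷ []) (eqn 1 v0 (v1 ⊕ # 1 ⊕ v2 ⊕ # 1 ⊕ v3) (sym ee) ∷ []) (v0 ⊕ v1) (v1 ⊕ # 1 ⊕ v2 ⊕ (v1 ⊕ # 1) ⊕ v3))) ∷ eql 1 v3 (v4 ⊕ v5) (∑<-split (r + 1 + c + (r + 1)) e f) ∷ eql 1 v4 (v6 ⊕ v7) (∑<-split (r + 1 + c) (r + 1) f) ∷ eql 1 v6 (v8 ⊕ v9) (∑<-split (r + 1) c f) ∷ hyp 1 (v8 ⊕ v7) ((v10 ⊕ # 1) ⊗ v1) both ∷ hyp 1 v9 (v11 ⊗ v1) (∑<-bound c q (λ i _ →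 f≤q _)) ∷ hyp 1 v5 (v12 ⊗ v1) (∑<-bound e q (λ i _ → f≤q _)) ∷ eql 1 ((v10 ⊕ # 1 ⊕ v11 ⊕ # 1 ⊕ v12) ⊗ v1) (v0 ⊗ v1) (cong (_* q) ee) ∷ hyp 1 (# 1) v1 1≤q ∷ []))
        where
        s₂ = ∑< c (λ i → f (r + 1 + i))
        s₃ = ∑< (r + 1) (λ i → f (r + 1 + c + i))
        s₄ = ∑< e (λ i → f (r + 1 + c + (r + 1) + i))
        both : ∑< (r + 1) f + s₃ ≤ (r + 1) * q
        both = ≤-trans (≤-reflexive (sym (∑<-+ (r + 1) f _))) (∑<-bound (r + 1) q (λ i _ → subst (λ t → f i + f t ≤ q) (+-comm i (r + 1 + c)) (pairs i)))

    -- Were r + 1 consecutive levels empty, only m - 1 would be left for mq elements.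
    populated : ∀ w → w + r ≤ L → ∃[ j ] j ≤ r × (∃[ u ] F (w + j) u ≡ true)
    populated w le = go (search< (λ i → f (w + i)) (r + 1)) (m≤n⇒∃[o]m+o≡n {w + (r + 1)} {m + r} (lin (w ∷ r ∷ L ∷ m ∷ []) (hyp 1 (v0 ⊕ v1) v2 le ∷ eql 1 (v2 ⊕ # 1) (v3 ⊕ v1) length≡ ∷ []) 1 (v0 ⊕ (v1 ⊕ # 1)) (v3 ⊕ v1)))
      where
      go : (∃[ i ] i < r + 1 × 1 ≤ f (w + i)) ⊎ (∑< (r + 1) (λ i → f (w + i)) ≡ 0) → (∃[ o ] w + (r + 1) + o ≡ m + r) → ∃[ j ] j ≤ r × (∃[ u ] F (w + j) u ≡ true)
      go (inj₁ (i , i< , h)) _ = i , (lin (i ∷ r ∷ []) (hyp 1 (# 1 ⊕ v0) (v1 ⊕ # 1) i< ∷ []) 1 v0 v1) , V.size-elem d {F (w + i)} h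
      go (inj₂ z) (o , eo) = ⊥-elim (refute (m ∷ q ∷ (∑< (m + r) f) ∷ (∑< (w + (r + 1) + o) f) ∷ (∑< (w + (r + 1)) f) ∷ s₃ ∷ (∑< w f) ∷ s₂ ∷ w ∷ o ∷ []) (hyp 1 (v0 ⊗ v1) v2 total ∷ eql 1 v2 v3 (cong (λ n → ∑< n f) (sym eo)) ∷ eql 1 v3 (v4 ⊕ v5) (∑<-split (w + (r + 1)) o f) ∷ eql 1 v4 (v6 ⊕ v7) (∑<-split w (r + 1) f) ∷ eql 1 v7 (# 0) z ∷ hyp 1 v6 (v8 ⊗ v1) (∑<-bound w q (λ i _ → f≤q i)) ∷ hyp 1 v5 (v9 ⊗ v1) (∑<-bound o q (λ i _ → f≤q _)) ∷ eql 1 ((v8 ⊕ v9 ⊕ # 1) ⊗ v1) (v0 ⊗ v1) (cong (_* q) (lin≡ (w ∷ r ∷ o ∷ m ∷ []) (eqn 1 (v0 ⊕ (v1 ⊕ # 1) ⊕ v2) (v3 ⊕ v1) eo ∷ []) (v0 ⊕ v2 ⊕ # 1) v3)) ∷ hyp 1 (# 1) v1 1≤q ∷ []))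
        where
        s₂ = ∑< (r + 1) (λ i → f (w + i))
        s₃ = ∑< o (λ i → f (w + (r + 1) + i))

    -- Two nonempty levels α, β shift every level k away from level k + h with h = α + β + m + 2 - t.
    collision : ∀ α β h {u v} → F α u ≡ true → F β v ≡ true → α + β + m + 2 ≡ h + t → r + 1 ≤ h → h + 1 ≤ m → ⊥
    collision α β h hu hv eq lo hi = crowded h lo hi (λ k → apart α β k (k + h) 0 (lin≡ (α ∷ β ∷ m ∷ h ∷ t ∷ k ∷ p ∷ []) (eqn 1 (v0 ⊕ v1 ⊕ v2 ⊕ # 2) (v3 ⊕ v4) eq ∷ []) (v0 ⊕ v1 ⊕ v5 ⊕ v2 ⊕ # 2) (v5 ⊕ v3 ⊕ v4 ⊕ # 0 ⊗ v6)) hu hv)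

    -- `collision` needs a distance h between r + 1 and m - 1. The pair of levels (0, 0) gives h = m
    -- + 2 - t. For larger t one level 0 is replaced by a nonempty level among r + 1 consecutive
    -- ones, and near the upper end of the range the pair consists of L and such a level.
    t≥3-impossible : 3 ≤ t → t ≤ 2 * m + r + 1 → ⊥
    t≥3-impossible t≥ t≤ = go (t + r ≤? m + 1) (t + r ≤? 2 * m)
      where
      go : Dec (t + r ≤ m + 1) → Dec (t + r ≤ 2 * m) → ⊥
      go (yes h₁) _ = let (h , eh) = m≤n⇒∃[o]m+o≡n {t} {m + 2} (lin (t ∷ r ∷ m ∷ []) (hyp 1 (v0 ⊕ v1) (v2 ⊕ # 1) h₁ ∷ []) 1 v0 (v2 ⊕ # 2)) in
        collision 0 0 h (proj₂ first) (proj₂ first) (lin≡ (m ∷ t ∷ h ∷ []) (eqn 1 (v0 ⊕ # 2) (v1 ⊕ v2) (sym eh) ∷ []) (# 0 ⊕ # 0 ⊕ v0 ⊕ # 2) (v2 ⊕ v1)) (lin (m ∷ t ∷ h ∷ r ∷ []) (eqr 1 (v1 ⊕ v2) (v0 ⊕ # 2) eh ∷ hyp 1 (v1 ⊕ v3) (v0 ⊕ # 1) h₁ ∷ []) 1 (v3 ⊕ # 1) v2) (lin (t ∷ h ∷ m ∷ []) (eql 1 (v0 ⊕ v1) (v2 ⊕ # 2) eh ∷ hyp 1 (# 3) v0 t≥ ∷ []) 1 (v1 ⊕ # 1) v2)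
      go (no h₁) (yes h₂) = mid (m≤n⇒∃[o]m+o≡n {m + 1} {t + r} (≰⇒≥ h₁))
        where
        mid : (∃[ w ] m + 1 + w ≡ t + r) → ⊥
        mid (w , ew) = let (j , j≤ , u , hu) = populated w (lin (m ∷ w ∷ t ∷ r ∷ L ∷ []) (eql 1 (v0 ⊕ # 1 ⊕ v1) (v2 ⊕ v3) ew ∷ hyp 1 (v2 ⊕ v3) (# 2 ⊗ v0) h₂ ∷ eqr 1 (v4 ⊕ # 1) (v0 ⊕ v3) length≡ ∷ []) 1 (v1 ⊕ v3) v4) in
          collision 0 (w + j) (r + 1 + j) (proj₂ first) hu (lin≡ (m ∷ w ∷ t ∷ r ∷ j ∷ []) (eqn 1 (v0 ⊕ # 1 ⊕ v1) (v2 ⊕ v3) ew ∷ []) (# 0 ⊕ (v1 ⊕ v4) ⊕ v0 ⊕ # 2) (v3 ⊕ # 1 ⊕ v4 ⊕ v2)) (lin (r ∷ j ∷ []) [] 1 (v0 ⊕ # 1) (v0 ⊕ # 1 ⊕ v1)) (lin (j ∷ r ∷ m ∷ []) (hyp 1 v0 v1 j≤ ∷ hyp 2 v1 (# 4) r≤4 ∷ hyp 1 (# 23) v2 m≥ ∷ []) 1 (v1 ⊕ # 1 ⊕ v0 ⊕ # 1) v2)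
      go (no h₁) (no h₂) = let (s , es) = m≤n⇒∃[o]m+o≡n t≤
                               (j , j≤ , u , hu) = populated (r + 1) (lin (m ∷ r ∷ L ∷ []) (eqr 1 (v2 ⊕ # 1) (v0 ⊕ v1) length≡ ∷ hyp 1 v1 (# 4) r≤4 ∷ hyp 1 (# 23) v0 m≥ ∷ []) 1 (v1 ⊕ # 1 ⊕ v1) v2) in
          collision L (r + 1 + j) (s + (r + 1 + j)) (proj₂ last) hu (lin≡ (m ∷ r ∷ t ∷ s ∷ L ∷ j ∷ []) (eqn 1 (# 2 ⊗ v0 ⊕ v1 ⊕ # 1) (v2 ⊕ v3) (sym es) ∷ eqn 1 (v4 ⊕ # 1) (v0 ⊕ v1) length≡ ∷ []) (v4 ⊕ (v1 ⊕ # 1 ⊕ v5) ⊕ v0 ⊕ # 2) (v3 ⊕ (v1 ⊕ # 1 ⊕ v5) ⊕ v2)) (lin (r ∷ s ∷ j ∷ []) [] 1 (v0 ⊕ # 1) (v1 ⊕ (v0 ⊕ # 1 ⊕ v2)))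
            (lin (t ∷ s ∷ m ∷ r ∷ j ∷ []) (eql 1 (v0 ⊕ v1) (# 2 ⊗ v2 ⊕ v3 ⊕ # 1) es ∷ hyp 1 (# 1 ⊕ # 2 ⊗ v2) (v0 ⊕ v3) (≰⇒> h₂) ∷ hyp 1 v4 v3 j≤ ∷ hyp 4 v3 (# 4) r≤4 ∷ hyp 1 (# 23) v2 m≥ ∷ []) 1 (v1 ⊕ (v3 ⊕ # 1 ⊕ v4) ⊕ # 1) v2)

  double-inj : ∀ {y z : 𝔽} → y +F y ≡ z +F z → y ≡ z
  double-inj {y} {z} e = *F-cancelˡ {[ 2 ]ₚ} 2≢0 (trans (twice y) (trans e (sym (twice z))))
    where
    2≢0 : [ 2 ]ₚ ≢ [ 0 ]ₚ
    2≢0 e = 0≢1+n (sym ([]-inj (lin (m ∷ p ∷ []) (eqr 1 v1 (# 3 ⊕ # 4 ⊗ v0) p≡ ∷ []) 1 (# 1 ⊕ # 2) v1) (lin (m ∷ p ∷ []) (eqr 1 v1 (# 3 ⊕ # 4 ⊗ v0) p≡ ∷ []) 1 (# 1 ⊕ # 0) v1) e))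
    twice : ∀ y → [ 2 ]ₚ *F y ≡ y +F y
    twice y = trans (cong (_*F y) (sym ([]-+ 1 1))) (trans (*F-distribʳ y [ 1 ]ₚ [ 1 ]ₚ) (cong₂ _+F_ (*F-idˡ y) (*F-idˡ y)))

  -- Reflection makes -(x + L) the first element, which changes the offset t into 2r - 1 - t modulo
  -- p.
  negateFrame : ∀ {d} {A : Vec 𝔽 (suc d) → Bool} (Fr : Frame A) → ∀ t′ e → t′ < p → Frame.t Fr + t′ + 1 ≡ 2 * Frame.r Fr + e * p → Frame (transport A negAut)
  negateFrame {d} {A} Fr t′ e t′<p et = record
    { x = x′ ; L = L ; r = r ; t = t′ ; length≡ = length≡ ; r≤4 = r≤4 ; t<p = t′<p ; base = base′
    ; within = λ y w h → turn y (within (-F y) (-V w) h)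
    ; first = let (w , h) = last in -V w , flip₀ w h
    ; last = let (w , h) = first in -V w , flipL w h
    ; sum-free = sumFree-transport A negAut sum-free
    ; large = ≤-trans large (≤-reflexive (sym (size-transport A negAut))) }
    where
    open Frame Fr
    x′ : 𝔽
    x′ = -F (x +F [ L ]ₚ)
    negneg : ∀ (w : Vec 𝔽 d) → w ≡ -V (-V w)
    negneg w = V.grp d (w ∷ []) (gv 0) (:- (:- gv 0)) refl
    unneg : ∀ a → a ≡ -F (-F a)
    unneg a = (Fp.grp (a ∷ []) (gv 0) (:- (:- (gv 0))) refl)
    flip : ∀ a b l → b +F a ≡ l → x +F b ≡ -F (-F (x +F l) +F a)
    flip a b l refl = (Fp.grp (x ∷ b ∷ a ∷ []) (gv 0 :+ gv 1) (:- (:- (gv 0 :+ (gv 1 :+ gv 2)) :+ gv 2)) refl)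
    flip₀ : ∀ w → A ((x +F [ L ]ₚ) Vec.∷ w) ≡ true → A (-F (x′ +F [ 0 ]ₚ) Vec.∷ (-V (-V w))) ≡ true
    flip₀ w h = subst₂ (λ y w → A (y Vec.∷ w) ≡ true) (flip [ 0 ]ₚ [ L ]ₚ [ L ]ₚ (trans ([]-+ L 0) (cong [_]ₚ (+-identityʳ L)))) (negneg w) h
    flipL : ∀ w → A ((x +F [ 0 ]ₚ) Vec.∷ w) ≡ true → A (-F (x′ +F [ L ]ₚ) Vec.∷ (-V (-V w))) ≡ true
    flipL w h = subst₂ (λ y w → A (y Vec.∷ w) ≡ true) (flip [ L ]ₚ [ 0 ]ₚ [ L ]ₚ ([]-+ 0 L)) (negneg w) h
    turn : ∀ y → (∃[ k ] k ≤ L × -F y ≡ x +F [ k ]ₚ) → ∃[ k ] k ≤ L × y ≡ x′ +F [ k ]ₚ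
    turn y (k , k≤ , ey) = let (o , eo) = m≤n⇒∃[o]m+o≡n k≤ in
      o , (lin (k ∷ o ∷ L ∷ []) (eql 1 (v0 ⊕ v1) v2 eo ∷ []) 1 v1 v2) , trans (unneg y) (trans (cong (λ t → -F t) (trans ey (flip [ o ]ₚ [ k ]ₚ [ L ]ₚ (trans ([]-+ k o) (cong [_]ₚ eo))))) (sym (unneg _)))
    sums : [ t ]ₚ +F [ t′ ]ₚ ≡ ([ m + 2 ]ₚ +F [ m + 2 ]ₚ) +F ([ L ]ₚ +F [ L ]ₚ)
    sums = trans ([]-+ t t′) (trans (sym ([]-+p (t + t′))) (trans (cong [_]ₚ (lin≡ (t ∷ t′ ∷ r ∷ e ∷ p ∷ m ∷ L ∷ []) (eqn 1 (v0 ⊕ v1 ⊕ # 1) (# 2 ⊗ v2 ⊕ v3 ⊗ v4) et ∷ eqn 2 (v5 ⊕ v2) (v6 ⊕ # 1) (sym length≡) ∷ eqn 1 v4 (# 3 ⊕ # 4 ⊗ v5) p≡ ∷ []) (v0 ⊕ v1 ⊕ v4) (v5 ⊕ # 2 ⊕ (v5 ⊕ # 2) ⊕ (v6 ⊕ v6) ⊕ v3 ⊗ v4)))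
      (trans ([]-mod (m + 2 + (m + 2) + (L + L)) e) (trans (sym ([]-+ (m + 2 + (m + 2)) (L + L))) (cong₂ _+F_ (sym ([]-+ (m + 2) (m + 2))) (sym ([]-+ L L)))))))
    reflect : ∀ x l T T′ M → (x +F x) +F T ≡ M → T +F T′ ≡ (M +F M) +F (l +F l) → (-F (x +F l) +F (-F (x +F l))) +F T′ ≡ M
    reflect x l T T′ M refl e₂ = trans (Fp.grp (x ∷ l ∷ T′ ∷ T ∷ []) (:- (gv 0 :+ gv 1) :+ :- (gv 0 :+ gv 1) :+ gv 2) (gv 3 :+ gv 2 :+ :- (gv 0 :+ gv 0 :+ gv 3 :+ (gv 1 :+ gv 1))) refl)
      (trans (cong (_-F (((x +F x) +F T) +F (l +F l))) e₂) (Fp.grp (x ∷ T ∷ l ∷ []) (gv 0 :+ gv 0 :+ gv 1 :+ (gv 0 :+ gv 0 :+ gv 1) :+ (gv 2 :+ gv 2) :+ :- (gv 0 :+ gv 0 :+ gv 1 :+ (gv 2 :+ gv 2))) (gv 0 :+ gv 0 :+ gv 1) refl))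
    base′ : (x′ +F x′) +F [ t′ ]ₚ ≡ [ m + 2 ]ₚ
    base′ = reflect x [ L ]ₚ [ t ]ₚ [ t′ ]ₚ [ m + 2 ]ₚ base sums

  shearFrame : ∀ {d} {A : Vec 𝔽 (suc d) → Bool} (Fr : Frame A) τ → Frame (transport A (shear τ))
  shearFrame {d} {A} Fr τ = record
    { x = x ; L = L ; r = r ; t = t ; length≡ = length≡ ; r≤4 = r≤4 ; t<p = t<p ; base = base
    ; within = λ y w h → within y _ h
    ; first = let (w , h) = first in w +V ((x +F [ 0 ]ₚ) ·V τ) , subst (λ w → A ((x +F [ 0 ]ₚ) Vec.∷ w) ≡ true) (back w ((x +F [ 0 ]ₚ) ·V τ)) h
    ; last = let (w , h) = last in w +V ((x +F [ L ]ₚ) ·V τ) , subst (λ w → A ((x +F [ L ]ₚ) Vec.∷ w) ≡ true) (back w ((x +F [ L ]ₚ) ·V τ)) h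
    ; sum-free = sumFree-transport A (shear τ) sum-free
    ; large = ≤-trans large (≤-reflexive (sym (size-transport A (shear τ)))) }
    where
    open Frame Fr
    back : ∀ (w v : Vec 𝔽 d) → w ≡ (w +V v) +V (-V v)
    back w v = V.grp d (w ∷ v ∷ []) (gv 0) (gv 0 :+ gv 1 :+ :- gv 1) refl

  -- A shear by τ moves the level at height y by yτ, so any point of a level at nonzero height can
  -- be brought to 0.
  centre : ∀ {d} {A : Vec 𝔽 (suc d) → Bool} (Fr : Frame A) k u → Frame.x Fr +F [ k ]ₚ ≢ [ 0 ]ₚ → InFrame.F Fr k u ≡ true →
           Σ (Vec 𝔽 d) λ τ → InFrame.F (shearFrame Fr τ) k 0V ≡ true
  centre {d} {A} Fr k u ≢0 hu = let (c , hc) = inverse _ ≢0 in (c ·V (-V u)) , subst (λ w → A ((x +F [ k ]ₚ) Vec.∷ w) ≡ true) (at c hc) hu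
    where
    open Frame Fr
    at : ∀ c → c *F (x +F [ k ]ₚ) ≡ [ 1 ]ₚ → u ≡ 0V +V (-V ((x +F [ k ]ₚ) ·V (c ·V (-V u))))
    at c hc = trans (V.grp d (u ∷ []) (gv 0) (g0 :+ :- (:- gv 0)) refl) (cong (λ t → 0V +V (-V t)) (sym (trans (sym (·V-* (x +F [ k ]ₚ) c (-V u))) (trans (cong (_·V (-V u)) (trans (*F-comm _ c) hc)) (·V-1 (-V u))))))

-- The types of the theorem for a variable p; with the literal 3 + 4m, arithmetic in F_p would unfold during conversion.
module Targets {p : ℕ} {{_ : NonZero p}} (m : ℕ) where

  a₀′ aT2′ aT5′ : Fin p
  a₀′  = (-F [ 3 * m + 1 ]ₚ) *F invF [ 2 ]ₚ
  aT2′ = [ 3 * m ]ₚ *F invF ([ 1 ]ₚ -F [ 3 ]ₚ)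
  aT5′ = [ m + 2 ]ₚ *F invF [ 2 ]ₚ

  Cuboid′ : ∀ {n'} → Vec (Fin p) (suc n') → Set
  Cuboid′ x = InInterval a₀′ (a₀′ +F [ m ]ₚ) (head x)

  Slab : Fin p → ∀ {n'} → Vec (Fin p) (suc n') → Set
  Slab a x = InInterval a (a +F [ m ∸ 1 ]ₚ) (head x)

  Type1′ : ∀ {n'} → (Vec (Fin p) (suc n') → Bool) → Set
  Type1′ A = Σ (Fin p) λ a →
    InInterval [ 1 ]ₚ [ 1 ]ₚ (a -F [ 3 ]ₚ *F (a +F [ m ∸ 1 ]ₚ)) ×
    Isomorphic A (Slab a)

  Body2 : ∀ {n'} → (Vec (Fin p) n' → Bool) → Vec (Fin p) (suc n') → Set
  Body2 V x =
    ((head x ≡ aT2′) × (V (tail x) ≡ false)) ⊎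
    (InInterval (aT2′ +F [ 1 ]ₚ) (aT2′ +F [ m ∸ 1 ]ₚ) (head x)) ⊎
    ((head x ≡ aT2′ +F [ m ]ₚ) × (V (tail x) ≡ true))

  Type2′ : ∀ {n'} → (Vec (Fin p) (suc n') → Bool) → Set
  Type2′ {n'} A = (1 ≤ n') × Σ (Vec (Fin p) n' → Bool) λ V →
    IsProperSubspace V ×
    Isomorphic A (Body2 V)

  A₀′ : ∀ {s} → (Vec (Fin p) s → Bool) → Fin p → Vec (Fin p) s → Set
  A₀′ P h y =
    ((h ≡ aT5′ -F [ 1 ]ₚ) × (y ≡ 0V)) ⊎
    ((h ≡ aT5′) × (P y ≡ false)) ⊎
    (InInterval (aT5′ +F [ 1 ]ₚ) (aT5′ +F [ m ∸ 2 ]ₚ) h) ⊎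
    ((h ≡ aT5′ +F [ m ∸ 1 ]ₚ) × ¬ (y ≡ 0V)) ⊎
    ((h ≡ aT5′ +F [ m ]ₚ) × (P y ≡ true))

  Body5 : ∀ {n'} s {t} (e : s + t ≡ n') → (Vec (Fin p) s → Bool) → Vec (Fin p) (suc n') → Set
  Body5 s e P x = A₀′ P (head x) (take s (cast (sym e) (tail x)))

  Type5′ : ∀ {n'} → (Vec (Fin p) (suc n') → Bool) → Set
  Type5′ {n'} A = Σ ℕ λ s → Σ ℕ λ t → Σ (s + t ≡ n') λ e →
    Σ (Vec (Fin p) s → Bool) λ P →
      (∃[ y ] P y ≡ true) ×
      (∀ x y z → P x ≡ true → P y ≡ true → P z ≡ true → ¬ ((x +V y) +V z ≡ 0V)) ×
      Isomorphic A (Body5 s e P)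

  Outcome : ∀ {n'} → (Vec (Fin p) (suc n') → Bool) → Set
  Outcome A = IsoToSubset A Cuboid′ ⊎ Type1′ A ⊎ Type2′ A ⊎ Type5′ A

-- From a frame to the extremal cuboid and to types 1 and 2

module Outcomes {p : ℕ} {{p-nonZero : NonZero p}} (p-prime : Prime p) (m : ℕ) (p≡ : p ≡ 3 + 4 * m) (m≥ : 23 ≤ m) where
  open PrimeField p-prime
  open Functionals p-prime
  open Automorphisms p-prime
  open Frames p-prime m p≡ m≥
  open Targets {p} m

  outcome-transport : ∀ {d} (A : Vec 𝔽 (suc d) → Bool) f → Outcome (transport A f) → Outcome A
  outcome-transport A f (inj₁ h) = inj₁ (isoToSubset-transport A f {Cuboid′} h)
  outcome-transport A f (inj₂ (inj₁ (a , c , h))) = inj₂ (inj₁ (a , c , iso-transport A f {Slab a} h))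
  outcome-transport A f (inj₂ (inj₂ (inj₁ (n , V , c , h)))) = inj₂ (inj₂ (inj₁ (n , V , c , iso-transport A f {Body2 V} h)))
  outcome-transport A f (inj₂ (inj₂ (inj₂ (s , t , e , P , c , c′ , h)))) = inj₂ (inj₂ (inj₂ (s , t , e , P , c , c′ , iso-transport A f {Body5 s e P} h)))

  interval-elim : ∀ {x b b′ y} lo n → b ≡ x +F [ lo ]ₚ → b′ ≡ x +F [ lo + n ]ₚ → n < p → InInterval b b′ y → ∃[ k ] k ≤ n × y ≡ x +F [ lo + k ]ₚ
  interval-elim {x} {b} {b′} {y} lo n eb eb′ n<p h = toℕ (y -F b) , ≤-trans h (≤-reflexive (trans (cong toℕ width) (toℕ-[]< n<p))) ,
      trans (back y b) (trans (cong₂ _+F_ eb (sym ([]-toℕ (y -F b)))) (trans (+F-assoc x _ _) (cong (x +F_) ([]-+ lo (toℕ (y -F b))))))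
    where
    back : ∀ y b → y ≡ b +F (y -F b)
    back y b = (Fp.grp (y ∷ b ∷ []) (gv 0) (gv 1 :+ (gv 0 :+ :- (gv 1))) refl)
    gap : ∀ x l n → x +F (l +F n) -F (x +F l) ≡ n
    gap x l n = (Fp.grp (x ∷ l ∷ n ∷ []) (gv 0 :+ (gv 1 :+ gv 2) :+ :- (gv 0 :+ gv 1)) (gv 2) refl)
    width : b′ -F b ≡ [ n ]ₚ
    width = trans (cong₂ _-F_ (trans eb′ (cong (x +F_) (sym ([]-+ lo n)))) eb) (gap x [ lo ]ₚ [ n ]ₚ)

  interval-intro : ∀ {x b b′ y} lo n k → b ≡ x +F [ lo ]ₚ → b′ ≡ x +F [ lo + n ]ₚ → n < p → k ≤ n → y ≡ x +F [ lo + k ]ₚ → InInterval b b′ y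
  interval-intro {x} {b} {b′} {y} lo n k eb eb′ n<p k≤n ey = ≤-trans (≤-reflexive (trans (cong toℕ (width k ey)) (toℕ-[]< (≤-<-trans k≤n n<p)))) (≤-trans k≤n (≤-reflexive (sym (trans (cong toℕ (width n eb′)) (toℕ-[]< n<p)))))
    where
    gap : ∀ x l n → x +F (l +F n) -F (x +F l) ≡ n
    gap x l n = (Fp.grp (x ∷ l ∷ n ∷ []) (gv 0 :+ (gv 1 :+ gv 2) :+ :- (gv 0 :+ gv 1)) (gv 2) refl)
    width : ∀ {z} n → z ≡ x +F [ lo + n ]ₚ → z -F b ≡ [ n ]ₚ
    width n e = trans (cong₂ _-F_ (trans e (cong (x +F_) (sym ([]-+ lo n)))) eb) (gap x [ lo ]ₚ [ n ]ₚ)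

  small : ∀ {k} → k ≤ m + 4 → k < p
  small {k} h = (lin (k ∷ m ∷ p ∷ []) (hyp 1 v0 (v1 ⊕ # 4) h ∷ eqr 1 v2 (# 3 ⊕ # 4 ⊗ v1) p≡ ∷ hyp 3 (# 23) v1 m≥ ∷ []) 1 (# 1 ⊕ v0) v2)

  []≢0 : ∀ {k} → 1 ≤ k → k < p → [ k ]ₚ ≢ [ 0 ]ₚ
  []≢0 k≥ k<p e = 1+n≰n (subst (1 ≤_) ([]-inj k<p (lin (m ∷ p ∷ []) (eqr 1 v1 (# 3 ⊕ # 4 ⊗ v0) p≡ ∷ []) 1 (# 1 ⊕ # 0) v1) e) k≥)

  half : ∀ c → c *F invF [ 2 ]ₚ +F c *F invF [ 2 ]ₚ ≡ c
  half c = trans (sym (*F-distribˡ c _ _)) (trans (cong (c *F_) (trans (sym (cong₂ _+F_ (*F-idˡ _) (*F-idˡ _))) (trans (sym (*F-distribʳ (invF [ 2 ]ₚ) [ 1 ]ₚ [ 1 ]ₚ))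
    (trans (cong (_*F invF [ 2 ]ₚ) ([]-+ 1 1)) (invF-spec [ 2 ]ₚ ([]≢0 (s≤s z≤n) (small (lin (m ∷ []) (hyp 1 (# 23) v0 m≥ ∷ []) 1 (# 2) (v0 ⊕ # 4))))))))) (trans (*F-comm c [ 1 ]ₚ) (*F-idˡ c)))

  triple : ∀ y → [ 3 ]ₚ *F y ≡ y +F y +F y
  triple y = trans (cong (_*F y) (sym ([]-+ 2 1))) (trans (*F-distribʳ y [ 2 ]ₚ [ 1 ]ₚ) (cong₂ _+F_ (trans (cong (_*F y) (sym ([]-+ 1 1))) (trans (*F-distribʳ y [ 1 ]ₚ [ 1 ]ₚ) (cong₂ _+F_ (*F-idˡ y) (*F-idˡ y)))) (*F-idˡ y)))

  []-neg : ∀ {a b} → a + b ≡ p → -F [ a ]ₚ ≡ [ b ]ₚ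
  []-neg {a} {b} e = Fp.⊞-cancelʳ [ a ]ₚ (trans (trans (+F-comm (-F [ a ]ₚ) [ a ]ₚ) (+F-invʳ [ a ]ₚ)) (sym (trans ([]-+ b a) (trans (cong [_]ₚ (trans (+-comm b a) e)) []-p))))

  -- From (1 - 3)a = 3m one gets 2a = -3m = m + 3 in F_p. The starting points are compared through
  -- their doubles because a frame determines x through 2x.
  aT2-double : aT2′ +F aT2′ ≡ [ m + 3 ]ₚ
  aT2-double = flip aT2′ [ 3 * m ]ₚ [ m + 3 ]ₚ key ([]-neg {3 * m} {m + 3} (lin≡ (m ∷ p ∷ []) (eqn 1 (# 3 ⊕ # 4 ⊗ v0) v1 (sym p≡) ∷ []) (# 3 ⊗ v0 ⊕ (v0 ⊕ # 3)) v1))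
    where
    c : 𝔽
    c = [ 1 ]ₚ -F [ 3 ]ₚ
    zero-diff : ∀ a b → a -F b ≡ [ 0 ]ₚ → a ≡ b
    zero-diff a b e = Fp.⊞-cancelʳ (-F b) (trans e (sym (+F-invʳ b)))
    c≢0 : c ≢ [ 0 ]ₚ
    c≢0 e = absurd ([]-inj (small (lin (m ∷ []) (hyp 1 (# 23) v0 m≥ ∷ []) 1 (# 1) (v0 ⊕ # 4))) (small (lin (m ∷ []) (hyp 1 (# 23) v0 m≥ ∷ []) 1 (# 3) (v0 ⊕ # 4))) (zero-diff [ 1 ]ₚ [ 3 ]ₚ e))
      where absurd : 1 ≡ 3 → ⊥
            absurd ()
    key : aT2′ -F (aT2′ +F aT2′ +F aT2′) ≡ [ 3 * m ]ₚ
    key = trans (cong₂ _-F_ (sym (trans (*F-comm aT2′ [ 1 ]ₚ) (*F-idˡ aT2′))) (trans (sym (triple aT2′)) (*F-comm [ 3 ]ₚ aT2′))) (trans (cong (aT2′ *F [ 1 ]ₚ +F_) (sym (*F-neg aT2′ [ 3 ]ₚ)))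
      (trans (sym (*F-distribˡ aT2′ [ 1 ]ₚ (-F [ 3 ]ₚ))) (trans (*F-assoc [ 3 * m ]ₚ (invF c) c) (trans (cong ([ 3 * m ]ₚ *F_) (trans (*F-comm (invF c) c) (invF-spec c c≢0))) (trans (*F-comm [ 3 * m ]ₚ [ 1 ]ₚ) (*F-idˡ _))))))
    flip : ∀ y c b → y -F (y +F y +F y) ≡ c → -F c ≡ b → y +F y ≡ b
    flip y c b refl e = trans (Fp.grp (y ∷ []) (gv 0 :+ gv 0) (:- (gv 0 :+ :- (gv 0 :+ gv 0 :+ gv 0))) refl) e

  -- Twice a₀ is -(3m + 1) = m + 2, so t = 0 means x = a₀, and more generally x = a₀ + o if t + 2o =
  -- 0 in F_p.
  cuboid : ∀ {d} {A : Vec 𝔽 (suc d) → Bool} (Fr : Frame A) o e → Frame.L Fr + o ≤ m → Frame.t Fr + 2 * o ≡ e * p → IsoToSubset A Cuboid′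
  cuboid {d} {A} Fr o e le et = idAut , λ { (y Vec.∷ w) h → let (k , k≤ , ey) = within y w h in
      interval-intro {a₀′} 0 m (o + k) (sym (Fp.⊞-idʳ a₀′)) refl (small (lin (m ∷ []) [] 1 v0 (v0 ⊕ # 4))) (lin (k ∷ L ∷ o ∷ m ∷ []) (hyp 1 v0 v1 k≤ ∷ hyp 1 (v1 ⊕ v2) v3 le ∷ []) 1 (v2 ⊕ v0) v3)
        (trans ey (trans (cong (_+F [ k ]ₚ) x≡) (trans (+F-assoc a₀′ _ _) (cong (a₀′ +F_) ([]-+ o k))))) }
    where
    open Frame Fr
    a₀-double : a₀′ +F a₀′ ≡ [ m + 2 ]ₚ
    a₀-double = trans (half (-F [ 3 * m + 1 ]ₚ)) ([]-neg {3 * m + 1} {m + 2} (lin≡ (m ∷ p ∷ []) (eqn 1 (# 3 ⊕ # 4 ⊗ v0) v1 (sym p≡) ∷ []) (# 3 ⊗ v0 ⊕ # 1 ⊕ (v0 ⊕ # 2)) v1))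
    shuffle : ∀ a o t → (a +F o) +F (a +F o) +F t ≡ (a +F a) +F (t +F (o +F o))
    shuffle a o t = (Fp.grp (a ∷ o ∷ t ∷ []) (gv 0 :+ gv 1 :+ (gv 0 :+ gv 1) :+ gv 2) (gv 0 :+ gv 0 :+ (gv 2 :+ (gv 1 :+ gv 1))) refl)
    x≡ : x ≡ a₀′ +F [ o ]ₚ
    x≡ = double-inj (Fp.⊞-cancelʳ [ t ]ₚ (trans base (sym (trans (shuffle a₀′ [ o ]ₚ [ t ]ₚ) (trans (cong₂ _+F_ a₀-double
      (trans (cong ([ t ]ₚ +F_) ([]-+ o o)) (trans ([]-+ t (o + o)) (trans (cong [_]ₚ (lin≡ (t ∷ o ∷ e ∷ p ∷ []) (eqn 1 (v0 ⊕ # 2 ⊗ v1) (v2 ⊗ v3) et ∷ []) (v0 ⊕ (v1 ⊕ v1)) (# 0 ⊕ v2 ⊗ v3))) ([]-mod 0 e))))) (Fp.⊞-idʳ _))))))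

  -- There are just m levels for mq elements, so all are full. In F_p the expression a - 3(a + m -
  -- 1) with a = x equals t + 4, which is 1 for t = -3.
  type1 : ∀ {d} {A : Vec 𝔽 (suc d) → Bool} (Fr : Frame A) → Frame.r Fr ≡ 0 → Frame.t Fr + 3 ≡ p → Type1′ A
  type1 {d} {A} Fr r≡0 et = x , ≤-reflexive (cong (λ z → toℕ (z -F [ 1 ]ₚ)) cond) , idAut , λ { (y Vec.∷ w) → fwd y w , bwd y w }
    where
    open InFrame Fr
    m-1 : (m ∸ 1) + 1 ≡ m
    m-1 = m∸n+n≡m (lin (m ∷ []) (hyp 1 (# 23) v0 m≥ ∷ []) 1 (# 1) v0)
    shuffle : ∀ x n t s → (x +F x) +F t ≡ s → t +F [ 3 ]ₚ ≡ [ 0 ]ₚ → x -F ((x +F n) +F (x +F n) +F (x +F n)) ≡ -F (s +F [ 3 ]ₚ +F (n +F n +F n))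
    shuffle x n t s refl e = trans (Fp.grp (x ∷ n ∷ []) (gv 0 :+ :- (gv 0 :+ gv 1 :+ (gv 0 :+ gv 1) :+ (gv 0 :+ gv 1))) (:- (gv 0 :+ gv 0 :+ g0 :+ (gv 1 :+ gv 1 :+ gv 1))) refl)
      (cong (λ z → -F (z +F (n +F n +F n))) (trans (cong (x +F x +F_) (sym e)) (sym (+F-assoc (x +F x) t [ 3 ]ₚ))))
    cond : x -F [ 3 ]ₚ *F (x +F [ m ∸ 1 ]ₚ) ≡ [ 1 ]ₚ
    cond = trans (cong (λ z → x -F z) (triple (x +F [ m ∸ 1 ]ₚ))) (trans (shuffle x [ m ∸ 1 ]ₚ [ t ]ₚ [ m + 2 ]ₚ base (trans ([]-+ t 3) (trans (cong [_]ₚ et) []-p)))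
      (trans (cong (λ z → -F z) (trans (cong₂ _+F_ ([]-+ (m + 2) 3) (trans (cong (_+F [ m ∸ 1 ]ₚ) ([]-+ (m ∸ 1) (m ∸ 1))) ([]-+ ((m ∸ 1) + (m ∸ 1)) (m ∸ 1)))) ([]-+ (m + 2 + 3) ((m ∸ 1) + (m ∸ 1) + (m ∸ 1)))))
        ([]-neg (lin≡ ((m ∸ 1) ∷ m ∷ p ∷ []) (eqn 3 (v0 ⊕ # 1) v1 m-1 ∷ eqn 1 (# 3 ⊕ # 4 ⊗ v1) v2 (sym p≡) ∷ []) (v1 ⊕ # 2 ⊕ # 3 ⊕ (v0 ⊕ v0 ⊕ v0) ⊕ # 1) v2))))
    n<p : m ∸ 1 < p
    n<p = small (lin ((m ∸ 1) ∷ m ∷ []) (eql 1 (v0 ⊕ # 1) v1 m-1 ∷ []) 1 v0 (v1 ⊕ # 4))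
    fwd : ∀ y w → A (y Vec.∷ w) ≡ true → InInterval x (x +F [ m ∸ 1 ]ₚ) y
    fwd y w h = let (k , k≤ , ey) = within y w h in interval-intro {x} 0 (m ∸ 1) k (sym (Fp.⊞-idʳ x)) refl n<p (lin (k ∷ L ∷ m ∷ r ∷ (m ∸ 1) ∷ []) (hyp 1 v0 v1 k≤ ∷ eql 1 (v1 ⊕ # 1) (v2 ⊕ v3) length≡ ∷ eql 1 v3 (# 0) r≡0 ∷ eqr 1 (v4 ⊕ # 1) v2 m-1 ∷ []) 1 v0 v4) ey
    bwd : ∀ y w → InInterval x (x +F [ m ∸ 1 ]ₚ) y → A (y Vec.∷ w) ≡ true
    bwd y w h = let (k , k≤ , ey) = interval-elim {x} 0 (m ∸ 1) (sym (Fp.⊞-idʳ x)) refl n<p h in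
      subst (λ y → A (y Vec.∷ w) ≡ true) (sym ey) (full {k} (∑<-tight (m + r) q (λ i _ → f≤q i) (≤-trans (≤-reflexive (cong (λ z → (m + z) * q) r≡0)) (≤-trans (≤-reflexive (cong (_* q) (+-identityʳ m))) total)) k
        (lin (k ∷ (m ∸ 1) ∷ m ∷ r ∷ []) (hyp 1 v0 v1 k≤ ∷ eql 1 (v1 ⊕ # 1) v2 m-1 ∷ []) 1 (# 1 ⊕ v0) (v2 ⊕ v3))) w)

  module _ {d} {A : Vec 𝔽 (suc d) → Bool} (Fr : Frame A) (r≡1 : Frame.r Fr ≡ 1) (et : Frame.t Fr + 1 ≡ p) where
    open InFrame Fr

    -- Twice this element is 3m + 3.
    pos-m≢0 : x +F [ m ]ₚ ≢ [ 0 ]ₚ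
    pos-m≢0 e = []≢0 {3 * m + 3} (lin (m ∷ []) (hyp 3 (# 23) v0 m≥ ∷ []) 1 (# 1) (# 3 ⊗ v0 ⊕ # 3)) (lin (m ∷ p ∷ []) (eqr 1 v1 (# 3 ⊕ # 4 ⊗ v0) p≡ ∷ hyp 1 (# 23) v0 m≥ ∷ []) 1 (# 1 ⊕ (# 3 ⊗ v0 ⊕ # 3)) v1)
      (trans (sym (trans (cong (_+F ([ m ]ₚ +F [ m ]ₚ +F [ 1 ]ₚ)) base) (trans (cong ([ m + 2 ]ₚ +F_) (trans (cong (_+F [ 1 ]ₚ) ([]-+ m m)) ([]-+ (m + m) 1))) (trans ([]-+ (m + 2) (m + m + 1)) (cong [_]ₚ (lin≡ (m ∷ []) [] (v0 ⊕ # 2 ⊕ (v0 ⊕ v0 ⊕ # 1)) (# 3 ⊗ v0 ⊕ # 3)))))))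
        (trans (shuffle x [ m ]ₚ [ t ]ₚ [ 1 ]ₚ) (trans (cong₂ _+F_ (cong₂ _+F_ e e) (trans ([]-+ t 1) (trans (cong [_]ₚ et) []-p))) zeros)))
      where
      shuffle : ∀ x a t o → (x +F x) +F t +F (a +F a +F o) ≡ (x +F a) +F (x +F a) +F (t +F o)
      shuffle x a t o = (Fp.grp (x ∷ t ∷ a ∷ o ∷ []) (gv 0 :+ gv 0 :+ gv 1 :+ (gv 2 :+ gv 2 :+ gv 3)) (gv 0 :+ gv 2 :+ (gv 0 :+ gv 2) :+ (gv 1 :+ gv 3)) refl)
      zeros : [ 0 ]ₚ +F [ 0 ]ₚ +F [ 0 ]ₚ ≡ [ 0 ]ₚ
      zeros = trans (Fp.⊞-idʳ _) (Fp.⊞-idʳ _)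

    -- For t = -1 the index triple (m, m, m) is sent to level 0. So the levels m and 0 share at most
    -- q elements, and the total of the m + 1 levels forces equality: the levels between are full,
    -- level m is a subgroup by `subgroup`, and level 0 is its complement.
    type2-centred : F m 0V ≡ true → Type2′ A
    type2-centred h0 = positive d (F m) w₁ outside h0 , F m , ((h0 , closed , closed-·V {H = F m} h0 closed) , w₁ , outside) , idAut , λ { (y Vec.∷ w) → fwd y w , bwd y w }
      where
      3F : ∀ {u v w} → F m u ≡ true → F m v ≡ true → F m w ≡ true → F 0 ((u +V v) +V w) ≡ false
      3F = free m m m 0 0 (lin≡ (p ∷ t ∷ m ∷ []) (eqn 1 v0 (v1 ⊕ # 1) (sym et) ∷ eqn 1 (# 3 ⊕ # 4 ⊗ v2) v0 (sym p≡) ∷ []) (v2 ⊕ v2 ⊕ v2 ⊕ v2 ⊕ # 2) (# 0 ⊕ v1 ⊕ # 0 ⊗ v0))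
      fm+f0 : f m + f 0 ≤ q
      fm+f0 = apart m m m 0 0 (lin≡ (p ∷ t ∷ m ∷ []) (eqn 1 v0 (v1 ⊕ # 1) (sym et) ∷ eqn 1 (# 3 ⊕ # 4 ⊗ v2) v0 (sym p≡) ∷ []) (v2 ⊕ v2 ⊕ v2 ⊕ v2 ⊕ # 2) (# 0 ⊕ v1 ⊕ # 0 ⊗ v0)) h0 h0
      o = proj₁ (m≤n⇒∃[o]m+o≡n {1} {m} (lin (m ∷ []) (hyp 1 (# 23) v0 m≥ ∷ []) 1 (# 1) v0))
      eo : 1 + o ≡ m
      eo = proj₂ (m≤n⇒∃[o]m+o≡n {1} {m} (lin (m ∷ []) (hyp 1 (# 23) v0 m≥ ∷ []) 1 (# 1) v0))
      middle : ℕ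
      middle = ∑< o (λ i → f (1 + i))
      sum≡ : ∑< (m + r) f ≡ f 0 + middle + f m
      sum≡ = trans (cong (λ n → ∑< n f) (lin≡ (m ∷ o ∷ r ∷ []) (eqn 1 v0 (# 1 ⊕ v1) (sym eo) ∷ eqn 1 v2 (# 1) r≡1 ∷ []) (v0 ⊕ v2) (# 1 ⊕ (# 1 ⊕ v1)))) (cong₂ _+_ (∑<-first o f) (cong f eo))
      middle≤ : middle ≤ o * q
      middle≤ = ∑<-bound o q (λ i _ → f≤q _)
      mq : m * q ≡ q + o * q
      mq = cong (_* q) (sym eo)
      tight : q ≤ f m + f 0
      tight = (lin (m ∷ q ∷ (∑< (m + r) f) ∷ (f 0) ∷ middle ∷ (f m) ∷ o ∷ []) (hyp 1 (v0 ⊗ v1) v2 total ∷ eql 1 v2 (v3 ⊕ v4 ⊕ v5) sum≡ ∷ hyp 1 v4 (v6 ⊗ v1) middle≤ ∷ eqr 1 (v0 ⊗ v1) (v1 ⊕ v6 ⊗ v1) mq ∷ []) 1 v1 (v5 ⊕ v3))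
      closed : V.Closed d (F m)
      closed = subgroup {F m} {F 0} h0 3F tight
      w₁ : Vec 𝔽 d
      w₁ = proj₁ first
      excl : ∀ w → F m w ≡ true → F 0 w ≡ false
      excl w h = subst (λ t → F 0 t ≡ false) (V.grp d (w ∷ []) (gv 0 :+ g0 :+ g0) (gv 0) refl) (3F h h0 h0)
      outside : F m w₁ ≡ false
      outside = ¬true⇒false λ h → true≢false (proj₂ first) (excl w₁ h)
      positive : ∀ d (G : Vec 𝔽 d → Bool) w → G w ≡ false → G 0V ≡ true → 1 ≤ d
      positive zero    G Vec.[] h h′ = ⊥-elim (true≢false h′ h)
      positive (suc d) G w      h h′ = s≤s z≤n
      fullmid : ∀ i → i < o → ∀ w → F (1 + i) w ≡ true
      fullmid i i<o = full {1 + i} (∑<-tight o q (λ i _ → f≤q _) (lin (m ∷ q ∷ (∑< (m + r) f) ∷ (f 0) ∷ middle ∷ (f m) ∷ o ∷ []) (hyp 1 (v0 ⊗ v1) v2 total ∷ eql 1 v2 (v3 ⊕ v4 ⊕ v5) sum≡ ∷ hyp 1 (v5 ⊕ v3) v1 fm+f0 ∷ eqr 1 (v0 ⊗ v1) (v1 ⊕ v6 ⊗ v1) mq ∷ []) 1 (v6 ⊗ v1) v4) i i<o)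
      x≡ : x ≡ aT2′
      x≡ = double-inj (trans (Fp.⊞-cancelʳ [ t ]ₚ (trans base (trans (sym ([]-mod (m + 2) 1)) (trans (cong [_]ₚ (lin≡ (p ∷ t ∷ m ∷ []) (eqn 1 v0 (v1 ⊕ # 1) (sym et) ∷ []) (v2 ⊕ # 2 ⊕ # 1 ⊗ v0) (v2 ⊕ # 3 ⊕ v1))) (sym ([]-+ (m + 3) t)))))) (sym aT2-double))
      lo : aT2′ +F [ 1 ]ₚ ≡ x +F [ 1 ]ₚ
      lo = cong (_+F [ 1 ]ₚ) (sym x≡)
      m∸1 : (m ∸ 1) + 1 ≡ m
      m∸1 = m∸n+n≡m (lin (m ∷ []) (hyp 1 (# 23) v0 m≥ ∷ []) 1 (# 1) v0)
      m∸2 : (m ∸ 2) + 2 ≡ m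
      m∸2 = m∸n+n≡m (lin (m ∷ []) (hyp 1 (# 23) v0 m≥ ∷ []) 1 (# 2) v0)
      hi : aT2′ +F [ m ∸ 1 ]ₚ ≡ x +F [ 1 + (m ∸ 2) ]ₚ
      hi = cong₂ (λ a k → a +F [ k ]ₚ) (sym x≡) (lin≡ ((m ∸ 1) ∷ m ∷ (m ∸ 2) ∷ []) (eqn 1 (v0 ⊕ # 1) v1 m∸1 ∷ eqn 1 v1 (v2 ⊕ # 2) (sym m∸2) ∷ []) v0 (# 1 ⊕ v2))
      n<p : m ∸ 2 < p
      n<p = small (lin ((m ∸ 2) ∷ m ∷ []) (eql 1 (v0 ⊕ # 2) v1 m∸2 ∷ []) 1 v0 (v1 ⊕ # 4))
      fwd : ∀ y w → A (y Vec.∷ w) ≡ true → Body2 (F m) (y Vec.∷ w)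
      fwd y w h = let (k , k≤ , ey) = within y w h in level k (lin (k ∷ L ∷ m ∷ r ∷ []) (hyp 1 v0 v1 k≤ ∷ eql 1 (v1 ⊕ # 1) (v2 ⊕ v3) length≡ ∷ eql 1 v3 (# 1) r≡1 ∷ []) 1 v0 v2) ey (subst (λ y → A (y Vec.∷ w) ≡ true) ey h) (k ≟ m)
        where
        level : ∀ k → k ≤ m → y ≡ x +F [ k ]ₚ → F k w ≡ true → Dec (k ≡ m) → Body2 (F m) (y Vec.∷ w)
        level k       k≤ ey hk (yes refl) = inj₂ (inj₂ (trans ey (cong (_+F [ m ]ₚ) x≡) , hk))
        level zero    k≤ ey hk (no _) = inj₁ (trans ey (trans (Fp.⊞-idʳ x) x≡) , ¬true⇒false λ h → true≢false hk (excl w h))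
        level (suc k) k≤ ey hk (no k≢) = inj₂ (inj₁ (interval-intro {x} 1 (m ∸ 2) k lo hi n<p (lin (m ∷ (m ∸ 2) ∷ k ∷ []) (eqr 1 (v1 ⊕ # 2) v0 m∸2 ∷ hyp 1 (# 1 ⊕ (# 1 ⊕ v2)) v0 (≤∧≢⇒< k≤ k≢) ∷ []) 1 v2 v1) ey))
      bwd : ∀ y w → Body2 (F m) (y Vec.∷ w) → A (y Vec.∷ w) ≡ true
      bwd y w (inj₁ (ey , h)) = subst (λ y → A (y Vec.∷ w) ≡ true) (sym (trans ey (trans (sym x≡) (sym (Fp.⊞-idʳ x))))) (complementary {F 0} {F m} (λ w h → ¬true⇒false λ h′ → true≢false h (excl w h′)) (≤-trans tight (≤-reflexive (+-comm (f m) (f 0)))) w h)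
      bwd y w (inj₂ (inj₁ h)) = let (k , k≤ , ey) = interval-elim {x} 1 (m ∸ 2) lo hi n<p h in
        subst (λ y → A (y Vec.∷ w) ≡ true) (sym ey) (fullmid k (lin (k ∷ (m ∸ 2) ∷ m ∷ o ∷ []) (hyp 1 v0 v1 k≤ ∷ eql 1 (v1 ⊕ # 2) v2 m∸2 ∷ eqr 1 (# 1 ⊕ v3) v2 eo ∷ []) 1 (# 1 ⊕ v0) v3) w)
      bwd y w (inj₂ (inj₂ (ey , h))) = subst (λ y → A (y Vec.∷ w) ≡ true) (sym (trans ey (cong (_+F [ m ]ₚ) (sym x≡)))) h

-- Type 5 and the case distinction by the offset

module Orientation {p : ℕ} {{p-nonZero : NonZero p}} (p-prime : Prime p) (m : ℕ) (p≡ : p ≡ 3 + 4 * m) (m≥ : 23 ≤ m) where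
  open PrimeField p-prime
  open Functionals p-prime
  open Automorphisms p-prime
  open Frames p-prime m p≡ m≥
  open Targets {p} m
  open Outcomes p-prime m p≡ m≥

  module _ {d} {A : Vec 𝔽 (suc d) → Bool} (Fr : Frame A) (r≡2 : Frame.r Fr ≡ 2) (t≡2 : Frame.t Fr ≡ 2) where
    open InFrame Fr

    private
      a≡ : aT5′ ≡ x +F [ 1 ]ₚ
      a≡ = double-inj (trans (half [ m + 2 ]ₚ) (sym (trans (shuffle x [ 1 ]ₚ) (trans (cong ((x +F x) +F_) (trans ([]-+ 1 1) (cong [_]ₚ (sym t≡2)))) base))))
        where shuffle : ∀ x o → (x +F o) +F (x +F o) ≡ (x +F x) +F (o +F o)
              shuffle x o = (Fp.grp (x ∷ o ∷ []) (gv 0 :+ gv 1 :+ (gv 0 :+ gv 1)) (gv 0 :+ gv 0 :+ (gv 1 :+ gv 1)) refl)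

    pos-0≢0 : x +F [ 0 ]ₚ ≢ [ 0 ]ₚ
    pos-0≢0 e = []≢0 {m} (lin (m ∷ []) (hyp 1 (# 23) v0 m≥ ∷ []) 1 (# 1) v0) (small (lin (m ∷ []) [] 1 v0 (v0 ⊕ # 4)))
      (sym (Fp.⊞-cancelʳ [ 2 ]ₚ (trans (sym (cong (_+F [ 2 ]ₚ) (trans (cong₂ _+F_ x≡0 x≡0) (+F-idˡ _)))) (trans (cong (λ z → (x +F x) +F [ z ]ₚ) (sym t≡2)) (trans base (sym ([]-+ m 2)))))))
      where x≡0 : x ≡ [ 0 ]ₚ
            x≡0 = trans (sym (Fp.⊞-idʳ x)) e

    -- For t = 2 the index triples (0, 0, 0), (0, 0, 1) and (m + 1, m + 1, m + 1) are sent to m, m +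
    -- 1 and 0. The pairs of levels 0, m and 1, m + 1 hold at most q elements each, and the total
    -- forces equality: K is a subgroup, level m its complement, level 1 the complement of P. The
    -- third relation becomes 0 ∉ 3P modulo K.
    type5-centred : F 0 0V ≡ true → Type5′ A
    type5-centred h0 = build (flatten K h0 closed)
      where
      K P : Vec 𝔽 d → Bool
      K = F 0
      P = F (m + 1)
      3K : ∀ {u v w} → K u ≡ true → K v ≡ true → K w ≡ true → F m ((u +V v) +V w) ≡ false
      3K = free 0 0 0 m 0 (lin≡ (t ∷ m ∷ p ∷ []) (eqn 1 (# 2) v0 (sym t≡2) ∷ []) (# 0 ⊕ # 0 ⊕ # 0 ⊕ v1 ⊕ # 2) (v1 ⊕ v0 ⊕ # 0 ⊗ v2))
      2K+F₁ : ∀ {u v w} → K u ≡ true → K v ≡ true → F 1 w ≡ true → P ((u +V v) +V w) ≡ false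
      2K+F₁ = free 0 0 1 (m + 1) 0 (lin≡ (t ∷ m ∷ p ∷ []) (eqn 1 (# 2) v0 (sym t≡2) ∷ []) (# 0 ⊕ # 0 ⊕ # 1 ⊕ v1 ⊕ # 2) (v1 ⊕ # 1 ⊕ v0 ⊕ # 0 ⊗ v2))
      3P : ∀ {u v w} → P u ≡ true → P v ≡ true → P w ≡ true → K ((u +V v) +V w) ≡ false
      3P = free (m + 1) (m + 1) (m + 1) 0 1 (lin≡ (t ∷ m ∷ p ∷ []) (eqn 1 (# 2) v0 (sym t≡2) ∷ eqn 1 (# 3 ⊕ # 4 ⊗ v1) v2 (sym p≡) ∷ []) (v1 ⊕ # 1 ⊕ (v1 ⊕ # 1) ⊕ (v1 ⊕ # 1) ⊕ v1 ⊕ # 2) (# 0 ⊕ v0 ⊕ # 1 ⊗ v2))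
      f0+fm : f 0 + f m ≤ q
      f0+fm = apart 0 0 0 m 0 (lin≡ (t ∷ m ∷ p ∷ []) (eqn 1 (# 2) v0 (sym t≡2) ∷ []) (# 0 ⊕ # 0 ⊕ # 0 ⊕ v1 ⊕ # 2) (v1 ⊕ v0 ⊕ # 0 ⊗ v2)) h0 h0
      f1+fm+1 : f 1 + f (m + 1) ≤ q
      f1+fm+1 = apart 0 0 1 (m + 1) 0 (lin≡ (t ∷ m ∷ p ∷ []) (eqn 1 (# 2) v0 (sym t≡2) ∷ []) (# 0 ⊕ # 0 ⊕ # 1 ⊕ v1 ⊕ # 2) (v1 ⊕ # 1 ⊕ v0 ⊕ # 0 ⊗ v2)) h0 h0
      o = proj₁ (m≤n⇒∃[o]m+o≡n {2} {m} (lin (m ∷ []) (hyp 1 (# 23) v0 m≥ ∷ []) 1 (# 2) v0))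
      eo : 2 + o ≡ m
      eo = proj₂ (m≤n⇒∃[o]m+o≡n {2} {m} (lin (m ∷ []) (hyp 1 (# 23) v0 m≥ ∷ []) 1 (# 2) v0))
      middle : ℕ
      middle = ∑< o (λ i → f (2 + i))
      sum≡ : ∑< (m + r) f ≡ f 0 + f 1 + middle + f m + f (m + 1)
      sum≡ = trans (cong (λ n → ∑< n f) (lin≡ (m ∷ o ∷ r ∷ []) (eqn 1 v0 (# 2 ⊕ v1) (sym eo) ∷ eqn 1 v2 (# 2) r≡2 ∷ []) (v0 ⊕ v2) (# 1 ⊕ (# 1 ⊕ (# 2 ⊕ v1)))))
        (cong₂ _+_ (cong₂ _+_ (∑<-split 2 o f) (cong f eo)) (cong f (trans (cong suc eo) (+-comm 1 m))))
      middle≤ : middle ≤ o * q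
      middle≤ = ∑<-bound o q (λ i _ → f≤q _)
      mq : m * q ≡ q + (q + o * q)
      mq = cong (_* q) (sym eo)
      tight₀ : q ≤ f 0 + f m
      tight₀ = (lin (m ∷ q ∷ (∑< (m + r) f) ∷ (f 0) ∷ (f 1) ∷ middle ∷ (f m) ∷ (f (m + 1)) ∷ o ∷ []) (hyp 1 (v0 ⊗ v1) v2 total ∷ eql 1 v2 (v3 ⊕ v4 ⊕ v5 ⊕ v6 ⊕ v7) sum≡ ∷ hyp 1 v5 (v8 ⊗ v1) middle≤ ∷ eqr 1 (v0 ⊗ v1) (v1 ⊕ (v1 ⊕ v8 ⊗ v1)) mq ∷ hyp 1 (v4 ⊕ v7) v1 f1+fm+1 ∷ []) 1 v1 (v3 ⊕ v6))
      tight₁ : q ≤ f 1 + f (m + 1)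
      tight₁ = (lin (m ∷ q ∷ (∑< (m + r) f) ∷ (f 0) ∷ (f 1) ∷ middle ∷ (f m) ∷ (f (m + 1)) ∷ o ∷ []) (hyp 1 (v0 ⊗ v1) v2 total ∷ eql 1 v2 (v3 ⊕ v4 ⊕ v5 ⊕ v6 ⊕ v7) sum≡ ∷ hyp 1 v5 (v8 ⊗ v1) middle≤ ∷ eqr 1 (v0 ⊗ v1) (v1 ⊕ (v1 ⊕ v8 ⊗ v1)) mq ∷ hyp 1 (v3 ⊕ v6) v1 f0+fm ∷ []) 1 v1 (v4 ⊕ v7))
      fullmid : ∀ i → i < o → ∀ w → F (2 + i) w ≡ true
      fullmid i i<o = full {2 + i} (∑<-tight o q (λ i _ → f≤q _) (lin (m ∷ q ∷ (∑< (m + r) f) ∷ (f 0) ∷ (f 1) ∷ middle ∷ (f m) ∷ (f (m + 1)) ∷ o ∷ []) (hyp 1 (v0 ⊗ v1) v2 total ∷ eql 1 v2 (v3 ⊕ v4 ⊕ v5 ⊕ v6 ⊕ v7) sum≡ ∷ eqr 1 (v0 ⊗ v1) (v1 ⊕ (v1 ⊕ v8 ⊗ v1)) mq ∷ hyp 1 (v3 ⊕ v6) v1 f0+fm ∷ hyp 1 (v4 ⊕ v7) v1 f1+fm+1 ∷ []) 1 (v8 ⊗ v1) v5) i i<o)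
      closed : V.Closed d K
      closed = subgroup {K} {F m} h0 3K tight₀
      K-Fm : ∀ w → K w ≡ true → F m w ≡ false
      K-Fm w h = subst (λ t → F m t ≡ false) (V.grp d (w ∷ []) (gv 0 :+ g0 :+ g0) (gv 0) refl) (3K h h0 h0)
      Fm-K : ∀ w → K w ≡ false → F m w ≡ true
      Fm-K = complementary {F m} {K} (λ w h → ¬true⇒false λ h′ → true≢false h (K-Fm w h′)) (≤-trans tight₀ (≤-reflexive (+-comm (f 0) (f m))))
      F₁-P : ∀ w → F 1 w ≡ true → P w ≡ false
      F₁-P w h = subst (λ t → P t ≡ false) (V.grp d (w ∷ []) (g0 :+ g0 :+ gv 0) (gv 0) refl) (2K+F₁ h0 h0 h)
      P-F₁ : ∀ w → P w ≡ false → F 1 w ≡ true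
      P-F₁ = complementary {F 1} {P} F₁-P tight₁
      -- If w + k were outside P, it would lie in level 1, and adding 0 and -k from K would put w
      -- outside P. Hence P is a union of cosets of K and descends to the quotient F_p^s.
      invariant : ∀ w k → K k ≡ true → P w ≡ true → P (w +V k) ≡ true
      invariant w k hk hw = stay (P (w +V k)) refl
        where
        stay : ∀ b → P (w +V k) ≡ b → P (w +V k) ≡ true
        stay true  e = e
        stay false e = ⊥-elim (true≢false hw (subst (λ t → P t ≡ false) (V.grp d (w ∷ k ∷ []) (g0 :+ :- gv 1 :+ (gv 0 :+ gv 1)) (gv 0) refl)
          (2K+F₁ h0 (V.closed-⊟ d {K} h0 closed k hk) (P-F₁ (w +V k) e))))

      build : (Σ ℕ λ s → Σ ℕ λ t → Σ (s + t ≡ d) λ e → Σ (Aut {p} d) λ θ →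
               ∀ w → (K w ≡ true → take s (cast (sym e) (φ θ w)) ≡ 0V) × (take s (cast (sym e) (φ θ w)) ≡ 0V → K w ≡ true)) → Type5′ A
      build (s , t′ , e , θ , hθ) = s , t′ , e , P′ , nonempty , P′-free , onTail θ , λ { (y Vec.∷ w) → fwd y w , bwd y w }
        where
        top : Vec 𝔽 d → Vec 𝔽 s
        top w = take s (cast (sym e) (φ θ w))
        -- A section of `top`; by the invariance of P its choice is immaterial.
        lift : Vec 𝔽 s → Vec 𝔽 d
        lift y = ψ θ (cast e (y Vec.++ 0V))
        top-lift : ∀ y → top (lift y) ≡ y
        top-lift y = trans (cong (λ w → take s (cast (sym e) w)) (φψ θ _)) (trans (cong (take s) (trans (VecP.cast-trans e (sym e) _) (VecP.cast-is-id refl _))) (take-++ y 0V))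
          where take-++ : ∀ {a b} (u : Vec 𝔽 a) (v : Vec 𝔽 b) → take a (u Vec.++ v) ≡ u
                take-++ Vec.[] v = refl
                take-++ (x Vec.∷ u) v = cong (x Vec.∷_) (take-++ u v)
        top-+ : ∀ u v → top (u +V v) ≡ top u +V top v
        top-+ u v = trans (cong (λ w → take s (cast (sym e) w)) (φ-add θ u v)) (trans (cong (take s) (cast-+ (sym e) (φ θ u) (φ θ v))) (take-+ s (cast (sym e) (φ θ u)) (cast (sym e) (φ θ v))))
          where
          cast-+ : ∀ {a b} (e : a ≡ b) (u v : Vec 𝔽 a) → cast e (u +V v) ≡ cast e u +V cast e v
          cast-+ refl u v = trans (VecP.cast-is-id refl _) (sym (cong₂ _+V_ (VecP.cast-is-id refl u) (VecP.cast-is-id refl v)))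
          take-+ : ∀ a {b} (u v : Vec 𝔽 (a + b)) → take a (u +V v) ≡ take a u +V take a v
          take-+ zero    u v = refl
          take-+ (suc a) (x Vec.∷ u) (y Vec.∷ v) = cong ((x +F y) Vec.∷_) (take-+ a u v)
        same-top : ∀ u v → top u ≡ top v → P u ≡ true → P v ≡ true
        same-top u v e h = subst (λ t → P t ≡ true) (V.grp d (u ∷ v ∷ []) (gv 0 :+ (gv 1 :+ :- gv 0)) (gv 1) refl)
          (invariant u (v +V (-V u)) (proj₂ (hθ _) (V.⊞-cancelʳ s (top u) (trans (sym (top-+ (v +V (-V u)) u)) (trans (cong top (V.grp d (u ∷ v ∷ []) (gv 1 :+ :- gv 0 :+ gv 0) (gv 1) refl)) (trans (sym e) (sym (V.⊞-idˡ s (top u)))))))) h)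
        P′ : Vec 𝔽 s → Bool
        P′ y = P (lift y)
        P-P′ : ∀ w → P w ≡ true → P′ (top w) ≡ true
        P-P′ w = same-top w (lift (top w)) (sym (top-lift (top w)))
        P′-P : ∀ w → P′ (top w) ≡ true → P w ≡ true
        P′-P w = same-top (lift (top w)) w (top-lift (top w))
        nonempty : ∃[ y ] P′ y ≡ true
        nonempty = let (w , h) = last in top w , P-P′ w (subst (λ k → F k w ≡ true) (lin≡ (L ∷ m ∷ r ∷ []) (eqn 1 (v0 ⊕ # 1) (v1 ⊕ v2) length≡ ∷ eqn 1 v2 (# 2) r≡2 ∷ []) v0 (v1 ⊕ # 1)) h)
        P′-free : ∀ x y z → P′ x ≡ true → P′ y ≡ true → P′ z ≡ true → ¬ ((x +V y) +V z ≡ 0V)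
        P′-free x y z hx hy hz e0 = true≢false (proj₂ (hθ ((lift x +V lift y) +V lift z)) (trans (top-+ (lift x +V lift y) (lift z)) (trans (cong₂ _+V_ (trans (top-+ (lift x) (lift y)) (cong₂ _+V_ (top-lift x) (top-lift y))) (top-lift z)) e0))) (3P hx hy hz)
        m∸1 : (m ∸ 1) + 1 ≡ m
        m∸1 = m∸n+n≡m (lin (m ∷ []) (hyp 1 (# 23) v0 m≥ ∷ []) 1 (# 1) v0)
        m∸2 : (m ∸ 2) + 2 ≡ m
        m∸2 = m∸n+n≡m (lin (m ∷ []) (hyp 1 (# 23) v0 m≥ ∷ []) 1 (# 2) v0)
        m∸3 : (m ∸ 3) + 3 ≡ m
        m∸3 = m∸n+n≡m (lin (m ∷ []) (hyp 1 (# 23) v0 m≥ ∷ []) 1 (# 3) v0)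
        at : ∀ k → aT5′ +F [ k ]ₚ ≡ x +F [ 1 + k ]ₚ
        at k = trans (cong (_+F [ k ]ₚ) a≡) (trans (+F-assoc x _ _) (cong (x +F_) ([]-+ 1 k)))
        at-0 : aT5′ -F [ 1 ]ₚ ≡ x +F [ 0 ]ₚ
        at-0 = trans (cong (_-F [ 1 ]ₚ) a≡) (cancel x [ 1 ]ₚ)
          where cancel : ∀ x o → x +F o -F o ≡ x +F [ 0 ]ₚ
                cancel x o = (Fp.grp (x ∷ o ∷ []) (gv 0 :+ gv 1 :+ :- (gv 1)) (gv 0 :+ g0) refl)
        hi : aT5′ +F [ m ∸ 2 ]ₚ ≡ x +F [ 2 + (m ∸ 3) ]ₚ
        hi = trans (at (m ∸ 2)) (cong (λ k → x +F [ k ]ₚ) (lin≡ ((m ∸ 2) ∷ m ∷ (m ∸ 3) ∷ []) (eqn 1 (v0 ⊕ # 2) v1 m∸2 ∷ eqn 1 v1 (v2 ⊕ # 3) (sym m∸3) ∷ []) (# 1 ⊕ v0) (# 2 ⊕ v2)))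
        at-m : aT5′ +F [ m ∸ 1 ]ₚ ≡ x +F [ m ]ₚ
        at-m = trans (at (m ∸ 1)) (cong (λ k → x +F [ k ]ₚ) (trans (+-comm 1 (m ∸ 1)) m∸1))
        at-m+1 : aT5′ +F [ m ]ₚ ≡ x +F [ m + 1 ]ₚ
        at-m+1 = trans (at m) (cong (λ k → x +F [ k ]ₚ) (+-comm 1 m))
        n<p : m ∸ 3 < p
        n<p = small (lin ((m ∸ 3) ∷ m ∷ []) (eql 1 (v0 ⊕ # 3) v1 m∸3 ∷ []) 1 v0 (v1 ⊕ # 4))
        fwd : ∀ y w → A (y Vec.∷ w) ≡ true → A₀′ P′ y (top w)
        fwd y w h = let (k , k≤ , ey) = within y w h in level k (lin (k ∷ L ∷ m ∷ r ∷ []) (hyp 1 v0 v1 k≤ ∷ eql 1 (v1 ⊕ # 1) (v2 ⊕ v3) length≡ ∷ eql 1 v3 (# 2) r≡2 ∷ []) 1 v0 (v2 ⊕ # 1)) ey (subst (λ y → A (y Vec.∷ w) ≡ true) ey h) (k ≟ m) (k ≟ m + 1)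
          where
          level : ∀ k → k ≤ m + 1 → y ≡ x +F [ k ]ₚ → F k w ≡ true → Dec (k ≡ m) → Dec (k ≡ m + 1) → A₀′ P′ y (top w)
          level k k≤ ey hk (yes refl) _ = inj₂ (inj₂ (inj₂ (inj₁ (trans ey (sym at-m) , λ e0 → true≢false hk (K-Fm w (proj₂ (hθ w) e0))))))
          level k k≤ ey hk (no _) (yes refl) = inj₂ (inj₂ (inj₂ (inj₂ (trans ey (sym at-m+1) , P-P′ w hk))))
          level 0 k≤ ey hk (no _) (no _) = inj₁ (trans ey (sym at-0) , proj₁ (hθ w) hk)
          level 1 k≤ ey hk (no _) (no _) = inj₂ (inj₁ (trans ey (sym a≡) , ¬true⇒false λ h → true≢false (P′-P w h) (F₁-P w hk)))
          level (suc (suc k)) k≤ ey hk (no k≢) (no k≢′) = inj₂ (inj₂ (inj₁ (interval-intro {x} 2 (m ∸ 3) k (at 1) hi n<p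
            (lin (m ∷ (m ∸ 3) ∷ k ∷ []) (eqr 1 (v1 ⊕ # 3) v0 m∸3 ∷ hyp 1 (# 1 ⊕ (# 1 ⊕ (# 1 ⊕ v2))) v0 (≤∧≢⇒< (≤-pred (≤-trans (≤∧≢⇒< k≤ k≢′) (≤-reflexive (+-comm m 1)))) k≢) ∷ []) 1 v2 v1) ey)))
        bwd : ∀ y w → A₀′ P′ y (top w) → A (y Vec.∷ w) ≡ true
        bwd y w (inj₁ (ey , h)) = subst (λ y → A (y Vec.∷ w) ≡ true) (sym (trans ey at-0)) (proj₂ (hθ w) h)
        bwd y w (inj₂ (inj₁ (ey , h))) = subst (λ y → A (y Vec.∷ w) ≡ true) (sym (trans ey a≡)) (P-F₁ w (¬true⇒false λ hP → true≢false (P-P′ w hP) h))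
        bwd y w (inj₂ (inj₂ (inj₁ h))) = let (k , k≤ , ey) = interval-elim {x} 2 (m ∸ 3) (at 1) hi n<p h in
          subst (λ y → A (y Vec.∷ w) ≡ true) (sym ey) (fullmid k (lin (k ∷ (m ∸ 3) ∷ m ∷ o ∷ []) (hyp 1 v0 v1 k≤ ∷ eql 1 (v1 ⊕ # 3) v2 m∸3 ∷ eqr 1 (# 2 ⊕ v3) v2 eo ∷ []) 1 (# 1 ⊕ v0) v3) w)
        bwd y w (inj₂ (inj₂ (inj₂ (inj₁ (ey , h))))) = subst (λ y → A (y Vec.∷ w) ≡ true) (sym (trans ey at-m)) (Fm-K w (¬true⇒false λ hK → h (proj₁ (hθ w) hK)))
        bwd y w (inj₂ (inj₂ (inj₂ (inj₂ (ey , h))))) = subst (λ y → A (y Vec.∷ w) ≡ true) (sym (trans ey at-m+1)) (P′-P w h)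

  -- `t≥3-impossible` leaves r ≤ t ≤ 2. The pairs (t, r) = (0, 0), (1, 0), (1, 1) give subsets of
  -- the extremal cuboid, (2, 0) type 1, (2, 1) type 2 and (2, 2) type 5. Except for (0, 0) and (2,
  -- 2), a reflection is used to reach the offset -2, 0, -3 or -1 in which the target is stated.
  oriented : ∀ {d} {A : Vec 𝔽 (suc d) → Bool} (Fr : Frame A) → Frame.r Fr ≤ Frame.t Fr → Frame.t Fr ≤ 2 * m + Frame.r Fr + 1 → Outcome A
  oriented {d} {A} Fr r≤t t≤ = go t refl r refl r≤t
    where
    open Frame Fr
    turned : ∀ t′ e → t′ < p → t + t′ + 1 ≡ 2 * r + e * p → (∀ (Fr′ : Frame (transport A negAut)) → Frame.t Fr′ ≡ t′ → Frame.r Fr′ ≡ r → Frame.L Fr′ ≡ L → Outcome (transport A negAut)) → Outcome A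
    turned t′ e t′<p et k = outcome-transport A negAut (k (negateFrame Fr t′ e t′<p et) refl refl refl)
    below : ∀ k → 1 ≤ k → k ≤ 3 → ∃[ o ] o + k ≡ p × o < p
    below k k≥ k≤ = let (o , e) = m≤n⇒∃[o]m+o≡n {k} {p} (lin (k ∷ m ∷ p ∷ []) (hyp 1 v0 (# 3) k≤ ∷ eqr 1 v2 (# 3 ⊕ # 4 ⊗ v1) p≡ ∷ []) 1 v0 v2) in o , trans (+-comm o k) e , (lin (k ∷ o ∷ p ∷ []) (eql 1 (v0 ⊕ v1) v2 e ∷ hyp 1 (# 1) v0 k≥ ∷ []) 1 (# 1 ⊕ v1) v2)
    go : ∀ t₀ → t ≡ t₀ → ∀ r₀ → r ≡ r₀ → r₀ ≤ t₀ → Outcome A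
    go 0 et 0 er _ = inj₁ (cuboid Fr 0 0 (lin (L ∷ m ∷ r ∷ []) (eql 1 (v0 ⊕ # 1) (v1 ⊕ v2) length≡ ∷ eql 1 v2 (# 0) er ∷ []) 1 (v0 ⊕ # 0) v1) (lin≡ (t ∷ p ∷ []) (eqn 1 v0 (# 0) et ∷ []) (v0 ⊕ # 2 ⊗ (# 0)) (# 0 ⊗ v1)))
    go 1 et 0 er _ = let (o , eo , o<) = below 2 (s≤s z≤n) (s≤s (s≤s z≤n)) in turned o 1 o< (lin≡ (t ∷ r ∷ o ∷ p ∷ []) (eqn 1 v0 (# 1) et ∷ eqn 2 (# 0) v1 (sym er) ∷ eqn 1 (v2 ⊕ # 2) v3 eo ∷ []) (v0 ⊕ v2 ⊕ # 1) (# 2 ⊗ v1 ⊕ # 1 ⊗ v3))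
      (λ Fr′ et′ er′ eL → inj₁ (cuboid Fr′ 1 1 (lin ((Frame.L Fr′) ∷ L ∷ m ∷ r ∷ []) (eql 1 v0 v1 eL ∷ eql 1 (v1 ⊕ # 1) (v2 ⊕ v3) length≡ ∷ eql 1 v3 (# 0) er ∷ []) 1 (v0 ⊕ # 1) v2) (lin≡ ((Frame.t Fr′) ∷ o ∷ p ∷ []) (eqn 1 v0 v1 et′ ∷ eqn 1 (v1 ⊕ # 2) v2 eo ∷ []) (v0 ⊕ # 2 ⊗ (# 1)) (# 1 ⊗ v2))))
    go 1 et 1 er _ = turned 0 0 (lin (m ∷ p ∷ []) (eqr 1 v1 (# 3 ⊕ # 4 ⊗ v0) p≡ ∷ []) 1 (# 1 ⊕ # 0) v1) (lin≡ (t ∷ r ∷ p ∷ []) (eqn 1 v0 (# 1) et ∷ eqn 2 (# 1) v1 (sym er) ∷ []) (v0 ⊕ # 0 ⊕ # 1) (# 2 ⊗ v1 ⊕ # 0 ⊗ v2))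
      (λ Fr′ et′ er′ eL → inj₁ (cuboid Fr′ 0 0 (lin ((Frame.L Fr′) ∷ L ∷ m ∷ r ∷ []) (eql 1 v0 v1 eL ∷ eql 1 (v1 ⊕ # 1) (v2 ⊕ v3) length≡ ∷ eql 1 v3 (# 1) er ∷ []) 1 (v0 ⊕ # 0) v2) (lin≡ ((Frame.t Fr′) ∷ p ∷ []) (eqn 1 v0 (# 0) et′ ∷ []) (v0 ⊕ # 2 ⊗ (# 0)) (# 0 ⊗ v1))))
    go 2 et 0 er _ = let (o , eo , o<) = below 3 (s≤s z≤n) ≤-refl in turned o 1 o< (lin≡ (t ∷ r ∷ o ∷ p ∷ []) (eqn 1 v0 (# 2) et ∷ eqn 2 (# 0) v1 (sym er) ∷ eqn 1 (v2 ⊕ # 3) v3 eo ∷ []) (v0 ⊕ v2 ⊕ # 1) (# 2 ⊗ v1 ⊕ # 1 ⊗ v3))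
      (λ Fr′ et′ er′ eL → inj₂ (inj₁ (type1 Fr′ (trans er′ er) (trans (cong (_+ 3) et′) eo))))
    go 2 et 1 er _ = let (o , eo , o<) = below 1 ≤-refl (s≤s z≤n) in turned o 1 o< (lin≡ (t ∷ r ∷ o ∷ p ∷ []) (eqn 1 v0 (# 2) et ∷ eqn 2 (# 1) v1 (sym er) ∷ eqn 1 (v2 ⊕ # 1) v3 eo ∷ []) (v0 ⊕ v2 ⊕ # 1) (# 2 ⊗ v1 ⊕ # 1 ⊗ v3))
      (λ Fr′ et′ er′ eL → two Fr′ (trans er′ er) (trans (cong (_+ 1) et′) eo) eL)
      where
      two : ∀ (Fr′ : Frame (transport A negAut)) → Frame.r Fr′ ≡ 1 → Frame.t Fr′ + 1 ≡ p → Frame.L Fr′ ≡ L → Outcome (transport A negAut)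
      two Fr′ er′ et′ eL = let (w , hw) = Frame.last Fr′ ; (τ , hτ) = centre Fr′ m w (pos-m≢0 Fr′ er′ et′) (subst (λ k → InFrame.F Fr′ k w ≡ true) (lin≡ ((Frame.L Fr′) ∷ L ∷ m ∷ r ∷ []) (eqn 1 v0 v1 eL ∷ eqn 1 (v1 ⊕ # 1) (v2 ⊕ v3) length≡ ∷ eqn 1 v3 (# 1) er ∷ []) v0 v2) hw) in
        outcome-transport (transport A negAut) (shear τ) (inj₂ (inj₂ (inj₁ (type2-centred (shearFrame Fr′ τ) er′ et′ hτ))))
    go 2 et 2 er _ = let (w , hw) = first ; (τ , hτ) = centre Fr 0 w (pos-0≢0 Fr er et) hw in
      outcome-transport A (shear τ) (inj₂ (inj₂ (inj₂ (type5-centred (shearFrame Fr τ) er et hτ))))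
    go (suc (suc (suc t₀))) et r₀ er _ = ⊥-elim (InFrame.t≥3-impossible Fr (subst (3 ≤_) (sym et) (s≤s (s≤s (s≤s z≤n)))) t≤)
    go 0 et (suc r₀) er ()
    go 1 et (suc (suc r₀)) er (s≤s ())
    go 2 et (suc (suc (suc r₀))) er (s≤s (s≤s ()))

  -- The reflection t ↦ 2r - 1 - t maps the offsets outside [r, 2m + r + 1] into this range, which
  -- has (p + 1)/2 elements.
  outcome : ∀ {d} {A : Vec 𝔽 (suc d) → Bool} → Frame A → Outcome A
  outcome {d} {A} Fr = go (r ≤? t) (t ≤? 2 * m + r + 1)
    where
    open Frame Fr
    go : Dec (r ≤ t) → Dec (t ≤ 2 * m + r + 1) → Outcome A
    go (yes h) (yes h′) = oriented Fr h h′
    go (no h) _ = let (t′ , e) = m≤n⇒∃[o]m+o≡n {t + 1} {2 * r} (lin (t ∷ r ∷ []) (hyp 2 (# 1 ⊕ v0) v1 (≰⇒> h) ∷ []) 1 (v0 ⊕ # 1) (# 2 ⊗ v1)) in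
      outcome-transport A negAut (oriented (negateFrame Fr t′ 0 (lin (t ∷ t′ ∷ r ∷ m ∷ p ∷ []) (eql 1 (v0 ⊕ # 1 ⊕ v1) (# 2 ⊗ v2) e ∷ hyp 2 v2 (# 4) r≤4 ∷ eqr 1 v4 (# 3 ⊕ # 4 ⊗ v3) p≡ ∷ hyp 4 (# 23) v3 m≥ ∷ []) 1 (# 1 ⊕ v1) v4) (lin≡ (t ∷ t′ ∷ r ∷ p ∷ []) (eqn 1 (v0 ⊕ # 1 ⊕ v1) (# 2 ⊗ v2) e ∷ []) (v0 ⊕ v1 ⊕ # 1) (# 2 ⊗ v2 ⊕ # 0 ⊗ v3)))
        (lin (r ∷ t ∷ t′ ∷ []) (eqr 1 (v1 ⊕ # 1 ⊕ v2) (# 2 ⊗ v0) e ∷ hyp 1 (# 1 ⊕ v1) v0 (≰⇒> h) ∷ []) 1 v0 v2) (lin (t ∷ t′ ∷ r ∷ m ∷ []) (eql 1 (v0 ⊕ # 1 ⊕ v1) (# 2 ⊗ v2) e ∷ hyp 1 v2 (# 4) r≤4 ∷ hyp 2 (# 23) v3 m≥ ∷ []) 1 v1 (# 2 ⊗ v3 ⊕ v2 ⊕ # 1)))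
    go (yes _) (no h) = let (t′ , e) = m≤n⇒∃[o]m+o≡n {t + 1} {2 * r + p} (lin (t ∷ p ∷ r ∷ []) (hyp 1 (# 1 ⊕ v0) v1 t<p ∷ []) 1 (v0 ⊕ # 1) (# 2 ⊗ v2 ⊕ v1)) in
      outcome-transport A negAut (oriented (negateFrame Fr t′ 1 (lin (t ∷ t′ ∷ r ∷ p ∷ m ∷ []) (eql 1 (v0 ⊕ # 1 ⊕ v1) (# 2 ⊗ v2 ⊕ v3) e ∷ hyp 1 (# 1 ⊕ (# 2 ⊗ v4 ⊕ v2 ⊕ # 1)) v0 (≰⇒> h) ∷ hyp 1 v2 (# 4) r≤4 ∷ hyp 2 (# 23) v4 m≥ ∷ []) 1 (# 1 ⊕ v1) v3) (lin≡ (t ∷ t′ ∷ r ∷ p ∷ []) (eqn 1 (v0 ⊕ # 1 ⊕ v1) (# 2 ⊗ v2 ⊕ v3) e ∷ []) (v0 ⊕ v1 ⊕ # 1) (# 2 ⊗ v2 ⊕ # 1 ⊗ v3)))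
        (lin (r ∷ p ∷ t ∷ t′ ∷ []) (eqr 1 (v2 ⊕ # 1 ⊕ v3) (# 2 ⊗ v0 ⊕ v1) e ∷ hyp 1 (# 1 ⊕ v2) v1 t<p ∷ []) 2 v0 v3) (lin (t ∷ t′ ∷ r ∷ p ∷ m ∷ []) (eql 1 (v0 ⊕ # 1 ⊕ v1) (# 2 ⊗ v2 ⊕ v3) e ∷ hyp 1 (# 1 ⊕ (# 2 ⊗ v4 ⊕ v2 ⊕ # 1)) v0 (≰⇒> h) ∷ eql 1 v3 (# 3 ⊕ # 4 ⊗ v4) p≡ ∷ []) 1 v1 (# 2 ⊗ v4 ⊕ v2 ⊕ # 1)))

-- Choice of coordinates and conclusion

argmax : ∀ n → 1 ≤ n → (f : Fin n → ℕ) → ∃[ i ] ∀ j → f j ≤ f i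
argmax (suc n) _ f = maximum f

module Reduction {p : ℕ} {{p-nonZero : NonZero p}} (p-prime : Prime p) (m : ℕ) (p≡ : p ≡ 3 + 4 * m) (m≥ : 23 ≤ m) (bigT : BigEnoughT m)
                 {d : ℕ} (A : Vec (Fin p) (suc d) → Bool) where
  open PrimeField p-prime
  open Functionals p-prime
  open Automorphisms p-prime
  open OneDim p-prime
  open Frames p-prime m p≡ m≥
  open Targets {p} m
  open Outcomes p-prime m p≡ m≥
  open Orientation p-prime m p≡ m≥

  fibre≡level : ∀ c i (f : Aut {p} (suc d)) → (∀ x → head (φ f x) ≡ dot c x) → Fibres.fibre A c i ≡ V.size d (λ w → transport A f (i Vec.∷ w))
  fibre≡level c i f hf = trans (sym (bijection-∑ (vecType (suc d)) (vecType (suc d)) (ψ f) (φ f) (φψ f) (ψφ f) (λ x → ⟨ A x ⟩ * ⟨ does (dot c x FinP.≟ i) ⟩)))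
    (trans (∑-cong (allVecs (suc d)) (λ y → cong (λ t → ⟨ A (ψ f y) ⟩ * ⟨ does (t FinP.≟ i) ⟩) (trans (sym (hf (ψ f y))) (cong head (φψ f y)))))
    (trans (∑-allVecs d _) (trans (∑-cong (allFin p) (λ x → ∑-*ʳ (allVecs d) (λ w → ⟨ A (ψ f (x Vec.∷ w)) ⟩) ⟨ does (x FinP.≟ i) ⟩)) (collapse i))))
    where
    g : 𝔽 → ℕ
    g x = ∑ (allVecs d) (λ w → ⟨ A (ψ f (x Vec.∷ w)) ⟩)
    collapse : ∀ i → ∑ (allFin p) (λ x → g x * ⟨ does (x FinP.≟ i) ⟩) ≡ g i
    collapse i = trans (∑-cong (allFin p) (λ x → at x (x FinP.≟ i))) (trans (∑-*ˡ (allFin p) (g i) (λ x → ⟨ does (x FinP.≟ i) ⟩)) (trans (cong (g i *_) (FinType.once (finType p) i)) (*-identityʳ (g i))))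
      where at : ∀ x (D : Dec (x ≡ i)) → g x * ⟨ does D ⟩ ≡ g i * ⟨ does D ⟩
            at x (yes e) = cong (λ t → g t * 1) e
            at x (no _)  = trans (*-zeroʳ (g x)) (sym (*-zeroʳ (g i)))

  scaled-frame : ∀ {B : Vec 𝔽 (suc d) → Bool} → SumFree B → m * p ^ d ≤ V.size (suc d) B →
                 Config p-prime m (FibreStructure.S p-prime m p≡ m≥ B) → (∃[ L ] L ≤ m + 3 × Hull (FibreStructure.S p-prime m p≡ m≥ B) L) → Outcome B
  scaled-frame {B} sf lg C (L , L≤ , H) = outcome-transport B (scaleHead u u≢0) (outcome frame)
    where
    open FibreStructure p-prime m p≡ m≥ B using (S; S-intro; S-elim)
    open Hull H
    inv = inverse δ δ≢0
    u : 𝔽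
    u = proj₁ inv
    uδ : u *F δ ≡ [ 1 ]ₚ
    uδ = proj₂ inv
    u≢0 : u ≢ [ 0 ]ₚ
    u≢0 e = 1≢0 (trans (sym uδ) (trans (cong (_*F δ) e) (*F-zeroˡ δ)))
    -- `scaleHead` undoes u by whatever element `inverse` returns; uniqueness of inverses identifies
    -- it with δ, so that the progression with difference δ becomes an interval.
    v : 𝔽
    v = proj₁ (inverse u u≢0)
    v≡δ : v ≡ δ
    v≡δ = trans (sym (trans (*F-comm v [ 1 ]ₚ) (*F-idˡ v))) (trans (cong (v *F_) (sym uδ)) (trans (sym (*F-assoc v u δ)) (trans (cong (_*F δ) (proj₂ (inverse u u≢0))) (*F-idˡ δ))))
    x₀ : 𝔽
    x₀ = u *F x
    at : ∀ k → v *F (x₀ +F [ k ]ₚ) ≡ AP x δ k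
    at k = trans (cong (_*F (x₀ +F [ k ]ₚ)) v≡δ) (trans (*F-distribˡ δ x₀ [ k ]ₚ) (cong₂ _+F_ (trans (sym (*F-assoc δ u x)) (trans (cong (_*F x) (trans (*F-comm δ u) uδ)) (*F-idˡ x))) (*F-comm δ [ k ]ₚ)))
    B′ = transport B (scaleHead u u≢0)
    nonempty : ∀ k → S (AP x δ k) ≡ true → ∃[ w ] B′ ((x₀ +F [ k ]ₚ) Vec.∷ w) ≡ true
    nonempty k h = let (w , hw) = S-elim h in w , subst (λ y → B (y Vec.∷ w) ≡ true) (sym (at k)) hw
    L<p : L < p
    L<p = (lin (L ∷ m ∷ p ∷ []) (hyp 1 v0 (v1 ⊕ # 3) L≤ ∷ eqr 1 v2 (# 3 ⊕ # 4 ⊗ v1) p≡ ∷ hyp 3 (# 23) v1 m≥ ∷ []) 1 (# 1 ⊕ v0) v2)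
    m≤S : m ≤ Fp.size S
    m≤S = go (Config.sizes C)
      where go : (Fp.size S ≡ m × Fp.size (Config.X C) ≡ m) ⊎ (Fp.size S ≡ m + 1 × Fp.size (Config.X C) ≡ m) ⊎ (Fp.size S ≡ m + 2 × Fp.size (Config.X C) + 1 ≡ m) → m ≤ Fp.size S
            go (inj₁ (e , _)) = ≤-reflexive (sym e)
            go (inj₂ (inj₁ (e , _))) = ≤-trans (m≤m+n m 1) (≤-reflexive (sym e))
            go (inj₂ (inj₂ (e , _))) = ≤-trans (m≤m+n m 2) (≤-reflexive (sym e))
    S≤L+1 : Fp.size S ≤ suc L * 1
    S≤L+1 = ≤-trans (≤-reflexive (hull-size H L<p)) (∑<-bound (suc L) 1 (λ i _ → ⟨⟩≤1 _))
    -- At least m support elements occupy L + 1 positions, so the surplus r is a natural number; it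
    -- is at most 4 by L ≤ m + 3.
    rr : ∃[ r ] m + r ≡ L + 1
    rr = m≤n⇒∃[o]m+o≡n (lin (m ∷ (Fp.size S) ∷ L ∷ []) (hyp 1 v0 v1 m≤S ∷ hyp 1 v1 ((# 1 ⊕ v2) ⊗ (# 1)) S≤L+1 ∷ []) 1 v0 (v2 ⊕ # 1))
    offset : 𝔽
    offset = [ m + 2 ]ₚ -F (x₀ +F x₀)
    frame : Frame B′
    frame = record
      { x = x₀ ; L = L ; r = proj₁ rr ; t = toℕ offset ; length≡ = sym (proj₂ rr)
      ; r≤4 = +-cancelˡ-≤ m (proj₁ rr) 4 (≤-trans (≤-reflexive (proj₂ rr)) (lin (L ∷ m ∷ []) (hyp 1 v0 (v1 ⊕ # 3) L≤ ∷ []) 1 (v0 ⊕ # 1) (v1 ⊕ # 4)))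
      ; t<p = FinP.toℕ<n offset
      ; base = trans (cong ((x₀ +F x₀) +F_) ([]-toℕ offset)) (back (x₀ +F x₀) [ m + 2 ]ₚ)
      ; within = λ y w h → pull y (within (v *F y) (S-intro h))
      ; first = nonempty 0 (subst (λ t → S t ≡ true) (sym (AP-0 x δ)) first) ; last = nonempty L last
      ; sum-free = sumFree-transport B (scaleHead u u≢0) sf
      ; large = ≤-trans lg (≤-reflexive (sym (size-transport B (scaleHead u u≢0)))) }
      where
      back : ∀ a b → a +F (b -F a) ≡ b
      back a b = (Fp.grp (a ∷ b ∷ []) (gv 0 :+ (gv 1 :+ :- (gv 0))) (gv 1) refl)
      pull : ∀ y → (∃[ k ] k ≤ L × v *F y ≡ AP x δ k) → ∃[ k ] k ≤ L × y ≡ x₀ +F [ k ]ₚ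
      pull y (k , k≤ , e) = k , k≤ , *F-cancelˡ {v} (λ e → δ≢0 (trans (sym v≡δ) e)) (trans e (sym (at k)))

  reduction : SumFree A → (∃[ z ] A z ≡ true) → m * p ^ d ≤ V.size (suc d) A → Outcome A
  reduction sf ne lg = start (Fibres.large-fibre A m p≡ (≤-trans (s≤s z≤n) m≥) sf ne lg)
    where
    start : (∃[ c ] ∃[ i ] c ≢ 0V × m * p ^ d ≤ (3 * m + 3) * Fibres.fibre A c i) → Outcome A
    start (c , i , c≢0 , dense) = let (f , hf) = functionalAut c c≢0 in outcome-transport A f (straight f hf)
      where
      straight : (f : Aut {p} (suc d)) → (∀ x → head (φ f x) ≡ dot c x) → Outcome (transport A f)
      -- The dense fibre found by counting need not be the largest one; `config` is about the
      -- maximum, so the density is passed on to i₀.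
      straight f hf = let (i₀ , max) = argmax p (lin (m ∷ p ∷ []) (eqr 1 v1 (# 3 ⊕ # 4 ⊗ v0) p≡ ∷ []) 1 (# 1) v1) a
                          C = config sf′ i₀ max (≤-trans dense (*-monoʳ-≤ (3 * m + 3) (≤-trans (≤-reflexive (fibre≡level c i f hf)) (max i)))) lg′
        in scaled-frame sf′ lg′ C (SupportHull.support-hull p-prime m p≡ m≥ bigT C)
        where
        open FibreStructure p-prime m p≡ m≥ (transport A f) using (a; config)
        sf′ : SumFree (transport A f)
        sf′ = sumFree-transport A f sf
        lg′ : m * p ^ d ≤ V.size (suc d) (transport A f)
        lg′ = ≤-trans lg (≤-reflexive (sym (size-transport A f)))

theorem1p10 : (m : ℕ) → Prime (3 + 4 * m) → 23 ≤ m → BigEnoughT m →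
    (n' : ℕ) → (A : Vec (Fin (3 + 4 * m)) (suc n') → Bool) →
    SumFree31 A → Nontrivial m A → m * (3 + 4 * m) ^ n' ≤ card A →
    Normal m A ⊎ Type5 m A
theorem1p10 m p-prime m≥ bigT n' A (nonempty , sum-free) nontrivial large = conclude (Reduction.reduction p-prime m refl m≥ bigT A sum-free nonempty
    (≤-trans large (≤-reflexive (PrimeField.card≡size p-prime A))))
  where
  conclude : Targets.Outcome m A → Normal m A ⊎ Type5 m A
  conclude (inj₁ trivial) = ⊥-elim (nontrivial trivial)
  conclude (inj₂ (inj₁ h)) = inj₁ (inj₁ h)
  conclude (inj₂ (inj₂ (inj₁ h))) = inj₁ (inj₂ h)
  conclude (inj₂ (inj₂ (inj₂ h))) = inj₂ h
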